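{- Let $\widetilde{W}/W\in\{\widetilde{C}_n/C_n,\widetilde{B}_n/B_n,\widetilde{B}_n/D_n,\widetilde{D}_n/D_n\}$, let $w\in\widetilde{W}/W$ and $\lambda=\mathcal{C}(w)$. Then $\mathcal{R}(\lambda)$ is a reduced expression for $w$, and the number of boxes in the upper diagram $U_\lambda$ equals the Coxeter length of $w$.
   Context: Groups. Let $N=2n+1$. A mirrored $\mathbb{Z}$-permutation is a bijection $w:\mathbb{Z}\to\mathbb{Z}$ with $w(i+N)=w(i)+N$ and $w(-i)=-w(i)$ for all $i\in\mathbb{Z}$; it is determined by $(w(1),\dots,w(n))$. Under composition these form the affine Coxeter group $\widetilde{C}_n$. Define elements by their images $(w(1),\dots,w(n))$: $s_i=(1,\dots,i-1,i+1,i,i+2,\dots,n)$ for $1\le i\le n-1$; $s_0^C=(-1,2,3,\dots,n)$; $s_0^D=(-2,-1,3,\dots,n)$; $s_n^C=(1,\dots,n-1,n+1)$; $s_n^D=(1,\dots,n-2,n+1,n+2)$. The four types are: - $\widetilde{C}/C$: $\widetilde{W}$ is all mirrored $\mathbb{Z}$-permutations, generators $s_0=s_0^C,s_1,\dots,s_{n-1},s_n=s_n^C$ ($n\ge2$). - $\widetilde{B}/B$: those with $|\{i\le0:w(i)\ge1\}|$ even, generators $s_0=s_0^D,s_1,\dots,s_{n-1},s_n=s_n^C$ ($n\ge3$). - $\widetilde{B}/D$: those with $|\{i\le n:w(i)\ge n+1\}|$ even, generators $s_0=s_0^C,s_1,\dots,s_{n-1},s_n=s_n^D$ ($n\ge3$).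 - $\widetilde{D}/D$: those satisfying both parity conditions, generators $s_0=s_0^D,s_1,\dots,s_{n-1},s_n=s_n^D$ ($n\ge4$). $W$ is generated by $s_1,\dots,s_n$, and $\widetilde{W}/W$ denotes the set of minimal length representatives of the cosets $wW$; $\widetilde{W}$ acts on it by left multiplication of cosets. Coxeter length and reduced expressions are with respect to $s_0,\dots,s_n$ of the given type. Abaci and cores. An abacus has runners (columns) $1,\dots,2n$; runner $i$ has entries labeled $mN+i$ for each level $m\in\mathbb{Z}$; some entries are beads, the others gaps; reading order is the order of labels; "lowest" means largest label; the abacus is flush if no bead is preceded by a gap on its runner. $\mathcal{A}(w)$ is the flush abacus whose lowest bead in each runner is an element of $\{w(1),\dots,w(2n)\}$. $\mathcal{C}(w)$ is the partition whose southeast boundary is the lattice path obtained by reading the entries of $\mathcal{A}(w)$ in reading order, recording a north-step for each bead and an east-step for each gap (first row at the top). $w\mapsto\mathcal{C}(w)$ is injective on $\widetilde{W}/W$, and $\widetilde{W}$ acts on its image by transport of structure. Residues. Entries of $\mathbb{N}^2$ are $(i,j)$ = (row, column); the $k$-th diagonal is $\{j-i=k\}$ and the main diagonal is $k=0$. Write $p\,\|\,q$ for the element of $\{0,\dots,q-1\}$ congruent to $p$ mod $q$. The fixed residue of $(i,j)$ is $(j-i)\|(2n)$ if this is $\le n$, and $2n-((j-i)\|(2n))$ otherwise. An escalator is a connected component of the cells with $(j-i)\|(2n)\in\{n-1,n,n+1\}$; a descalator is a connected component of the cells with $(j-i)\|(2n)\in\{0,1,2n-1\}$; upper means above the main diagonal,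 lower means below; the descalator containing the main diagonal is the main descalator. Given $\lambda$, let a row meet an upper escalator in cells $c_1,c_2,c_3$ (left to right): if the row of $\lambda$ ends immediately left of $c_1$, then $c_1$ has both residues $n-1,n$, $c_2$ has residue $n$, $c_3$ undefined; if it ends at $c_1$: residues $n-1,n,n$; if it ends at $c_2$: $n,n,n-1$; if it ends at $c_3$: $c_1$ undefined, $c_2$ has residue $n$, $c_3$ has both residues $n-1,n$; otherwise undefined. Upper descalators: the same rule with $n-1$ replaced by $1$ and $n$ by $0$. Lower escalators/descalators: transposed rule, column by column. Main descalator: residue $0$ if $i=j$; if $|i-j|=1$, residue $1$ when $i+j\equiv1$ mod $4$ and $0$ when $i+j\equiv3$ mod $4$. Type $\widetilde{C}/C$ uses fixed residues only; $\widetilde{B}/B$ uses the descalator rules on descalators; $\widetilde{B}/D$ uses the escalator rules on escalators; $\widetilde{D}/D$ uses both; all remaining cells have their fixed residue. Central peeling procedure. The reference diagonal is the main diagonal in types $\widetilde{C}/C,\widetilde{B}/D$ and the first diagonal in types $\widetilde{B}/B,\widetilde{D}/D$. Start with $\lambda^{(1)}=\lambda$. At step $i$ (while $\lambda^{(i)}$ is nonempty) let $d^{(i)}$ be the number of boxes of $\lambda^{(i)}$ on the reference diagonal, $B_i$ the box at the end of the $d^{(i)}$-th row of $\lambda^{(i)}$, and $r_i$ its residue; if $B_i$ is both $n$-removable and $(n-1)$-removable (has both residues), set $r_i=n$. Let $\lambda^{(i+1)}$ be the result of $s_{r_i}$ acting on $\lambda^{(i)}$. $\mathcal{R}(\lambda)$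 is the product $s_{r_1}s_{r_2}\cdots s_{r_\ell}$ over all steps. The upper diagram $U_\lambda$ is the set of boxes $B_i$ encountered, with the following conditions: in types $\widetilde{B}/D,\widetilde{D}/D$, an application of $s_n^D$ removes two boxes from row $d^{(i)}$ and the box not on the $n$-th diagonal is recorded; in types $\widetilde{B}/B,\widetilde{D}/D$, an application of $s_0^D$ removes two boxes from row $d^{(i)}$ and the box not on the main or $2n$-th diagonal is recorded. -}

module Defs where

open import Data.Bool using (Bool; if_then_else_; not; _∧_)
open import Data.Bool.ListAction using (any)
open import Data.Fin using (Fin; toℕ)
open import Data.Integer as ℤ using (ℤ; +_)
open import Data.Integer.Divisibility.Signed using (_∣?_)
open import Data.Integer.DivMod using (_/ℕ_; _%ℕ_)
open import Data.List using (List; []; _∷_; filter; filterᵇ; foldr; length; map; upTo)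
open import Data.List.Membership.Propositional using (_∈_)
open import Data.List.Relation.Unary.All using (All)
open import Data.List.Relation.Unary.Unique.Propositional using (Unique)
open import Data.Nat using (ℕ; zero; suc; _+_; _*_; _∸_; _≤_; _<_; _≡ᵇ_; _≤ᵇ_; _≤?_; _⊔_; _%_)
open import Data.Nat.Divisibility using (_∣_)
import Data.Nat.Properties as ℕ
open import Data.Product using (_×_; _,_; ∃-syntax)
open import Data.Product.Properties using (≡-dec)
open import Data.Sum using (_⊎_)
open import Data.Vec using (Vec; []; _∷_; lookup)
open import Function using (Bijective; _⇔_; _∘_; id)
open import Relation.Binary using (DecidableEquality)
open import Relation.Binary.Construct.Closure.Equivalence using (EqClosure)
open import Relation.Binary.PropositionalEquality using (_≡_; _≢_)
open import Relation.Nullary using (¬_)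
open import Relation.Nullary.Decidable using (⌊_⌋)

------------------------------------------------------------------------
-- The four families.  Each is given by the variant (C or D) of its
-- generator s₀ and the variant of its generator sₙ.

data Variant : Set where
  C D : Variant

data AffineType : Set where
  C̃/C B̃/B B̃/D D̃/D : AffineType

variant₀ variantₙ : AffineType → Variant
variant₀ C̃/C = C
variant₀ B̃/B = D
variant₀ B̃/D = C
variant₀ D̃/D = D
variantₙ C̃/C = C
variantₙ B̃/B = C
variantₙ B̃/D = D
variantₙ D̃/D = D

minRank : AffineType → ℕ
minRank C̃/C = 2
minRank B̃/B = 3
minRank B̃/D = 3
minRank D̃/D = 4

------------------------------------------------------------------------
-- Mirrored ℤ-permutations and the groups W̃.

-- N = 2n + 1, written as a successor so that it is visibly nonzero.
period : ℕ → ℕ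
period n = suc (2 * n)

record MirroredPermutation (n : ℕ) : Set where
  field
    ⟦_⟧       : ℤ → ℤ
    bijective : Bijective _≡_ _≡_ ⟦_⟧
    periodic  : ∀ i → ⟦ i ℤ.+ + period n ⟧ ≡ ⟦ i ⟧ ℤ.+ + period n
    mirrored  : ∀ i → ⟦ ℤ.- i ⟧ ≡ ℤ.- ⟦ i ⟧

open MirroredPermutation public using (⟦_⟧)

-- The set P is finite with an even number of elements.
EvenCardinality : {A : Set} → (A → Set) → Set
EvenCardinality P =
  ∃[ xs ] Unique xs × (∀ x → x ∈ xs ⇔ P x) × 2 ∣ length xs

module _ (n : ℕ) where

  -- The extension of a window (f 1 , … , f n) to all of ℤ that is forced by
  -- w(0) = 0, w(N - i) = N - w(i) and w(i + N) = w(i) + N.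
  extend : (ℕ → ℤ) → ℤ → ℤ
  extend f k = base (k %ℕ period n) ℤ.+ (k /ℕ period n) ℤ.* + period n
    where
    base : ℕ → ℤ
    base r = if r ≡ᵇ 0 then + 0 else
             if r ≤ᵇ n then f r else + period n ℤ.- f (period n ∸ r)

  window₀ : Variant → ℕ → ℤ
  window₀ C k = if k ≡ᵇ 1 then ℤ.- + 1 else + k
  window₀ D k = if k ≡ᵇ 1 then ℤ.- + 2 else
                if k ≡ᵇ 2 then ℤ.- + 1 else + k

  windowₙ : Variant → ℕ → ℤ
  windowₙ C k = if k ≡ᵇ n then + (n + 1) else + k
  windowₙ D k = if k ≡ᵇ n ∸ 1 then + (n + 1) else
                if k ≡ᵇ n then + (n + 2) else + k

  windowᵢ : ℕ → ℕ → ℤ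
  windowᵢ i k = if k ≡ᵇ i then + (i + 1) else
                if k ≡ᵇ i + 1 then + i else + k

module _ (t : AffineType) (n : ℕ) where

  record _∈W̃ (w : MirroredPermutation n) : Set where
    field
      even₀ : variant₀ t ≡ D →
              EvenCardinality (λ i → i ℤ.≤ + 0 × + 1 ℤ.≤ ⟦ w ⟧ i)
      evenₙ : variantₙ t ≡ D →
              EvenCardinality (λ i → i ℤ.≤ + n × + suc n ℤ.≤ ⟦ w ⟧ i)

  generator : Fin (suc n) → ℤ → ℤ
  generator i = extend n (
    if toℕ i ≡ᵇ 0 then window₀ n (variant₀ t) else
    if toℕ i ≡ᵇ n then windowₙ n (variantₙ t) else windowᵢ n (toℕ i))

  ----------------------------------------------------------------------
  -- Words in s₀, …, sₙ, Coxeter length and minimal coset representatives.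

  Word : Set
  Word = List (Fin (suc n))

  product : Word → ℤ → ℤ
  product = foldr (λ i w → generator i ∘ w) id

  _Expresses_ : Word → (ℤ → ℤ) → Set
  is Expresses w = ∀ k → product is k ≡ w k

  _ReducedFor_ : Word → (ℤ → ℤ) → Set
  is ReducedFor w =
    is Expresses w × (∀ js → js Expresses w → length is ≤ length js)

  HasLength : (ℤ → ℤ) → ℕ → Set
  HasLength w ℓ = ∃[ is ] is ReducedFor w × length is ≡ ℓ

  -- The generators are involutions, so W is the set of products of such words.
  ParabolicWord : Word → Set
  ParabolicWord = All (λ i → toℕ i ≢ 0)

  -- w ∈ W̃ is a minimal length representative of the coset wW.
  record _∈W̃/W (w : MirroredPermutation n) : Set where
    field
      member  : w ∈W̃
      minimal : ∀ us → ParabolicWord us → ∀ {ℓ ℓ′} →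
                HasLength ⟦ w ⟧ ℓ → HasLength (⟦ w ⟧ ∘ product us) ℓ′ → ℓ ≤ ℓ′

------------------------------------------------------------------------
-- Abaci and cores.

-- The rows of a partition, largest first.
Partition : Set
Partition = List ℕ

-- Rows and columns are numbered from 1; a missing row has length 0.
row : Partition → ℕ → ℕ
row []       _             = 0
row (_ ∷ _)  zero          = 0
row (p ∷ _)  (suc zero)    = p
row (_ ∷ ps) (suc (suc i)) = row ps (suc i)

column : Partition → ℕ → ℕ
column κ j = length (filter (j ≤?_) κ)

data Step : Set where
  north east : Step

-- The path runs from the bottom left: a north-step at horizontal position x
-- is the right end of a row of length x, and later rows lie higher.
shape : ℕ → List Step → Partition → Partition
shape x       []           rows = rows
shape x       (east  ∷ ps) rows = shape (suc x) ps rows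
shape zero    (north ∷ ps) rows = shape zero ps rows
shape (suc x) (north ∷ ps) rows = shape (suc x) ps (suc x ∷ rows)

module _ (n : ℕ) where

  lowestBeads : MirroredPermutation n → List ℤ
  lowestBeads w = map (λ i → ⟦ w ⟧ (+ suc i)) (upTo (2 * n))

  -- In a flush abacus the beads on a runner are the entries at or above the
  -- lowest bead of that runner; two labels share a runner when they are
  -- congruent modulo N.
  isBead : MirroredPermutation n → ℤ → Bool
  isBead w e =
    any (λ b → ⌊ + period n ∣? b ℤ.- e ⌋ ∧ ⌊ e ℤ.≤? b ⌋) (lowestBeads w)

  -- Multiples of N label no entry of the abacus.
  isEntry : ℤ → Bool
  isEntry e = not ⌊ + period n ∣? e ⌋

  -- All entries below -M are beads and all entries above M are gaps, where M
  -- is the largest absolute value of a lowest bead.  Outside [-M , M] the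
  -- boundary path is therefore a vertical and a horizontal ray.
  boundary : MirroredPermutation n → List Step
  boundary w = map step (filterᵇ isEntry labels)
    where
    M : ℕ
    M = foldr _⊔_ 0 (map ℤ.∣_∣ (lowestBeads w))
    labels : List ℤ
    labels = map (λ k → + k ℤ.- + M) (upTo (suc (2 * M)))
    step : ℤ → Step
    step e = if isBead w e then north else east

  𝒞 : MirroredPermutation n → Partition
  𝒞 w = shape 0 (boundary w) []

------------------------------------------------------------------------
-- Cells and connected components.

-- (row , column), both numbered from 1.
Cell : Set
Cell = ℕ × ℕ

_≟ᶜ_ : DecidableEquality Cell
_≟ᶜ_ = ≡-dec ℕ._≟_ ℕ._≟_

data Neighbours : Cell → Cell → Set where
  horizontal : ∀ {i j} → Neighbours (i , j) (i , suc j)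
  vertical   : ∀ {i j} → Neighbours (i , j) (suc i , j)

Connected : (Cell → Set) → Cell → Cell → Set
Connected S = EqClosure (λ c c′ → S c × S c′ × Neighbours c c′)

-- c′ lies in the connected component of c within S.
InComponent : (Cell → Set) → Cell → Cell → Set
InComponent S c c′ = S c × S c′ × Connected S c c′

IsCell : Cell → Set
IsCell (i , j) = 1 ≤ i × 1 ≤ j

AboveMain BelowMain : Cell → Set
AboveMain (i , j) = i < j
BelowMain (i , j) = j < i

-- Row i (column j) meets the component of (i , j) exactly in three
-- consecutive cells, of which (i , j) is the first.
RowTriple ColumnTriple : (Cell → Set) → Cell → Set
RowTriple S (i , j) = ∀ x →
  InComponent S (i , j) (i , x) ⇔ (x ∈ j ∷ 1 + j ∷ 2 + j ∷ [])
ColumnTriple S (i , j) = ∀ x →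
  InComponent S (i , j) (x , j) ⇔ (x ∈ i ∷ 1 + i ∷ 2 + i ∷ [])

------------------------------------------------------------------------
-- Residues.

-- The representative of p modulo q in {0, …, q - 1}, for q > 0.
_‖_ : ℤ → ℕ → ℕ
p ‖ zero  = 0
p ‖ suc q = p %ℕ suc q

-- The residues of c₁, c₂, c₃ when the row (column) of the partition ends at
-- the given position and c₁ is at the given start.  Here (a , b) is (n - 1 , n)
-- on escalators and (1 , 0) on descalators; [] means undefined.
data Rule (a b : ℕ) : (end start : ℕ) → Vec (List ℕ) 3 → Set where
  ends-before-c₁ : ∀ {s} → Rule a b s (1 + s) ((a ∷ b ∷ []) ∷ (b ∷ []) ∷ [] ∷ [])
  ends-at-c₁     : ∀ {s} → Rule a b s s ((a ∷ []) ∷ (b ∷ []) ∷ (b ∷ []) ∷ [])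
  ends-at-c₂     : ∀ {s} → Rule a b (1 + s) s ((b ∷ []) ∷ (b ∷ []) ∷ (a ∷ []) ∷ [])
  ends-at-c₃     : ∀ {s} → Rule a b (2 + s) s ([] ∷ (b ∷ []) ∷ (a ∷ b ∷ []) ∷ [])

data SlidingResidue (S : Cell → Set) (a b : ℕ) (κ : Partition) : Cell → ℕ → Set where
  upper : ∀ {i j rs r} (p : Fin 3) →
          (∀ c → InComponent S (i , j) c → AboveMain c) →
          RowTriple S (i , j) → Rule a b (row κ i) j rs → r ∈ lookup rs p →
          SlidingResidue S a b κ (i , toℕ p + j) r
  lower : ∀ {i j rs r} (p : Fin 3) →
          (∀ c → InComponent S (i , j) c → BelowMain c) →
          ColumnTriple S (i , j) → Rule a b (column κ j) i rs → r ∈ lookup rs p →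
          SlidingResidue S a b κ (toℕ p + i , j) r

module _ (n : ℕ) where

  diagonal : Cell → ℕ
  diagonal (i , j) = (+ j ℤ.- + i) ‖ (2 * n)

  fixedResidue : Cell → ℕ
  fixedResidue c = if diagonal c ≤ᵇ n then diagonal c else 2 * n ∸ diagonal c

  EscalatorCell DescalatorCell : Cell → Set
  EscalatorCell c =
    IsCell c × (diagonal c ≡ n ∸ 1 ⊎ diagonal c ≡ n ⊎ diagonal c ≡ n + 1)
  DescalatorCell c =
    IsCell c × (diagonal c ≡ 0 ⊎ diagonal c ≡ 1 ⊎ diagonal c ≡ 2 * n ∸ 1)

  OnMainDescalator : Cell → Set
  OnMainDescalator c = ∃[ i ] InComponent DescalatorCell (i , i) c

referenceDiagonal : Variant → ℕ
referenceDiagonal C = 0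
referenceDiagonal D = 1

-- On the main descalator ∣i - j∣ ≤ 1, so off the main diagonal i + j is odd.
mainResidue : Cell → ℕ
mainResidue (i , j) = if i ≡ᵇ j then 0 else
                      if (i + j) % 4 ≡ᵇ 1 then 1 else 0

module _ (t : AffineType) (n : ℕ) where

  data HasResidue (κ : Partition) : Cell → ℕ → Set where
    escalator       : ∀ {c r} → variantₙ t ≡ D →
                      SlidingResidue (EscalatorCell n) (n ∸ 1) n κ c r → HasResidue κ c r
    descalator      : ∀ {c r} → variant₀ t ≡ D →
                      SlidingResidue (DescalatorCell n) 1 0 κ c r → HasResidue κ c r
    main-descalator : ∀ {c} → variant₀ t ≡ D →
                      OnMainDescalator n c → HasResidue κ c (mainResidue c)
    fixed           : ∀ {c} → IsCell c →
                      (variantₙ t ≡ D → ¬ EscalatorCell n c) →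
                      (variant₀ t ≡ D → ¬ DescalatorCell n c) →
                      HasResidue κ c (fixedResidue n c)

  ----------------------------------------------------------------------
  -- The action of W̃ on the image of 𝒞.

  -- μ = sᵢ κ, that is, sᵢ v W = v′ W for the representatives with 𝒞 v = κ
  -- and 𝒞 v′ = μ.
  _·_↦_ : Fin (suc n) → Partition → Partition → Set
  i · κ ↦ μ = ∃[ v ] ∃[ v′ ] ∃[ us ]
    _∈W̃/W t n v × _∈W̃/W t n v′ × 𝒞 n v ≡ κ × 𝒞 n v′ ≡ μ ×
    ParabolicWord t n us ×
    (∀ k → generator t n i (⟦ v ⟧ k) ≡ ⟦ v′ ⟧ (product t n us k))

  ----------------------------------------------------------------------
  -- The central peeling procedure.

  referenceBoxes : Partition → ℕ
  referenceBoxes κ =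
    length (filter (λ i → i + referenceDiagonal (variant₀ t) ≤? row κ i) (map suc (upTo (length κ))))

  -- The box recorded in the upper diagram when sᵢ takes κ to μ and the peeled
  -- box is the last one of row d.
  data Recorded (κ μ : Partition) (d : ℕ) (i : Fin (suc n)) : Cell → Set where
    recorded  : ¬ (variant₀ t ≡ D × toℕ i ≡ 0) → ¬ (variantₙ t ≡ D × toℕ i ≡ n) →
                Recorded κ μ d i (d , row κ d)
    recordedₙ : variantₙ t ≡ D → toℕ i ≡ n → row κ d ≡ 2 + row μ d →
                ∀ {j} → row μ d < j → j ≤ row κ d → j ≢ d + n →
                Recorded κ μ d i (d , j)
    recorded₀ : variant₀ t ≡ D → toℕ i ≡ 0 → row κ d ≡ 2 + row μ d →
                ∀ {j} → row μ d < j → j ≤ row κ d → j ≢ d → j ≢ d + 2 * n →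
                Recorded κ μ d i (d , j)

  -- Peeling κ is a run of the procedure that starts at κ and ends at the empty
  -- partition; its indices are the word ℛ(κ) and the boxes of U_κ, in order.
  data Peeling : Partition → Word t n → List Cell → Set where
    done : Peeling [] [] []
    peel : ∀ {κ μ is U c} → κ ≢ [] →
           let d = referenceBoxes κ
               B = d , row κ d in
           1 ≤ d →
           (i : Fin (suc n)) → HasResidue κ B (toℕ i) →
           (HasResidue κ B (n ∸ 1) → HasResidue κ B n → toℕ i ≡ n) →
           i · κ ↦ μ → Recorded κ μ d i c →
           Peeling μ is U → Peeling κ (i ∷ is) (c ∷ U)

-- Coxeter length is computed by counting the hyperplanes that separate alcoves: the
-- count drops by one under sᵢ exactly at a descent, an element of W̃ without descents
-- is trivial, and therefore the count is the length.  With g = w⁻¹, the beads of the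
-- abacus of w are the entries e with g(e) < N, and sᵢ is a left descent of w if it
-- moves some bead back into a gap; it then shortens w, keeps it minimal in its coset
-- and raises no count of beads beyond a given label.  The last box of row d⁽ⁱ⁾ belongs
-- to the first bead b after the reference diagonal.  By flushness b lies within one
-- period of that diagonal, so its residue can be read off its content, and the
-- generator sᵣ of that residue moves b into a gap.  In variant D of s₀ the content 1
-- is ambiguous; the parity of the number of beads after the main diagonal resolves it
-- in the same way as the residues modulo 4 on the main descalator.  Each step thus
-- decreases the length by one and removes the recorded box from the core, so the
-- recorded boxes are distinct.

module Submission where

open import Defs
open import Data.Bool using (Bool; true; false; if_then_else_; T; _∧_; _∨_; not)
open import Data.Bool.ListAction using (any)
import Data.Bool.Properties as Bool
open import Data.Empty using (⊥; ⊥-elim)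
open import Data.Fin using (Fin; toℕ; fromℕ<)
open import Data.Fin.Patterns
import Data.Fin.Properties as Fin
open import Data.Integer as ℤ using (ℤ; +_; -[1+_]; +≤+; +<+; -≤+; -<+; -<-; ∣_∣)
open import Data.Integer.Divisibility.Signed using (_∣_; divides; _∣?_)
open import Data.Integer.DivMod using (_/ℕ_; _%ℕ_; a≡a%ℕn+[a/ℕn]*n; n%ℕd<d)
import Data.Integer.Properties as ℤ
open import Data.Integer.Tactic.RingSolver using (solve-∀)
open import Data.List as List using (List; []; _∷_; _++_; deduplicate; filter; filterᵇ; foldr; length; map; upTo)
import Data.List.Properties as List
open import Data.List.Membership.Propositional using (_∈_; find; lose)
open import Data.List.Membership.Propositional.Properties
  using (∈-∃++; ∈-++⁺ˡ; ∈-++⁺ʳ; ∈-++⁻; ∈-map⁺; ∈-map⁻; ∈-filter⁺; ∈-filter⁻; ∈-upTo⁺; ∈-upTo⁻)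
open import Data.List.Relation.Unary.All as All using (All; []; _∷_)
import Data.List.Relation.Unary.All.Properties as All
open import Data.List.Relation.Unary.AllPairs as AllPairs using (AllPairs; []; _∷_)
import Data.List.Relation.Unary.AllPairs.Properties as AllPairs
open import Data.List.Relation.Unary.Any using (here; there)
import Data.List.Relation.Unary.Any.Properties as Any
open import Data.List.Relation.Unary.Unique.Propositional using (Unique)
import Data.List.Relation.Unary.Unique.Propositional.Properties as Unique
open import Data.Maybe using (Maybe; just; nothing)
open import Data.Nat as ℕ using (ℕ; zero; suc; z≤n; s≤s; _∸_; _≡ᵇ_; _≤ᵇ_; _⊔_)
open import Data.Nat.Divisibility as ℕ using () renaming (_∣_ to _∣ℕ_)
open import Data.Nat.DivMod using ([m+kn]%n≡m%n)
import Data.Nat.Properties as ℕ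
import Data.Nat.Tactic.RingSolver as ℕ-Solver
open import Data.Product using (_×_; _,_; proj₁; proj₂; ∃; ∃-syntax; ∃₂)
open import Data.Sum as Sum using (_⊎_; inj₁; inj₂; [_,_]′)
open import Data.Vec as Vec using (Vec; []; _∷_; lookup)
open import Data.Vec.N-ary using (N-ary; curryⁿ; _$ⁿ_; ∀ⁿ)
open import Function using (_∘_; id; _⇔_; mk⇔; Equivalence)
import Function.Properties.Equivalence as ⇔
open import Relation.Binary.Construct.Closure.ReflexiveTransitive using (ε; _◅_)
import Relation.Binary.Construct.Closure.Symmetric as Symmetric
open import Relation.Binary.Definitions using (tri<; tri≈; tri>)
open import Relation.Binary.PropositionalEquality
  using (_≡_; _≢_; _≗_; refl; sym; trans; cong; cong₂; subst; subst₂)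
open import Relation.Nullary using (¬_; ¬?; Dec; yes; no; T?; _×-dec_; toWitness; fromWitness; ⌊_⌋)
open import Relation.Unary using (Decidable)

-- Fourier–Motzkin elimination on linear forms over ℤ, c₀ + c₁ x₁ + … + cₙ xₙ
-- being represented by c₀ ∷ c₁ ∷ … ∷ cₙ ∷ [].

-- The action on cores and the residues are relations, so each step owes two things: some generator
-- is available, and every residue that the procedure admits names that same generator. The action
-- may use any representative with the given core, so `𝒞` must also be injective on representatives.
-- For this the bead counts are recovered from the diagonals of the partition, and `v⁻¹w` is shown
-- to have no descents.
--
-- Contents and labels are linked by the symmetry `e ↦ 2N - e`, which exchanges beads and gaps. At
-- the label `N` it gives as many gaps before as beads after. Each further entry, bead or gap,
-- raises the difference by one, and multiples of `N` leave it alone. So the `c`-th diagonal cuts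
-- the boundary path at the same label for every core, and the content of a row end tells the label
-- of its bead.
--
-- The generators of variant D remove two boxes of the row. For them a bound on bead counts is too
-- weak, and the count has to be followed exactly through the move of the bead.
--
-- Many inequalities involve a product `k * N` with unknown `k`. Such a product is one variable for
-- the linear arithmetic, and the trichotomy `Scale` supplies its bounds.

module Linear where

  infix  4 _:≤_ _:<_ _:=_
  infixl 6 _:+_ _:-_
  infixl 7 _:*_
  infix  30 #_
  infix  3 _⊢_

  data Expr (n : ℕ) : Set where
    var       : Fin n → Expr n
    con       : ℤ → Expr n
    _:+_ _:-_ : Expr n → Expr n → Expr n
    :-_       : Expr n → Expr n
    _:*_      : ℤ → Expr n → Expr n

  #_ : ∀ {n} → ℕ → Expr n
  # k = con (+ k)

  data Relation (n : ℕ) : Set where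
    _:≤_ _:<_ _:=_ : Expr n → Expr n → Relation n
    :⊥             : Relation n

  data Sequent (n : ℕ) : Set where
    _⊢_ : List (Relation n) → Relation n → Sequent n

  private variable n : ℕ

  ⟦_⟧ₑ : Expr n → Vec ℤ n → ℤ
  ⟦ var i  ⟧ₑ ρ = lookup ρ i
  ⟦ con c  ⟧ₑ ρ = c
  ⟦ a :+ b ⟧ₑ ρ = ⟦ a ⟧ₑ ρ ℤ.+ ⟦ b ⟧ₑ ρ
  ⟦ a :- b ⟧ₑ ρ = ⟦ a ⟧ₑ ρ ℤ.- ⟦ b ⟧ₑ ρ
  ⟦ :- a   ⟧ₑ ρ = ℤ.- ⟦ a ⟧ₑ ρ
  ⟦ c :* a ⟧ₑ ρ = c ℤ.* ⟦ a ⟧ₑ ρ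

  ⟦_⟧ᵣ : Relation n → Vec ℤ n → Set
  ⟦ a :≤ b ⟧ᵣ ρ = ⟦ a ⟧ₑ ρ ℤ.≤ ⟦ b ⟧ₑ ρ
  ⟦ a :< b ⟧ᵣ ρ = ⟦ a ⟧ₑ ρ ℤ.< ⟦ b ⟧ₑ ρ
  ⟦ a := b ⟧ᵣ ρ = ⟦ a ⟧ₑ ρ ≡ ⟦ b ⟧ₑ ρ
  ⟦ :⊥     ⟧ᵣ ρ = ⊥

  implications : List (Relation n) → Set → Vec ℤ n → Set
  implications []       G ρ = G
  implications (h ∷ hs) G ρ = ⟦ h ⟧ᵣ ρ → implications hs G ρ

  ⟦_⟧ₛ : Sequent n → Vec ℤ n → Set
  ⟦ hs ⊢ g ⟧ₛ ρ = implications hs (⟦ g ⟧ᵣ ρ) ρ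

  Form : ℕ → Set
  Form n = Vec ℤ (suc n)

  dot : Vec ℤ n → Vec ℤ n → ℤ
  dot []       []       = + 0
  dot (c ∷ cs) (x ∷ xs) = c ℤ.* x ℤ.+ dot cs xs

  eval : Form n → Vec ℤ n → ℤ
  eval f ρ = dot f (+ 1 ∷ ρ)

  scale : ℤ → Vec ℤ n → Vec ℤ n
  scale c = Vec.map (c ℤ.*_)

  add : Vec ℤ n → Vec ℤ n → Vec ℤ n
  add = Vec.zipWith ℤ._+_

  constant : ℤ → Form n
  constant c = c ∷ Vec.replicate _ (+ 0)

  unit : Fin n → Vec ℤ n
  unit Fin.zero    = + 1 ∷ Vec.replicate _ (+ 0)
  unit (Fin.suc i) = + 0 ∷ unit i

  dot-scale : ∀ c (f ρ : Vec ℤ n) → dot (scale c f) ρ ≡ c ℤ.* dot f ρ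
  dot-scale c []      []      = sym (ℤ.*-zeroʳ c)
  dot-scale c (a ∷ f) (x ∷ ρ) =
    trans (cong (ℤ._+_ (c ℤ.* a ℤ.* x)) (dot-scale c f ρ)) (lemma c a x (dot f ρ))
    where
    lemma : ∀ c a x y → c ℤ.* a ℤ.* x ℤ.+ c ℤ.* y ≡ c ℤ.* (a ℤ.* x ℤ.+ y)
    lemma = solve-∀

  dot-add : ∀ (f h ρ : Vec ℤ n) → dot (add f h) ρ ≡ dot f ρ ℤ.+ dot h ρ
  dot-add []      []      []      = refl
  dot-add (a ∷ f) (b ∷ h) (x ∷ ρ) =
    trans (cong (ℤ._+_ ((a ℤ.+ b) ℤ.* x)) (dot-add f h ρ)) (lemma a b x (dot f ρ) (dot h ρ))
    where
    lemma : ∀ a b x y z →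
            (a ℤ.+ b) ℤ.* x ℤ.+ (y ℤ.+ z) ≡ a ℤ.* x ℤ.+ y ℤ.+ (b ℤ.* x ℤ.+ z)
    lemma = solve-∀

  dot-zero : ∀ (ρ : Vec ℤ n) → dot (Vec.replicate n (+ 0)) ρ ≡ + 0
  dot-zero []      = refl
  dot-zero (x ∷ ρ) = cong₂ ℤ._+_ (ℤ.*-zeroˡ x) (dot-zero ρ)

  dot-unit : ∀ (i : Fin n) ρ → dot (unit i) ρ ≡ lookup ρ i
  dot-unit Fin.zero    (x ∷ ρ) =
    trans (cong₂ ℤ._+_ (ℤ.*-identityˡ x) (dot-zero ρ)) (ℤ.+-identityʳ x)
  dot-unit (Fin.suc i) (x ∷ ρ) =
    trans (cong₂ ℤ._+_ (ℤ.*-zeroˡ x) (dot-unit i ρ)) (ℤ.+-identityˡ _)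

  eval-constant : ∀ c (ρ : Vec ℤ n) → eval (constant c) ρ ≡ c
  eval-constant c ρ = trans (cong₂ ℤ._+_ (ℤ.*-identityʳ c) (dot-zero ρ)) (ℤ.+-identityʳ c)

  linearise : Expr n → Form n
  linearise (var i)  = unit (Fin.suc i)
  linearise (con c)  = constant c
  linearise (a :+ b) = add (linearise a) (linearise b)
  linearise (a :- b) = add (linearise a) (scale (ℤ.- + 1) (linearise b))
  linearise (:- a)   = scale (ℤ.- + 1) (linearise a)
  linearise (c :* a) = scale c (linearise a)

  eval-linearise : ∀ (a : Expr n) ρ → eval (linearise a) ρ ≡ ⟦ a ⟧ₑ ρ
  eval-linearise (var i)  ρ = dot-unit (Fin.suc i) (+ 1 ∷ ρ)
  eval-linearise (con c)  ρ = eval-constant c ρ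
  eval-linearise (a :+ b) ρ = trans (dot-add (linearise a) (linearise b) _)
    (cong₂ ℤ._+_ (eval-linearise a ρ) (eval-linearise b ρ))
  eval-linearise (a :- b) ρ = trans (dot-add (linearise a) _ _)
    (cong₂ ℤ._+_ (eval-linearise a ρ)
      (trans (dot-scale (ℤ.- + 1) (linearise b) _)
        (trans (ℤ.-1*i≡-i _) (cong ℤ.-_ (eval-linearise b ρ)))))
  eval-linearise (:- a)   ρ = trans (dot-scale (ℤ.- + 1) (linearise a) _)
    (trans (ℤ.-1*i≡-i _) (cong ℤ.-_ (eval-linearise a ρ)))
  eval-linearise (c :* a) ρ = trans (dot-scale c (linearise a) _)
    (cong (c ℤ.*_) (eval-linearise a ρ))

  -- A relation amounts to forms f ≥ 0 and zeros e = 0.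
  forms zeros : Relation n → List (Form n)
  forms (a :≤ b) = linearise (b :- a) ∷ []
  forms (a :< b) = linearise (b :- a :- con (+ 1)) ∷ []
  forms (a := b) = []
  forms :⊥       = constant -[1+ 0 ] ∷ []
  zeros (a := b) = linearise (b :- a) ∷ []
  zeros _        = []

  Nonneg : Vec ℤ n → Form n → Set
  Nonneg ρ f = + 0 ℤ.≤ eval f ρ

  Zero : Vec ℤ n → Form n → Set
  Zero ρ f = eval f ρ ≡ + 0

  ≤-diff : ∀ {a b} → a ℤ.≤ b → + 0 ℤ.≤ b ℤ.- a
  ≤-diff = ℤ.i≤j⇒0≤j-i

  -- Within the procedure integrality enters here only: a strict inequality is tightened by one. The
  -- elimination itself is rational.
  <-diff : ∀ {a b} → a ℤ.< b → + 0 ℤ.≤ b ℤ.- a ℤ.- + 1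
  <-diff {a} {b} a<b = subst (+ 0 ℤ.≤_) (lemma a b) (≤-diff (ℤ.i<j⇒suc[i]≤j a<b))
    where
    lemma : ∀ a b → b ℤ.- (+ 1 ℤ.+ a) ≡ b ℤ.- a ℤ.- + 1
    lemma = solve-∀

  nonneg : ∀ (e : Expr n) {ρ} → + 0 ℤ.≤ ⟦ e ⟧ₑ ρ → Nonneg ρ (linearise e)
  nonneg e {ρ} = subst (+ 0 ℤ.≤_) (sym (eval-linearise e ρ))

  forms-sound : ∀ (r : Relation n) {ρ} → ⟦ r ⟧ᵣ ρ → All (Nonneg ρ) (forms r)
  forms-sound (a :≤ b) h = nonneg (b :- a) (≤-diff h) ∷ []
  forms-sound (a :< b) h = nonneg (b :- a :- con (+ 1)) (<-diff h) ∷ []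
  forms-sound (a := b) h = []

  zeros-sound : ∀ (r : Relation n) {ρ} → ⟦ r ⟧ᵣ ρ → All (Zero ρ) (zeros r)
  zeros-sound (a :≤ b) h = []
  zeros-sound (a :< b) h = []
  zeros-sound (a := b) {ρ} h = trans (eval-linearise (b :- a) ρ) (ℤ.i≡j⇒i-j≡0 (sym h)) ∷ []

  -- combine p f h is a nonnegative combination of f and h; when the coefficients
  -- of a variable in f and h are p > 0 and q < 0 it is free of that variable.
  combine : ℕ → ℕ → Form n → Form n → Form n
  combine p q f h = add (scale (+ q) f) (scale (+ p) h)

  0≤* : ∀ p {x} → + 0 ℤ.≤ x → + 0 ℤ.≤ + p ℤ.* x
  0≤* p {x} h = subst (ℤ._≤ + p ℤ.* x) (ℤ.*-zeroʳ (+ p)) (ℤ.*-monoˡ-≤-nonNeg (+ p) h)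

  combine-sound : ∀ p q {f h : Form n} {ρ} → Nonneg ρ f → Nonneg ρ h → Nonneg ρ (combine p q f h)
  combine-sound p q {f} {h} {ρ} f≥0 h≥0 = subst (+ 0 ℤ.≤_)
    (sym (trans (dot-add (scale (+ q) f) (scale (+ p) h) _)
      (cong₂ ℤ._+_ (dot-scale (+ q) f _) (dot-scale (+ p) h _))))
    (ℤ.+-mono-≤ (0≤* q f≥0) (0≤* p h≥0))

  data Sign : Set where
    positive negative : ℕ → Sign
    vanishing         : Sign

  sign : ℤ → Sign
  sign (+ zero)    = vanishing
  sign (+ p@(suc _)) = positive p
  sign -[1+ q ]    = negative (suc q)

  -- `s` is the sign of the coefficient of `i` in `f`. Only forms with a coefficient of the opposite
  -- sign are paired with `f`, for there `combine` cancels the variable.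
  against : Fin (suc n) → Sign → Form n → List (Form n) → List (Form n)
  against i s            f []       = []
  against i s            f (h ∷ hs) with s | sign (lookup h i)
  ... | positive p | negative q = combine p q f h ∷ against i s f hs
  ... | negative q | positive p = combine p q h f ∷ against i s f hs
  ... | _          | _          = against i s f hs

  against-sound : ∀ i s {f : Form n} {hs ρ} → Nonneg ρ f → All (Nonneg ρ) hs →
                  All (Nonneg ρ) (against i s f hs)
  against-sound i s f≥0 [] = []
  against-sound i s {f} {h ∷ hs} f≥0 (h≥0 ∷ hs≥0) with s | sign (lookup h i)
  ... | positive p | negative q = combine-sound p q {f} {h} f≥0 h≥0 ∷ against-sound i
    (positive p) f≥0 hs≥0
  ... | negative q | positive p = combine-sound p q {h} {f} h≥0 f≥0 ∷ against-sound i
    (negative q) f≥0 hs≥0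
  ... | positive p | positive _ = against-sound i (positive p) f≥0 hs≥0
  ... | positive p | vanishing  = against-sound i (positive p) f≥0 hs≥0
  ... | negative q | negative _ = against-sound i (negative q) f≥0 hs≥0
  ... | negative q | vanishing  = against-sound i (negative q) f≥0 hs≥0
  ... | vanishing  | _          = against-sound i vanishing f≥0 hs≥0

  eliminate : Fin (suc n) → List (Form n) → List (Form n)
  eliminate i []       = []
  eliminate i (f ∷ fs) with sign (lookup f i)
  ... | vanishing = f ∷ eliminate i fs
  -- Pairing with the later forms only meets every pair once.
  ... | s         = against i s f fs List.++ eliminate i fs

  eliminate-sound : ∀ i {fs : List (Form n)} {ρ} → All (Nonneg ρ) fs →
                    All (Nonneg ρ) (eliminate i fs)
  eliminate-sound i []            = []
  eliminate-sound i {f ∷ fs} (f≥0 ∷ fs≥0) with sign (lookup f i)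
  ... | vanishing    = f≥0 ∷ eliminate-sound i fs≥0
  ... | s@(positive _) = All.++⁺ (against-sound i s f≥0 fs≥0) (eliminate-sound i fs≥0)
  ... | s@(negative _) = All.++⁺ (against-sound i s f≥0 fs≥0) (eliminate-sound i fs≥0)

  allZero : Vec ℤ n → Bool
  allZero []                = true
  allZero (+ zero    ∷ cs)  = allZero cs
  allZero (+ (suc _) ∷ cs)  = false
  allZero (-[1+ _ ]  ∷ cs)  = false

  dot-allZero : ∀ (cs ρ : Vec ℤ n) → T (allZero cs) → dot cs ρ ≡ + 0
  dot-allZero []              []      _ = refl
  dot-allZero (+ zero ∷ cs) (x ∷ ρ) p = cong₂ ℤ._+_ (ℤ.*-zeroˡ x) (dot-allZero cs ρ p)

  isNegativeConstant : Form n → Bool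
  isNegativeConstant (-[1+ _ ] ∷ cs) = allZero cs
  isNegativeConstant (+ _ ∷ cs)      = false

  negativeConstant-sound : ∀ (f : Form n) {ρ} → T (isNegativeConstant f) → ¬ Nonneg ρ f
  negativeConstant-sound (c@(-[1+ k ]) ∷ cs) {ρ} isNeg f≥0 =
    contra (subst (+ 0 ℤ.≤_) (cong₂ ℤ._+_ (ℤ.*-identityʳ c) (dot-allZero cs ρ isNeg)) f≥0)
    where
    contra : ¬ + 0 ℤ.≤ c
    contra ()

  anyNegative : List (Form n) → Bool
  anyNegative []       = false
  anyNegative (f ∷ fs) = isNegativeConstant f ∨ anyNegative fs

  anyNegative-sound : ∀ (fs : List (Form n)) {ρ} → T (anyNegative fs) → ¬ All (Nonneg ρ) fs
  anyNegative-sound (f ∷ fs) p (f≥0 ∷ fs≥0) =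
    [ (λ q → negativeConstant-sound f q f≥0) , (λ q → anyNegative-sound fs q fs≥0) ]′
      (Equivalence.to (Bool.T-∨ {isNegativeConstant f}) p)

  constant≢0 : Form n → Bool
  constant≢0 (+ zero ∷ cs) = false
  constant≢0 (_      ∷ cs) = allZero cs

  constant≢0-sound : ∀ (f : Form n) {ρ} → T (constant≢0 f) → ¬ Zero ρ f
  constant≢0-sound (c@(+ (suc k)) ∷ cs) {ρ} p z =
    bad (trans (sym z) (cong₂ ℤ._+_ (ℤ.*-identityʳ c) (dot-allZero cs ρ p)))
    where
    bad : ¬ + 0 ≡ c ℤ.+ + 0
    bad ()
  constant≢0-sound (c@(-[1+ k ]) ∷ cs) {ρ} p z =
    bad (trans (sym z) (cong₂ ℤ._+_ (ℤ.*-identityʳ c) (dot-allZero cs ρ p)))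
    where
    bad : ¬ + 0 ≡ c
    bad ()

  anyNonzero : List (Form n) → Bool
  anyNonzero []       = false
  anyNonzero (e ∷ es) = constant≢0 e ∨ anyNonzero es

  anyNonzero-sound : ∀ (es : List (Form n)) {ρ} → T (anyNonzero es) → ¬ All (Zero ρ) es
  anyNonzero-sound (e ∷ es) p (e≡0 ∷ es≡0) =
    [ (λ q → constant≢0-sound e q e≡0) , (λ q → anyNonzero-sound es q es≡0) ]′
      (Equivalence.to (Bool.T-∨ {constant≢0 e}) p)

  -- The multiplier of the equation `e` that cancels the pivot variable once `f` is scaled by the
  -- absolute value of the pivot coefficient. The absolute value keeps the direction of an
  -- inequality.
  cofactor : ℤ → ℤ → ℤ
  cofactor (+ _)    a = ℤ.- a
  cofactor -[1+ _ ] a = a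

  scale-zero : ∀ k {x} → x ≡ + 0 → k ℤ.* x ≡ + 0
  scale-zero k refl = ℤ.*-zeroʳ k

  substitute : Fin (suc n) → Form n → Form n → Form n
  substitute i e f = add (scale (+ ℤ.∣ lookup e i ∣) f)
    (scale (cofactor (lookup e i) (lookup f i)) e)

  eval-substitute : ∀ i (e f : Form n) {ρ} → Zero ρ e →
                    eval (substitute i e f) ρ ≡ + ℤ.∣ lookup e i ∣ ℤ.* eval f ρ
  eval-substitute i e f {ρ} e≡0 = trans (dot-add (scale (+ ℤ.∣ lookup e i ∣) f) _ _)
    (trans (cong₂ ℤ._+_ (dot-scale (+ ℤ.∣ lookup e i ∣) f _)
      (trans (dot-scale k e _) (scale-zero k e≡0))) (ℤ.+-identityʳ _))
    where
    k = cofactor (lookup e i) (lookup f i)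

  pivot : Fin (suc n) → List (Form n) → Maybe (Form n)
  pivot i []       = nothing
  pivot i (e ∷ es) with lookup e i
  ... | + zero = pivot i es
  ... | _      = just e

  pivot-sound : ∀ i {es : List (Form n)} {ρ e} → All (Zero ρ) es → pivot i es ≡ just e → Zero ρ e
  pivot-sound i {e ∷ es} (e≡0 ∷ es≡0) eq with lookup e i
  pivot-sound i {e ∷ es} (e≡0 ∷ es≡0) eq   | + zero    = pivot-sound i es≡0 eq
  pivot-sound i {e ∷ es} (e≡0 ∷ es≡0) refl | + (suc _) = e≡0
  pivot-sound i {e ∷ es} (e≡0 ∷ es≡0) refl | -[1+ _ ]  = e≡0

  refute : List (Fin (suc n)) → List (Form n) → List (Form n) → Bool
  refute []       es fs = anyNonzero es ∨ anyNegative fs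
  refute (i ∷ is) es fs with pivot i es
  -- Substitution never increases the number of forms, so it is preferred to elimination. The pivot
  -- itself turns into the zero form.
  ... | just e  = refute is (List.map (substitute i e) es) (List.map (substitute i e) fs)
  ... | nothing = refute is es (eliminate i fs)

  refute-sound : ∀ is (es fs : List (Form n)) {ρ} → T (refute is es fs) →
                 All (Zero ρ) es → ¬ All (Nonneg ρ) fs
  refute-sound []       es fs p es≡0 fs≥0 =
    [ (λ q → anyNonzero-sound es q es≡0) , (λ q → anyNegative-sound fs q fs≥0) ]′
      (Equivalence.to (Bool.T-∨ {anyNonzero es}) p)
  refute-sound (i ∷ is) es fs {ρ} p es≡0 fs≥0 with pivot i es in eq
  ... | nothing = refute-sound is es _ p es≡0 (eliminate-sound i fs≥0)
  ... | just e  = refute-sound is _ _ p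
    (All.map⁺ (All.map (λ {f} f≡0 → trans (eval-substitute i e f e≡0)
      (scale-zero (+ ℤ.∣ lookup e i ∣) f≡0)) es≡0))
    (All.map⁺ (All.map (λ {f} f≥0 → subst (+ 0 ℤ.≤_) (sym (eval-substitute i e f e≡0))
      (0≤* ℤ.∣ lookup e i ∣ f≥0)) fs≥0))
    where
    e≡0 : Zero ρ e
    e≡0 = pivot-sound i es≡0 eq

  -- Position 0 of a form is its constant term, hence the shift by `Fin.suc`.
  variables : ∀ n → List (Fin (suc n))
  variables n = List.map Fin.suc (List.allFin n)

  hypotheses equations : List (Relation n) → List (Form n)
  hypotheses = List.concatMap forms
  equations  = List.concatMap zeros

  contradictory : List (Relation n) → Bool
  contradictory {n} hs = refute (variables n) (equations hs) (hypotheses hs)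

  valid : Sequent n → Bool
  valid (hs ⊢ a :≤ b) = contradictory ((b :< a) ∷ hs)
  valid (hs ⊢ a :< b) = contradictory ((b :≤ a) ∷ hs)
  valid (hs ⊢ a := b) = contradictory ((b :< a) ∷ hs) ∧ contradictory ((a :< b) ∷ hs)
  valid (hs ⊢ :⊥)     = contradictory hs

  Holds : Vec ℤ n → List (Relation n) → Set
  Holds ρ = All (λ r → ⟦ r ⟧ᵣ ρ)

  introduce : ∀ (hs : List (Relation n)) {G ρ} → (Holds ρ hs → G) → implications hs G ρ
  introduce []       k   = k []
  introduce (h ∷ hs) k p = introduce hs (λ ps → k (p ∷ ps))

  contradictory-sound : ∀ (hs : List (Relation n)) {ρ} → T (contradictory hs) → ¬ Holds ρ hs
  contradictory-sound hs p ps = refute-sound (variables _) (equations hs) (hypotheses hs) p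
    (All.concat⁺ (All.map⁺ (All.map (λ {r} → zeros-sound r) ps)))
    (All.concat⁺ (All.map⁺ (All.map (λ {r} → forms-sound r) ps)))

  sound : ∀ (s : Sequent n) ρ → T (valid s) → ⟦ s ⟧ₛ ρ
  sound (hs ⊢ a :≤ b) ρ p = introduce hs λ ps →
    ℤ.≮⇒≥ λ q → contradictory-sound ((b :< a) ∷ hs) p (q ∷ ps)
  sound (hs ⊢ a :< b) ρ p = introduce hs λ ps →
    ℤ.≰⇒> λ q → contradictory-sound ((b :≤ a) ∷ hs) p (q ∷ ps)
  sound (hs ⊢ a := b) ρ p = introduce hs λ ps → ℤ.≤-antisym
    (ℤ.≮⇒≥ λ q → contradictory-sound ((b :< a) ∷ hs) (proj₁ (Equivalence.to Bool.T-∧ p)) (q ∷ ps))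
    (ℤ.≮⇒≥ λ q → contradictory-sound ((a :< b) ∷ hs) (proj₂ (Equivalence.to Bool.T-∧ p)) (q ∷ ps))
  sound (hs ⊢ :⊥)     ρ p = introduce hs (contradictory-sound hs p)

  -- The implicit argument is computed away: when the procedure succeeds, its type evaluates to the
  -- unit type and is filled in by eta. Every use is thus a proof by reflection, and a sequent on
  -- which the procedure fails is a type error.
  lin : ∀ n (f : N-ary n (Expr n) (Sequent n)) →
        let s = f $ⁿ Vec.map var (Vec.allFin n) in
        {T (valid s)} → ∀ⁿ n (curryⁿ {n = n} ⟦ s ⟧ₛ)
  lin n f {p} = prove n (λ ρ → sound (f $ⁿ Vec.map var (Vec.allFin n)) ρ p)
    where
    prove : ∀ n {P : Vec ℤ n → Set} → (∀ ρ → P ρ) → ∀ⁿ n (curryⁿ {n = n} P)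
    prove zero    h = h []
    prove (suc n) h = λ x → prove n (λ ρ → h (x ∷ ρ))

open Linear using (lin; _:≤_; _:<_; _:=_; :⊥; _:+_; _:-_; :-_; _:*_; con; #_; _⊢_)

-- Translations by multiples of the period and division with remainder.

module Shifts where
  open import Data.Integer using (_+_; _-_; _*_; -_; _≤_; _<_)
  +-cancelʳ : ∀ c a b → a + c ≡ b + c → a ≡ b
  +-cancelʳ = lin 3 λ c a b → (a :+ c := b :+ c) ∷ [] ⊢ a := b

  neg-shift : ∀ x k N → - (x + k * N) ≡ - x + (- k) * N
  neg-shift = solve-∀

  shift-shift : ∀ x k l N → x + k * N + l * N ≡ x + (k + l) * N
  shift-shift = solve-∀

  shift-one : ∀ x k N → x + k * N + N ≡ x + (+ 1 + k) * N
  shift-one = solve-∀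

  shift-0 : ∀ x N → x + + 0 * N ≡ x
  shift-0 = solve-∀

  shift-1 : ∀ x N → x + + 1 * N ≡ x + N
  shift-1 = solve-∀

  shift-cancel : ∀ x k N → x + k * N + - k * N ≡ x
  shift-cancel = solve-∀

open Shifts

module DivisionBy (m : ℕ) where
  open import Data.Integer using (_+_; _-_; _*_; -_; _≤_; _<_)

  N : ℤ
  N = + suc m

  quotient-< : ∀ {q q′} → q < q′ → q * N + N ≤ q′ * N
  quotient-< {q} {q′} q<q′ = subst (_≤ q′ * N) (lemma q N)
    (ℤ.*-monoʳ-≤-nonNeg N (ℤ.i<j⇒suc[i]≤j q<q′))
    where
    lemma : ∀ q N → (+ 1 + q) * N ≡ q * N + N
    lemma = solve-∀

  quotient-≤ : ∀ {q q′} → q ≤ q′ → q * N ≤ q′ * N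
  quotient-≤ = ℤ.*-monoʳ-≤-nonNeg N

  quotient-unique : ∀ {r r′ q q′} → + 0 ≤ r → r < N → + 0 ≤ r′ → r′ < N →
                    r + q * N ≡ r′ + q′ * N → q ≡ q′
  quotient-unique {r} {r′} {q} {q′} a b c d e with ℤ.<-cmp q q′
  ... | tri≈ _ q≡q′ _ = q≡q′
  ... | tri< q<q′ _ _ = ⊥-elim (lin 5 (λ r r′ x y N →
    (r :< N) ∷ (# 0 :≤ r′) ∷ (r :+ x := r′ :+ y) ∷ (x :+ N :≤ y) ∷ [] ⊢ :⊥)
    r r′ (q * N) (q′ * N) N b c e (quotient-< {q} {q′} q<q′))
  ... | tri> _ _ q′<q = ⊥-elim (lin 5 (λ r r′ x y N →
    (r :< N) ∷ (# 0 :≤ r′) ∷ (r :+ x := r′ :+ y) ∷ (x :+ N :≤ y) ∷ [] ⊢ :⊥)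
    r′ r (q′ * N) (q * N) N d a (sym e) (quotient-< {q′} {q} q′<q))

  remainder-unique : ∀ {r r′ q q′} → + 0 ≤ r → r < N → + 0 ≤ r′ → r′ < N →
                     r + q * N ≡ r′ + q′ * N → r ≡ r′
  remainder-unique {r} {r′} {q} {q′} a b c d e =
    +-cancelʳ (q * N) r r′
      (trans e (cong (λ k → r′ + k * N) (sym (quotient-unique {r} {r′} {q} {q′} a b c d e))))

  data Quotient (e : ℤ) : Set where
    quot : ∀ r q → r ℕ.< suc m → e ≡ + r + q * N → Quotient e

  divide : ∀ e → Quotient e
  divide e = quot (e %ℕ suc m) (e /ℕ suc m) (n%ℕd<d e (suc m))
                  (a≡a%ℕn+[a/ℕn]*n e (suc m))

  divMod-unique : ∀ r q → r ℕ.< suc m →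
    (+ r + q * N) %ℕ suc m ≡ r × (+ r + q * N) /ℕ suc m ≡ q
  divMod-unique r q r<N =
    ℤ.+-injective (remainder-unique {_} {_} {e /ℕ suc m} {q} (+≤+ z≤n) (+<+ r′<N) (+≤+ z≤n)
      (+<+ r<N) (sym eq)) ,
    quotient-unique {_} {_} {e /ℕ suc m} {q} (+≤+ z≤n) (+<+ r′<N) (+≤+ z≤n) (+<+ r<N) (sym eq)
    where
    e = + r + q * N
    r′<N = n%ℕd<d e (suc m)
    eq = a≡a%ℕn+[a/ℕn]*n e (suc m)

  -- A product `k * N` is opaque to linear arithmetic. This trichotomy makes it usable there: it
  -- vanishes or is at least a whole period away from 0.
  data Scale (k : ℤ) : Set where
    below : k < + 0 → k * N ≤ - N → Scale k
    none  : k ≡ + 0 → k * N ≡ + 0 → Scale k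
    above : + 0 < k → N ≤ k * N → Scale k

  scale : ∀ k → Scale k
  scale k with ℤ.<-cmp k (+ 0)
  ... | tri< k<0 _ _ = below k<0 (lin 3 (λ N x y → (x :+ N :≤ y) ∷ (y := # 0) ∷ [] ⊢ x :≤ :- N)
    N (k * N) (+ 0 * N) (quotient-< {k} {+ 0} k<0) (ℤ.*-zeroˡ N))
  ... | tri≈ _ refl _ = none refl (ℤ.*-zeroˡ N)
  ... | tri> _ _ k>0 = above k>0 (lin 3 (λ N x y → (y :+ N :≤ x) ∷ (y := # 0) ∷ [] ⊢ N :≤ x)
    N (k * N) (+ 0 * N) (quotient-< {+ 0} {k} k>0) (ℤ.*-zeroˡ N))

-- Mirrored permutations with explicit inverses.

module Permutations (n : ℕ) where
  open import Data.Integer using (_+_; _-_; _*_; -_; _≤_; _<_)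
  open DivisionBy (2 ℕ.* n) public

  n₊ : ℤ
  n₊ = + n

  N≡ : N ≡ + 1 + (n₊ + n₊)
  N≡ = cong (λ k → + suc (n ℕ.+ k)) (ℕ.+-identityʳ n)

  0≤n : + 0 ≤ n₊
  0≤n = +≤+ z≤n

  -- The multiples of `N` are fixed by every mirrored permutation and label no entry of an abacus.
  Entry : ℤ → Set
  Entry x = ¬ N ∣ x

  entry-shift : ∀ {x} k → Entry x → Entry (x + k * N)
  entry-shift {x} k ent (divides q eq) = ent (divides (q - k)
    (trans (sym (shift-cancel x k N)) (trans (cong (_+ - k * N) eq)
      (sym (ℤ.*-distribʳ-+ N q (- k))))))

  entry-neg : ∀ {x} → Entry x → Entry (- x)
  entry-neg {x} ent (divides q eq) = ent (divides (- q)
    (trans (sym (ℤ.neg-involutive x)) (trans (cong -_ eq) (ℤ.neg-distribˡ-* q N))))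

  entry-between : ∀ {x} → + 0 < x → x < N → Entry x
  entry-between {x} 0<x x<N (divides q eq) =
    lin 1 (λ x → (# 0 :< x) ∷ (x := # 0) ∷ [] ⊢ :⊥) x 0<x
      (remainder-unique {x} {+ 0} {+ 0} {q} (ℤ.<⇒≤ 0<x) x<N (+≤+ z≤n) (+<+ (s≤s z≤n))
        (trans (shift-0 x N) (trans eq (sym (ℤ.+-identityˡ (q * N))))))

  entry-quotient : ∀ {r q} → + 0 < r → r < N → Entry (r + q * N)
  entry-quotient {r} {q} a b = entry-shift q (entry-between a b)

  -- The inverse is carried as a function in place of a proof of surjectivity, so that `inverse` and
  -- `_⊙_` are built directly; the beads of `w` are described by `from w`.
  record Aut : Set where
    field
      to from : ℤ → ℤ
      to-from : ∀ x → to (from x) ≡ x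
      from-to : ∀ x → from (to x) ≡ x
      to-+N   : ∀ x → to (x + N) ≡ to x + N
      to-neg  : ∀ x → to (- x) ≡ - to x

    to-injective : ∀ {x y} → to x ≡ to y → x ≡ y
    to-injective {x} {y} eq = trans (sym (from-to x)) (trans (cong from eq) (from-to y))

    to-shift⁺ : ∀ m x → to (x + + m * N) ≡ to x + + m * N
    to-shift⁺ zero    x = trans (cong to (shift-0 x N)) (sym (shift-0 (to x) N))
    to-shift⁺ (suc m) x = trans (cong to (sym (shift-one x (+ m) N)))
      (trans (to-+N (x + + m * N)) (trans (cong (_+ N) (to-shift⁺ m x)) (shift-one (to x) (+ m) N)))

    to-shift : ∀ k x → to (x + k * N) ≡ to x + k * N
    to-shift (+ m) x = to-shift⁺ m x
    to-shift k@(-[1+ m ]) x = +-cancelʳ (- k * N) (to (x + k * N)) (to x + k * N)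
      (trans (sym (to-shift⁺ (suc m) (x + k * N)))
        (trans (cong to (shift-cancel x k N)) (sym (shift-cancel (to x) k N))))

    from-+N : ∀ x → from (x + N) ≡ from x + N
    from-+N x = trans (cong (λ y → from (y + N)) (sym (to-from x)))
      (trans (cong from (sym (to-+N (from x)))) (from-to (from x + N)))

    from-neg : ∀ x → from (- x) ≡ - from x
    from-neg x = trans (cong (from ∘ -_) (sym (to-from x)))
      (trans (cong from (sym (to-neg (from x)))) (from-to (- from x)))

    to-0 : to (+ 0) ≡ + 0
    to-0 = lin 1 (λ x → (x := :- x) ∷ [] ⊢ x := # 0) (to (+ 0)) (to-neg (+ 0))

    to-multiple : ∀ {x} → N ∣ x → N ∣ to x
    to-multiple {x} (divides q eq) = divides q
      (trans (cong to (trans eq (sym (ℤ.+-identityˡ _))))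
        (trans (to-shift q (+ 0)) (trans (cong (_+ q * N) to-0) (ℤ.+-identityˡ _))))

  open Aut public

  inverse : Aut → Aut
  inverse w = record
    { to = from w ; from = to w ; to-from = from-to w ; from-to = to-from w
    ; to-+N = from-+N w ; to-neg = from-neg w }

  from-shift : ∀ w k x → from w (x + k * N) ≡ from w x + k * N
  from-shift w = to-shift (inverse w)

  to-entry : ∀ w {x} → Entry x → Entry (to w x)
  to-entry w {x} ent m = ent (subst (N ∣_) (from-to w x) (to-multiple (inverse w) m))

  from-entry : ∀ w {x} → Entry x → Entry (from w x)
  from-entry w = to-entry (inverse w)

  identity : Aut
  identity = record
    { to = id ; from = id ; to-from = λ _ → refl ; from-to = λ _ → refl
    ; to-+N = λ _ → refl ; to-neg = λ _ → refl }

  infixr 9 _⊙_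
  _⊙_ : Aut → Aut → Aut
  v ⊙ w = record
    { to = to v ∘ to w
    ; from = from w ∘ from v
    ; to-from = λ x → trans (cong (to v) (to-from w (from v x))) (to-from v x)
    ; from-to = λ x → trans (cong (from w) (from-to v (to w x))) (from-to w x)
    ; to-+N = λ x → trans (cong (to v) (to-+N w x)) (to-+N v (to w x))
    ; to-neg = λ x → trans (cong (to v) (to-neg w x)) (to-neg v (to w x))
    }

  toAut : MirroredPermutation n → Aut
  toAut w = record
    { to = ⟦ w ⟧
    ; from = λ y → proj₁ (surjective y)
    ; to-from = λ y → proj₂ (surjective y) refl
    ; from-to = λ x → injective (proj₂ (surjective (⟦ w ⟧ x)) refl)
    ; to-+N = MirroredPermutation.periodic w
    ; to-neg = MirroredPermutation.mirrored w
    }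
    where
    injective  = proj₁ (MirroredPermutation.bijective w)
    surjective = proj₂ (MirroredPermutation.bijective w)

  fromAut : Aut → MirroredPermutation n
  fromAut w = record
    { ⟦_⟧ = to w
    ; bijective = to-injective w , λ y → from w y , λ { refl → to-from w y }
    ; periodic = to-+N w
    ; mirrored = to-neg w
    }

  from-≗ : ∀ v w → to v ≗ to w → from v ≗ from w
  from-≗ v w eq x = to-injective w (trans (sym (eq (from v x)))
    (trans (to-from v x) (sym (to-from w x))))

if-true : ∀ {A : Set} {b} {x y : A} → T b → (if b then x else y) ≡ x
if-true {b = true} _ = refl

if-false : ∀ {A : Set} {b} {x y : A} → ¬ T b → (if b then x else y) ≡ y
if-false {b = false} _ = refl
if-false {b = true}  f = ⊥-elim (f _)

if-≡ : ∀ {A : Set} {a b} {x y : A} → a ≡ b → (if a ≡ᵇ b then x else y) ≡ x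
if-≡ {a = a} {b} eq = if-true (ℕ.≡⇒≡ᵇ a b eq)

if-≢ : ∀ {A : Set} {a b} {x y : A} → a ≢ b → (if a ≡ᵇ b then x else y) ≡ y
if-≢ {a = a} {b} ne = if-false (ne ∘ ℕ.≡ᵇ⇒≡ a b)

rank₂ : ∀ t {n} → minRank t ℕ.≤ n → 2 ℕ.≤ n
rank₂ C̃/C h = h
rank₂ B̃/B h = ℕ.≤-trans (s≤s (s≤s z≤n)) h
rank₂ B̃/D h = ℕ.≤-trans (s≤s (s≤s z≤n)) h
rank₂ D̃/D h = ℕ.≤-trans (s≤s (s≤s z≤n)) h

rank₃-₀ : ∀ t {n} → minRank t ℕ.≤ n → variant₀ t ≡ D → 3 ℕ.≤ n
rank₃-₀ B̃/B h _ = h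
rank₃-₀ D̃/D h _ = ℕ.≤-trans (s≤s (s≤s (s≤s z≤n))) h

rank₃-ₙ : ∀ t {n} → minRank t ℕ.≤ n → variantₙ t ≡ D → 3 ℕ.≤ n
rank₃-ₙ B̃/D h _ = h
rank₃-ₙ D̃/D h _ = ℕ.≤-trans (s≤s (s≤s (s≤s z≤n))) h

-- Extending a window to all integers.

module Extensions (n : ℕ) where
  open import Data.Integer using (_+_; _-_; _*_; -_; _≤_; _<_)
  open Permutations n public

  -- A copy of the function local to `extend`, with which it agrees by definition, so that its
  -- values can be named.
  base : (ℕ → ℤ) → ℕ → ℤ
  base f r = if r ≡ᵇ 0 then + 0 else
             if r ≤ᵇ n then f r else N - f (period n ∸ r)

  extend-cong : ∀ f e {r q} → e %ℕ period n ≡ r → e /ℕ period n ≡ q →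
                extend n f e ≡ base f r + q * N
  extend-cong f e refl refl = refl

  extend-base : ∀ f r q → r ℕ.< period n → extend n f (+ r + q * N) ≡ base f r + q * N
  extend-base f r q r<N = let (a , b) = divMod-unique r q r<N in
    extend-cong f (+ r + q * N) a b

  base-low : ∀ f {r} → 1 ℕ.≤ r → r ℕ.≤ n → base f r ≡ f r
  base-low f {suc r} _ r≤n = if-true (ℕ.≤⇒≤ᵇ r≤n)

  base-high : ∀ f {r} → n ℕ.< r → base f r ≡ N - f (period n ∸ r)
  base-high f {suc r} n<r = if-false (λ p → ℕ.<⇒≱ n<r (ℕ.≤ᵇ⇒≤ (suc r) n p))

  n<period : n ℕ.< period n
  n<period = s≤s (ℕ.m≤m+n n _)

  period∸ : ∀ {r} → r ℕ.≤ period n → + (period n ∸ r) ≡ N - + r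
  period∸ {r} r≤ = trans (sym (ℤ.⊖-≥ r≤)) (sym (ℤ.m-n≡m⊖n (period n) r))

  extend-low : ∀ f {r} q → 1 ℕ.≤ r → r ℕ.≤ n → extend n f (+ r + q * N) ≡ f r + q * N
  extend-low f {r} q 1≤r r≤n =
    trans (extend-base f r q (ℕ.≤-<-trans r≤n n<period)) (cong (_+ q * N) (base-low f 1≤r r≤n))

  extend-window : ∀ f {r} → 1 ℕ.≤ r → r ℕ.≤ n → extend n f (+ r) ≡ f r
  extend-window f {r} 1≤r r≤n = trans (cong (extend n f) (sym (shift-0 (+ r) N)))
    (trans (extend-low f (+ 0) 1≤r r≤n) (shift-0 (f r) N))

  -- The label `- r + qN` has remainder `N - r` and quotient `q - 1`, and this remainder is in the
  -- upper half of the period.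
  extend-high : ∀ f {r} q → 1 ℕ.≤ r → r ℕ.≤ n →
                extend n f (- + r + q * N) ≡ - f r + q * N
  extend-high f {r} q 1≤r r≤n = trans (cong (extend n f) eq)
    (trans (extend-base f r′ (q - + 1) r′<N)
    (trans (cong (_+ (q - + 1) * N) (trans (base-high f n<r′) (cong (λ k → N - f k) r″)))
      (lemma N (f r) q)))
    where
    r≤N = ℕ.<⇒≤ (ℕ.≤-<-trans r≤n n<period)
    r′ = period n ∸ r
    r″ : period n ∸ r′ ≡ r
    r″ = ℕ.m∸[m∸n]≡n r≤N
    r′<N : r′ ℕ.< period n
    r′<N = ℤ.drop‿+<+ (subst (_< N) (sym (period∸ r≤N))
      (lin 2 (λ N r → (# 1 :≤ r) ∷ [] ⊢ N :- r :< N) N (+ r) (+≤+ 1≤r)))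
    n<r′ : n ℕ.< r′
    n<r′ = ℤ.drop‿+<+ (subst (n₊ <_) (sym (period∸ r≤N))
      (lin 3 (λ N n r → (N := # 1 :+ (n :+ n)) ∷ (r :≤ n) ∷ [] ⊢ n :< N :- r) N n₊ (+ r) N≡
        (+≤+ r≤n)))
    lemma : ∀ N x q → N - x + (q - + 1) * N ≡ - x + q * N
    lemma = solve-∀
    lemma′ : ∀ N x q → - x + q * N ≡ N - x + (q - + 1) * N
    lemma′ = solve-∀
    eq : - + r + q * N ≡ + r′ + (q - + 1) * N
    eq = trans (lemma′ N (+ r) q) (cong (_+ (q - + 1) * N) (sym (period∸ r≤N)))

  extend-multiple : ∀ f q → extend n f (+ 0 + q * N) ≡ + 0 + q * N
  extend-multiple f q = extend-base f 0 q (s≤s z≤n)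

  -- Modulo `N` every integer is `0`, `r` or `- r` with `1 ≤ r ≤ n`, so the values on the window
  -- determine a mirrored permutation.
  data Signed : ℤ → Set where
    multiple : ∀ k → Signed (+ 0 + k * N)
    plus     : ∀ r k → 1 ℕ.≤ r → r ℕ.≤ n → Signed (+ r + k * N)
    minus    : ∀ r k → 1 ℕ.≤ r → r ℕ.≤ n → Signed (- + r + k * N)

  signed : ∀ e → Signed e
  signed e with divide e
  ... | quot zero q _ eq = subst Signed (sym eq) (multiple q)
  ... | quot (suc r) q r<N eq with suc r ℕ.≤? n
  ...   | yes r≤n = subst Signed (sym eq) (plus (suc r) q (s≤s z≤n) r≤n)
  ...   | no r≰n = subst Signed (sym (trans eq eq′)) (minus r′ (q + + 1) 1≤r′ r′≤n)
    where
    r′ = period n ∸ suc r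
    r′≡ : + r′ ≡ N - + suc r
    r′≡ = period∸ (ℕ.<⇒≤ r<N)
    1≤r′ : 1 ℕ.≤ r′
    1≤r′ = ℕ.m<n⇒0<n∸m r<N
    r′≤n : r′ ℕ.≤ n
    r′≤n = ℤ.drop‿+≤+ (lin 4 (λ N n r r′ → (N := # 1 :+ (n :+ n)) ∷ (n :< r) ∷ (r′ := N :- r) ∷ []
      ⊢ r′ :≤ n)
      N n₊ (+ suc r) (+ r′) N≡ (+<+ (ℕ.≰⇒> r≰n)) r′≡)
    lemma : ∀ r N q → r + q * N ≡ - (N - r) + (q + + 1) * N
    lemma = solve-∀
    eq′ : + suc r + q * N ≡ - + r′ + (q + + 1) * N
    eq′ = trans (lemma (+ suc r) N q) (cong (λ x → - x + (q + + 1) * N) (sym r′≡))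

  extend-shift : ∀ f e k → extend n f (e + k * N) ≡ extend n f e + k * N
  extend-shift f e k with signed e
  ... | multiple q = trans (cong (extend n f) (shift-shift (+ 0) q k N))
    (trans (extend-multiple f (q + k)) (sym (trans (cong (_+ k * N) (extend-multiple f q))
      (shift-shift (+ 0) q k N))))
  ... | plus r q a b = trans (cong (extend n f) (shift-shift (+ r) q k N))
    (trans (extend-low f (q + k) a b) (sym (trans (cong (_+ k * N) (extend-low f q a b))
      (shift-shift (f r) q k N))))
  ... | minus r q a b = trans (cong (extend n f) (shift-shift (- + r) q k N))
    (trans (extend-high f (q + k) a b) (sym (trans (cong (_+ k * N) (extend-high f q a b))
      (shift-shift (- f r) q k N))))

  extend-neg : ∀ f e → extend n f (- e) ≡ - extend n f e
  extend-neg f e with signed e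
  ... | multiple q = trans (cong (extend n f) (neg-shift (+ 0) q N))
    (trans (extend-multiple f (- q)) (sym (trans (cong -_ (extend-multiple f q))
      (neg-shift (+ 0) q N))))
  ... | plus r q a b = trans (cong (extend n f) (neg-shift (+ r) q N))
    (trans (extend-high f (- q) a b) (sym (trans (cong -_ (extend-low f q a b))
      (neg-shift (f r) q N))))
  ... | minus r q a b = trans (cong (extend n f) (trans (neg-shift (- + r) q N)
    (cong (_+ - q * N) (ℤ.neg-involutive (+ r)))))
    (trans (extend-low f (- q) a b) (sym (trans (cong -_ (extend-high f q a b))
      (trans (neg-shift (- f r) q N) (cong (_+ - q * N) (ℤ.neg-involutive (f r)))))))

  -- y is the image of x under the reflection that exchanges p + kN with q + kN
  -- and - p + kN with - q + kN for every k; the arrows are for p < q.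
  data Swap (p q x y : ℤ) : Set where
    stay : y ≡ x → Swap p q x y
    ↑    : ∀ k → x ≡ p + k * N → y ≡ q + k * N → Swap p q x y
    ↓    : ∀ k → x ≡ q + k * N → y ≡ p + k * N → Swap p q x y
    -↑   : ∀ k → x ≡ - q + k * N → y ≡ - p + k * N → Swap p q x y
    -↓   : ∀ k → x ≡ - p + k * N → y ≡ - q + k * N → Swap p q x y

  swap-shift : ∀ {p q x y} k → Swap p q x y → Swap p q (x + k * N) (y + k * N)
  swap-shift {p} {q} k s with s
  ... | stay eq   = stay (cong (_+ k * N) eq)
  ... | ↑ l a b   = ↑ (l + k) (trans (cong (_+ k * N) a) (shift-shift p l k N))
    (trans (cong (_+ k * N) b) (shift-shift q l k N))
  ... | ↓ l a b   = ↓ (l + k) (trans (cong (_+ k * N) a) (shift-shift q l k N))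
    (trans (cong (_+ k * N) b) (shift-shift p l k N))
  ... | -↑ l a b  = -↑ (l + k) (trans (cong (_+ k * N) a) (shift-shift (- q) l k N))
    (trans (cong (_+ k * N) b) (shift-shift (- p) l k N))
  ... | -↓ l a b  = -↓ (l + k) (trans (cong (_+ k * N) a) (shift-shift (- p) l k N))
    (trans (cong (_+ k * N) b) (shift-shift (- q) l k N))

  neg-shift′ : ∀ {x} p k → x ≡ - p + k * N → - x ≡ p + - k * N
  neg-shift′ p k eq = trans (cong -_ eq) (trans (neg-shift (- p) k N)
    (cong (_+ - k * N) (ℤ.neg-involutive p)))

  swap-neg : ∀ {p q x y} → Swap p q x y → Swap p q (- x) (- y)
  swap-neg {p} {q} s with s
  ... | stay eq   = stay (cong -_ eq)
  ... | ↑ l a b   = -↓ (- l) (trans (cong -_ a) (neg-shift p l N))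
    (trans (cong -_ b) (neg-shift q l N))
  ... | ↓ l a b   = -↑ (- l) (trans (cong -_ a) (neg-shift q l N))
    (trans (cong -_ b) (neg-shift p l N))
  ... | -↑ l a b  = ↓ (- l) (neg-shift′ q l a) (neg-shift′ p l b)
  ... | -↓ l a b  = ↑ (- l) (neg-shift′ p l a) (neg-shift′ q l b)

  -- Being the image under a reflection is compatible with translation by `N` and with negation, so
  -- a check on the window suffices.
  extend-swap : ∀ {p q} f → (∀ r → 1 ℕ.≤ r → r ℕ.≤ n → Swap p q (+ r) (f r)) →
                ∀ e → Swap p q e (extend n f e)
  extend-swap {p} {q} f h e with signed e
  ... | multiple k = stay (extend-multiple f k)
  ... | plus r k a b = subst (Swap p q (+ r + k * N)) (sym (extend-low f k a b))
    (swap-shift k (h r a b))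
  ... | minus r k a b = subst (Swap p q (- + r + k * N)) (sym (extend-high f k a b))
    (swap-shift k (swap-neg (h r a b)))

-- The generators as affine reflections.

module Generators (t : AffineType) (n : ℕ) (rank : minRank t ℕ.≤ n) where
  open import Data.Integer using (_+_; _-_; _*_; -_; _≤_; _<_)
  open Extensions n public

  2≤n : 2 ℕ.≤ n
  2≤n = rank₂ t rank

  5≤N : + 5 ≤ N
  5≤N = lin 2 (λ N n → (N := # 1 :+ (n :+ n)) ∷ (# 2 :≤ n) ∷ [] ⊢ # 5 :≤ N)
    N n₊ N≡ (+≤+ 2≤n)

  -- The exchanged pair `p < q` of each generator. For `s₀ᴰ` it is `1 ↦ -2`, and `2 ↦ -1` is its
  -- mirror image; for `sₙᴰ` it is `n - 1 ↦ n + 1`, and `n ↦ n + 2` is its mirror image moved by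
  -- `N`. Descents on either side are read off this one pair.
  data Kind (i : Fin (suc n)) : ℤ → ℤ → Set where
    zeroC  : toℕ i ≡ 0 → variant₀ t ≡ C → Kind i (- + 1) (+ 1)
    zeroD  : toℕ i ≡ 0 → variant₀ t ≡ D → Kind i (- + 2) (+ 1)
    middle : 1 ℕ.≤ toℕ i → toℕ i ℕ.< n → Kind i (+ toℕ i) (+ 1 + + toℕ i)
    lastC  : toℕ i ≡ n → variantₙ t ≡ C → Kind i n₊ (+ 1 + n₊)
    lastD  : toℕ i ≡ n → variantₙ t ≡ D → Kind i (n₊ - + 1) (+ 1 + n₊)

  kind : ∀ i → ∃₂ (Kind i)
  kind i with toℕ i ℕ.≟ 0 | toℕ i ℕ.≟ n
  ... | yes i≡0 | _ with variant₀ t in eq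
  ...   | C = _ , _ , zeroC i≡0 eq
  ...   | D = _ , _ , zeroD i≡0 eq
  kind i | no _ | yes i≡n with variantₙ t in eq
  ...   | C = _ , _ , lastC i≡n eq
  ...   | D = _ , _ , lastD i≡n eq
  kind i | no i≢0 | no i≢n = _ , _ , middle (ℕ.n≢0⇒n>0 i≢0) (ℕ.≤∧≢⇒< (Fin.toℕ≤pred[n] i) i≢n)

  low high : Fin (suc n) → ℤ
  low i  = proj₁ (kind i)
  high i = proj₁ (proj₂ (kind i))

  kindOf : ∀ i → Kind i (low i) (high i)
  kindOf i = proj₂ (proj₂ (kind i))

  window : Fin (suc n) → ℕ → ℤ
  window i = if toℕ i ≡ᵇ 0 then window₀ n (variant₀ t) else
             if toℕ i ≡ᵇ n then windowₙ n (variantₙ t) else windowᵢ n (toℕ i)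

  n≢0 : n ≢ 0
  n≢0 n≡0 with subst (2 ℕ.≤_) n≡0 2≤n
  ... | ()

  window-zero : ∀ {i v} → toℕ i ≡ 0 → variant₀ t ≡ v → window i ≡ window₀ n v
  window-zero i≡0 refl = if-≡ i≡0

  window-last : ∀ {i v} → toℕ i ≡ n → variantₙ t ≡ v → window i ≡ windowₙ n v
  window-last i≡n refl = trans (if-≢ (n≢0 ∘ trans (sym i≡n))) (if-≡ i≡n)

  window-middle : ∀ {i} → 1 ℕ.≤ toℕ i → toℕ i ℕ.< n → window i ≡ windowᵢ n (toℕ i)
  window-middle 1≤i i<n = trans (if-≢ (ℕ.>⇒≢ 1≤i)) (if-≢ (ℕ.<⇒≢ i<n))

  n∸1≡ : + (n ∸ 1) ≡ n₊ - + 1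
  n∸1≡ = trans (sym (ℤ.⊖-≥ (ℕ.≤-trans (s≤s z≤n) 2≤n))) (sym (ℤ.m-n≡m⊖n n 1))

  private
    at : ∀ {x p : ℤ} → x ≡ p → x ≡ p + + 0 * N
    at {p = p} eq = trans eq (sym (shift-0 p N))

    n+1≡ : + (n ℕ.+ 1) ≡ + 1 + n₊
    n+1≡ = cong +_ (ℕ.+-comm n 1)

    n+2≡ : + (n ℕ.+ 2) ≡ + 2 + n₊
    n+2≡ = cong +_ (ℕ.+-comm n 2)

  swap-window : ∀ {i p q} → Kind i p q → ∀ r → 1 ℕ.≤ r → r ℕ.≤ n → Swap p q (+ r) (window i r)
  swap-window {i} (zeroC i≡0 v) r 1≤r r≤n rewrite window-zero {i} i≡0 v with r ℕ.≟ 1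
  ... | yes refl = ↓ (+ 0) (at refl) (at refl)
  ... | no r≢1 = stay (if-≢ r≢1)
  swap-window {i} (zeroD i≡0 v) r 1≤r r≤n rewrite window-zero {i} i≡0 v with r ℕ.≟ 1 | r ℕ.≟ 2
  ... | yes refl | _ = ↓ (+ 0) (at refl) (at refl)
  ... | no _ | yes refl = -↓ (+ 0) (at refl) (at refl)
  ... | no r≢1 | no r≢2 = stay (trans (if-≢ r≢1) (if-≢ r≢2))
  swap-window {i} (middle 1≤i i<n) r 1≤r r≤n rewrite window-middle {i} 1≤i i<n
    with r ℕ.≟ toℕ i | r ℕ.≟ toℕ i ℕ.+ 1
  ... | yes refl | _ = ↑ (+ 0) (at refl) (at (trans (if-≡ {a = toℕ i} refl)
    (cong +_ (ℕ.+-comm (toℕ i) 1))))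
  ... | no r≢i | yes r≡i+1 = ↓ (+ 0) (at (cong +_ (trans r≡i+1 (ℕ.+-comm (toℕ i) 1))))
    (at (trans (if-≢ r≢i) (if-≡ r≡i+1)))
  ... | no r≢i | no r≢i+1 = stay (trans (if-≢ r≢i) (if-≢ r≢i+1))
  swap-window {i} (lastC i≡n v) r 1≤r r≤n rewrite window-last {i} i≡n v with r ℕ.≟ n
  ... | yes refl = ↑ (+ 0) (at refl) (at (trans (if-≡ {a = n} refl) n+1≡))
  ... | no r≢n = stay (if-≢ r≢n)
  swap-window {i} (lastD i≡n v) r 1≤r r≤n rewrite window-last {i} i≡n v with r ℕ.≟ n ∸ 1 | r ℕ.≟ n
  ... | yes refl | _ = ↑ (+ 0) (at n∸1≡) (at (trans (if-≡ {a = n ∸ 1} refl) n+1≡))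
  -- `n = N - (n + 1)` goes to `n + 2 = N - (n - 1)`: the mirrored exchange, one period up.
  ... | no r≢n-1 | yes refl = -↑ (+ 1)
    (lin 2 (λ N n → (N := # 1 :+ (n :+ n)) ∷ [] ⊢ n := :- (# 1 :+ n) :+ + 1 :* N) N n₊ N≡)
    (trans (trans (if-≢ r≢n-1) (trans (if-≡ {a = n} refl) n+2≡))
      (lin 2 (λ N n → (N := # 1 :+ (n :+ n)) ∷ [] ⊢ # 2 :+ n := :- (n :- # 1) :+ + 1 :* N) N n₊ N≡))
  ... | no r≢n-1 | no r≢n = stay (trans (if-≢ r≢n-1) (if-≢ r≢n))

  private
    1≤n = ℕ.≤-trans (s≤s z≤n) 2≤n

    extend-at-− : ∀ f {r x} → 1 ℕ.≤ r → r ℕ.≤ n → f r ≡ x → extend n f (- + r) ≡ - x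
    extend-at-− f {r} a b eq = trans (extend-neg f (+ r)) (cong -_ (trans (extend-window f a b) eq))

    extend-at-n+1 : ∀ f {x} → f n ≡ x → extend n f (+ 1 + n₊) ≡ N - x
    extend-at-n+1 f {x} eq = trans (cong (extend n f)
        (lin 2 (λ N n → (N := # 1 :+ (n :+ n)) ∷ [] ⊢ # 1 :+ n := :- n :+ + 1 :* N) N n₊ N≡))
      (trans (extend-high f (+ 1) 1≤n ℕ.≤-refl)
        (trans (cong (λ y → - y + + 1 * N) eq) (lin 2 (λ N x → [] ⊢ :- x :+ + 1 :* N := N :- x) N
          x)))

  generator-low : ∀ {i p q} → Kind i p q → generator t n i p ≡ q
  generator-low {i} (zeroC i≡0 v) rewrite window-zero {i} i≡0 v = extend-at-−
    (window₀ n C) ℕ.≤-refl 1≤n refl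
  generator-low {i} (zeroD i≡0 v) rewrite window-zero {i} i≡0 v = extend-at-− (window₀ n D)
    (s≤s z≤n) 2≤n refl
  generator-low {i} (middle 1≤i i<n) rewrite window-middle {i} 1≤i i<n =
    trans (extend-window (windowᵢ n (toℕ i)) 1≤i (ℕ.<⇒≤ i<n))
      (trans (if-≡ {a = toℕ i} refl) (cong +_ (ℕ.+-comm (toℕ i) 1)))
  generator-low {i} (lastC i≡n v) rewrite window-last {i} i≡n v =
    trans (extend-window (windowₙ n C) 1≤n ℕ.≤-refl) (trans (if-≡ {a = n} refl) n+1≡)
  generator-low {i} (lastD i≡n v) rewrite window-last {i} i≡n v =
    trans (cong (extend n (windowₙ n D)) (sym n∸1≡))
      (trans (extend-window (windowₙ n D) (ℕ.∸-monoˡ-≤ 1 2≤n) (ℕ.m∸n≤m n 1))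
        (trans (if-≡ {a = n ∸ 1} refl) n+1≡))

  generator-high : ∀ {i p q} → Kind i p q → generator t n i q ≡ p
  generator-high {i} (zeroC i≡0 v) rewrite window-zero {i} i≡0 v = extend-window
    (window₀ n C) ℕ.≤-refl 1≤n
  generator-high {i} (zeroD i≡0 v) rewrite window-zero {i} i≡0 v = extend-window
    (window₀ n D) ℕ.≤-refl 1≤n
  generator-high {i} (middle 1≤i i<n) rewrite window-middle {i} 1≤i i<n =
    trans (extend-window (windowᵢ n (toℕ i)) (s≤s z≤n) i<n)
      (trans (if-≢ (ℕ.>⇒≢ (ℕ.n<1+n (toℕ i)))) (if-≡ {a = suc (toℕ i)} (ℕ.+-comm 1 (toℕ i))))
  generator-high {i} (lastC i≡n v) rewrite window-last {i} i≡n v =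
    trans (extend-at-n+1 (windowₙ n C) (trans (if-≡ {a = n} refl) n+1≡))
      (lin 2 (λ N n → (N := # 1 :+ (n :+ n)) ∷ [] ⊢ N :- (# 1 :+ n) := n) N n₊ N≡)
  generator-high {i} (lastD i≡n v) rewrite window-last {i} i≡n v =
    trans (extend-at-n+1 (windowₙ n D) (trans (if-≢ n≢n-1) (trans (if-≡ {a = n} refl) n+2≡)))
      (lin 2 (λ N n → (N := # 1 :+ (n :+ n)) ∷ [] ⊢ N :- (# 2 :+ n) := n :- # 1) N n₊ N≡)
    where
    n≢n-1 : n ≢ n ∸ 1
    n≢n-1 eq = lin 1 (λ n → (n := n :- # 1) ∷ [] ⊢ :⊥) n₊ (trans (cong +_ eq) n∸1≡)

  generator-swap : ∀ {i p q} → Kind i p q → ∀ e → Swap p q e (generator t n i e)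
  generator-swap {i} K = extend-swap (window i) (swap-window K)

  generator-shift : ∀ i e k → generator t n i (e + k * N) ≡ generator t n i e + k * N
  generator-shift i = extend-shift (window i)

  generator-neg : ∀ i e → generator t n i (- e) ≡ - generator t n i e
  generator-neg i = extend-neg (window i)

  generator-involutive : ∀ i e → generator t n i (generator t n i e) ≡ e
  generator-involutive i e with kind i
  ... | p , q , K with generator-swap K e
  ...   | stay eq  = trans (cong (generator t n i) eq) eq
  ...   | ↑ k a b  = trans (cong (generator t n i) b)
    (trans (generator-shift i q k) (trans (cong (_+ k * N) (generator-high K)) (sym a)))
  ...   | ↓ k a b  = trans (cong (generator t n i) b)
    (trans (generator-shift i p k) (trans (cong (_+ k * N) (generator-low K)) (sym a)))
  ...   | -↑ k a b = trans (cong (generator t n i) b)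
    (trans (generator-shift i (- p) k) (trans (cong (_+ k * N)
      (trans (generator-neg i p) (cong -_ (generator-low K)))) (sym a)))
  ...   | -↓ k a b = trans (cong (generator t n i) b)
    (trans (generator-shift i (- q) k) (trans (cong (_+ k * N)
      (trans (generator-neg i q) (cong -_ (generator-high K)))) (sym a)))

  gen : Fin (suc n) → Aut
  gen i = record
    { to = generator t n i ; from = generator t n i
    ; to-from = generator-involutive i ; from-to = generator-involutive i
    ; to-+N = λ x → trans (cong (generator t n i) (sym (shift-1 x N)))
        (trans (generator-shift i x (+ 1)) (shift-1 (generator t n i x) N))
    ; to-neg = generator-neg i
    }

-- The hyperplane count and its behaviour at descents.

module Length (t : AffineType) (n : ℕ) (rank : minRank t ℕ.≤ n) where
  open import Data.Integer using (_+_; _-_; _*_; -_; _≤_; _<_)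
  open Generators t n rank public

  -- Numbers of walls crossed on the way to `x`. For an entry, `ψ` counts the multiples of `N`
  -- between `x` and the interval from 0 to `N`. `χ` counts the odd multiples of `N / 2` between `x`
  -- and the interval from `- N / 2` to `N / 2`: the floor jumps where `x` passes from `n` to
  -- `n + 1` modulo `N`.
  ψ χ : ℤ → ℕ
  ψ x = ∣ x /ℕ period n ∣
  χ x = ψ (x + n₊)

  floor : ∀ {x} r q → + 0 ≤ r → r < N → x ≡ r + q * N → x /ℕ period n ≡ q
  floor (+ r) q _ r<N refl = proj₂ (divMod-unique r q (ℤ.drop‿+<+ r<N))

  ψ-floor : ∀ {x} r q → + 0 ≤ r → r < N → x ≡ r + q * N → ψ x ≡ ∣ q ∣
  ψ-floor r q a b eq = cong ∣_∣ (floor r q a b eq)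

  data Division (x : ℤ) : Set where
    division : ∀ r q → + 0 < r → r < N → x ≡ r + q * N → Division x

  divisionOf : ∀ {x} → Entry x → Division x
  divisionOf {x} ent with divide x
  ... | quot zero q _ eq = ⊥-elim (ent (divides q (trans eq (ℤ.+-identityˡ (q * N)))))
  ... | quot (suc r) q r<N eq = division (+ suc r) q (+<+ (s≤s z≤n)) (+<+ r<N) eq

  -- For an entry the floor of `(N - x) / N` is the negative of the floor of `x / N`; for a multiple
  -- of `N` it would be off by one.
  ψ-reflect : ∀ {x} → Entry x → ψ (N - x) ≡ ψ x
  ψ-reflect {x} ent with divisionOf ent
  ... | division r q 0<r r<N eq = trans
    (ψ-floor (N - r) (- q) (ℤ.i≤j⇒0≤j-i (ℤ.<⇒≤ r<N))
      (lin 2 (λ N r → (# 0 :< r) ∷ [] ⊢ N :- r :< N) N r 0<r)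
      (trans (cong (λ z → N - z) eq) (lemma N r q)))
    (trans (ℤ.∣-i∣≡∣i∣ q) (sym (ψ-floor r q (ℤ.<⇒≤ 0<r) r<N eq)))
    where
    lemma : ∀ N r q → N - (r + q * N) ≡ (N - r) + (- q) * N
    lemma = solve-∀

  -- Reflection in 0 matches the walls crossed by `x` with those crossed by `- x`, and the wall 0 is
  -- left over.
  ψ-neg : ∀ {x} → Entry x → x < + 0 → ψ x ≡ suc (ψ (- x))
  ψ-neg {x} ent x<0 with divisionOf ent
  ... | division r (+ m) 0<r r<N eq = ⊥-elim (lin 3 (λ x r y →
    (x :< # 0) ∷ (# 0 :< r) ∷ (# 0 :≤ y) ∷ (x := r :+ y) ∷ [] ⊢ :⊥)
    x r (+ m * N) x<0 0<r (quotient-≤ {+ 0} {+ m} (+≤+ z≤n)) eq)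
  ... | division r q@(-[1+ m ]) 0<r r<N eq = trans (ψ-floor r q (ℤ.<⇒≤ 0<r) r<N eq)
    (cong suc (sym (ψ-floor (N - r) (+ m) (ℤ.i≤j⇒0≤j-i (ℤ.<⇒≤ r<N))
      (lin 2 (λ N r → (# 0 :< r) ∷ [] ⊢ N :- r :< N) N r 0<r)
      (trans (cong -_ eq) (lemma N r (+ m))))))
    where
    lemma : ∀ N r m → - (r + - (+ 1 + m) * N) ≡ (N - r) + m * N
    lemma = solve-∀

  -- The wall left over is now `N`. It is the negative case conjugated by `x ↦ N - x`.
  ψ-over : ∀ {x} → Entry x → N < x → ψ x ≡ suc (ψ (N + N - x))
  ψ-over {x} ent N<x = trans (sym (ψ-reflect ent)) (trans (ψ-neg ent′
      (lin 2 (λ N x → (N :< x) ∷ [] ⊢ N :- x :< # 0) N x N<x))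
    (cong suc (trans (sym (ψ-reflect (entry-neg ent′))) (cong ψ (lemma N x)))))
    where
    ent′ : Entry (N - x)
    ent′ = subst Entry (lemma₂ N x) (entry-shift (+ 1) (entry-neg ent))
      where
      lemma₂ : ∀ N x → - x + + 1 * N ≡ N - x
      lemma₂ = solve-∀
    lemma : ∀ N x → N - - (N - x) ≡ N + N - x
    lemma = solve-∀

  private
    remainder-bound : ∀ {r} → r ℕ.< period n → + 0 ≤ n₊ + n₊ - + r × n₊ + n₊ - + r < N
    remainder-bound {r} r<N =
      lin 3 (λ N n r → (N := # 1 :+ (n :+ n)) ∷ (r :< N) ∷ [] ⊢ # 0 :≤ n :+ n :- r) N n₊ (+ r) N≡
        (+<+ r<N) ,
      lin 3 (λ N n r → (N := # 1 :+ (n :+ n)) ∷ (# 0 :≤ r) ∷ [] ⊢ n :+ n :- r :< N) N n₊ (+ r) N≡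
        (+≤+ z≤n)

  χ-neg : ∀ x → χ (- x) ≡ χ x
  χ-neg x with divide (x + n₊)
  ... | quot r q r<N eq = trans
    (ψ-floor (n₊ + n₊ - + r) (- q) (proj₁ b) (proj₂ b)
      (trans (lemma x n₊) (trans (cong (λ z → n₊ + n₊ - z) eq) (lemma₂ n₊ (+ r) q N))))
    (trans (ℤ.∣-i∣≡∣i∣ q) (sym (ψ-floor (+ r) q (+≤+ z≤n) (+<+ r<N) eq)))
    where
    b = remainder-bound r<N
    lemma : ∀ x n → - x + n ≡ n + n - (x + n)
    lemma = solve-∀
    lemma₂ : ∀ n r q N → n + n - (r + q * N) ≡ (n + n - r) + (- q) * N
    lemma₂ = solve-∀

  -- Reflection in the wall `N / 2`, on which no integer lies because `N` is odd.
  χ-over : ∀ {x} → n₊ < x → χ x ≡ suc (χ (N - x))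
  χ-over {x} n<x with divide (x + n₊)
  ... | quot r q r<N eq = go q eq
    where
    b = remainder-bound r<N
    lemma : ∀ x n N → N - x + n ≡ N + n + n - (x + n)
    lemma = solve-∀
    lemma₂ : ∀ n r q N → N + n + n - (r + (+ 1 + q) * N) ≡ (n + n - r) + (- q) * N
    lemma₂ = solve-∀
    impossible : ∀ q → q ≤ + 0 → x + n₊ ≢ + r + q * N
    impossible q q≤0 eq = lin 5 (λ N n x r y → (N := # 1 :+ (n :+ n)) ∷ (n :< x) ∷ (r :< N) ∷
      (y :≤ # 0) ∷ (x :+ n := r :+ y) ∷ [] ⊢ :⊥)
      N n₊ x (+ r) (q * N) N≡ n<x (+<+ r<N) (quotient-≤ {q} {+ 0} q≤0) eq
    go : ∀ q → x + n₊ ≡ + r + q * N → χ x ≡ suc (χ (N - x))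
    go (+ zero)    eq = ⊥-elim (impossible (+ 0) ℤ.≤-refl eq)
    go -[1+ m ]    eq = ⊥-elim (impossible -[1+ m ] -≤+ eq)
    go (+ (suc m)) eq = trans (ψ-floor (+ r) (+ suc m) (+≤+ z≤n) (+<+ r<N) eq)
      (cong suc (sym (trans (ψ-floor (n₊ + n₊ - + r) (- + m) (proj₁ b) (proj₂ b)
        (trans (lemma x n₊ N) (trans (cong (λ z → N + n₊ + n₊ - z) eq) (lemma₂ n₊ (+ r) (+ m) N))))
        (ℤ.∣-i∣≡∣i∣ (+ m)))))

  -- The length of w counts the affine hyperplanes that separate the fundamental
  -- alcove from its image.  With x = w(i) and y = w(j), i < j, pairs x y counts
  -- the two parallel classes of eᵢ ± eⱼ, and self x those of the multiples of eᵢ: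
  -- the reflections of s₀ᶜ contribute self₀ and those of sₙᶜ contribute selfₙ.
  pairs : ℤ → ℤ → ℕ
  pairs x y = ψ (y - x) ℕ.+ ψ (x + y)

  self₀ selfₙ : Variant → ℤ → ℕ
  self₀ C x = ψ x
  self₀ D x = 0
  selfₙ C x = χ x
  selfₙ D x = 0

  self : ℤ → ℕ
  self x = self₀ (variant₀ t) x ℕ.+ selfₙ (variantₙ t) x

  cross : ℕ → ℤ → (ℕ → ℤ) → ℕ
  cross zero    z x = 0
  cross (suc m) z x = pairs z (x 0) ℕ.+ cross m z (x ∘ suc)

  size : ℕ → (ℕ → ℤ) → ℕ
  size zero    x = 0
  size (suc m) x = self (x 0) ℕ.+ cross m (x 0) (x ∘ suc) ℕ.+ size m (x ∘ suc)

  cross-cong : ∀ m z x y → (∀ j → j ℕ.< m → pairs z (x j) ≡ pairs z (y j))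
    → cross m z x ≡ cross m z y
  cross-cong zero    z x y eq = refl
  cross-cong (suc m) z x y eq = cong₂ ℕ._+_ (eq 0 (s≤s z≤n))
    (cross-cong m z (x ∘ suc) (y ∘ suc) (λ j j<m → eq (suc j) (s≤s j<m)))

  size-cong : ∀ m x y → (∀ j → j ℕ.< m → x j ≡ y j) → size m x ≡ size m y
  size-cong zero    x y eq = refl
  size-cong (suc m) x y eq = cong₂ ℕ._+_
    (cong₂ ℕ._+_ (cong self (eq 0 (s≤s z≤n)))
      (trans (cong (λ z → cross m z (x ∘ suc)) (eq 0 (s≤s z≤n)))
        (cross-cong m (y 0) (x ∘ suc) (y ∘ suc) (λ j j<m → cong (pairs (y 0))
          (eq (suc j) (s≤s j<m))))))
    (size-cong m (x ∘ suc) (y ∘ suc) (λ j j<m → eq (suc j) (s≤s j<m)))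

  cross-split : ∀ k m z x → cross (k ℕ.+ m) z x ≡ cross k z x ℕ.+ cross m z (x ∘ (k ℕ.+_))
  cross-split zero    m z x = refl
  cross-split (suc k) m z x = trans (cong (pairs z (x 0) ℕ.+_) (cross-split k m z (x ∘ suc)))
    (sym (ℕ.+-assoc (pairs z (x 0)) _ _))

  -- For generators that leave the first `k` positions alone: the pairs between these and the moved
  -- positions keep their total, so the whole count drops where the tail drops.
  size-prefix : ∀ k m x y → (∀ j → j ℕ.< k → x j ≡ y j) →
    (∀ j → j ℕ.< k → cross m (x j) (x ∘ (k ℕ.+_)) ≡ cross m (x j) (y ∘ (k ℕ.+_))) →
    size m (x ∘ (k ℕ.+_)) ≡ suc (size m (y ∘ (k ℕ.+_))) →
    size (k ℕ.+ m) x ≡ suc (size (k ℕ.+ m) y)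
  size-prefix zero    m x y _  _ eq = eq
  size-prefix (suc k) m x y xy c eq = trans
    (cong₂ ℕ._+_ (cong₂ ℕ._+_ (cong self x₀≡y₀) cross-eq)
      (size-prefix k m (x ∘ suc) (y ∘ suc) (λ j j<k → xy (suc j) (s≤s j<k))
        (λ j j<k → c (suc j) (s≤s j<k)) eq))
    (ℕ.+-suc _ _)
    where
    x₀≡y₀ = xy 0 (s≤s z≤n)
    cross-eq : cross (k ℕ.+ m) (x 0) (x ∘ suc) ≡ cross (k ℕ.+ m) (y 0) (y ∘ suc)
    cross-eq = trans (cross-split k m (x 0) (x ∘ suc))
      (trans (cong₂ ℕ._+_
          (cross-cong k (x 0) (x ∘ suc) (y ∘ suc) (λ j j<k → cong (pairs (x 0))
            (xy (suc j) (s≤s j<k))))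
          (c 0 (s≤s z≤n)))
        (trans (sym (cross-split k m (x 0) (y ∘ suc)))
          (cong (λ z → cross (k ℕ.+ m) z (y ∘ suc)) x₀≡y₀)))

  -- Replacing `x` by `N - x` exchanges the two summands, each up to `ψ-reflect`.
  pairs-reflect : ∀ z x → Entry (x - z) → Entry (z + x) → pairs z (N - x) ≡ pairs z x
  pairs-reflect z x e₁ e₂ = trans
    (cong₂ ℕ._+_ (trans (cong ψ (lemma₁ N x z)) (ψ-reflect e₂))
      (trans (cong ψ (lemma₂ N x z)) (ψ-reflect e₁)))
    (ℕ.+-comm (ψ (z + x)) (ψ (x - z)))
    where
    lemma₁ : ∀ N x z → N - x - z ≡ N - (z + x)
    lemma₁ = solve-∀
    lemma₂ : ∀ N x z → z + (N - x) ≡ N - (x - z)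
    lemma₂ = solve-∀

  pairs-neg : ∀ x y → pairs (- x) y ≡ pairs x y
  pairs-neg x y = trans (cong₂ ℕ._+_ (cong ψ (lemma₁ x y)) (cong ψ (lemma₂ x y)))
    (ℕ.+-comm (ψ (x + y)) (ψ (y - x)))
    where
    lemma₁ : ∀ x y → y - - x ≡ x + y
    lemma₁ = solve-∀
    lemma₂ : ∀ x y → - x + y ≡ y - x
    lemma₂ = solve-∀

  cross-neg : ∀ m z x y → (∀ j → j ℕ.< m → x j ≡ y j) → cross m z x ≡ cross m (- z) y
  cross-neg zero    z x y eq = refl
  cross-neg (suc m) z x y eq = cong₂ ℕ._+_
    (trans (cong (pairs z) (eq 0 (s≤s z≤n))) (sym (pairs-neg z (y 0))))
    (cross-neg m z (x ∘ suc) (y ∘ suc) (λ j j<m → eq (suc j) (s≤s j<m)))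

  private
    rearrange : ∀ a f b c d e → a ℕ.+ (suc f ℕ.+ b) ℕ.+ (c ℕ.+ d ℕ.+ e) ≡ suc
      (c ℕ.+ (f ℕ.+ d) ℕ.+ (a ℕ.+ b ℕ.+ e))
    rearrange = ℕ-Solver.solve-∀

  -- Two positions trade their roles, and only the pair that they form with each other loses a wall.
  -- The crossed indices allow for values that are also negated or reflected on the way.
  size-first-two : ∀ m x y →
    self (x 0) ≡ self (y 1) → self (x 1) ≡ self (y 0) →
    pairs (x 0) (x 1) ≡ suc (pairs (y 0) (y 1)) →
    cross m (x 0) (x ∘ suc ∘ suc) ≡ cross m (y 1) (y ∘ suc ∘ suc) →
    cross m (x 1) (x ∘ suc ∘ suc) ≡ cross m (y 0) (y ∘ suc ∘ suc) →
    size m (x ∘ suc ∘ suc) ≡ size m (y ∘ suc ∘ suc) →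
    size (suc (suc m)) x ≡ suc (size (suc (suc m)) y)
  size-first-two m x y a b f c d e rewrite a | b | f | c | d | e = rearrange
    (self (y 1)) (pairs (y 0) (y 1)) (cross m (y 1) (y ∘ suc ∘ suc))
    (self (y 0)) (cross m (y 0) (y ∘ suc ∘ suc)) (size m (y ∘ suc ∘ suc))

  -- A difference of images that is a multiple of `N` would, by injectivity, come from such a
  -- difference of arguments. This puts the floor identities for entries at the disposal of all
  -- pairs.
  entry-difference : ∀ (g : Aut) {a b} → Entry (b - a) → Entry (to g b - to g a)
  entry-difference g {a} {b} ent (divides k eq) = ent (divides k
    (lin 3 (λ a b c → (b := a :+ c) ∷ [] ⊢ b :- a := c) a b (k * N) b≡))
    where
    b≡ : b ≡ a + k * N
    b≡ = to-injective g (trans (lin 3 (λ a b c → (b :- a := c) ∷ [] ⊢ b := a :+ c) (to g a) (to g b)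
      (k * N) eq) (sym (to-shift g k a)))

  entry-sum : ∀ (g : Aut) {a b} → Entry (a + b) → Entry (to g a + to g b)
  entry-sum g {a} {b} ent = subst Entry
    (trans (cong (λ z → to g b - z) (to-neg g a)) (lemma (to g a) (to g b)))
    (entry-difference g {(- a)} {b} (subst Entry (sym (lemma a b)) ent))
    where
    lemma : ∀ a b → b - - a ≡ a + b
    lemma = solve-∀

  values : (ℤ → ℤ) → ℕ → ℤ
  values f j = f (+ suc j)

  length′ : (ℤ → ℤ) → ℕ
  length′ f = size n (values f)

  private
    window-value : ∀ i {r} → 1 ℕ.≤ r → r ℕ.≤ n → generator t n i (+ r) ≡ window i r
    window-value i = extend-window (window i)

  fixes-zeroC : ∀ {i r} → toℕ i ≡ 0 → variant₀ t ≡ C → 2 ℕ.≤ r → r ℕ.≤ n → generator t n i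
    (+ r) ≡ + r
  fixes-zeroC {i} {r} i≡0 v 2≤r r≤n = trans (window-value i (ℕ.≤-trans (s≤s z≤n) 2≤r) r≤n)
    (trans (cong (λ f → f r) (window-zero {i} i≡0 v)) (if-≢ (ℕ.>⇒≢ 2≤r)))

  fixes-zeroD : ∀ {i r} → toℕ i ≡ 0 → variant₀ t ≡ D → 3 ℕ.≤ r → r ℕ.≤ n → generator t n i
    (+ r) ≡ + r
  fixes-zeroD {i} {r} i≡0 v 3≤r r≤n = trans (window-value i (ℕ.≤-trans (s≤s z≤n) 3≤r) r≤n)
    (trans (cong (λ f → f r) (window-zero {i} i≡0 v))
      (trans (if-≢ (ℕ.>⇒≢ (ℕ.≤-trans (s≤s (s≤s z≤n)) 3≤r))) (if-≢ (ℕ.>⇒≢ 3≤r))))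

  fixes-middle : ∀ {i r} → 1 ℕ.≤ toℕ i → toℕ i ℕ.< n → 1 ℕ.≤ r → r ℕ.≤ n →
                 r ≢ toℕ i → r ≢ suc (toℕ i) → generator t n i (+ r) ≡ + r
  fixes-middle {i} {r} a b 1≤r r≤n r≢i r≢i+1 = trans (window-value i 1≤r r≤n)
    (trans (cong (λ f → f r) (window-middle {i} a b))
      (trans (if-≢ r≢i) (if-≢ (r≢i+1 ∘ λ eq → trans eq (ℕ.+-comm (toℕ i) 1)))))

  fixes-lastC : ∀ {i r} → toℕ i ≡ n → variantₙ t ≡ C → 1 ℕ.≤ r → r ℕ.< n → generator t n i
    (+ r) ≡ + r
  fixes-lastC {i} {r} i≡n v 1≤r r<n = trans (window-value i 1≤r (ℕ.<⇒≤ r<n))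
    (trans (cong (λ f → f r) (window-last {i} i≡n v)) (if-≢ (ℕ.<⇒≢ r<n)))

  fixes-lastD : ∀ {i r} → toℕ i ≡ n → variantₙ t ≡ D → 1 ℕ.≤ r → suc r ℕ.< n → generator t n i
    (+ r) ≡ + r
  fixes-lastD {i} {r} i≡n v 1≤r r<n = trans (window-value i 1≤r (ℕ.<⇒≤ (ℕ.<-trans (ℕ.n<1+n r) r<n)))
    (trans (cong (λ f → f r) (window-last {i} i≡n v))
      (trans (if-≢ (ℕ.<⇒≢ (ℕ.∸-monoˡ-≤ 1 r<n)))
        (if-≢ (ℕ.<⇒≢ (ℕ.<-trans (ℕ.n<1+n r) r<n)))))

  value-second : ∀ {i} → toℕ i ≡ 0 → variant₀ t ≡ D → generator t n i (+ 2) ≡ - + 1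
  value-second {i} i≡0 v = trans (window-value i (s≤s z≤n) 2≤n)
    (cong (λ f → f 2) (window-zero {i} i≡0 v))

  value-last : ∀ {i} → toℕ i ≡ n → variantₙ t ≡ D → generator t n i n₊ ≡ N - (n₊ - + 1)
  value-last {i} i≡n v = trans (window-value i (ℕ.≤-trans (s≤s z≤n) 2≤n) ℕ.≤-refl)
    (trans (cong (λ f → f n) (window-last {i} i≡n v))
      (trans (if-≢ n≢n-1) (trans (if-≡ {a = n} refl) (trans (cong +_ (ℕ.+-comm n 2))
        (lin 2 (λ N n → (N := # 1 :+ (n :+ n)) ∷ [] ⊢ # 2 :+ n := N :- (n :- # 1)) N n₊ N≡)))))
    where
    n≢n-1 : n ≢ n ∸ 1
    n≢n-1 eq = lin 1 (λ n → (n := n :- # 1) ∷ [] ⊢ :⊥) n₊ (trans (cong +_ eq) n∸1≡)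

  module Descent (g : Aut) where

    entry-value : ∀ {r} → 1 ℕ.≤ r → r ℕ.≤ n → Entry (to g (+ r))
    entry-value 1≤r r≤n = to-entry g (entry-between (+<+ 1≤r) (+<+ (ℕ.≤-<-trans r≤n n<period)))

    entry-minus : ∀ {a b} → a ℕ.< b → b ℕ.≤ n → Entry (to g (+ b) - to g (+ a))
    entry-minus {a} {b} a<b b≤n = entry-difference g {+ a} {+ b} (entry-between
      (lin 2 (λ a b → (a :< b) ∷ [] ⊢ # 0 :< b :- a) (+ a) (+ b) (+<+ a<b))
      (lin 4 (λ N n a b → (N := # 1 :+ (n :+ n)) ∷ (# 0 :≤ n) ∷ (# 0 :≤ a) ∷ (b :≤ n) ∷ []
        ⊢ b :- a :< N)
        N n₊ (+ a) (+ b) N≡ 0≤n (+≤+ z≤n) (+≤+ b≤n)))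

    entry-plus : ∀ {a b} → 1 ℕ.≤ a → a ℕ.≤ n → b ℕ.≤ n → Entry (to g (+ a) + to g (+ b))
    entry-plus {a} {b} 1≤a a≤n b≤n = entry-sum g {+ a} {+ b} (entry-between
      (lin 2 (λ a b → (# 1 :≤ a) ∷ (# 0 :≤ b) ∷ [] ⊢ # 0 :< a :+ b) (+ a) (+ b) (+≤+ 1≤a) (+≤+ z≤n))
      (lin 4 (λ N n a b → (N := # 1 :+ (n :+ n)) ∷ (a :≤ n) ∷ (b :≤ n) ∷ [] ⊢ a :+ b :< N)
        N n₊ (+ a) (+ b) N≡ (+≤+ a≤n) (+≤+ b≤n)))

    to-n+1 : to g (+ 1 + n₊) ≡ N - to g n₊
    to-n+1 = trans (cong (to g) (lin 2 (λ N n → (N := # 1 :+ (n :+ n)) ∷ [] ⊢ # 1 :+ n := :- n :+ N)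
      N n₊ N≡))
      (trans (to-+N g (- n₊)) (trans (cong (_+ N) (to-neg g n₊)) (ℤ.+-comm (- to g n₊) N)))

    to-reflect : ∀ x → to g (N - x) ≡ N - to g x
    to-reflect x = trans (cong (to g) (ℤ.+-comm N (- x)))
      (trans (to-+N g (- x)) (trans (cong (_+ N) (to-neg g x)) (ℤ.+-comm (- to g x) N)))

    Shortens : Fin (suc n) → Set
    Shortens i = length′ (to g) ≡ suc (length′ (to g ∘ generator t n i))

    private
      at-size : ∀ {k} {x y : ℕ → ℤ} → k ≡ n → size k x ≡ suc (size k y) → size n x ≡ suc (size n y)
      at-size refl eq = eq

      module _ (i : Fin (suc n)) where
        x y : ℕ → ℤ
        x = values (to g)
        y = values (to g ∘ generator t n i)

    -- The first value is negative and changes its sign, so its `ψ` gives up the wall 0. `χ` is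
    -- even, and the pairs only exchange their two summands.
    shortens-zeroC : ∀ i → toℕ i ≡ 0 → variant₀ t ≡ C → to g (+ 1) < to g (- + 1) → Shortens i
    shortens-zeroC i i≡0 v desc = at-size (ℕ.m+[n∸m]≡n 1≤n)
      (cong₂ ℕ._+_ (cong₂ ℕ._+_ self-eq cross-eq) size-eq)
      where
      1≤n = ℕ.≤-trans (s≤s z≤n) 2≤n
      x₀ = to g (+ 1)
      x₀<0 : x₀ < + 0
      x₀<0 = lin 2 (λ x z → (x :< z) ∷ (z := :- x) ∷ [] ⊢ x :< # 0) x₀ (to g (- + 1)) desc
        (to-neg g (+ 1))
      y₀ : y i 0 ≡ - x₀
      y₀ = trans (cong (to g) (generator-high (zeroC {i} i≡0 v))) (to-neg g (+ 1))
      rest : ∀ j → j ℕ.< n ∸ 1 → x i (suc j) ≡ y i (suc j)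
      rest j j< = cong (to g) (sym (fixes-zeroC i≡0 v (s≤s (s≤s z≤n))
        (subst (suc (suc j) ℕ.≤_) (ℕ.m+[n∸m]≡n 1≤n) (s≤s j<))))
      selfₙ-eq : ∀ v → selfₙ v x₀ ≡ selfₙ v (- x₀)
      selfₙ-eq C = sym (χ-neg x₀)
      selfₙ-eq D = refl
      self₀-eq : ∀ {w} → w ≡ C → self₀ w x₀ ≡ suc (self₀ w (- x₀))
      self₀-eq refl = ψ-neg (entry-value ℕ.≤-refl 1≤n) x₀<0
      self-eq : self x₀ ≡ suc (self (y i 0))
      self-eq = trans (cong₂ ℕ._+_ (self₀-eq v) (selfₙ-eq (variantₙ t)))
        (cong (suc ∘ self) (sym y₀))
      cross-eq : cross (n ∸ 1) x₀ (x i ∘ suc) ≡ cross (n ∸ 1) (y i 0) (y i ∘ suc)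
      cross-eq = trans (cross-neg (n ∸ 1) x₀ _ _ rest) (cong (λ z → cross (n ∸ 1) z (y i ∘ suc))
        (sym y₀))
      size-eq = size-cong (n ∸ 1) (x i ∘ suc) (y i ∘ suc) rest

    -- The first two values become `- x₁` and `- x₀`. Their difference stays; their sum is negative
    -- and changes its sign, and `ψ` of the sum gives up one wall.
    shortens-zeroD : ∀ i → toℕ i ≡ 0 → variant₀ t ≡ D → to g (+ 1) < to g (- + 2) → Shortens i
    shortens-zeroD i i≡0 v desc = at-size (ℕ.m+[n∸m]≡n 2≤n)
      (size-first-two (n ∸ 2) (x i) (y i)
        (trans (self-neg v x₀) (cong self (sym y₁)))
        (trans (self-neg v x₁) (cong self (sym y₀)))
        (trans (cong₂ ℕ._+_ (cong ψ (lemma x₀ x₁))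
            (trans (ψ-neg (entry-plus ℕ.≤-refl 1≤n 2≤n) sum<0)
              (cong (suc ∘ ψ) (lemma₂ x₀ x₁))))
          (trans (ℕ.+-suc _ _) (cong suc (cong₂ (λ a b → ψ (b - a) ℕ.+ ψ (a + b)) (sym y₀)
            (sym y₁)))))
        (trans (cross-neg (n ∸ 2) x₀ _ _ rest) (cong (λ z → cross (n ∸ 2) z (y i ∘ suc ∘ suc))
          (sym y₁)))
        (trans (cross-neg (n ∸ 2) x₁ _ _ rest) (cong (λ z → cross (n ∸ 2) z (y i ∘ suc ∘ suc))
          (sym y₀)))
        (size-cong (n ∸ 2) _ _ rest))
      where
      1≤n = ℕ.≤-trans (s≤s z≤n) 2≤n
      x₀ = to g (+ 1)
      x₁ = to g (+ 2)
      sum<0 : x₀ + x₁ < + 0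
      sum<0 = lin 3 (λ x w z → (x :< z) ∷ (z := :- w) ∷ [] ⊢ x :+ w :< # 0) x₀ x₁
        (to g (- + 2)) desc (to-neg g (+ 2))
      y₀ : y i 0 ≡ - x₁
      y₀ = trans (cong (to g) (generator-high (zeroD {i} i≡0 v))) (to-neg g (+ 2))
      y₁ : y i 1 ≡ - x₀
      y₁ = trans (cong (to g) (value-second {i} i≡0 v)) (to-neg g (+ 1))
      rest : ∀ j → j ℕ.< n ∸ 2 → x i (suc (suc j)) ≡ y i (suc (suc j))
      rest j j< = cong (to g) (sym (fixes-zeroD i≡0 v (s≤s (s≤s (s≤s z≤n)))
        (subst (suc (suc (suc j)) ℕ.≤_) (ℕ.m+[n∸m]≡n 2≤n) (s≤s (s≤s j<)))))
      lemma : ∀ x y → y - x ≡ - x - - y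
      lemma = solve-∀
      lemma₂ : ∀ x y → - (x + y) ≡ - y + - x
      lemma₂ = solve-∀
      selfₙ-neg : ∀ v x → selfₙ v x ≡ selfₙ v (- x)
      selfₙ-neg C x = sym (χ-neg x)
      selfₙ-neg D x = refl
      self₀-neg : ∀ {w} → w ≡ D → ∀ x → self₀ w x ≡ self₀ w (- x)
      self₀-neg refl x = refl
      self-neg : variant₀ t ≡ D → ∀ x → self x ≡ self (- x)
      self-neg v x = cong₂ ℕ._+_ (self₀-neg v x) (selfₙ-neg (variantₙ t) x)

    -- Neighbouring values are exchanged. Their sum stays, and their difference, which was negative,
    -- changes its sign.
    shortens-middle : ∀ i → 1 ℕ.≤ toℕ i → toℕ i ℕ.< n → to g (+ 1 + + toℕ i) < to g (+ toℕ i)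
      → Shortens i
    shortens-middle i 1≤i i<n desc = at-size n≡ (size-prefix k (2 ℕ.+ m) (x i) (y i) prefix crosses
      (size-first-two m (x i ∘ (k ℕ.+_)) (y i ∘ (k ℕ.+_))
        (cong self x₀≡y₁) (cong self x₁≡y₀)
        (trans (cong₂ ℕ._+_ (trans (ψ-neg entry diff<0) (cong (suc ∘ ψ) (lemma x₁ x₀)))
          (cong ψ (ℤ.+-comm x₀ x₁)))
          (cong suc (cong₂ pairs x₁≡y₀ x₀≡y₁)))
        (trans (cross-cong m x₀ _ _ (λ j j<m → cong (pairs x₀) (rest j j<m)))
          (cong (λ z → cross m z (y i ∘ (k ℕ.+_) ∘ suc ∘ suc)) x₀≡y₁))
        (trans (cross-cong m x₁ _ _ (λ j j<m → cong (pairs x₁) (rest j j<m)))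
          (cong (λ z → cross m z (y i ∘ (k ℕ.+_) ∘ suc ∘ suc)) x₁≡y₀))
        (size-cong m _ _ rest)))
      where
      K = middle {i} 1≤i i<n
      k = toℕ i ∸ 1
      m = n ∸ suc (toℕ i)
      i≡ : suc k ≡ toℕ i
      i≡ = ℕ.m+[n∸m]≡n 1≤i
      n≡ : k ℕ.+ (2 ℕ.+ m) ≡ n
      n≡ = trans (ℕ.+-suc k (suc m)) (trans (cong suc (ℕ.+-suc k m))
        (trans (cong (λ a → suc a ℕ.+ m) i≡) (ℕ.m+[n∸m]≡n i<n)))
      x₀ = x i (k ℕ.+ 0)
      x₁ = x i (k ℕ.+ 1)
      k+0 : suc (k ℕ.+ 0) ≡ toℕ i
      k+0 = trans (cong suc (ℕ.+-identityʳ k)) i≡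
      k+1 : suc (k ℕ.+ 1) ≡ suc (toℕ i)
      k+1 = cong suc (trans (ℕ.+-comm k 1) i≡)
      x₀≡ : x₀ ≡ to g (+ toℕ i)
      x₀≡ = cong (to g ∘ +_) k+0
      x₁≡ : x₁ ≡ to g (+ suc (toℕ i))
      x₁≡ = cong (to g ∘ +_) k+1
      x₀≡y₁ : x₀ ≡ y i (k ℕ.+ 1)
      x₀≡y₁ = trans x₀≡ (cong (to g) (sym (trans (cong (generator t n i ∘ +_) k+1)
        (generator-high K))))
      x₁≡y₀ : x₁ ≡ y i (k ℕ.+ 0)
      x₁≡y₀ = trans x₁≡ (cong (to g) (sym (trans (cong (generator t n i ∘ +_) k+0)
        (generator-low K))))
      entry : Entry (x₁ - x₀)
      entry = subst₂ (λ a b → Entry (b - a)) (sym x₀≡) (sym x₁≡) (entry-minus ℕ.≤-refl i<n)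
      diff<0 : x₁ - x₀ < + 0
      diff<0 = lin 4 (λ a b a′ b′ → (b′ :< a′) ∷ (a := a′) ∷ (b := b′) ∷ [] ⊢ b :- a :< # 0)
        x₀ x₁ (to g (+ toℕ i)) (to g (+ suc (toℕ i))) desc x₀≡ x₁≡
      lemma : ∀ a b → - (a - b) ≡ b - a
      lemma = solve-∀
      prefix : ∀ j → j ℕ.< k → x i j ≡ y i j
      prefix j j<k = cong (to g) (sym (fixes-middle 1≤i i<n (s≤s z≤n)
        (ℕ.<⇒≤ (ℕ.<-trans j<i i<n)) (ℕ.<⇒≢ j<i) (ℕ.<⇒≢ (ℕ.m<n⇒m<1+n j<i))))
        where
        j<i : suc j ℕ.< toℕ i
        j<i = subst (suc j ℕ.<_) i≡ (s≤s j<k)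
      rest : ∀ j → j ℕ.< m → x i (k ℕ.+ (2 ℕ.+ j)) ≡ y i (k ℕ.+ (2 ℕ.+ j))
      rest j j<m = cong (to g) (sym (fixes-middle 1≤i i<n (s≤s z≤n)
        (subst (suc (k ℕ.+ (2 ℕ.+ j)) ℕ.≤_) n≡ (subst (ℕ._≤ k ℕ.+ (2 ℕ.+ m)) (ℕ.+-suc k (2 ℕ.+ j))
          (ℕ.+-monoʳ-≤ k (s≤s (s≤s j<m)))))
        (ℕ.>⇒≢ (ℕ.<-trans (ℕ.n<1+n (toℕ i)) i<)) (ℕ.>⇒≢ i<)))
        where
        i< : suc (toℕ i) ℕ.< suc (k ℕ.+ (2 ℕ.+ j))
        i< = s≤s (subst₂ ℕ._≤_ (trans (ℕ.+-comm k 2) (cong suc i≡)) refl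
          (ℕ.+-monoʳ-≤ k (ℕ.m≤m+n 2 j)))
      crosses : ∀ j → j ℕ.< k → cross (2 ℕ.+ m) (x i j) (x i ∘ (k ℕ.+_)) ≡ cross (2 ℕ.+ m) (x i j)
        (y i ∘ (k ℕ.+_))
      crosses j _ = trans
        (cong₂ (λ a b → a ℕ.+ b) (cong (pairs (x i j)) x₀≡y₁)
          (cong₂ ℕ._+_ (cong (pairs (x i j)) x₁≡y₀)
          (cross-cong m (x i j) _ _ (λ l l<m → cong (pairs (x i j)) (rest l l<m)))))
        (exchange (pairs (x i j) (y i (k ℕ.+ 1))) (pairs (x i j) (y i (k ℕ.+ 0))) _)
        where
        exchange : ∀ a b c → a ℕ.+ (b ℕ.+ c) ≡ b ℕ.+ (a ℕ.+ c)
        exchange = ℕ-Solver.solve-∀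

    -- The last value `X` becomes `N - X`, and the descent says that `X` is beyond the wall `N / 2`,
    -- which `χ` gives up. `ψ` and all pairs are invariant under this reflection.
    shortens-lastC : ∀ i → toℕ i ≡ n → variantₙ t ≡ C → to g (+ 1 + n₊) < to g n₊ → Shortens i
    shortens-lastC i i≡n v desc = at-size n≡ (size-prefix k 1 (x i) (y i) prefix crosses
      (cong (λ a → a ℕ.+ 0 ℕ.+ 0) self-eq))
      where
      1≤n = ℕ.≤-trans (s≤s z≤n) 2≤n
      k = n ∸ 1
      1+k≡ : suc k ≡ n
      1+k≡ = ℕ.m+[n∸m]≡n 1≤n
      n≡ : k ℕ.+ 1 ≡ n
      n≡ = trans (ℕ.+-comm k 1) 1+k≡
      last : suc (k ℕ.+ 0) ≡ n
      last = trans (cong suc (ℕ.+-identityʳ k)) 1+k≡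
      X = to g n₊
      x₀ : x i (k ℕ.+ 0) ≡ X
      x₀ = cong (to g ∘ +_) last
      y₀ : y i (k ℕ.+ 0) ≡ N - X
      y₀ = trans (cong (to g ∘ generator t n i ∘ +_) last)
        (trans (cong (to g) (generator-low (lastC {i} i≡n v))) to-n+1)
      n<X : n₊ < X
      n<X = lin 4 (λ N n x z → (N := # 1 :+ (n :+ n)) ∷ (z :< x) ∷ (z := N :- x) ∷ [] ⊢ n :< x)
        N n₊ X (to g (+ 1 + n₊)) N≡ desc to-n+1
      self₀-eq : ∀ w → self₀ w X ≡ self₀ w (N - X)
      self₀-eq C = sym (ψ-reflect (entry-value 1≤n ℕ.≤-refl))
      self₀-eq D = refl
      selfₙ-eq : ∀ {w} → w ≡ C → selfₙ w X ≡ suc (selfₙ w (N - X))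
      selfₙ-eq refl = χ-over n<X
      self-eq : self (x i (k ℕ.+ 0)) ≡ suc (self (y i (k ℕ.+ 0)))
      self-eq = trans (cong self x₀) (trans (cong₂ ℕ._+_ (self₀-eq (variant₀ t)) (selfₙ-eq v))
        (trans (ℕ.+-suc _ _) (cong (suc ∘ self) (sym y₀))))
      prefix : ∀ j → j ℕ.< k → x i j ≡ y i j
      prefix j j<k = cong (to g) (sym (fixes-lastC i≡n v (s≤s z≤n)
        (subst (suc j ℕ.<_) 1+k≡ (s≤s j<k))))
      crosses : ∀ j → j ℕ.< k → cross 1 (x i j) (x i ∘ (k ℕ.+_)) ≡ cross 1 (x i j) (y i ∘ (k ℕ.+_))
      crosses j j<k = cong (ℕ._+ 0) (trans (cong (pairs (x i j)) x₀)
        (trans (sym (pairs-reflect (x i j) X (entry-minus j<n ℕ.≤-refl)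
          (entry-plus (s≤s z≤n) (ℕ.<⇒≤ j<n) ℕ.≤-refl)))
          (cong (pairs (x i j)) (sym y₀))))
        where
        j<n = subst (suc j ℕ.<_) 1+k≡ (s≤s j<k)

    -- The last two values become `N - X₁` and `N - X₀`. Their difference stays, and their sum,
    -- which exceeds `N`, is reflected in `N`.
    shortens-lastD : ∀ i → toℕ i ≡ n → variantₙ t ≡ D → to g (+ 1 + n₊) < to g (n₊ - + 1)
      → Shortens i
    shortens-lastD i i≡n v desc = at-size n≡ (size-prefix k 2 (x i) (y i) prefix crosses
      (size-first-two 0 (x i ∘ (k ℕ.+_)) (y i ∘ (k ℕ.+_))
        (trans (cong self x₀) (trans (self-reflect v (entry-value 1≤n-1 n-1≤n))
          (cong self (sym y₁))))
        (trans (cong self x₁) (trans (self-reflect v (entry-value 1≤n ℕ.≤-refl))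
          (cong self (sym y₀))))
        (trans (cong₂ pairs x₀ x₁) (trans (cong₂ ℕ._+_ (cong ψ (lemma N X₀ X₁))
            (trans (ψ-over (entry-plus 1≤n-1 n-1≤n ℕ.≤-refl) N<sum)
              (cong (suc ∘ ψ) (lemma₂ N X₀ X₁))))
          (trans (ℕ.+-suc _ _) (cong suc (cong₂ pairs (sym y₀) (sym y₁))))))
        refl refl refl))
      where
      1≤n = ℕ.≤-trans (s≤s z≤n) 2≤n
      1≤n-1 : 1 ℕ.≤ n ∸ 1
      1≤n-1 = ℕ.∸-monoˡ-≤ 1 2≤n
      n-1≤n : n ∸ 1 ℕ.≤ n
      n-1≤n = ℕ.m∸n≤m n 1
      1+n-1≡ : suc (n ∸ 1) ≡ n
      1+n-1≡ = ℕ.m+[n∸m]≡n 1≤n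
      k = n ∸ 2
      2+k≡ : suc (suc k) ≡ n
      2+k≡ = ℕ.m+[n∸m]≡n 2≤n
      n≡ : k ℕ.+ 2 ≡ n
      n≡ = trans (ℕ.+-comm k 2) 2+k≡
      at₀ : suc (k ℕ.+ 0) ≡ n ∸ 1
      at₀ = ℕ.suc-injective (trans (cong (suc ∘ suc) (ℕ.+-identityʳ k)) (trans 2+k≡ (sym 1+n-1≡)))
      at₁ : suc (k ℕ.+ 1) ≡ n
      at₁ = trans (cong suc (ℕ.+-comm k 1)) 2+k≡
      X₀ = to g (+ (n ∸ 1))
      X₁ = to g n₊
      x₀ : x i (k ℕ.+ 0) ≡ X₀
      x₀ = cong (to g ∘ +_) at₀
      x₁ : x i (k ℕ.+ 1) ≡ X₁
      x₁ = cong (to g ∘ +_) at₁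
      y₀ : y i (k ℕ.+ 0) ≡ N - X₁
      y₀ = trans (cong (to g ∘ generator t n i) (trans (cong +_ at₀) n∸1≡))
        (trans (cong (to g) (generator-low (lastD {i} i≡n v))) to-n+1)
      y₁ : y i (k ℕ.+ 1) ≡ N - X₀
      y₁ = trans (cong (to g ∘ generator t n i ∘ +_) at₁)
        (trans (cong (to g) (value-last {i} i≡n v))
        (trans (to-reflect (n₊ - + 1)) (cong (λ z → N - to g z) (sym n∸1≡))))
      N<sum : N < X₀ + X₁
      N<sum = lin 4 (λ N x y z → (z :< x) ∷ (z := N :- y) ∷ [] ⊢ N :< x :+ y) N X₀ X₁
        (to g (+ 1 + n₊))
        (subst (λ z → to g (+ 1 + n₊) < to g z) (sym n∸1≡) desc) to-n+1
      lemma : ∀ N a b → b - a ≡ N - a - (N - b)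
      lemma = solve-∀
      lemma₂ : ∀ N a b → N + N - (a + b) ≡ N - b + (N - a)
      lemma₂ = solve-∀
      self₀-reflect : ∀ w {x} → Entry x → self₀ w x ≡ self₀ w (N - x)
      self₀-reflect C ent = sym (ψ-reflect ent)
      self₀-reflect D ent = refl
      selfₙ-reflect : ∀ {w} → w ≡ D → ∀ x → selfₙ w x ≡ selfₙ w (N - x)
      selfₙ-reflect refl x = refl
      self-reflect : variantₙ t ≡ D → ∀ {x} → Entry x → self x ≡ self (N - x)
      self-reflect v {x} ent = cong₂ ℕ._+_ (self₀-reflect (variant₀ t) ent) (selfₙ-reflect v x)
      prefix : ∀ j → j ℕ.< k → x i j ≡ y i j
      prefix j j<k = cong (to g) (sym (fixes-lastD i≡n v (s≤s z≤n)
        (subst (suc (suc j) ℕ.<_) 2+k≡ (s≤s (s≤s j<k)))))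
      crosses : ∀ j → j ℕ.< k → cross 2 (x i j) (x i ∘ (k ℕ.+_)) ≡ cross 2 (x i j) (y i ∘ (k ℕ.+_))
      crosses j j<k = trans
        (cong₂ (λ a b → a ℕ.+ (b ℕ.+ 0))
          (trans (cong (pairs z) x₀) (trans (sym (pairs-reflect z X₀ (entry-minus j<n-1 n-1≤n)
            (entry-plus (s≤s z≤n) (ℕ.<⇒≤ j<n) n-1≤n))) (cong (pairs z) (sym y₁))))
          (trans (cong (pairs z) x₁) (trans (sym (pairs-reflect z X₁ (entry-minus j<n ℕ.≤-refl)
            (entry-plus (s≤s z≤n) (ℕ.<⇒≤ j<n) ℕ.≤-refl))) (cong (pairs z) (sym y₀)))))
        (exchange (pairs z (y i (k ℕ.+ 1))) (pairs z (y i (k ℕ.+ 0))))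
        where
        z = x i j
        2+j<n = subst (suc (suc j) ℕ.<_) 2+k≡ (s≤s (s≤s j<k))
        j<n : suc j ℕ.< n
        j<n = ℕ.<-trans (ℕ.n<1+n _) 2+j<n
        j<n-1 : suc j ℕ.< n ∸ 1
        j<n-1 = ℕ.∸-monoˡ-≤ 1 2+j<n
        exchange : ∀ a b → a ℕ.+ (b ℕ.+ 0) ≡ b ℕ.+ (a ℕ.+ 0)
        exchange = ℕ-Solver.solve-∀

    shortens : ∀ {i p q} → Kind i p q → to g q < to g p → Shortens i
    shortens {i} (zeroC a b)  = shortens-zeroC i a b
    shortens {i} (zeroD a b)  = shortens-zeroD i a b
    shortens {i} (middle a b) = shortens-middle i a b
    shortens {i} (lastC a b)  = shortens-lastC i a b
    shortens {i} (lastD a b)  = shortens-lastD i a b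

  -- The window `1, …, n` lies in the fundamental alcove: its differences and sums are between 0 and
  -- `N`, its values at most `n`.
  length-identity : length′ id ≡ 0
  length-identity = go n 0 ℕ.≤-refl
    where
    ψ-small : ∀ {x} → + 0 ≤ x → x < N → ψ x ≡ 0
    ψ-small {x} a b = ψ-floor x (+ 0) a b (sym (shift-0 x N))
    pairs-small : ∀ {a b} → a ℕ.≤ b → b ℕ.≤ n → pairs (+ a) (+ b) ≡ 0
    pairs-small {a} {b} a≤b b≤n = cong₂ ℕ._+_
      (ψ-small (ℤ.i≤j⇒0≤j-i (+≤+ a≤b))
        (lin 4 (λ N n a b → (N := # 1 :+ (n :+ n)) ∷ (# 0 :≤ n) ∷ (# 0 :≤ a) ∷ (b :≤ n) ∷ []
          ⊢ b :- a :< N)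
          N n₊ (+ a) (+ b) N≡ 0≤n (+≤+ z≤n) (+≤+ b≤n)))
      (ψ-small (+≤+ z≤n)
        (lin 4 (λ N n a b → (N := # 1 :+ (n :+ n)) ∷ (a :≤ b) ∷ (b :≤ n) ∷ [] ⊢ a :+ b :< N)
          N n₊ (+ a) (+ b) N≡ (+≤+ a≤b) (+≤+ b≤n)))
    self₀-small : ∀ v {a} → a ℕ.≤ n → self₀ v (+ a) ≡ 0
    self₀-small C a≤n = ψ-small (+≤+ z≤n) (+<+ (ℕ.≤-<-trans a≤n n<period))
    self₀-small D a≤n = refl
    selfₙ-small : ∀ v {a} → a ℕ.≤ n → selfₙ v (+ a) ≡ 0
    selfₙ-small C {a} a≤n = ψ-small (+≤+ z≤n)
      (lin 3 (λ N n a → (N := # 1 :+ (n :+ n)) ∷ (a :≤ n) ∷ [] ⊢ a :+ n :< N) N n₊ (+ a) N≡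
        (+≤+ a≤n))
    selfₙ-small D a≤n = refl
    cross-zero : ∀ m z x → (∀ j → j ℕ.< m → pairs z (x j) ≡ 0) → cross m z x ≡ 0
    cross-zero zero    z x h = refl
    cross-zero (suc m) z x h = cong₂ ℕ._+_ (h 0 (s≤s z≤n))
      (cross-zero m z (x ∘ suc) (λ j j<m → h (suc j) (s≤s j<m)))
    go : ∀ m k → k ℕ.+ m ℕ.≤ n → size m (λ j → + suc (k ℕ.+ j)) ≡ 0
    go zero    k bound = refl
    go (suc m) k bound = cong₂ ℕ._+_
      (cong₂ ℕ._+_
        (cong₂ ℕ._+_ (self₀-small (variant₀ t) k+0≤n) (selfₙ-small (variantₙ t) k+0≤n))
        (cross-zero m _ _ λ j j<m → pairs-small (s≤s (ℕ.+-monoʳ-≤ k z≤n))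
          (ℕ.≤-trans (subst (ℕ._≤ k ℕ.+ suc m) (ℕ.+-suc k (suc j)) (ℕ.+-monoʳ-≤ k (s≤s j<m)))
            bound)))
      (trans (size-cong m _ _ (λ j _ → cong (λ l → + suc l) (ℕ.+-suc k j)))
        (go m (suc k) (subst (ℕ._≤ n) (ℕ.+-suc k m) bound)))
      where
      k+0≤n : suc (k ℕ.+ 0) ℕ.≤ n
      k+0≤n = ℕ.≤-trans (subst (ℕ._≤ k ℕ.+ suc m) (ℕ.+-suc k 0) (ℕ.+-monoʳ-≤ k (s≤s z≤n))) bound

-- Counting and parity of finite sets given by predicates.

module Cardinality where

  open Equivalence public using () renaming (to to ⇒; from to ⇐)

  -- `EvenCardinality` with the number made visible, so that sets can be compared by injections.
  record Card {A : Set} (P : A → Set) (k : ℕ) : Set where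
    constructor card
    field
      elements : List A
      unique   : Unique elements
      members  : ∀ x → x ∈ elements ⇔ P x
      count    : length elements ≡ k

  -- Pigeonhole: the image of the head is cut out of `ys`, and by injectivity the images of the tail
  -- survive the cut.
  injection-length : ∀ {A B : Set} (f : A → B) (xs : List A) (ys : List B) → Unique xs →
    (∀ {x} → x ∈ xs → f x ∈ ys) → (∀ {x y} → x ∈ xs → y ∈ xs → f x ≡ f y → x ≡ y) →
    length xs ℕ.≤ length ys
  injection-length f []       ys _ _ _ = z≤n
  injection-length f (x ∷ xs) ys (x∉xs ∷ uxs) into inj with ∈-∃++ (into (here refl))
  ... | as , bs , refl = subst (suc (length xs) ℕ.≤_) (sym eq)
    (s≤s (injection-length f xs (as ++ bs) uxs into′ (λ p q → inj (there p) (there q))))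
    where
    eq : length (as ++ f x ∷ bs) ≡ suc (length (as ++ bs))
    eq = trans (List.length-++ as) (trans (ℕ.+-suc (length as) (length bs))
      (cong suc (sym (List.length-++ as))))
    into′ : ∀ {y} → y ∈ xs → f y ∈ as ++ bs
    into′ {y} y∈xs with ∈-++⁻ as (into (there y∈xs))
    ... | inj₁ p         = ∈-++⁺ˡ p
    ... | inj₂ (there p) = ∈-++⁺ʳ as p
    ... | inj₂ (here fy≡fx) = ⊥-elim (All.lookup x∉xs y∈xs
      (sym (inj (there y∈xs) (here refl) fy≡fx)))

  card-≤ : ∀ {A B : Set} {P : A → Set} {Q : B → Set} {k l} (f : A → B) → (∀ {x} → P x → Q (f x)) →
           (∀ {x y} → P x → P y → f x ≡ f y → x ≡ y) → Card P k → Card Q l → k ℕ.≤ l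
  card-≤ f into inj (card xs u m refl) (card ys v m′ refl) = injection-length f xs ys u
    (λ {x} p → ⇐ (m′ (f x)) (into (⇒ (m x) p))) (λ {x} {y} p q → inj (⇒ (m x) p) (⇒ (m y) q))

  card-⊆ : ∀ {A : Set} {P Q : A → Set} {k l} → (∀ {x} → P x → Q x) → Card P k → Card Q l → k ℕ.≤ l
  card-⊆ into = card-≤ id into (λ _ _ eq → eq)

  card-unique : ∀ {A : Set} {P : A → Set} {k l} → Card P k → Card P l → k ≡ l
  card-unique c d = ℕ.≤-antisym (card-⊆ id c d) (card-⊆ id d c)

  card-cong : ∀ {A : Set} {P Q : A → Set} {k} → (∀ x → P x ⇔ Q x) → Card P k → Card Q k
  card-cong eq (card xs u m c) = card xs u (λ x → ⇔.trans (m x) (eq x)) c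

  card-preimage : ∀ {A B : Set} {P : A → Set} {k} (f : A → B) (f⁻¹ : B → A) →
    (∀ x → f⁻¹ (f x) ≡ x) → (∀ y → f (f⁻¹ y) ≡ y) → Card P k → Card (P ∘ f⁻¹) k
  card-preimage {P = P} f f⁻¹ lr rl (card xs u m c) = card (map f xs)
    (Unique.map⁺ (λ {x} {y} eq → trans (sym (lr x)) (trans (cong f⁻¹ eq) (lr y))) u)
    (λ y → mk⇔
      (λ p → let (x , x∈xs , y≡fx) = ∈-map⁻ f p in
             ⇒ (m (f⁻¹ y)) (subst (_∈ xs) (sym (trans (cong f⁻¹ y≡fx) (lr x))) x∈xs))
      (λ p → subst (_∈ map f xs) (rl y) (∈-map⁺ f (⇐ (m (f⁻¹ y)) p))))
    (trans (List.length-map f xs) c)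

  card-add : ∀ {A : Set} {P Q : A → Set} {k} x → ¬ P x → (∀ y → Q y ⇔ (y ≡ x ⊎ P y)) → Card P k
    → Card Q (suc k)
  card-add x ¬Px eq (card xs u m c) = card (x ∷ xs)
    (All.tabulate (λ {y} y∈xs x≡y → ¬Px (⇒ (m x) (subst (_∈ xs) (sym x≡y) y∈xs))) ∷ u)
    (λ y → mk⇔ (λ { (here y≡x) → ⇐ (eq y) (inj₁ y≡x) ; (there p) → ⇐ (eq y) (inj₂ (⇒ (m y) p)) })
      (λ Qy → [here-there] (⇒ (eq y) Qy)))
    (cong suc c)
    where
    [here-there] : ∀ {y} → (y ≡ x ⊎ _) → y ∈ x ∷ xs
    [here-there] (inj₁ y≡x) = here y≡x
    [here-there] (inj₂ Py)  = there (⇐ (m _) Py)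

  card-remove : ∀ {P Q : ℤ → Set} {k} x → P x → (∀ y → Q y ⇔ (P y × y ≢ x)) → Card P k →
                ∃[ l ] k ≡ suc l × Card Q l
  card-remove {P} {Q} {k} x Px eq c@(card xs u m _) = length ys , card-unique c c′ , Card-Q
    where
    ys = filter (λ y → ¬? (y ℤ.≟ x)) xs
    Card-Q : Card Q (length ys)
    Card-Q = card ys (Unique.filter⁺ (λ y → ¬? (y ℤ.≟ x)) u)
      (λ y → mk⇔
        (λ p → let (q , y≢x) = ∈-filter⁻ (λ y → ¬? (y ℤ.≟ x)) p in ⇐ (eq y) (⇒ (m y) q , y≢x))
        (λ Qy → let (Py , y≢x) = ⇒ (eq y) Qy in ∈-filter⁺ (λ y → ¬? (y ℤ.≟ x)) (⇐ (m y) Py) y≢x))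
      refl
    c′ : Card P (suc (length ys))
    c′ = card-add x (λ Qx → proj₂ (⇒ (eq x) Qx) refl)
      (λ y → mk⇔ (λ Py → split y Py)
        (λ { (inj₁ refl) → Px ; (inj₂ Qy) → proj₁ (⇒ (eq y) Qy) })) Card-Q
      where
      split : ∀ y → P y → y ≡ x ⊎ Q y
      split y Py with y ℤ.≟ x
      ... | yes y≡x = inj₁ y≡x
      ... | no y≢x  = inj₂ (⇐ (eq y) (Py , y≢x))

  card-singleton : ∀ {A : Set} {P : A → Set} c → (∀ x → P x ⇔ x ≡ c) → Card P 1
  card-singleton c eq = card (c ∷ []) ([] ∷ [])
    (λ x → mk⇔ (λ { (here x≡c) → ⇐ (eq x) x≡c ; (there ()) }) (λ Px → here (⇒ (eq x) Px))) refl

  card-empty : ∀ {A : Set} {P : A → Set} → (∀ x → ¬ P x) → Card P 0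
  card-empty none = card [] [] (λ x → mk⇔ (λ ()) (λ Px → ⊥-elim (none x Px))) refl

  fromEven : ∀ {A : Set} {P : A → Set} → EvenCardinality P → ∃[ k ] Card P k × 2 ∣ℕ k
  fromEven (xs , u , m , e) = length xs , card xs u m refl , e

  toEven : ∀ {A : Set} {P : A → Set} {k} → Card P k → 2 ∣ℕ k → EvenCardinality P
  toEven (card xs u m refl) e = xs , u , m , e

  even-not-singleton : ∀ {A : Set} {P : A → Set} c → (∀ x → P x ⇔ x ≡ c) → ¬ EvenCardinality P
  even-not-singleton c eq ev with fromEven ev
  ... | k , K , 2∣k with card-unique K (card-singleton c eq)
  ...   | refl with ℕ.∣⇒≤ 2∣k
  ...     | s≤s ()

  even-cong : ∀ {A : Set} {P Q : A → Set} → (∀ x → P x ⇔ Q x) → EvenCardinality P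
    → EvenCardinality Q
  even-cong eq ev = let (k , K , e) = fromEven ev in toEven (card-cong eq K) e

  -- A change by exactly one element in either direction; two such changes restore the parity.
  Flip : (P Q : ℤ → Set) → Set
  Flip P Q = ∀ {k} → Card P k → ∃[ l ] (l ≡ suc k ⊎ k ≡ suc l) × Card Q l

  flip-flip : ∀ {P Q R} → Flip P Q → Flip Q R → EvenCardinality P → EvenCardinality R
  flip-flip pq qr ev with fromEven ev
  ... | k , K , e with pq K
  ...   | l , kl , L with qr L
  ...     | m , lm , M = toEven M (parity kl lm)
    where
    2+ : ∀ {a} → 2 ∣ℕ a → 2 ∣ℕ 2 ℕ.+ a
    2+ = ℕ.∣m∣n⇒∣m+n (ℕ.divides 1 refl)
    2- : ∀ {a} → 2 ∣ℕ 2 ℕ.+ a → 2 ∣ℕ a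
    2- h = ℕ.∣m+n∣m⇒∣n h (ℕ.divides 1 refl)
    parity : (l ≡ suc k ⊎ k ≡ suc l) → (m ≡ suc l ⊎ l ≡ suc m) → 2 ∣ℕ m
    parity (inj₁ refl) (inj₁ refl) = 2+ e
    parity (inj₁ refl) (inj₂ refl) = e
    parity (inj₂ refl) (inj₁ refl) = e
    parity (inj₂ refl) (inj₂ refl) = 2- e

-- The generators preserve the parity conditions.

module Parity (t : AffineType) (n : ℕ) (rank : minRank t ℕ.≤ n) where
  open import Data.Integer using (_+_; _-_; _*_; -_; _≤_; _<_)
  open Length t n rank public
  open Cardinality public

  Crossing : ℤ → (ℤ → ℤ) → ℤ → Set
  Crossing h w k = k ≤ h × + 1 + h ≤ w k

  InGroup : (ℤ → ℤ) → Set
  InGroup w = (variant₀ t ≡ D → EvenCardinality (Crossing (+ 0) w)) ×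
              (variantₙ t ≡ D → EvenCardinality (Crossing n₊ w))

  -- When the pair lies strictly between 0 and `N`, each translate of the pair and of its mirror
  -- image is on one side of 0.
  swap-≤0 : ∀ {p q x y} → + 0 < p → p < q → q < N → Swap p q x y → x ≤ + 0 → y ≤ + 0
  swap-≤0 a b c (stay refl) d = d
  swap-≤0 {p} {q} {x} {y} a b c (↑ k e f) d with scale k
  ... | below _ g = lin 6 (λ p q x y z N → (q :< N) ∷ (z :≤ :- N) ∷ (y := q :+ z) ∷ [] ⊢ y :≤ # 0) p
    q x y (k * N) N c g f
  ... | none _ g = ⊥-elim (lin 6 (λ p q x y z N → (# 0 :< p) ∷ (z := # 0) ∷ (x := p :+ z) ∷
    (x :≤ # 0) ∷ [] ⊢ :⊥) p q x y (k * N) N a g e d)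
  ... | above _ g = ⊥-elim (lin 6 (λ p q x y z N → (# 0 :< p) ∷ (p :< q) ∷ (q :< N) ∷ (N :≤ z) ∷
    (x := p :+ z) ∷ (x :≤ # 0) ∷ [] ⊢ :⊥) p q x y (k * N) N a b c g e d)
  swap-≤0 {p} {q} {x} {y} a b c (↓ k e f) d = lin 4 (λ p q y z → (p :< q) ∷ (q :+ z :≤ # 0) ∷
    (y := p :+ z) ∷ [] ⊢ y :≤ # 0) p q y (k * N) b (subst (_≤ + 0) e d) f
  swap-≤0 {p} {q} {x} {y} a b c (-↑ k e f) d with scale k
  ... | below _ g = lin 6 (λ p q x y z N → (# 0 :< p) ∷ (p :< q) ∷ (q :< N) ∷ (z :≤ :- N) ∷
    (y := :- p :+ z) ∷ [] ⊢ y :≤ # 0) p q x y (k * N) N a b c g f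
  ... | none _ g = lin 6 (λ p q x y z N → (# 0 :< p) ∷ (z := # 0) ∷ (y := :- p :+ z) ∷ []
    ⊢ y :≤ # 0) p q x y (k * N) N a g f
  ... | above _ g = ⊥-elim (lin 6 (λ p q x y z N → (q :< N) ∷ (N :≤ z) ∷ (x := :- q :+ z) ∷
    (x :≤ # 0) ∷ [] ⊢ :⊥) p q x y (k * N) N c g e d)
  swap-≤0 {p} {q} {x} {y} a b c (-↓ k e f) d = lin 4 (λ p q y z → (p :< q) ∷ (:- p :+ z :≤ # 0) ∷
    (y := :- q :+ z) ∷ [] ⊢ y :≤ # 0) p q y (k * N) b (subst (_≤ + 0) e d) f

  -- When the pair lies between `- n` and `n`, no translate of it or of its mirror image contains
  -- the step from `n` to `n + 1`, because `N = 2n + 1`.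
  swap-≤n : ∀ {p q x y} → - n₊ ≤ p → p < q → q ≤ n₊ → Swap p q x y → x ≤ n₊ → y ≤ n₊
  swap-≤n a b c (stay refl) d = d
  swap-≤n {p} {q} {x} {y} a b c (↑ k e f) d with scale k
  ... | below _ g = lin 6 (λ p q y z N n → (N := # 1 :+ (n :+ n)) ∷ (:- n :≤ p) ∷ (p :< q) ∷
    (q :≤ n) ∷ (z :≤ :- N) ∷ (y := q :+ z) ∷ [] ⊢ y :≤ n) p q y (k * N) N n₊ N≡ a b c g f
  ... | none _ g = lin 4 (λ q y z n → (q :≤ n) ∷ (z := # 0) ∷ (y := q :+ z) ∷ [] ⊢ y :≤ n) q y
    (k * N) n₊ c g f
  ... | above _ g = ⊥-elim (lin 5 (λ p x z N n → (N := # 1 :+ (n :+ n)) ∷ (:- n :≤ p) ∷ (N :≤ z) ∷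
    (x := p :+ z) ∷ (x :≤ n) ∷ [] ⊢ :⊥) p x (k * N) N n₊ N≡ a g e d)
  swap-≤n {p} {q} {x} {y} a b c (↓ k e f) d = lin 5 (λ p q y z n → (p :< q) ∷ (q :+ z :≤ n) ∷
    (y := p :+ z) ∷ [] ⊢ y :≤ n) p q y (k * N) n₊ b (subst (_≤ n₊) e d) f
  swap-≤n {p} {q} {x} {y} a b c (-↑ k e f) d with scale k
  ... | below _ g = lin 6 (λ p q y z N n → (N := # 1 :+ (n :+ n)) ∷ (:- n :≤ p) ∷ (p :< q) ∷
    (q :≤ n) ∷ (z :≤ :- N) ∷ (y := :- p :+ z) ∷ [] ⊢ y :≤ n) p q y (k * N) N n₊ N≡ a b c g f
  ... | none _ g = lin 4 (λ p y z n → (:- n :≤ p) ∷ (z := # 0) ∷ (y := :- p :+ z) ∷ [] ⊢ y :≤ n) p y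
    (k * N) n₊ a g f
  ... | above _ g = ⊥-elim (lin 5 (λ q x z N n → (N := # 1 :+ (n :+ n)) ∷ (q :≤ n) ∷ (N :≤ z) ∷
    (x := :- q :+ z) ∷ (x :≤ n) ∷ [] ⊢ :⊥) q x (k * N) N n₊ N≡ c g e d)
  swap-≤n {p} {q} {x} {y} a b c (-↓ k e f) d = lin 5 (λ p q y z n → (p :< q) ∷ (:- p :+ z :≤ n) ∷
    (y := :- q :+ z) ∷ [] ⊢ y :≤ n) p q y (k * N) n₊ b (subst (_≤ n₊) e d) f

  module Toggling (w : Aut) (s : ℤ → ℤ) (involutive : ∀ x → s (s x) ≡ x) (h : ℤ) where

    -- `R` is `P` pulled back along `s` and has the same cardinality. `R` and `Q` test the same
    -- value `to w (s k)`, but `R` asks for `s k ≤ h` where `Q` asks for `k ≤ h`, so they differ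
    -- only at points that `s` carries across `h`.
    P R Q : ℤ → Set
    P = Crossing h (to w)
    R k = s k ≤ h × + 1 + h ≤ to w (s k)
    Q = Crossing h (to w ∘ s)

    even-R : EvenCardinality P → EvenCardinality R
    even-R ev = let (k , K , e) = fromEven ev in toEven (card-preimage s s involutive involutive K) e

    stable : (∀ x → x ≤ h → s x ≤ h) → EvenCardinality P → EvenCardinality Q
    stable pres ev = even-cong (λ x → mk⇔
      (λ { (a , b) → subst (_≤ h) (involutive x) (pres (s x) a) , b })
      (λ { (a , b) → pres x a , b })) (even-R ev)

    -- R and Q differ only on {u , u′} and {v , v′}; of each pair exactly one of R u and
    -- Q u′ (R v and Q v′) holds, so passing from R to Q flips the parity twice.
    toggled : ∀ u v u′ v′ → u ≢ v → u′ ≢ v′ →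
              s u ≤ h → s v ≤ h → ¬ u ≤ h → ¬ v ≤ h → u′ ≤ h → v′ ≤ h → ¬ s u′ ≤ h → ¬ s v′ ≤ h →
              (+ 1 + h ≤ to w (s u) ⊎ + 1 + h ≤ to w (s u′)) → ¬
                (+ 1 + h ≤ to w (s u) × + 1 + h ≤ to w (s u′)) →
              (+ 1 + h ≤ to w (s v) ⊎ + 1 + h ≤ to w (s v′)) → ¬
                (+ 1 + h ≤ to w (s v) × + 1 + h ≤ to w (s v′)) →
              (∀ x → x ≢ u → x ≢ v → x ≢ u′ → x ≢ v′ → x ≤ h ⇔ s x ≤ h) →
              EvenCardinality P → EvenCardinality Q
    toggled u v u′ v′ u≢v u′≢v′ su sv u> v> u′≤ v′≤ su′ sv′ ou eu ov ev others even =
      even-cong R₂⇔Q (flip-flip (flip₁ ou) (flip₂ ov) (even-R even))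
      where
      G : ℤ → Set
      G k = + 1 + h ≤ to w (s k)
      R₁ R₂ : ℤ → Set
      R₁ k = (R k × k ≢ u) ⊎ (k ≡ u′ × G u′)
      R₂ k = (R₁ k × k ≢ v) ⊎ (k ≡ v′ × G v′)
      removed : ∀ {S : ℤ → Set} {k} → ∃[ l ] k ≡ suc l × Card S l → ∃[ l ]
        (l ≡ suc k ⊎ k ≡ suc l) × Card S l
      removed (l , eq , L) = l , inj₂ eq , L
      flip₁ : G u ⊎ G u′ → Flip R R₁
      flip₁ (inj₁ gu) K = removed (card-remove {Q = R₁} u (su , gu) (λ y → mk⇔
              (λ { (inj₁ r) → r ; (inj₂ (_ , gu′)) → ⊥-elim (eu (gu , gu′)) }) inj₁) K)
      flip₁ (inj₂ gu′) K = _ , inj₁ refl , card-add u′ (λ { (a , _) → su′ a }) (λ y → mk⇔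
              (λ { (inj₁ (r , _)) → inj₂ r ; (inj₂ (e , _)) → inj₁ e })
              (λ { (inj₁ e) → inj₂ (e , gu′)
                 ; (inj₂ r) → inj₁ (r , λ { refl → eu (proj₂ r , gu′) }) })) K
      flip₂ : G v ⊎ G v′ → Flip R₁ R₂
      flip₂ (inj₁ gv) K = removed (card-remove {Q = R₂} v (inj₁ ((sv , gv) , u≢v ∘ sym)) (λ y → mk⇔
              (λ { (inj₁ r) → r ; (inj₂ (_ , gv′)) → ⊥-elim (ev (gv , gv′)) }) inj₁) K)
      flip₂ (inj₂ gv′) K = _ , inj₁ refl , card-add v′ (λ
        { (inj₁ ((a , _) , _)) → sv′ a ; (inj₂ (e , _)) → u′≢v′ (sym e) }) (λ y → mk⇔
              (λ { (inj₁ (r , _)) → inj₂ r ; (inj₂ (e , _)) → inj₁ e })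
              (λ { (inj₁ e) → inj₂ (e , gv′)
                 ; (inj₂ r) → inj₁ (r , λ { refl → not-v r gv′ }) })) K
        where
        not-v : R₁ v → G v′ → ⊥
        not-v (inj₁ (r , _)) gv′ = ev (proj₂ r , gv′)
        not-v (inj₂ (refl , _)) _ = v> u′≤
      R₂⇔Q : ∀ x → R₂ x ⇔ Q x
      R₂⇔Q x = mk⇔ forward backward
        where
        forward : R₂ x → Q x
        forward (inj₂ (refl , g)) = v′≤ , g
        forward (inj₁ (inj₂ (refl , g) , _)) = u′≤ , g
        forward (inj₁ (inj₁ ((a , g) , x≢u) , x≢v)) =
          ⇐ (others x x≢u x≢v (λ { refl → su′ a }) (λ { refl → sv′ a })) a , g
        backward : Q x → R₂ x
        backward (a , g) with x ℤ.≟ v′ | x ℤ.≟ u′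
        ... | yes refl | _ = inj₂ (refl , g)
        ... | no _ | yes refl = inj₁ (inj₂ (refl , g) , λ { refl → v> a })
        ... | no x≢v′ | no x≢u′ = inj₁ (inj₁ ((⇒ (others x x≢u x≢v x≢u′ x≢v′) a , g) , x≢u) , x≢v)
          where
          x≢u : x ≢ u
          x≢u refl = u> a
          x≢v : x ≢ v
          x≢v refl = v> a

  C≢D : ∀ {v} → v ≡ C → v ≢ D
  C≢D refl ()

  sign-split : ∀ {y} → Entry y → + 1 ≤ y ⊎ + 1 ≤ - y
  sign-split {y} ent with + 1 ℤ.≤? y
  ... | yes p = inj₁ p
  ... | no ¬p = inj₂ (go (ℤ.<-cmp y (+ 0)))
    where
    go : _ → + 1 ≤ - y
    go (tri< y<0 _ _) = lin 1 (λ y → (y :< # 0) ∷ [] ⊢ # 1 :≤ :- y) y y<0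
    go (tri≈ _ refl _) = ⊥-elim (ent (divides (+ 0) refl))
    go (tri> _ _ y>0) = ⊥-elim (¬p (lin 1 (λ y → (# 0 :< y) ∷ [] ⊢ # 1 :≤ y) y y>0))

  half-split : ∀ y → + 1 + n₊ ≤ y ⊎ + 1 + n₊ ≤ N - y
  half-split y with + 1 + n₊ ℤ.≤? y
  ... | yes p = inj₁ p
  ... | no ¬p = inj₂ (lin 3 (λ N n y → (N := # 1 :+ (n :+ n)) ∷ (y :< # 1 :+ n) ∷ []
    ⊢ # 1 :+ n :≤ N :- y) N n₊ y N≡ (ℤ.≰⇒> ¬p))

  private
    module _ (w : Aut) (i : Fin (suc n)) where
      open Toggling w (generator t n i) (generator-involutive i)

      value-neg : ∀ x → to w (generator t n i (- x)) ≡ - to w (generator t n i x)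
      value-neg x = trans (cong (to w) (generator-neg i x)) (to-neg w (generator t n i x))

      generator-reflect : ∀ x → generator t n i (N - x) ≡ N - generator t n i x
      generator-reflect = Descent.to-reflect (gen i)

      value-reflect : ∀ x → to w (generator t n i (N - x)) ≡ N - to w (generator t n i x)
      value-reflect x = trans (cong (to w) (generator-reflect x))
        (Descent.to-reflect w (generator t n i x))

      -- `s₀ᴰ` carries exactly `1, 2` down and `-1, -2` up across 0. The values at `x` and `- x` are
      -- opposite and nonzero, so just one of each such pair is positive.
      toggle₀ : toℕ i ≡ 0 → variant₀ t ≡ D → EvenCardinality (Crossing (+ 0) (to w)) →
                EvenCardinality (Crossing (+ 0) (to w ∘ generator t n i))
      toggle₀ i≡0 v = toggled (+ 0) (+ 1) (+ 2) (- + 1) (- + 2) (λ ()) (λ ())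
        (subst (_≤ + 0) (sym s1) -≤+) (subst (_≤ + 0) (sym s2) -≤+)
        (λ { (+≤+ ()) }) (λ { (+≤+ ()) }) -≤+ -≤+
        (λ p → up (subst (_≤ + 0) s-1 p)) (λ p → up (subst (_≤ + 0) s-2 p))
        (either (+ 1) (entry (s≤s z≤n))) (both (+ 1)) (either (+ 2) (entry ℕ.≤-refl))
          (both (+ 2)) others
        where
        K = zeroD {i} i≡0 v
        s1 = generator-high K
        s2 = value-second {i} i≡0 v
        s-1 : generator t n i (- + 1) ≡ + 2
        s-1 = trans (generator-neg i (+ 1)) (cong -_ s1)
        s-2 : generator t n i (- + 2) ≡ + 1
        s-2 = generator-low K
        up : ∀ {m} → ¬ + suc m ≤ + 0
        up (+≤+ ())
        entry : ∀ {m} → suc m ℕ.≤ 2 → Entry (+ suc m)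
        entry m≤2 = entry-between (+<+ (s≤s z≤n)) (+<+ (ℕ.≤-<-trans m≤2 (ℕ.≤-<-trans 2≤n n<period)))
        either : ∀ x → Entry x → + 1 ≤ to w (generator t n i x) ⊎ + 1 ≤ to w (generator t n i (- x))
        either x ent = Sum.map₂ (subst (+ 1 ≤_) (sym (value-neg x)))
          (sign-split (to-entry (w ⊙ gen i) {x} ent))
        both : ∀ x → ¬ (+ 1 ≤ to w (generator t n i x) × + 1 ≤ to w (generator t n i (- x)))
        both x (a , b) = lin 2 (λ y z → (# 1 :≤ y) ∷ (# 1 :≤ z) ∷ (z := :- y) ∷ [] ⊢ :⊥)
          (to w (generator t n i x)) (to w (generator t n i (- x))) a b (value-neg x)
        same : ∀ {x y} → x ≢ + 1 → x ≢ + 2 → x ≢ - + 1 → x ≢ - + 2 → Swap (- + 2) (+ 1) x y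
          → x ≤ + 0 → y ≤ + 0
        same a b c d (stay refl) e = e
        same {x} {y} a b c d (↑ k eq f) e with scale k
        ... | below _ g = lin 3 (λ y z N → (# 5 :≤ N) ∷ (z :≤ :- N) ∷ (y := # 1 :+ z) ∷ []
          ⊢ y :≤ # 0) y (k * N) N 5≤N g f
        ... | none refl _ = ⊥-elim (d eq)
        ... | above _ g = ⊥-elim (lin 3 (λ x z N → (# 5 :≤ N) ∷ (N :≤ z) ∷ (x := :- # 2 :+ z) ∷
          (x :≤ # 0) ∷ [] ⊢ :⊥) x (k * N) N 5≤N g eq e)
        same {x} {y} a b c d (↓ k eq f) e = lin 3 (λ x y z → (x := # 1 :+ z) ∷ (y := :- # 2 :+ z) ∷
          (x :≤ # 0) ∷ [] ⊢ y :≤ # 0) x y (k * N) eq f e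
        same {x} {y} a b c d (-↑ k eq f) e with scale k
        ... | below _ g = lin 3 (λ y z N → (# 5 :≤ N) ∷ (z :≤ :- N) ∷ (y := # 2 :+ z) ∷ []
          ⊢ y :≤ # 0) y (k * N) N 5≤N g f
        ... | none refl _ = ⊥-elim (c eq)
        ... | above _ g = ⊥-elim (lin 3 (λ x z N → (# 5 :≤ N) ∷ (N :≤ z) ∷ (x := :- # 1 :+ z) ∷
          (x :≤ # 0) ∷ [] ⊢ :⊥) x (k * N) N 5≤N g eq e)
        same {x} {y} a b c d (-↓ k eq f) e = lin 3 (λ x y z → (x := # 2 :+ z) ∷ (y := :- # 1 :+ z) ∷
          (x :≤ # 0) ∷ [] ⊢ y :≤ # 0) x y (k * N) eq f e
        others : ∀ x → x ≢ + 1 → x ≢ + 2 → x ≢ - + 1 → x ≢ - + 2 → x ≤ + 0 ⇔ generator t n i x ≤ + 0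
        others x a b c d = mk⇔ (same a b c d (generator-swap K x))
          (λ p → subst (_≤ + 0) (generator-involutive i x)
            (same (moved d s1) (moved c s2) (moved b s-1) (moved a s-2)
              (generator-swap K (generator t n i x)) p))
          where
          moved : ∀ {y z} → x ≢ y → generator t n i z ≡ y → generator t n i x ≢ z
          moved {y} {z} ne eq sx≡z = ne (trans (sym (generator-involutive i x))
            (trans (cong (generator t n i) sx≡z) eq))

      -- The points carried across are `n + 1, n + 2` and their images `n, n - 1` under `x ↦ N - x`.
      -- As `N` is odd, exactly one of `y` and `N - y` exceeds `n`.
      toggleₙ : toℕ i ≡ n → variantₙ t ≡ D → EvenCardinality (Crossing n₊ (to w)) →
                EvenCardinality (Crossing n₊ (to w ∘ generator t n i))
      toggleₙ i≡n v = toggled n₊ u v′ (N - u) (N - v′)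
        (λ eq → lin 2 (λ u v → (u := v) ∷ (v := # 1 :+ u) ∷ [] ⊢ :⊥) u v′ eq refl)
        (λ eq → lin 3 (λ N u v → (N :- u := N :- v) ∷ (v := # 1 :+ u) ∷ [] ⊢ :⊥) N u v′ eq refl)
        (subst (_≤ n₊) (sym su) (lin 1 (λ n → [] ⊢ n :- # 1 :≤ n) n₊))
        (ℤ.≤-reflexive sv)
        (lin 1 (λ n → (# 1 :+ n :≤ n) ∷ [] ⊢ :⊥) n₊)
        (lin 1 (λ n → (# 2 :+ n :≤ n) ∷ [] ⊢ :⊥) n₊)
        (lin 2 (λ N n → (N := # 1 :+ (n :+ n)) ∷ [] ⊢ N :- (# 1 :+ n) :≤ n) N n₊ N≡)
        (lin 2 (λ N n → (N := # 1 :+ (n :+ n)) ∷ [] ⊢ N :- (# 2 :+ n) :≤ n) N n₊ N≡)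
        (λ p → lin 3 (λ N n x → (N := # 1 :+ (n :+ n)) ∷ (x :≤ n) ∷ (x := N :- (n :- # 1)) ∷ []
          ⊢ :⊥) N n₊ (generator t n i (N - u)) N≡ p (trans (generator-reflect u)
          (cong (λ z → N - z) su)))
        (λ p → lin 3 (λ N n x → (N := # 1 :+ (n :+ n)) ∷ (x :≤ n) ∷ (x := N :- n) ∷ [] ⊢ :⊥) N n₊
          (generator t n i (N - v′)) N≡ p (trans (generator-reflect v′) (cong (λ z → N - z) sv)))
        (either u) (both u) (either v′) (both v′) others
        where
        K = lastD {i} i≡n v
        u = + 1 + n₊
        v′ = + 2 + n₊
        su = generator-high K
        sv : generator t n i v′ ≡ n₊
        sv = trans (cong (generator t n i) (lin 2 (λ N n → (N := # 1 :+ (n :+ n)) ∷ []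
          ⊢ # 2 :+ n := N :- (n :- # 1)) N n₊ N≡))
          (trans (generator-reflect (n₊ - + 1)) (trans (cong (λ z → N - z) (generator-low K))
            (lin 2 (λ N n → (N := # 1 :+ (n :+ n)) ∷ [] ⊢ N :- (# 1 :+ n) := n) N n₊ N≡)))
        either : ∀ x → + 1 + n₊ ≤ to w (generator t n i x) ⊎ + 1 + n₊ ≤ to w
          (generator t n i (N - x))
        either x = Sum.map₂ (subst (+ 1 + n₊ ≤_) (sym (value-reflect x)))
          (half-split (to w (generator t n i x)))
        both : ∀ x → ¬ (+ 1 + n₊ ≤ to w (generator t n i x) × + 1 + n₊ ≤ to w
          (generator t n i (N - x)))
        both x (a , b) = lin 4 (λ N n y z → (N := # 1 :+ (n :+ n)) ∷ (# 1 :+ n :≤ y) ∷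
          (# 1 :+ n :≤ z) ∷ (z := N :- y) ∷ [] ⊢ :⊥) 
          N n₊ (to w (generator t n i x)) (to w (generator t n i (N - x))) N≡ a b (value-reflect x)
        3≤n : + 2 ≤ n₊
        3≤n = +≤+ 2≤n
        step : ∀ k → k * N ≡ (k - + 1) * N + N
        step k = lemma k N
          where
          lemma : ∀ k N → k * N ≡ (k - + 1) * N + N
          lemma = solve-∀
        same : ∀ {x y} → x ≢ u → x ≢ v′ → x ≢ N - u → x ≢ N - v′ → Swap (n₊ - + 1) (+ 1 + n₊) x y
          → x ≤ n₊ → y ≤ n₊
        same a b c d (stay refl) e = e
        same {x} {y} a b c d (↑ k eq f) e with scale k
        ... | below _ g = lin 4 (λ y z N n → (N := # 1 :+ (n :+ n)) ∷ (# 2 :≤ n) ∷ (z :≤ :- N) ∷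
          (y := (# 1 :+ n) :+ z) ∷ [] ⊢ y :≤ n) y (k * N) N n₊ N≡ 3≤n g f
        ... | none refl _ = ⊥-elim (d (trans eq (lin 2 (λ N n → (N := # 1 :+ (n :+ n)) ∷ []
          ⊢ n :- # 1 :+ # 0 := N :- (# 2 :+ n)) N n₊ N≡)))
        ... | above _ g = ⊥-elim (lin 4 (λ x z N n → (N := # 1 :+ (n :+ n)) ∷ (# 2 :≤ n) ∷ (N :≤ z)
          ∷ (x := (n :- # 1) :+ z) ∷ (x :≤ n) ∷ [] ⊢ :⊥) x (k * N) N n₊ N≡ 3≤n g eq e)
        same {x} {y} a b c d (↓ k eq f) e = lin 4 (λ x y z n → (x := # 1 :+ n :+ z) ∷
          (y := n :- # 1 :+ z) ∷ (x :≤ n) ∷ [] ⊢ y :≤ n) x y (k * N) n₊ eq f e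
        same {x} {y} a b c d (-↑ k eq f) e with scale (k - + 1)
        ... | below _ g = lin 5 (λ y z z′ N n → (N := # 1 :+ (n :+ n)) ∷ (# 2 :≤ n) ∷ (z′ :≤ :- N) ∷
          (z := z′ :+ N) ∷ (y := :- (n :- # 1) :+ z) ∷ [] ⊢ y :≤ n) y (k * N)
          ((k - + 1) * N) N n₊ N≡ 3≤n g (step k) f
        ... | none k≡1 g = ⊥-elim (c (lin 5 (λ x z z′ N n → (N := # 1 :+ (n :+ n)) ∷ (z′ := # 0) ∷
          (z := z′ :+ N) ∷ (x := :- (# 1 :+ n) :+ z) ∷ [] ⊢ x := N :- (# 1 :+ n)) x (k * N)
          ((k - + 1) * N) N n₊ N≡ g (step k) eq))
        ... | above _ g = ⊥-elim (lin 5 (λ x z z′ N n → (N := # 1 :+ (n :+ n)) ∷ (# 2 :≤ n) ∷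
          (N :≤ z′) ∷ (z := z′ :+ N) ∷ (x := :- (# 1 :+ n) :+ z) ∷ (x :≤ n) ∷ [] ⊢ :⊥) x (k * N)
          ((k - + 1) * N) N n₊ N≡ 3≤n g (step k) eq e)
        same {x} {y} a b c d (-↓ k eq f) e = lin 4 (λ x y z n → (x := :- (n :- # 1) :+ z) ∷
          (y := :- (# 1 :+ n) :+ z) ∷ (x :≤ n) ∷ [] ⊢ y :≤ n) x y (k * N) n₊ eq f e
        others : ∀ x → x ≢ u → x ≢ v′ → x ≢ N - u → x ≢ N - v′ → x ≤ n₊ ⇔ generator t n i x ≤ n₊
        others x a b c d = mk⇔ (same a b c d (generator-swap K x))
          (λ p → subst (_≤ n₊) (generator-involutive i x)
            (same (moved d su-) (moved c sv-) (moved b su′) (moved a sv′)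
              (generator-swap K (generator t n i x)) p))
          where
          moved : ∀ {y z} → x ≢ y → generator t n i z ≡ y → generator t n i x ≢ z
          moved {y} {z} ne eq sx≡z = ne (trans (sym (generator-involutive i x))
            (trans (cong (generator t n i) sx≡z) eq))
          su- : generator t n i u ≡ N - v′
          su- = trans su (lin 2 (λ N n → (N := # 1 :+ (n :+ n)) ∷ [] ⊢ n :- # 1 := N :- (# 2 :+ n))
            N n₊ N≡)
          sv- : generator t n i v′ ≡ N - u
          sv- = trans sv (lin 2 (λ N n → (N := # 1 :+ (n :+ n)) ∷ [] ⊢ n := N :- (# 1 :+ n)) N n₊
            N≡)
          su′ : generator t n i (N - u) ≡ v′
          su′ = trans (generator-reflect u) (trans (cong (λ z → N - z) su)
            (lin 2 (λ N n → (N := # 1 :+ (n :+ n)) ∷ [] ⊢ N :- (n :- # 1) := # 2 :+ n) N n₊ N≡))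
          sv′ : generator t n i (N - v′) ≡ u
          sv′ = trans (generator-reflect v′) (trans (cong (λ z → N - z) sv)
            (lin 2 (λ N n → (N := # 1 :+ (n :+ n)) ∷ [] ⊢ N :- n := # 1 :+ n) N n₊ N≡))

      even₀-step : ∀ {p q} → Kind i p q → variant₀ t ≡ D → EvenCardinality (Crossing (+ 0) (to w)) →
                   EvenCardinality (Crossing (+ 0) (to w ∘ generator t n i))
      even₀-step (zeroC _ v) v′ = ⊥-elim (C≢D v v′)
      even₀-step (zeroD i≡0 v) _ = toggle₀ i≡0 v
      even₀-step K@(middle a b) _ = stable (+ 0) λ x → swap-≤0 (+<+ a) (+<+ ℕ.≤-refl)
        (+<+ (ℕ.≤-<-trans b n<period)) (generator-swap K x)
      even₀-step K@(lastC _ _) _ = stable (+ 0) λ x → swap-≤0 (+<+ (ℕ.≤-trans (s≤s z≤n) 2≤n))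
        (+<+ ℕ.≤-refl)
        (lin 2 (λ N n → (N := # 1 :+ (n :+ n)) ∷ (# 2 :≤ n) ∷ [] ⊢ # 1 :+ n :< N) N n₊ N≡ (+≤+ 2≤n))
        (generator-swap K x)
      even₀-step K@(lastD _ _) _ = stable (+ 0) λ x → swap-≤0
        (lin 1 (λ n → (# 2 :≤ n) ∷ [] ⊢ # 0 :< n :- # 1) n₊ (+≤+ 2≤n))
        (lin 1 (λ n → [] ⊢ n :- # 1 :< # 1 :+ n) n₊)
        (lin 2 (λ N n → (N := # 1 :+ (n :+ n)) ∷ (# 2 :≤ n) ∷ [] ⊢ # 1 :+ n :< N) N n₊ N≡ (+≤+ 2≤n))
        (generator-swap K x)

      evenₙ-step : ∀ {p q} → Kind i p q → variantₙ t ≡ D → EvenCardinality (Crossing n₊ (to w)) →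
                   EvenCardinality (Crossing n₊ (to w ∘ generator t n i))
      evenₙ-step K@(zeroC _ _) _ = stable n₊ λ x → swap-≤n
        (lin 1 (λ n → (# 2 :≤ n) ∷ [] ⊢ :- n :≤ con (- + 1)) n₊ (+≤+ 2≤n))
          -<+ (+≤+ (ℕ.≤-trans (s≤s z≤n) 2≤n)) (generator-swap K x)
      evenₙ-step K@(zeroD _ _) _ = stable n₊ λ x → swap-≤n
        (lin 1 (λ n → (# 2 :≤ n) ∷ [] ⊢ :- n :≤ con (- + 2)) n₊ (+≤+ 2≤n))
          -<+ (+≤+ (ℕ.≤-trans (s≤s z≤n) 2≤n)) (generator-swap K x)
      evenₙ-step K@(middle a b) _ = stable n₊ λ x → swap-≤n
        (lin 2 (λ n i → (# 0 :≤ n) ∷ (# 0 :≤ i) ∷ [] ⊢ :- n :≤ i) n₊ (+ toℕ i) 0≤n (+≤+ z≤n))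
          (+<+ ℕ.≤-refl) (+≤+ b) (generator-swap K x)
      evenₙ-step (lastC _ v) v′ = ⊥-elim (C≢D v v′)
      evenₙ-step (lastD i≡n v) _ = toggleₙ i≡n v

  inGroup-step : ∀ w i → InGroup (to w) → InGroup (to w ∘ generator t n i)
  inGroup-step w i (e₀ , eₙ) = (λ v → even₀-step w i (kindOf i) v (e₀ v)) ,
    (λ v → evenₙ-step w i (kindOf i) v (eₙ v))

  inGroup-cong : ∀ {f g} → f ≗ g → InGroup f → InGroup g
  inGroup-cong {f} {g} eq (e₀ , eₙ) = even-cong same ∘ e₀ , even-cong same ∘ eₙ
    where
    same : ∀ {h} x → Crossing h f x ⇔ Crossing h g x
    same {h} x = mk⇔ (λ (a , b) → a , subst (+ 1 + h ≤_) (eq x) b)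
      (λ (a , b) → a , subst (+ 1 + h ≤_) (sym (eq x)) b)

  inGroup-identity : InGroup id
  inGroup-identity = (λ _ → toEven (card-empty no-crossing) (2 ℕ.∣0)) ,
    (λ _ → toEven (card-empty no-crossing) (2 ℕ.∣0))
    where
    no-crossing : ∀ {h} x → ¬ Crossing h id x
    no-crossing {h} x (a , b) = lin 2 (λ h x → (x :≤ h) ∷ (# 1 :+ h :≤ x) ∷ [] ⊢ :⊥) h x a b

  member⇒inGroup : ∀ {w} → _∈W̃ t n w → InGroup ⟦ w ⟧
  member⇒inGroup m = _∈W̃.even₀ m , _∈W̃.evenₙ m

  inGroup⇒member : ∀ w → InGroup (to w) → _∈W̃ t n (fromAut w)
  inGroup⇒member w (e₀ , eₙ) = record { even₀ = e₀ ; evenₙ = eₙ }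

-- An element of the group without descents is the identity.

module Words (t : AffineType) (n : ℕ) (rank : minRank t ℕ.≤ n) where
  open import Data.Integer using (_+_; _-_; _*_; -_; _≤_; _<_)
  open Parity t n rank public

  -- `kind` finds its case by deciding equalities; uniqueness lets any evidence stand in for the
  -- pair that it finds.
  kind-unique : ∀ {i p q p′ q′} → Kind i p q → Kind i p′ q′ → p ≡ p′ × q ≡ q′
  kind-unique (zeroC a b)  (zeroC c d)  = refl , refl
  kind-unique (zeroC a b)  (zeroD c d)  = ⊥-elim (C≢D b d)
  kind-unique (zeroC a b)  (middle c d) = ⊥-elim (ℕ.>⇒≢ c a)
  kind-unique (zeroC a b)  (lastC c d)  = ⊥-elim (n≢0 (trans (sym c) a))
  kind-unique (zeroC a b)  (lastD c d)  = ⊥-elim (n≢0 (trans (sym c) a))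
  kind-unique (zeroD a b)  (zeroC c d)  = ⊥-elim (C≢D d b)
  kind-unique (zeroD a b)  (zeroD c d)  = refl , refl
  kind-unique (zeroD a b)  (middle c d) = ⊥-elim (ℕ.>⇒≢ c a)
  kind-unique (zeroD a b)  (lastC c d)  = ⊥-elim (n≢0 (trans (sym c) a))
  kind-unique (zeroD a b)  (lastD c d)  = ⊥-elim (n≢0 (trans (sym c) a))
  kind-unique (middle a b) (zeroC c d)  = ⊥-elim (ℕ.>⇒≢ a c)
  kind-unique (middle a b) (zeroD c d)  = ⊥-elim (ℕ.>⇒≢ a c)
  kind-unique (middle a b) (middle c d) = refl , refl
  kind-unique (middle a b) (lastC c d)  = ⊥-elim (ℕ.<⇒≢ b c)
  kind-unique (middle a b) (lastD c d)  = ⊥-elim (ℕ.<⇒≢ b c)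
  kind-unique (lastC a b)  (zeroC c d)  = ⊥-elim (n≢0 (trans (sym a) c))
  kind-unique (lastC a b)  (zeroD c d)  = ⊥-elim (n≢0 (trans (sym a) c))
  kind-unique (lastC a b)  (middle c d) = ⊥-elim (ℕ.<⇒≢ d a)
  kind-unique (lastC a b)  (lastC c d)  = refl , refl
  kind-unique (lastC a b)  (lastD c d)  = ⊥-elim (C≢D b d)
  kind-unique (lastD a b)  (zeroC c d)  = ⊥-elim (n≢0 (trans (sym a) c))
  kind-unique (lastD a b)  (zeroD c d)  = ⊥-elim (n≢0 (trans (sym a) c))
  kind-unique (lastD a b)  (middle c d) = ⊥-elim (ℕ.<⇒≢ d a)
  kind-unique (lastD a b)  (lastC c d)  = ⊥-elim (C≢D d b)
  kind-unique (lastD a b)  (lastD c d)  = refl , refl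

  low-≡ : ∀ {i p q} → Kind i p q → low i ≡ p
  low-≡ {i} K = proj₁ (kind-unique (kindOf i) K)

  high-≡ : ∀ {i p q} → Kind i p q → high i ≡ q
  high-≡ {i} K = proj₂ (kind-unique (kindOf i) K)

  zeroᶠ lastᶠ : Fin (suc n)
  zeroᶠ = Fin.zero
  lastᶠ = fromℕ< (ℕ.n<1+n n)

  middleᶠ : ∀ {j} → j ℕ.< n → Fin (suc n)
  middleᶠ j<n = fromℕ< (ℕ.m<n⇒m<1+n j<n)

  toℕ-lastᶠ : toℕ lastᶠ ≡ n
  toℕ-lastᶠ = Fin.toℕ-fromℕ< (ℕ.n<1+n n)

  toℕ-middleᶠ : ∀ {j} (j<n : j ℕ.< n) → toℕ (middleᶠ j<n) ≡ j
  toℕ-middleᶠ j<n = Fin.toℕ-fromℕ< (ℕ.m<n⇒m<1+n j<n)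

  Ascent : (ℤ → ℤ) → Fin (suc n) → Set
  Ascent f i = f (low i) < f (high i)

  ascent : ∀ f {i p q} → Kind i p q → Ascent f i → f p < f q
  ascent f K = subst₂ (λ p q → f p < f q) (low-≡ K) (high-≡ K)

  1≤n : 1 ℕ.≤ n
  1≤n = ℕ.≤-trans (s≤s z≤n) 2≤n

  module Windows (w : Aut) where
    open Descent w public

    W : ℕ → ℤ
    W r = to w (+ r)

    ascent-middle : (∀ i → toℕ i ≢ 0 → Ascent (to w) i) → ∀ {j} → 1 ℕ.≤ j → j ℕ.< n → W j < W
      (suc j)
    ascent-middle asc {j} 1≤j j<n = subst (λ k → W k < W (suc k)) j≡
      (ascent (to w) (middle (subst (1 ℕ.≤_) (sym j≡) 1≤j) (subst (ℕ._< n) (sym j≡) j<n))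
        (asc (middleᶠ j<n) (λ eq → ℕ.>⇒≢ 1≤j (trans (sym j≡) eq))))
      where j≡ = toℕ-middleᶠ j<n

    -- Strict growth over the integers is growth by at least one, so the distance of the arguments
    -- is a lower bound. This later squeezes the window between its end values.
    increasing : (∀ i → toℕ i ≢ 0 → Ascent (to w) i) → ∀ {a b} → 1 ℕ.≤ a → a ℕ.≤ b → b ℕ.≤ n
      → W a + (+ b - + a) ≤ W b
    increasing asc {a} {b} 1≤a a≤b b≤n = go (b ∸ a) (ℕ.m+[n∸m]≡n a≤b)
      where
      go′ : ∀ d → a ℕ.+ d ℕ.≤ n → W a + + d ≤ W (a ℕ.+ d)
      go′ zero    h = ℤ.≤-reflexive (trans (ℤ.+-identityʳ (W a)) (cong W (sym (ℕ.+-identityʳ a))))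
      go′ (suc d) h = subst (λ k → W a + + suc d ≤ W k) (sym (ℕ.+-suc a d))
        (lin 4 (λ x d y z → (x :+ d :≤ y) ∷ (y :< z) ∷ [] ⊢ x :+ (# 1 :+ d) :≤ z) (W a) (+ d)
          (W (a ℕ.+ d)) (W (suc (a ℕ.+ d)))
          (go′ d (ℕ.<⇒≤ h′)) (ascent-middle asc (ℕ.≤-trans 1≤a (ℕ.m≤m+n a d)) h′))
        where
        h′ : a ℕ.+ d ℕ.< n
        h′ = subst (ℕ._≤ n) (ℕ.+-suc a d) h
      go : ∀ d → a ℕ.+ d ≡ b → W a + (+ b - + a) ≤ W b
      go d refl = subst (λ z → W a + z ≤ W b) (lin 2 (λ a d → [] ⊢ d := a :+ d :- a) (+ a) (+ d))
        (go′ d b≤n)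

    value-shift : ∀ r k → to w (+ r + k * N) ≡ W r + k * N
    value-shift r k = to-shift w k (+ r)

    value-shift⁻ : ∀ r k → to w (- + r + k * N) ≡ - W r + k * N
    value-shift⁻ r k = trans (to-shift w k (- + r)) (cong (_+ k * N) (to-neg w (+ r)))

    value-multiple : ∀ k → to w (+ 0 + k * N) ≡ + 0 + k * N
    value-multiple k = trans (to-shift w k (+ 0)) (cong (_+ k * N) (to-0 w))

    fixed-window : (∀ {r} → 1 ℕ.≤ r → r ℕ.≤ n → W r ≡ + r) → ∀ x → to w x ≡ x
    fixed-window h x = go (signed x)
      where
      go : ∀ {x} → Signed x → to w x ≡ x
      go (multiple k) = value-multiple k
      go (plus r k a b) = trans (value-shift r k) (cong (_+ k * N) (h a b))
      go (minus r k a b) = trans (value-shift⁻ r k) (cong (λ z → - z + k * N) (h a b))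

  -- In types D the inequalities alone leave room for a single crossing, which parity
  -- forbids.
  module NoDescents (w : Aut) (inGroup : InGroup (to w)) (asc : ∀ i → Ascent (to w) i) where
    open Windows w

    private
      inc : ∀ {a b} → 1 ℕ.≤ a → a ℕ.≤ b → b ℕ.≤ n → W a + (+ b - + a) ≤ W b
      inc = increasing (λ i _ → asc i)

      inc-≤ : ∀ {a b} → 1 ℕ.≤ a → a ℕ.≤ b → b ℕ.≤ n → W a ≤ W b
      inc-≤ {a} {b} p q r = lin 4 (λ x y a b → (x :+ (b :- a) :≤ y) ∷ (a :≤ b) ∷ [] ⊢ x :≤ y) (W a)
        (W b) (+ a) (+ b) (inc p q r) (+≤+ q)

      W₁<W₂ : W 1 < W 2
      W₁<W₂ = lin 2 (λ x y → (x :+ # 1 :≤ y) ∷ [] ⊢ x :< y) (W 1) (W 2) (inc ℕ.≤-refl (s≤s z≤n) 2≤n)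

      sum>0 : - W 2 < W 1
      sum>0 = go (variant₀ t) refl
        where
        go : ∀ v → variant₀ t ≡ v → - W 2 < W 1
        go C v = lin 3 (λ x y z → (z :< x) ∷ (z := :- x) ∷ (x :< y) ∷ [] ⊢ :- y :< x) (W 1) (W 2)
          (to w (- + 1))
          (ascent (to w) (zeroC {zeroᶠ} refl v) (asc zeroᶠ)) (to-neg w (+ 1)) W₁<W₂
        go D v = subst (_< W 1) (to-neg w (+ 2)) (ascent (to w) (zeroD {zeroᶠ} refl v) (asc zeroᶠ))

      W₂>0 : + 0 < W 2
      W₂>0 = lin 2 (λ x y → (x :< y) ∷ (:- y :< x) ∷ [] ⊢ # 0 :< y) (W 1) (W 2) W₁<W₂ sum>0

      W-last : (variantₙ t ≡ C → W n ≤ n₊) × (variantₙ t ≡ D → to w (n₊ - + 1) + W n < N)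
      W-last = (λ v → lin 4 (λ N n x z → (N := # 1 :+ (n :+ n)) ∷ (x :< z) ∷ (z := N :- x) ∷ []
        ⊢ x :≤ n) N n₊ (W n) (to w (+ 1 + n₊)) N≡
          (ascent (to w) (lastC toℕ-lastᶠ v) (asc lastᶠ)) to-n+1) ,
        (λ v → lin 4 (λ N x y z → (x :< z) ∷ (z := N :- y) ∷ [] ⊢ x :+ y :< N) N (to w (n₊ - + 1))
          (W n) (to w (+ 1 + n₊))
          (ascent (to w) (lastD toℕ-lastᶠ v) (asc lastᶠ)) to-n+1)

      W-n∸1 : W (n ∸ 1) ≡ to w (n₊ - + 1)
      W-n∸1 = cong (to w) n∸1≡

      Wₙ<N : W n < N
      Wₙ<N = go (variantₙ t) refl
        where
        go : ∀ v → variantₙ t ≡ v → W n < N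
        go C v = lin 3 (λ N n x → (N := # 1 :+ (n :+ n)) ∷ (# 0 :≤ n) ∷ (x :≤ n) ∷ [] ⊢ x :< N) N n₊
          (W n) N≡ 0≤n (proj₁ W-last v)
        go D v = lin 5 (λ N w₂ x x′ y → (# 0 :< w₂) ∷ (w₂ :≤ x) ∷ (x := x′) ∷ (x′ :+ y :< N) ∷ []
          ⊢ y :< N) N (W 2) (W (n ∸ 1)) (to w (n₊ - + 1)) (W n)
          W₂>0 (inc-≤ (s≤s z≤n) (ℕ.∸-monoˡ-≤ 1 (rank₃-ₙ t rank v)) (ℕ.m∸n≤m n 1)) W-n∸1
            (proj₂ W-last v)

      W₁>0 : + 0 < W 1
      W₁>0 = go (variant₀ t) refl
        where
        go : ∀ v → variant₀ t ≡ v → + 0 < W 1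
        go C v = lin 2 (λ x z → (z :< x) ∷ (z := :- x) ∷ [] ⊢ # 0 :< x) (W 1) (to w (- + 1))
          (ascent (to w) (zeroC {zeroᶠ} refl v) (asc zeroᶠ)) (to-neg w (+ 1))
        go D v = case (sign-split (entry-value ℕ.≤-refl 1≤n))
          where
          case : + 1 ≤ W 1 ⊎ + 1 ≤ - W 1 → + 0 < W 1
          case (inj₁ p) = lin 1 (λ x → (# 1 :≤ x) ∷ [] ⊢ # 0 :< x) (W 1) p
          -- With `W 1` negative, `-1` crosses 0. No other `k ≤ 0` does: `W 2, …, W n` are positive,
          -- and all window values lie strictly between `- N` and `N`.
          case (inj₂ p) = ⊥-elim (even-not-singleton (- + 1)
            (λ k → mk⇔ (λ (a , b) → crossing k (signed k) a b)
            (λ { refl → -≤+ , subst (+ 1 ≤_) (sym (to-neg w (+ 1))) p })) (proj₁ inGroup v))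
            where
            crossing : ∀ k → Signed k → k ≤ + 0 → + 1 ≤ to w k → k ≡ - + 1
            crossing k (multiple q) a b = ⊥-elim (lin 2
              (λ k x → (k :≤ # 0) ∷ (# 1 :≤ x) ∷ (x := k) ∷ [] ⊢ :⊥) k (to w k) a b
              (value-multiple q))
            crossing k (plus r q 1≤r r≤n) a b = go′ (scale q)
              where
              wk = value-shift r q
              go′ : Scale q → k ≡ - + 1
              go′ (below _ e) = ⊥-elim (lin 5 (λ N x wr wn z → (# 1 :≤ x) ∷ (x := wr :+ z) ∷
                (z :≤ :- N) ∷ (wr :≤ wn) ∷ (wn :< N) ∷ [] ⊢ :⊥)
                N (to w k) (W r) (W n) (q * N) b wk e (inc-≤ 1≤r r≤n ℕ.≤-refl) Wₙ<N)
              go′ (none _ e) = ⊥-elim (lin 3 (λ r k z → (# 1 :≤ r) ∷ (k :≤ # 0) ∷ (k := r :+ z) ∷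
                (z := # 0) ∷ [] ⊢ :⊥) (+ r) k (q * N) (+≤+ 1≤r) a refl e)
              go′ (above _ e) = ⊥-elim (lin 4 (λ N r k z → (# 1 :≤ r) ∷ (# 0 :< N) ∷ (k :≤ # 0) ∷
                (k := r :+ z) ∷ (N :≤ z) ∷ [] ⊢ :⊥) N (+ r) k (q * N) (+≤+ 1≤r)
                (+<+ (s≤s z≤n)) a refl e)
            crossing k (minus r q 1≤r r≤n) a b = go′ (scale q)
              where
              wk = value-shift⁻ r q
              r-cases : r ≡ 1 ⊎ 2 ℕ.≤ r
              r-cases = Sum.map₁ sym (Sum.swap (ℕ.m≤n⇒m<n∨m≡n 1≤r))
              go′ : Scale q → k ≡ - + 1
              go′ (above _ e) = ⊥-elim (lin 5 (λ N n r k z → (N := # 1 :+ (n :+ n)) ∷ (r :≤ n) ∷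
                (# 0 :≤ n) ∷ (k :≤ # 0) ∷ (k := :- r :+ z) ∷ (N :≤ z) ∷ [] ⊢ :⊥)
                N n₊ (+ r) k (q * N) N≡ (+≤+ r≤n) 0≤n a refl e)
              go′ (below _ e) = ⊥-elim (lin 7 (λ N x wr w₁ w₂ wn z → (# 1 :≤ x) ∷ (x := :- wr :+ z)
                ∷ (z :≤ :- N) ∷ (w₁ :≤ wr) ∷ (w₂ :≤ wn) ∷ (:- w₂ :< w₁) ∷ (wn :< N) ∷ [] ⊢ :⊥)
                N (to w k) (W r) (W 1) (W 2) (W n) (q * N) b wk e (inc-≤ ℕ.≤-refl 1≤r r≤n)
                  (inc-≤ (s≤s z≤n) 2≤n ℕ.≤-refl) sum>0 Wₙ<N)
              go′ (none refl e) = r-case r-cases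
                where
                r-case : r ≡ 1 ⊎ 2 ℕ.≤ r → k ≡ - + 1
                r-case (inj₁ refl) = refl
                r-case (inj₂ 2≤r) = ⊥-elim (lin 4 (λ x wr w₂ z → (# 1 :≤ x) ∷ (x := :- wr :+ z) ∷
                  (z := # 0) ∷ (w₂ :≤ wr) ∷ (# 0 :< w₂) ∷ [] ⊢ :⊥)
                  (to w k) (W r) (W 2) (+ 0 * N) b wk e (inc-≤ (s≤s z≤n) 2≤r r≤n) W₂>0)

      W>0 : ∀ {r} → 1 ℕ.≤ r → r ℕ.≤ n → + 0 < W r
      W>0 {r} a b = ℤ.<-≤-trans W₁>0 (inc-≤ ℕ.≤-refl a b)

      W<N : ∀ {r} → 1 ℕ.≤ r → r ℕ.≤ n → W r < N
      W<N {r} a b = ℤ.≤-<-trans (inc-≤ a b ℕ.≤-refl) Wₙ<N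

      Wₙ≤n : W n ≤ n₊
      Wₙ≤n = go (variantₙ t) refl
        where
        go : ∀ v → variantₙ t ≡ v → W n ≤ n₊
        go C v = proj₁ W-last v
        -- If `W n` exceeds `n`, then `W (n - 1) + W n < N` keeps the earlier values at most `n`,
        -- and `n` is the only crossing.
        go D v = ℤ.≮⇒≥ λ n<Wₙ → even-not-singleton n₊ (λ k → mk⇔
          (λ (a , b) → crossing n<Wₙ k (signed k) a b)
            (λ { refl → ℤ.≤-refl , ℤ.i<j⇒suc[i]≤j n<Wₙ })) (proj₂ inGroup v)
          where
          crossing : n₊ < W n → ∀ k → Signed k → k ≤ n₊ → + 1 + n₊ ≤ to w k → k ≡ n₊
          crossing n<Wₙ k (multiple q) a b = ⊥-elim (lin 3
            (λ n k x → (k :≤ n) ∷ (# 1 :+ n :≤ x) ∷ (x := k) ∷ [] ⊢ :⊥) n₊ k (to w k) a b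
            (value-multiple q))
          crossing n<Wₙ k (plus r q 1≤r r≤n) a b = go′ (scale q)
            where
            wk = value-shift r q
            go′ : Scale q → k ≡ n₊
            go′ (below _ e) = ⊥-elim (lin 5 (λ N n x wr z → (# 0 :≤ n) ∷ (# 1 :+ n :≤ x) ∷
              (x := wr :+ z) ∷ (z :≤ :- N) ∷ (wr :< N) ∷ [] ⊢ :⊥)
              N n₊ (to w k) (W r) (q * N) 0≤n b wk e (W<N 1≤r r≤n))
            go′ (above _ e) = ⊥-elim (lin 5 (λ N n r k z → (N := # 1 :+ (n :+ n)) ∷ (# 0 :≤ n) ∷
              (# 1 :≤ r) ∷ (k :≤ n) ∷ (k := r :+ z) ∷ (N :≤ z) ∷ [] ⊢ :⊥)
              N n₊ (+ r) k (q * N) N≡ 0≤n (+≤+ 1≤r) a refl e)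
            go′ (none refl e) = r-case (ℕ.m≤n⇒m<n∨m≡n r≤n)
              where
              r-case : r ℕ.< n ⊎ r ≡ n → k ≡ n₊
              r-case (inj₂ refl) = shift-0 n₊ N
              r-case (inj₁ r<n) = ⊥-elim (lin 8 (λ N n x wr z y y′ wn → (N := # 1 :+ (n :+ n)) ∷
                (# 1 :+ n :≤ x) ∷ (x := wr :+ z) ∷ (z := # 0) ∷ (wr :≤ y) ∷ (y := y′) ∷
                (y′ :+ wn :< N) ∷ (n :< wn) ∷ [] ⊢ :⊥)
                N n₊ (to w k) (W r) (+ 0 * N) (W (n ∸ 1)) (to w (n₊ - + 1)) (W n) N≡ b wk e
                  (inc-≤ 1≤r (ℕ.∸-monoˡ-≤ 1 r<n) (ℕ.m∸n≤m n 1)) W-n∸1 (proj₂ W-last v) n<Wₙ)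
          crossing n<Wₙ k (minus r q 1≤r r≤n) a b = go′ (scale (q - + 1))
            where
            wk = value-shift⁻ r q
            step : ∀ q N → q * N ≡ (q - + 1) * N + N
            step = solve-∀
            at-most : (q - + 1) * N ≤ - N → k ≡ n₊
            at-most e = ⊥-elim (lin 6 (λ N n x wr z z′ → (# 0 :≤ n) ∷ (# 1 :+ n :≤ x) ∷
              (x := :- wr :+ z) ∷ (z := z′ :+ N) ∷ (z′ :≤ :- N) ∷ (# 0 :< wr) ∷ [] ⊢ :⊥)
                N n₊ (to w k) (W r) (q * N) ((q - + 1) * N) 0≤n b wk (step q N) e (W>0 1≤r r≤n))
            at-least : + 0 ≤ (q - + 1) * N → k ≡ n₊
            at-least e = ⊥-elim (lin 6 (λ N n r k z z′ → (N := # 1 :+ (n :+ n)) ∷ (r :≤ n) ∷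
              (k :≤ n) ∷ (k := :- r :+ z) ∷ (z := z′ :+ N) ∷ (# 0 :≤ z′) ∷ [] ⊢ :⊥)
                N n₊ (+ r) k (q * N) ((q - + 1) * N) N≡ (+≤+ r≤n) a refl (step q N) e)
            go′ : Scale (q - + 1) → k ≡ n₊
            go′ (below _ e) = at-most e
            go′ (none _ e) = at-least (ℤ.≤-reflexive (sym e))
            go′ (above _ e) = at-least (ℤ.≤-trans (+≤+ z≤n) e)

    -- The values increase strictly from at least 1 to at most `n` in `n` places.
    identity-window : ∀ {r} → 1 ℕ.≤ r → r ℕ.≤ n → W r ≡ + r
    identity-window {r} 1≤r r≤n = ℤ.≤-antisym
      (lin 4 (λ x r n y → (x :+ (n :- r) :≤ y) ∷ (y :≤ n) ∷ [] ⊢ x :≤ r) (W r) (+ r) n₊ (W n)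
        (inc 1≤r r≤n ℕ.≤-refl) Wₙ≤n)
      (lin 3 (λ x r y → (y :+ (r :- # 1) :≤ x) ∷ (# 0 :< y) ∷ [] ⊢ r :≤ x) (W r) (+ r) (W 1)
        (inc ℕ.≤-refl 1≤r r≤n) W₁>0)

    is-identity : ∀ x → to w x ≡ x
    is-identity = fixed-window identity-window

-- The count as Coxeter length; inverses and minimal representatives.

module Reduced (t : AffineType) (n : ℕ) (rank : minRank t ℕ.≤ n) where
  open import Data.Integer using (_+_; _-_; _*_; -_; _≤_; _<_)
  open Words t n rank public

  prod : Word t n → ℤ → ℤ
  prod = product t n

  word : Word t n → Aut
  word []       = identity
  word (i ∷ ws) = gen i ⊙ word ws

  to-word : ∀ ws → to (word ws) ≗ prod ws
  to-word []       x = refl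
  to-word (i ∷ ws) x = cong (generator t n i) (to-word ws x)

  prod-++ : ∀ ws js x → prod (ws ++ js) x ≡ prod ws (prod js x)
  prod-++ []       js x = refl
  prod-++ (i ∷ ws) js x = cong (generator t n i) (prod-++ ws js x)

  length-cong : ∀ f g → f ≗ g → length′ f ≡ length′ g
  length-cong f g eq = size-cong n (values f) (values g) (λ j _ → eq (+ suc j))

  inGroup-prod : ∀ w ws → InGroup (to w) → InGroup (to w ∘ prod ws)
  inGroup-prod w []       e = e
  inGroup-prod w (i ∷ ws) e = inGroup-prod (w ⊙ gen i) ws (inGroup-step w i e)

  inGroup-word : ∀ ws → InGroup (prod ws)
  inGroup-word ws = inGroup-prod identity ws inGroup-identity

  inGroup-word⁻¹ : ∀ ws → InGroup (from (word ws))
  inGroup-word⁻¹ []       = inGroup-identity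
  inGroup-word⁻¹ (i ∷ ws) = inGroup-step (inverse (word ws)) i (inGroup-word⁻¹ ws)

  low<high : ∀ {i p q} → Kind i p q → p < q
  low<high (zeroC _ _)  = -<+
  low<high (zeroD _ _)  = -<+
  low<high (middle _ _) = +<+ ℕ.≤-refl
  low<high (lastC _ _)  = +<+ ℕ.≤-refl
  low<high (lastD _ _)  = lin 1 (λ n → [] ⊢ n :- # 1 :< # 1 :+ n) n₊

  shortens : ∀ w i → to w (high i) < to w (low i) → length′ (to w) ≡ suc
    (length′ (to w ∘ generator t n i))
  shortens w i = Descent.shortens w (kindOf i)

  descent-or-ascent : ∀ w i → to w (high i) < to w (low i) ⊎ Ascent (to w) i
  descent-or-ascent w i = go (ℤ.<-cmp (to w (high i)) (to w (low i)))
    where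
    go : _ → to w (high i) < to w (low i) ⊎ Ascent (to w) i
    go (tri< a _ _) = inj₁ a
    go (tri≈ _ e _) = ⊥-elim (ℤ.<⇒≢ (low<high (kindOf i)) (sym (to-injective w e)))
    go (tri> _ _ c) = inj₂ c

  lengthens : ∀ w i → Ascent (to w) i → length′ (to w ∘ generator t n i) ≡ suc (length′ (to w))
  lengthens w i asc = trans (shortens (w ⊙ gen i) i descent) (cong suc restored)
    where
    descent : to (w ⊙ gen i) (high i) < to (w ⊙ gen i) (low i)
    descent = subst₂ _<_ (cong (to w) (sym (generator-high (kindOf i))))
      (cong (to w) (sym (generator-low (kindOf i)))) asc
    restored : length′ (to w ∘ generator t n i ∘ generator t n i) ≡ length′ (to w)
    restored = length-cong (to w ∘ generator t n i ∘ generator t n i) (to w)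
      (λ x → cong (to w) (generator-involutive i x))

  length-step : ∀ w i → length′ (to w ∘ generator t n i) ℕ.≤ suc (length′ (to w))
  length-step w i = Sum.[ (λ d → ℕ.≤-trans (ℕ.n≤1+n _) (ℕ.≤-trans
    (ℕ.≤-reflexive (sym (shortens w i d))) (ℕ.n≤1+n _)))
                        , (λ a → ℕ.≤-reflexive (lengthens w i a)) ]′ (descent-or-ascent w i)

  length-prod : ∀ w ws → length′ (to w ∘ prod ws) ℕ.≤ length′ (to w) ℕ.+ length ws
  length-prod w []       = ℕ.≤-reflexive (sym (ℕ.+-identityʳ _))
  length-prod w (i ∷ ws) = ℕ.≤-trans (length-prod (w ⊙ gen i) ws)
    (ℕ.≤-trans (ℕ.+-monoˡ-≤ (length ws) (length-step w i)) (ℕ.≤-reflexive (sym (ℕ.+-suc _ _))))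

  -- Each letter raises the count by at most one, so the count is a lower bound for the length of
  -- every word; `reduced-word` attains it.
  length-≤-word : ∀ ws f → prod ws ≗ f → length′ f ℕ.≤ length ws
  length-≤-word ws f eq = subst₂ ℕ._≤_ (length-cong (prod ws) f eq)
    (cong (ℕ._+ length ws) length-identity) (length-prod identity ws)

  length-word⁻¹ : ∀ ws → length′ (from (word ws)) ℕ.≤ length ws
  length-word⁻¹ []       = ℕ.≤-reflexive length-identity
  length-word⁻¹ (i ∷ ws) = ℕ.≤-trans (length-step (inverse (word ws)) i) (s≤s (length-word⁻¹ ws))

  find-descent : ∀ w → (∃[ i ] to w (high i) < to w (low i)) ⊎ (∀ i → Ascent (to w) i)
  find-descent w = go (Fin.any? (λ i → to w (high i) ℤ.<? to w (low i)))
    where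
    go : Dec (∃[ i ] to w (high i) < to w (low i)) → _
    go (yes d) = inj₁ d
    go (no ¬d) = inj₂ λ i → Sum.[ (λ d → ⊥-elim (¬d (i , d))) , id ]′ (descent-or-ascent w i)

  length-is-0 : ∀ w → (∀ x → to w x ≡ x) → length′ (to w) ≡ 0
  length-is-0 w h = trans (length-cong (to w) id h) length-identity

  -- Right multiplication at a descent lowers the count by one until no descent is left, which is
  -- the identity. Undoing these steps appends the letters on the right.
  reduced-word : ∀ k w → InGroup (to w) → length′ (to w) ≡ k
    → ∃[ ws ] prod ws ≗ to w × length ws ≡ k
  reduced-word zero w e len = go (find-descent w)
    where
    go : _ → ∃[ ws ] prod ws ≗ to w × length ws ≡ 0
    go (inj₁ (i , d)) = ⊥-elim (ℕ.1+n≢0 (trans (sym (shortens w i d)) len))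
    go (inj₂ asc) = [] , (λ x → sym (NoDescents.is-identity w e asc x)) , refl
  reduced-word (suc k) w e len = go (find-descent w)
    where
    go : _ → ∃[ ws ] prod ws ≗ to w × length ws ≡ suc k
    go (inj₂ asc) = ⊥-elim (ℕ.1+n≢0 (trans (sym len) (length-is-0 w
      (NoDescents.is-identity w e asc))))
    go (inj₁ (i , d)) =
      let ws , eq , len′ = reduced-word k (w ⊙ gen i) (inGroup-step w i e) (ℕ.suc-injective (trans (sym (shortens w i d)) len)) in
      ws ++ i ∷ [] ,
      (λ x → trans (prod-++ ws (i ∷ []) x) (trans (eq (generator t n i x))
        (cong (to w) (generator-involutive i x)))) ,
      trans (List.length-++ ws) (trans (ℕ.+-comm (length ws) 1) (cong suc len′))

  reducedWord : ∀ w → InGroup (to w) → ∃[ ws ] prod ws ≗ to w × length ws ≡ length′ (to w)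
  reducedWord w e = reduced-word _ w e refl

  reducedFor : ∀ ws f → prod ws ≗ f → length ws ≡ length′ f → _ReducedFor_ t n ws f
  reducedFor ws f eq len = eq , λ js eq′ → ℕ.≤-trans (ℕ.≤-reflexive len) (length-≤-word js f eq′)

  hasLength : ∀ w → InGroup (to w) → HasLength t n (to w) (length′ (to w))
  hasLength w e = let ws , eq , len = reducedWord w e in ws , reducedFor ws (to w) eq len , len

  hasLength-≥ : ∀ f {ℓ} → HasLength t n f ℓ → length′ f ℕ.≤ ℓ
  hasLength-≥ f (ws , (eq , _) , refl) = length-≤-word ws f eq

  hasLength-≤ : ∀ w f {ℓ} → InGroup (to w) → to w ≗ f → HasLength t n f ℓ → ℓ ℕ.≤ length′ f
  hasLength-≤ w f e w≗f (ws , (_ , least) , refl) =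
    let js , eq , len = reducedWord w e in
    ℕ.≤-trans (least js (λ x → trans (eq x) (w≗f x))) (ℕ.≤-reflexive
      (trans len (length-cong (to w) f w≗f)))

  inGroup-inverse : ∀ w → InGroup (to w) → InGroup (from w)
  inGroup-inverse w e = let ws , eq , _ = reducedWord w e in
    inGroup-cong (from-≗ (word ws) w (λ x → trans (to-word ws x) (eq x))) (inGroup-word⁻¹ ws)

  -- The count is not visibly symmetric under inversion. A reduced word read backwards expresses the
  -- inverse, and its length bounds the count of the inverse.
  length-inverse-≤ : ∀ w → InGroup (to w) → length′ (from w) ℕ.≤ length′ (to w)
  length-inverse-≤ w e = let ws , eq , len = reducedWord w e in
    subst₂ ℕ._≤_ (length-cong (from (word ws)) (from w)
      (from-≗ (word ws) w (λ x → trans (to-word ws x) (eq x)))) len (length-word⁻¹ ws)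

  length-inverse : ∀ w → InGroup (to w) → length′ (from w) ≡ length′ (to w)
  length-inverse w e = ℕ.≤-antisym (length-inverse-≤ w e)
    (length-inverse-≤ (inverse w) (inGroup-inverse w e))

  inGroup-⊙ : ∀ v w → InGroup (to v) → InGroup (to w) → InGroup (to (v ⊙ w))
  inGroup-⊙ v w e e′ = let ws , eq , _ = reducedWord w e′ in
    inGroup-cong (λ x → cong (to v) (eq x)) (inGroup-prod v ws e)

  -- Left descents of `w` are right descents of `w⁻¹`, and inversion keeps the count.
  left-shortens : ∀ w i → InGroup (to w) → from w (high i) < from w (low i) →
                  length′ (to w) ≡ suc (length′ (generator t n i ∘ to w))
  left-shortens w i e d = trans (sym (length-inverse w e))
    (trans (shortens (inverse w) i d) (cong suc inverted))
    where
    inverted : length′ (from w ∘ generator t n i) ≡ length′ (generator t n i ∘ to w)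
    inverted = length-inverse (gen i ⊙ w) (inGroup-⊙ (gen i) w
      (inGroup-step identity i inGroup-identity) e)

  -- Minimality in the coset `wW` in terms of the count, with no reduced words to choose.
  Representative : Aut → Set
  Representative w = InGroup (to w) × (∀ ws → ParabolicWord t n ws → length′ (to w) ℕ.≤ length′
    (to w ∘ prod ws))

  minimal⇒representative : ∀ {w} → _∈W̃/W t n w → Representative (toAut w)
  minimal⇒representative {w} m = e , λ ws p → _∈W̃/W.minimal m ws p (hasLength (toAut w) e)
    (hasLength-product ws)
    where
    e : InGroup ⟦ w ⟧
    e = member⇒inGroup (_∈W̃/W.member m)
    hasLength-product : ∀ ws → HasLength t n (⟦ w ⟧ ∘ prod ws) (length′ (⟦ w ⟧ ∘ prod ws))
    hasLength-product ws = transport (reducedWord v e′)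
      where
      v = toAut w ⊙ word ws
      same : to v ≗ ⟦ w ⟧ ∘ prod ws
      same x = cong ⟦ w ⟧ (to-word ws x)
      e′ : InGroup (to v)
      e′ = inGroup-cong (λ x → sym (same x)) (inGroup-prod (toAut w) ws e)
      transport : ∃[ js ] prod js ≗ to v × length js ≡ length′ (to v) →
                  HasLength t n (⟦ w ⟧ ∘ prod ws) (length′ (⟦ w ⟧ ∘ prod ws))
      transport (js , eq , len) = js , reducedFor js (⟦ w ⟧ ∘ prod ws)
        (λ x → trans (eq x) (same x)) len′ , len′
        where
        len′ : length js ≡ length′ (⟦ w ⟧ ∘ prod ws)
        len′ = trans len (length-cong (to v) (⟦ w ⟧ ∘ prod ws) same)

  representative⇒minimal : ∀ w → Representative w → _∈W̃/W t n (fromAut w)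
  representative⇒minimal w (e , least) = record
    { member = inGroup⇒member w e
    ; minimal = λ us p ℓ ℓ′ → ℕ.≤-trans (hasLength-≤ w (to w) e (λ _ → refl) ℓ)
      (ℕ.≤-trans (least us p) (hasLength-≥ (to w ∘ prod us) ℓ′))
    }

  representative-ascent : ∀ w → Representative w → ∀ i → toℕ i ≢ 0 → Ascent (to w) i
  representative-ascent w (e , least) i i≢0 = Sum.[ (λ d → ⊥-elim (¬descent d)) , id ]′
    (descent-or-ascent w i)
    where
    ¬descent : ¬ to w (high i) < to w (low i)
    ¬descent d = ℕ.<⇒≱ (ℕ.≤-reflexive (sym (shortens w i d))) (least (i ∷ []) (i≢0 ∷ []))

  -- For `u` in `W` the chain `ℓ(w) ≤ ℓ(wu) ≤ ℓ(swu) + 1` and `ℓ(sw) = ℓ(w) - 1` give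
  -- `ℓ(sw) ≤ ℓ(swu)`.
  representative-left : ∀ w i → Representative w → from w (high i) < from w (low i) → Representative
    (gen i ⊙ w)
  representative-left w i (e , least) d = e₁ , λ ws p → ℕ.≤-pred
    (ℕ.≤-trans (ℕ.≤-reflexive (sym (left-shortens w i e d)))
      (ℕ.≤-trans (least ws p) (bound ws (reducedWord (v ws) (e₂ ws)))))
    where
    eᵢ : InGroup (to (gen i))
    eᵢ = inGroup-step identity i inGroup-identity
    e₁ : InGroup (to (gen i ⊙ w))
    e₁ = inGroup-⊙ (gen i) w eᵢ e
    v : Word t n → Aut
    v ws = (gen i ⊙ w) ⊙ word ws
    e₂ : ∀ ws → InGroup (to (v ws))
    e₂ ws = inGroup-⊙ (gen i ⊙ w) (word ws) e₁ (inGroup-cong (λ x → sym (to-word ws x))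
      (inGroup-word ws))
    same : ∀ ws → to (v ws) ≗ generator t n i ∘ to w ∘ prod ws
    same ws x = cong (λ y → generator t n i (to w y)) (to-word ws x)
    bound : ∀ ws → ∃[ js ] prod js ≗ to (v ws) × length js ≡ length′ (to (v ws)) →
            length′ (to w ∘ prod ws) ℕ.≤ suc (length′ (generator t n i ∘ to w ∘ prod ws))
    bound ws (js , eq , len) = ℕ.≤-trans (length-≤-word (i ∷ js) (to w ∘ prod ws) expresses)
        (s≤s (ℕ.≤-reflexive (trans len (length-cong (to (v ws)) (generator t n i ∘ to w ∘ prod ws)
          (same ws)))))
      where
      expresses : prod (i ∷ js) ≗ to w ∘ prod ws
      expresses x = trans (cong (generator t n i) (trans (eq x) (same ws x)))
        (generator-involutive i (to w (prod ws x)))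

-- Beads and gaps; representatives with the same beads are equal.

module Beads (t : AffineType) (n : ℕ) (rank : minRank t ℕ.≤ n) where
  open import Data.Integer using (_+_; _-_; _*_; -_; _≤_; _<_)
  open Reduced t n rank public

  0<N : + 0 < N
  0<N = +<+ (s≤s z≤n)

  -- The beads of the abacus of w lie at the entries w(j) - kN with j < N and k ≥ 0,
  -- and w⁻¹ commutes with the translation by N.
  Bead Gap : Aut → ℤ → Set
  Bead w e = Entry e × from w e < N
  Gap  w e = Entry e × N < from w e

  entry? : ∀ e → Dec (Entry e)
  entry? e = ¬? (N ∣? e)

  bead? : ∀ w e → Dec (Bead w e)
  bead? w e = entry? e ×-dec (from w e ℤ.<? N)

  entry≢N : ∀ {x} → Entry x → x ≢ N
  entry≢N ent refl = ent (divides (+ 1) (sym (ℤ.*-identityˡ N)))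

  bead⊎gap : ∀ w {e} → Entry e → Bead w e ⊎ Gap w e
  bead⊎gap w {e} ent = go (ℤ.<-cmp (from w e) N)
    where
    go : _ → Bead w e ⊎ Gap w e
    go (tri< a _ _) = inj₁ (ent , a)
    go (tri≈ _ b _) = ⊥-elim (entry≢N (from-entry w ent) b)
    go (tri> _ _ c) = inj₂ (ent , c)

  ¬bead×gap : ∀ w {e} → Bead w e → ¬ Gap w e
  ¬bead×gap w (_ , a) (_ , b) = ℤ.<-asym a b

  -- The abacus is antisymmetric about `N`: as `w⁻¹(2N - e) = 2N - w⁻¹(e)`, the test `w⁻¹(e) < N`
  -- turns into its opposite, and beads are exchanged with gaps.
  reflected : ℤ → ℤ
  reflected e = N + N - e

  reflected-involutive : ∀ e → reflected (reflected e) ≡ e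
  reflected-involutive e = lin 2 (λ N e → [] ⊢ N :+ N :- (N :+ N :- e) := e) N e

  entry-reflected : ∀ {e} → Entry e → Entry (reflected e)
  entry-reflected {e} ent = subst Entry (lemma N e) (entry-shift (+ 2) (entry-neg ent))
    where
    lemma : ∀ N e → - e + + 2 * N ≡ N + N - e
    lemma = solve-∀

  from-reflected : ∀ w e → from w (reflected e) ≡ reflected (from w e)
  from-reflected w e = trans (cong (from w) (lemma N e)) (trans (from-shift w (+ 2) (- e))
    (trans (cong (_+ + 2 * N) (from-neg w e)) (sym (lemma N (from w e)))))
    where
    lemma : ∀ N e → N + N - e ≡ - e + + 2 * N
    lemma = solve-∀

  bead-reflected : ∀ w {e} → Bead w e → Gap w (reflected e)
  bead-reflected w {e} (ent , a) = entry-reflected ent ,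
    lin 3 (λ N x y → (x :< N) ∷ (y := N :+ N :- x) ∷ [] ⊢ N :< y) N (from w e)
      (from w (reflected e)) a (from-reflected w e)

  gap-reflected : ∀ w {e} → Gap w e → Bead w (reflected e)
  gap-reflected w {e} (ent , a) = entry-reflected ent ,
    lin 3 (λ N x y → (N :< x) ∷ (y := N :+ N :- x) ∷ [] ⊢ y :< N) N (from w e)
      (from w (reflected e)) a (from-reflected w e)

  bead-flush : ∀ w {e} → Bead w e → Bead w (e - N)
  bead-flush w {e} (ent , a) = subst Entry (shift₁ e N) (entry-shift (- + 1) ent) ,
    subst (_< N) (trans (sym (shift₁ (from w e) N)) (trans (sym (from-shift w (- + 1) e))
      (cong (from w) (shift₁ e N))))
      (lin 2 (λ x N → (x :< N) ∷ (# 0 :< N) ∷ [] ⊢ x :- N :< N) (from w e) N a 0<N)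
    where
    shift₁ : ∀ e N → e + - + 1 * N ≡ e - N
    shift₁ = solve-∀

  last≢0 : toℕ lastᶠ ≢ 0
  last≢0 eq = n≢0 (trans (sym toℕ-lastᶠ) eq)

  module Monotone (w : Aut) (asc : ∀ i → toℕ i ≢ 0 → Ascent (to w) i) where
    open Windows w

    private
      inc-≤ : ∀ {a b} → 1 ℕ.≤ a → a ℕ.≤ b → b ℕ.≤ n → W a ≤ W b
      inc-≤ {a} {b} p q r = lin 4 (λ x y a b → (x :+ (b :- a) :≤ y) ∷ (a :≤ b) ∷ [] ⊢ x :≤ y) (W a)
        (W b) (+ a) (+ b) (increasing asc p q r) (+≤+ q)

      inc-< : ∀ {a b} → 1 ℕ.≤ a → a ℕ.< b → b ℕ.≤ n → W a < W b
      inc-< {a} {b} p q r = lin 4 (λ x y a b → (x :+ (b :- a) :≤ y) ∷ (a :< b) ∷ [] ⊢ x :< y) (W a)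
        (W b) (+ a) (+ b) (increasing asc p (ℕ.<⇒≤ q) r) (+<+ q)

    sum-C : variantₙ t ≡ C → ∀ {a b} → 1 ℕ.≤ a → a ℕ.≤ n → 1 ℕ.≤ b → b ℕ.≤ n → W a + W b < N
    sum-C v {a} {b} 1≤a a≤n 1≤b b≤n = lin 5 (λ N x y z z′ → (x :≤ z) ∷ (y :≤ z) ∷ (z :< z′) ∷
      (z′ := N :- z) ∷ [] ⊢ x :+ y :< N)
      N (W a) (W b) (W n) (to w (+ 1 + n₊)) (inc-≤ 1≤a a≤n ℕ.≤-refl) (inc-≤ 1≤b b≤n ℕ.≤-refl)
      (ascent (to w) (lastC toℕ-lastᶠ v) (asc lastᶠ last≢0)) to-n+1

    -- Since `w(N - b) = N - w(b)`, this compares values in the two halves of the period. Equality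
    -- of `a` and `b` is left out because at `n` it compares `n` with `n + 1`, which variant D of
    -- `sₙ` does not control.
    sum-< : ∀ {a b} → 1 ℕ.≤ a → a ℕ.< b → b ℕ.≤ n → W a + W b < N
    sum-< {a} {b} 1≤a a<b b≤n = go (variantₙ t) refl
      where
      go : ∀ v → variantₙ t ≡ v → W a + W b < N
      go C v = sum-C v 1≤a (ℕ.≤-trans (ℕ.<⇒≤ a<b) b≤n) (ℕ.≤-trans (s≤s z≤n) a<b) b≤n
      go D v = lin 7 (λ N x y z z″ u z′ → (x :≤ u) ∷ (y :≤ z) ∷ (z″ :< z′) ∷ (z″ := u) ∷
        (z′ := N :- z) ∷ [] ⊢ x :+ y :< N)
        N (W a) (W b) (W n) (to w (n₊ - + 1)) (W (n ∸ 1)) (to w (+ 1 + n₊))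
        (inc-≤ 1≤a (ℕ.∸-monoˡ-≤ 1 (ℕ.<-≤-trans a<b b≤n)) (ℕ.m∸n≤m n 1))
          (inc-≤ (ℕ.≤-trans (s≤s z≤n) a<b) b≤n ℕ.≤-refl)
        (ascent (to w) (lastD toℕ-lastᶠ v) (asc lastᶠ last≢0)) (cong (to w) (sym n∸1≡)) to-n+1

    data Half (x : ℤ) : Set where
      lower : ∀ a → 1 ℕ.≤ a → a ℕ.≤ n → x ≡ + a → Half x
      upper : ∀ a → 1 ℕ.≤ a → a ℕ.≤ n → x ≡ N - + a → Half x

    half : ∀ x → + 0 < x → x < N → Half x
    half (+ a) (+<+ 0<a) (+<+ a<N) = go (a ℕ.≤? n)
      where
      go : Dec (a ℕ.≤ n) → Half (+ a)
      go (yes a≤n) = lower a 0<a a≤n refl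
      go (no a≰n) = upper (period n ∸ a) (ℕ.m<n⇒0<n∸m a<N) a′≤n
          (lin 3 (λ N a b → (b := N :- a) ∷ [] ⊢ a := N :- b) N (+ a) (+ (period n ∸ a))
            (period∸ (ℕ.<⇒≤ a<N)))
        where
        a′≤n : period n ∸ a ℕ.≤ n
        a′≤n = ℤ.drop‿+≤+ (lin 4 (λ N n a b → (N := # 1 :+ (n :+ n)) ∷ (n :< a) ∷ (b := N :- a) ∷ []
          ⊢ b :≤ n)
          N n₊ (+ a) (+ (period n ∸ a)) N≡ (+<+ (ℕ.≰⇒> a≰n)) (period∸ (ℕ.<⇒≤ a<N)))

    -- n and n + 1 may be out of order in type D.
    monotone : ∀ {x y} → + 0 < x → x < y → y < N → (variantₙ t ≡ C ⊎ x + y ≢ N) → to w x < to w y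
    monotone {x} {y} 0<x x<y y<N ok = go (half x 0<x (ℤ.<-trans x<y y<N))
      (half y (ℤ.<-trans 0<x x<y) y<N)
      where
      go : Half x → Half y → to w x < to w y
      go (lower a p q refl) (lower b p′ q′ refl) = inc-< p (ℤ.drop‿+<+ x<y) q′
      go (upper a p q refl) (lower b p′ q′ refl) = ⊥-elim
        (lin 4 (λ N n a b → (N := # 1 :+ (n :+ n)) ∷ (a :≤ n) ∷ (b :≤ n) ∷ (N :- a :< b) ∷ [] ⊢ :⊥)
        N n₊ (+ a) (+ b) N≡ (+≤+ q) (+≤+ q′) x<y)
      go (upper a p q refl) (upper b p′ q′ refl) = lin 5
        (λ N x y x′ y′ → (y :< x) ∷ (x′ := N :- x) ∷ (y′ := N :- y) ∷ [] ⊢ x′ :< y′)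
        N (W a) (W b) (to w (N - + a)) (to w (N - + b))
        (inc-< p′ (ℤ.drop‿+<+ (lin 3 (λ N a b → (N :- a :< N :- b) ∷ [] ⊢ b :< a) N (+ a)
          (+ b) x<y)) q) (to-reflect (+ a)) (to-reflect (+ b))
      go (lower a p q refl) (upper b p′ q′ refl) = lin 4
        (λ N x y y′ → (x :+ y :< N) ∷ (y′ := N :- y) ∷ [] ⊢ x :< y′)
        N (W a) (W b) (to w (N - + b)) (sum ok (ℕ.<-cmp a b)) (to-reflect (+ b))
        where
        sum : variantₙ t ≡ C ⊎ + a + (N - + b) ≢ N → _ → W a + W b < N
        sum (inj₁ v) _ = sum-C v p q p′ q′
        sum (inj₂ ne) (tri< a<b _ _) = sum-< p a<b q′
        sum (inj₂ ne) (tri≈ _ refl _) = ⊥-elim (ne (lin 2 (λ N a → [] ⊢ a :+ (N :- a) := N) N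
          (+ a)))
        sum (inj₂ ne) (tri> _ _ b<a) = subst (_< N) (ℤ.+-comm (W b) (W a)) (sum-< p′ b<a q)

  positive-kind : ∀ {i p q} → Kind i p q → toℕ i ≢ 0 → + 0 < p × p < q × q < N
  positive-kind (zeroC a _) i≢0 = ⊥-elim (i≢0 a)
  positive-kind (zeroD a _) i≢0 = ⊥-elim (i≢0 a)
  positive-kind K@(middle a b) _ = +<+ a , low<high K , +<+ (ℕ.≤-<-trans b n<period)
  positive-kind K@(lastC _ _) _ = +<+ 1≤n , low<high K ,
    lin 2 (λ N n → (N := # 1 :+ (n :+ n)) ∷ (# 2 :≤ n) ∷ [] ⊢ # 1 :+ n :< N) N n₊ N≡ (+≤+ 2≤n)
  positive-kind K@(lastD _ _) _ = lin 1 (λ n → (# 2 :≤ n) ∷ [] ⊢ # 0 :< n :- # 1) n₊ (+≤+ 2≤n)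
    , low<high K ,
    lin 2 (λ N n → (N := # 1 :+ (n :+ n)) ∷ (# 2 :≤ n) ∷ [] ⊢ # 1 :+ n :< N) N n₊ N≡ (+≤+ 2≤n)

  -- `p + q = N` makes `q` the mirror image of `p`, the comparison that `monotone` excludes in
  -- variant D. The only pair of this form is `n, n + 1`, and it belongs to `sₙᶜ`.
  C⊎sum : ∀ {i p q} → Kind i p q → variantₙ t ≡ C ⊎ p + q ≢ N
  C⊎sum (zeroC _ _) = inj₂ (λ ())
  C⊎sum (zeroD _ _) = inj₂ (λ ())
  C⊎sum {i} (middle _ b) = inj₂ (λ eq → lin 3 (λ N n i → (N := # 1 :+ (n :+ n)) ∷ (i :< n) ∷
    (i :+ (# 1 :+ i) := N) ∷ [] ⊢ :⊥) N n₊ (+ toℕ i) N≡ (+<+ b) eq)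
  C⊎sum (lastC _ v) = inj₁ v
  C⊎sum (lastD _ _) = inj₂ (λ eq → lin 2 (λ N n → (N := # 1 :+ (n :+ n)) ∷
    (n :- # 1 :+ (# 1 :+ n) := N) ∷ [] ⊢ :⊥) N n₊ N≡ eq)

  module Uniqueness (v w : Aut) (V : Representative v) (W : Representative w)
                    (v⇒w : ∀ {e} → Bead v e → Bead w e) (w⇒v : ∀ {e} → Bead w e → Bead v e) where
    private
      -- `v⁻¹w`, to be shown free of descents. Equal beads make it map the interval between 0 and
      -- `N` into itself, which settles `s₀`. On this interval `v` is monotone up to one comparison,
      -- so another descent of `x` would be a descent of `w = v ∘ x`.
      x : Aut
      x = inverse v ⊙ w

      inGroup-x : InGroup (to x)
      inGroup-x = inGroup-⊙ (inverse v) w (inGroup-inverse v (proj₁ V)) (proj₁ W)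

      asc-v = representative-ascent v V
      asc-w = representative-ascent w W

      x<N : ∀ {r} → + 0 < r → r < N → to x r < N
      x<N {r} 0<r r<N = proj₂ (w⇒v (to-entry w (entry-between 0<r r<N) , subst (_< N)
        (sym (from-to w r)) r<N))

      -- If `x(r) < 0`, then `w(r) + N` is still a bead of `v`, but for `w` it lies past `w(r)`, the
      -- last bead of its runner.
      0<x : ∀ {r} → + 0 < r → r < N → + 0 < to x r
      0<x {r} 0<r r<N = go (ℤ.<-cmp (+ 0) (to x r))
        where
        ent = to-entry w (entry-between 0<r r<N)
        go : _ → + 0 < to x r
        go (tri< a _ _) = a
        go (tri≈ _ b _) = ⊥-elim (from-entry v ent (divides (+ 0)
          (trans (sym b) (sym (ℤ.*-zeroˡ N)))))
        go (tri> _ _ c) = ⊥-elim (lin 3 (λ N r y → (y :< N) ∷ (y := r :+ N) ∷ (# 0 :< r) ∷ [] ⊢ :⊥)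
          N r (from w (to w r + N)) (proj₂ bead)
            (trans (from-+N w (to w r)) (cong (_+ N) (from-to w r))) 0<r)
          where
          bead : Bead w (to w r + N)
          bead = v⇒w (subst Entry (shift-1 (to w r) N) (entry-shift (+ 1) ent) ,
            lin 3 (λ N y z → (z := y :+ N) ∷ (y :< # 0) ∷ [] ⊢ z :< N) N (from v (to w r))
              (from v (to w r + N)) (from-+N v (to w r)) c)

      vx : ∀ r → to v (to x r) ≡ to w r
      vx r = to-from v (to w r)

      ascent-nonzero : ∀ {i p q} → Kind i p q → toℕ i ≢ 0 → ¬ to x q < to x p
      ascent-nonzero {i} {p} {q} K i≢0 d = ℤ.<-asym (ascent (to w) K (asc-w i i≢0))
        (subst₂ _<_ (vx q) (vx p) (Monotone.monotone v asc-v (0<x 0<q q<N) d (x<N 0<p p<N)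
          (Sum.map₂ transfer (C⊎sum K))))
        where
        0<p = proj₁ (positive-kind K i≢0)
        p<q = proj₁ (proj₂ (positive-kind K i≢0))
        q<N = proj₂ (proj₂ (positive-kind K i≢0))
        0<q = ℤ.<-trans 0<p p<q
        p<N = ℤ.<-trans p<q q<N
        transfer : p + q ≢ N → to x q + to x p ≢ N
        transfer ne eq = ne (lin 3 (λ N p q → (p := N :- q) ∷ [] ⊢ p :+ q := N) N p q
          (to-injective x (trans (lin 3 (λ N a b → (a :+ b := N) ∷ [] ⊢ b := N :- a) N (to x q)
            (to x p) eq) (sym (Descent.to-reflect x q)))))

      ascent-x : ∀ i {p q} → Kind i p q → to x p < to x q
      ascent-x i (zeroC _ _) = lin 2 (λ y z → (# 0 :< z) ∷ (y := :- z) ∷ [] ⊢ y :< z) (to x (- + 1))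
        (to x (+ 1))
        (0<x (+<+ (s≤s z≤n)) (+<+ (ℕ.≤-<-trans 1≤n n<period))) (to-neg x (+ 1))
      ascent-x i (zeroD _ _) = lin 3 (λ y z u → (# 0 :< z) ∷ (# 0 :< u) ∷ (y := :- u) ∷ [] ⊢ y :< z)
        (to x (- + 2)) (to x (+ 1)) (to x (+ 2))
        (0<x (+<+ (s≤s z≤n)) (+<+ (ℕ.≤-<-trans 1≤n n<period)))
          (0<x (+<+ (s≤s z≤n)) (+<+ (ℕ.≤-<-trans 2≤n n<period))) (to-neg x (+ 2))
      ascent-x i K@(middle a _) = ℤ.≤∧≢⇒< (ℤ.≮⇒≥ (ascent-nonzero K (ℕ.>⇒≢ a)))
        (λ eq → ℤ.<⇒≢ (low<high K) (to-injective x eq))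
      ascent-x i K@(lastC a _) = ℤ.≤∧≢⇒< (ℤ.≮⇒≥ (ascent-nonzero K (λ z → n≢0 (trans (sym a) z))))
        (λ eq → ℤ.<⇒≢ (low<high K) (to-injective x eq))
      ascent-x i K@(lastD a _) = ℤ.≤∧≢⇒< (ℤ.≮⇒≥ (ascent-nonzero K (λ z → n≢0 (trans (sym a) z))))
        (λ eq → ℤ.<⇒≢ (low<high K) (to-injective x eq))

    equal : to v ≗ to w
    equal y = trans (cong (to v) (sym (NoDescents.is-identity x inGroup-x
      (λ i → ascent-x i (kindOf i)) y))) (vx y)

  -- Translated by `N` this is `swap-≤0`: generators other than `s₀` move no point across 0. Hence
  -- the beads depend on the coset only.
  parabolic-<N : ∀ {i} → toℕ i ≢ 0 → ∀ {x} → Entry x → x < N → generator t n i x < N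
  parabolic-<N {i} i≢0 {x} ent x<N = ℤ.≤∧≢⇒< ≤N (entry≢N (to-entry (gen i) ent))
    where
    K = kindOf i
    pos = positive-kind K i≢0
    y = x + - + 1 * N
    ≤0 : generator t n i y ≤ + 0
    ≤0 = swap-≤0 (proj₁ pos) (proj₁ (proj₂ pos)) (proj₂ (proj₂ pos)) (generator-swap K y)
      (lin 2 (λ x N → (x :< N) ∷ [] ⊢ x :+ - + 1 :* N :≤ # 0) x N x<N)
    ≤N : generator t n i x ≤ N
    ≤N = lin 3 (λ N z z′ → (z′ :≤ # 0) ∷ (z′ := z :+ - + 1 :* N) ∷ [] ⊢ z :≤ N) N
      (generator t n i x) (generator t n i y) ≤0 (generator-shift i x (- + 1))

  parabolic-word-<N : ∀ us → ParabolicWord t n us → ∀ {x} → Entry x → x < N → prod us x < N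
  parabolic-word-<N []       []       ent x<N = x<N
  parabolic-word-<N (i ∷ us) (p ∷ ps) {x} ent x<N = parabolic-<N p
    (subst Entry (to-word us x) (to-entry (word us) ent)) (parabolic-word-<N us ps ent x<N)

  parabolic-word-≮N : ∀ us → ParabolicWord t n us → ∀ {x} → Entry x → prod us x < N → x < N
  parabolic-word-≮N []       []       ent h = h
  parabolic-word-≮N (i ∷ us) (p ∷ ps) {x} ent h = parabolic-word-≮N us ps ent
    (subst (_< N) (generator-involutive i (prod us x)) (parabolic-<N p
      (to-entry (gen i) (subst Entry (to-word us x) (to-entry (word us) ent))) h))

  module Coset (v w : Aut) (us : Word t n) (ps : ParabolicWord t n us)
    (eq : ∀ k → to v k ≡ to w (prod us k)) where
    private
      from-w : ∀ e → from w e ≡ prod us (from v e)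
      from-w e = trans (cong (from w) (trans (sym (to-from v e)) (eq (from v e)))) (from-to w _)

    bead-⇒ : ∀ {e} → Bead v e → Bead w e
    bead-⇒ {e} (ent , a) = ent , subst (_< N) (sym (from-w e))
      (parabolic-word-<N us ps (from-entry v ent) a)

    bead-⇐ : ∀ {e} → Bead w e → Bead v e
    bead-⇐ {e} (ent , a) = ent , parabolic-word-≮N us ps (from-entry v ent)
      (subst (_< N) (from-w e) a)

-- Partitions read off lattice paths.

module Paths where
  open import Data.Integer using (_+_; _-_; _*_; -_; _≤_; _<_)

  norths easts : List Step → ℕ
  norths []           = 0
  norths (north ∷ ps) = suc (norths ps)
  norths (east  ∷ ps) = norths ps
  easts []           = 0
  easts (north ∷ ps) = easts ps
  easts (east  ∷ ps) = suc (easts ps)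

  shape-prefix : ∀ ps qs x rows → All (ℕ._≤ x) rows →
    ∃[ rows′ ] shape x (ps ++ qs) rows ≡ shape (x ℕ.+ easts ps) qs rows′ × All
      (ℕ._≤ x ℕ.+ easts ps) rows′
  shape-prefix []           qs x rows h rewrite ℕ.+-identityʳ x = rows , refl , h
  shape-prefix (east ∷ ps)  qs x rows h rewrite ℕ.+-suc x (easts ps) =
    shape-prefix ps qs (suc x) rows (All.map (λ a → ℕ.m≤n⇒m≤1+n a) h)
  shape-prefix (north ∷ ps) qs zero    rows h = shape-prefix ps qs zero rows h
  shape-prefix (north ∷ ps) qs (suc x) rows h = shape-prefix ps qs (suc x) (suc x ∷ rows)
    (ℕ.≤-refl ∷ h)

  -- A north-step at position 0 makes no row, hence the number of new rows is exact only from
  -- `1 ≤ y`.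
  shape-suffix : ∀ qs y rows →
    ∃[ zs ] shape y qs rows ≡ zs ++ rows × All (y ℕ.≤_) zs × length zs ℕ.≤ norths qs ×
      (1 ℕ.≤ y → length zs ≡ norths qs)
  shape-suffix []           y rows = [] , refl , [] , z≤n , λ _ → refl
  shape-suffix (east ∷ qs)  y rows = let zs , eq , ge , le , l = shape-suffix qs (suc y) rows in
    zs , eq , All.map (ℕ.≤-trans (ℕ.n≤1+n y)) ge , le , λ _ → l (s≤s z≤n)
  shape-suffix (north ∷ qs) zero rows = let zs , eq , ge , le , l = shape-suffix qs zero rows in
    zs , eq , ge , ℕ.m≤n⇒m≤1+n le , λ ()
  shape-suffix (north ∷ qs) (suc y) rows = let zs , eq , ge , le , l = shape-suffix qs (suc y) (suc y ∷ rows) in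
    zs ++ suc y ∷ [] , trans eq (sym (List.++-assoc zs (suc y ∷ []) rows)) , All.++⁺ ge
      (ℕ.≤-refl ∷ []) ,
    ℕ.≤-trans (ℕ.≤-reflexive (len zs)) (s≤s le) , λ p → trans (len zs) (cong suc (l p))
    where
    len : ∀ zs → length (zs ++ suc y ∷ []) ≡ suc (length zs)
    len zs = trans (List.length-++ zs) (ℕ.+-comm (length zs) 1)

  row-all-≤ : ∀ {y} rows i → All (ℕ._≤ y) rows → row rows i ℕ.≤ y
  row-all-≤ []         i             _        = z≤n
  row-all-≤ (_ ∷ _)    zero          _        = z≤n
  row-all-≤ (p ∷ ps)   (suc zero)    (h ∷ _)  = h
  row-all-≤ (p ∷ ps)   (suc (suc i)) (_ ∷ hs) = row-all-≤ ps (suc i) hs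

  row-++-≤ : ∀ {y} zs rows i → length zs ℕ.< i → All (ℕ._≤ y) rows → row (zs ++ rows) i ℕ.≤ y
  row-++-≤ []       rows i             _       h = row-all-≤ rows i h
  row-++-≤ (z ∷ zs) rows (suc (suc i)) (s≤s l) h = row-++-≤ zs rows (suc i) l h

  row-++-≥ : ∀ {y} zs rows i → 1 ℕ.≤ i → i ℕ.≤ length zs → All (y ℕ.≤_) zs → y ℕ.≤ row
    (zs ++ rows) i
  row-++-≥ (z ∷ zs) rows (suc zero)    _ _       (h ∷ _)  = h
  row-++-≥ (z ∷ zs) rows (suc (suc i)) _ (s≤s l) (_ ∷ hs) = row-++-≥ zs rows (suc i) (s≤s z≤n) l hs

  row-beyond : ∀ κ i → length κ ℕ.< i → row κ i ≡ 0
  row-beyond κ i h = ℕ.n≤0⇒n≡0 (subst (λ ρ → row ρ i ℕ.≤ 0) (List.++-identityʳ κ)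
    (row-++-≤ κ [] i h []))

  -- Any cut of the path brackets the rows: those made after the cut lie on top and are at least as
  -- long as the number of east-steps before it. `south-row` is the bound for those made before the
  -- cut.
  north-row : ∀ ps qs i → 1 ℕ.≤ i → i ℕ.≤ norths qs → easts ps ℕ.≤ row (shape 0 (ps ++ qs) []) i
  north-row ps qs i 1≤i i≤ = go (easts ps) refl
    where
    go : ∀ y → easts ps ≡ y → y ℕ.≤ row (shape 0 (ps ++ qs) []) i
    go zero    eq = z≤n
    go (suc y) eq =
      let rows , eq₁ , _ = shape-prefix ps qs 0 [] []
          zs , eq₂ , ge , _ , l = shape-suffix qs (easts ps) rows in
      subst₂ (λ k κ → k ℕ.≤ row κ i) eq (sym (trans eq₁ eq₂))
        (row-++-≥ zs rows i 1≤i (ℕ.≤-trans i≤ (ℕ.≤-reflexive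
          (sym (l (subst (1 ℕ.≤_) (sym eq) (s≤s z≤n)))))) ge)

  south-row : ∀ ps qs i → norths qs ℕ.< i → row (shape 0 (ps ++ qs) []) i ℕ.≤ easts ps
  south-row ps qs i h =
    let rows , eq₁ , le = shape-prefix ps qs 0 [] []
        zs , eq₂ , _ , l , _ = shape-suffix qs (easts ps) rows in
    subst (λ κ → row κ i ℕ.≤ easts ps) (sym (trans eq₁ eq₂))
      (row-++-≤ zs rows i (ℕ.≤-<-trans l h) le)

  shape-positive : ∀ ps x rows → All (1 ℕ.≤_) rows → All (1 ℕ.≤_) (shape x ps rows)
  shape-positive []           x       rows h = h
  shape-positive (east ∷ ps)  x       rows h = shape-positive ps (suc x) rows h
  shape-positive (north ∷ ps) zero    rows h = shape-positive ps zero rows h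
  shape-positive (north ∷ ps) (suc x) rows h = shape-positive ps (suc x) _ (s≤s z≤n ∷ h)

  Ascending : List ℤ → Set
  Ascending = AllPairs _<_

  split-at : ∀ e zs → Ascending zs → ∃₂ λ xs ys → zs ≡ xs ++ ys × All (_< e) xs × All (e ≤_) ys
  split-at e []       []       = [] , [] , refl , [] , []
  split-at e (z ∷ zs) (h ∷ hs) = go (z ℤ.<? e)
    where
    go : Dec (z < e) → ∃₂ λ xs ys → z ∷ zs ≡ xs ++ ys × All (_< e) xs × All (e ≤_) ys
    go (yes z<e) = let xs , ys , eq , a , b = split-at e zs hs in z ∷ xs , ys , cong (z ∷_) eq , z<e ∷ a , b
    go (no z≮e) = let e≤z = ℤ.≮⇒≥ z≮e in [] , z ∷ zs , refl , [] , e≤z ∷ All.map (λ p → ℤ.≤-trans e≤z (ℤ.<⇒≤ p)) h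

  filterᵇ≡filter : ∀ {A : Set} (p : A → Bool) xs → filterᵇ p xs ≡ filter (T? ∘ p) xs
  filterᵇ≡filter p []       = refl
  filterᵇ≡filter p (x ∷ xs) with p x
  ... | true  = cong (x ∷_) (filterᵇ≡filter p xs)
  ... | false = filterᵇ≡filter p xs

  ascending-upTo : ∀ (f : ℕ → ℤ) → (∀ {i j} → i ℕ.< j → f i < f j) → ∀ m → Ascending
    (map f (upTo m))
  ascending-upTo f inc m = AllPairs.map⁺ (AllPairs.applyUpTo⁺₁ id m (λ i<j _ → inc i<j))

  maximum : ∀ {x xs} → x ∈ xs → x ℕ.≤ foldr _⊔_ 0 xs
  maximum (here refl)        = ℕ.m≤m⊔n _ _
  maximum (there {x = y} p)  = ℕ.≤-trans (maximum p) (ℕ.m≤n⊔m y _)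

  filter-ascending : ∀ {P : ℤ → Set} (P? : Decidable P) {xs} → Ascending xs → Ascending
    (filter P? xs)
  filter-ascending P? = AllPairs.filter⁺ P?

  ascending⇒unique : ∀ {xs} → Ascending xs → AllPairs _≢_ xs
  ascending⇒unique = AllPairs.map ℤ.<⇒≢

  -- Meant for the rows that reach a given diagonal, which form an initial segment of all rows.
  threshold : ∀ {P : ℕ → Set} (P? : Decidable P) m d → d ℕ.≤ m → (∀ i → 1 ℕ.≤ i → P i ⇔ i ℕ.≤ d) →
              length (filter P? (map suc (upTo m))) ≡ d
  threshold {P} P? m d d≤m iff = card-unique c₁ c₂
    where
    open Cardinality
    c₁ : Card (λ i → 1 ℕ.≤ i × i ℕ.≤ d) (length (filter P? (map suc (upTo m))))
    c₁ = card _ (Unique.filter⁺ P? (Unique.map⁺ ℕ.suc-injective (Unique.upTo⁺ m)))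
      (λ i → mk⇔ (fwd i) (bwd i)) refl
      where
      fwd : ∀ i → i ∈ filter P? (map suc (upTo m)) → 1 ℕ.≤ i × i ℕ.≤ d
      fwd i p = let q , Pi = ∈-filter⁻ P? {xs = map suc (upTo m)} p in let j , _ , eq = ∈-map⁻ suc q in
        subst (1 ℕ.≤_) (sym eq) (s≤s z≤n) , ⇒ (iff i (subst (1 ℕ.≤_) (sym eq) (s≤s z≤n))) Pi
      bwd : ∀ i → 1 ℕ.≤ i × i ℕ.≤ d → i ∈ filter P? (map suc (upTo m))
      bwd (suc i) (a , b) = ∈-filter⁺ P? (∈-map⁺ suc (∈-upTo⁺ (ℕ.≤-trans b d≤m)))
        (⇐ (iff (suc i) a) b)
    c₂ : Card (λ i → 1 ℕ.≤ i × i ℕ.≤ d) d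
    c₂ = card (map suc (upTo d)) (Unique.map⁺ ℕ.suc-injective (Unique.upTo⁺ d))
      (λ i → mk⇔ (fwd i) (bwd i))
      (trans (List.length-map suc (upTo d)) (List.length-upTo d))
      where
      fwd : ∀ i → i ∈ map suc (upTo d) → 1 ℕ.≤ i × i ℕ.≤ d
      fwd i p = let j , q , eq = ∈-map⁻ suc p in subst (λ k → 1 ℕ.≤ k × k ℕ.≤ d) (sym eq) (s≤s z≤n , ∈-upTo⁻ q)
      bwd : ∀ i → 1 ℕ.≤ i × i ℕ.≤ d → i ∈ map suc (upTo d)
      bwd (suc i) (_ , b) = ∈-map⁺ suc (∈-upTo⁺ b)

-- Rows of the core in terms of beads and gaps.

module Cores (t : AffineType) (n : ℕ) (rank : minRank t ℕ.≤ n) where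
  open import Data.Integer using (_+_; _-_; _*_; -_; _≤_; _<_)
  open Beads t n rank public
  open Paths

  module Core (w : MirroredPermutation n) where
    v : Aut
    v = toAut w

    κ : Partition
    κ = 𝒞 n w

    private
      test : ℤ → ℤ → Bool
      test e b = ⌊ N ∣? b - e ⌋ ∧ ⌊ e ℤ.≤? b ⌋

      M : ℕ
      M = foldr _⊔_ 0 (map ∣_∣ (lowestBeads n w))

    runner-bound : ∀ {r} → + 0 < r → r < N → - + M ≤ to v r × to v r ≤ + M
    runner-bound {+ (suc i)} _ (+<+ (s≤s i<2n)) = bounds (to v (+ suc i))
      (maximum (∈-map⁺ ∣_∣ (∈-map⁺ (λ j → ⟦ w ⟧ (+ suc j)) (∈-upTo⁺ i<2n))))
      where
      bounds : ∀ x → ∣ x ∣ ℕ.≤ M → - + M ≤ x × x ≤ + M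
      bounds (+ a)      h = ℤ.≤-trans (ℤ.neg-≤-pos {M} {0}) (+≤+ z≤n) , +≤+ h
      bounds -[1+ a ]   h = ℤ.neg-mono-≤ (+≤+ h) , -≤+
    runner-bound {+ zero} (+<+ ()) _

    -- Each entry is the translate by `q` periods of a lowest bead `w(r)`, and it is a bead just
    -- when `q ≤ 0`.
    data Runner (e : ℤ) : Set where
      runner : ∀ r q → + 0 < r → r < N → from v e ≡ r + q * N → e ≡ to v r + q * N → Runner e

    runnerOf : ∀ {e} → Entry e → Runner e
    runnerOf {e} ent = go (divisionOf (from-entry v ent))
      where
      go : Division (from v e) → Runner e
      go (division r q a b eq) = runner r q a b eq (trans (sym (to-from v e))
        (trans (cong (to v) eq) (to-shift v q r)))

    bead-≤M : ∀ {e} → Bead v e → e ≤ + M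
    bead-≤M {e} (ent , fe<N) = go (runnerOf ent)
      where
      go : Runner e → e ≤ + M
      go (runner r q a b eq eq′) = bound (scale q)
        where
        w≤M = proj₂ (runner-bound a b)
        bound : Scale q → e ≤ + M
        bound (below _ s) = lin 5 (λ N e w z m → (# 0 :< N) ∷ (e := w :+ z) ∷ (z :≤ :- N) ∷ (w :≤ m)
          ∷ [] ⊢ e :≤ m) N e (to v r) (q * N) (+ M) 0<N eq′ s w≤M
        bound (none _ s)  = lin 4 (λ e w z m → (e := w :+ z) ∷ (z := # 0) ∷ (w :≤ m) ∷ [] ⊢ e :≤ m)
          e (to v r) (q * N) (+ M) eq′ s w≤M
        bound (above _ s) = ⊥-elim (lin 4 (λ N f r z → (f :< N) ∷ (f := r :+ z) ∷ (# 0 :< r) ∷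
          (N :≤ z) ∷ [] ⊢ :⊥) N (from v e) r (q * N) fe<N eq a s)

    gap-≥-M : ∀ {e} → Gap v e → - + M ≤ e
    gap-≥-M {e} (ent , N<fe) = go (runnerOf ent)
      where
      go : Runner e → - + M ≤ e
      go (runner r q a b eq eq′) = bound (scale q)
        where
        w≥M = proj₁ (runner-bound a b)
        small : q * N ≤ + 0 → ⊥
        small s = lin 4 (λ N f r z → (N :< f) ∷ (f := r :+ z) ∷ (r :< N) ∷ (z :≤ # 0) ∷ [] ⊢ :⊥) N
          (from v e) r (q * N) N<fe eq b s
        bound : Scale q → - + M ≤ e
        bound (below _ s) = ⊥-elim (small (ℤ.≤-trans s (-≤+)))
        bound (none _ s)  = ⊥-elim (small (ℤ.≤-reflexive s))
        bound (above _ s) = lin 5 (λ N e w z m → (# 0 :< N) ∷ (e := w :+ z) ∷ (N :≤ z) ∷ (:- m :≤ w)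
          ∷ [] ⊢ :- m :≤ e) N e (to v r) (q * N) (+ M) 0<N eq′ s w≥M

    isBead⇒ : ∀ {e} → T (isBead n w e) → from v e < N
    isBead⇒ {e} p = go (find (Any.any⁻ (test e) (lowestBeads n w) p))
      where
      go : ∃[ b ] b ∈ lowestBeads n w × T (test e b) → from v e < N
      go (b , b∈ , tb) = go′ (∈-map⁻ (λ j → ⟦ w ⟧ (+ suc j)) b∈)
        where
        both = ⇒ (Bool.T-∧ {⌊ N ∣? b - e ⌋}) tb
        e≤b : e ≤ b
        e≤b = toWitness (proj₂ both)
        go′ : ∃[ j ] j ∈ upTo (2 ℕ.* n) × b ≡ ⟦ w ⟧ (+ suc j) → from v e < N
        go′ (j , j∈ , b≡) = go″ (toWitness (proj₁ both))
          where
          go″ : N ∣ b - e → from v e < N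
          go″ (divides q eq) = bound (scale q)
            where
            e≡ : e ≡ ⟦ w ⟧ (+ suc j) + - q * N
            e≡ = trans (lin 3 (λ b e z → (b :- e := z) ∷ [] ⊢ e := b :- z) b e (q * N) eq)
              (cong₂ _+_ b≡ (ℤ.neg-distribˡ-* q N))
            fe : from v e ≡ + suc j + - q * N
            fe = trans (cong (from v) e≡) (trans (from-shift v (- q) _)
              (cong (_+ - q * N) (from-to v (+ suc j))))
            fe′ : from v e ≡ + suc j - q * N
            fe′ = trans fe (cong (λ z → + suc j + z) (sym (ℤ.neg-distribˡ-* q N)))
            j<N : + suc j < N
            j<N = +<+ (s≤s (∈-upTo⁻ j∈))
            bound : Scale q → from v e < N
            bound (below _ s) = ⊥-elim (lin 4 (λ N b e z → (# 0 :< N) ∷ (b :- e := z) ∷ (z :≤ :- N)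
              ∷ (e :≤ b) ∷ [] ⊢ :⊥) N b e (q * N) 0<N eq s e≤b)
            bound (none _ s) = lin 4 (λ N f r z → (f := r :- z) ∷ (z := # 0) ∷ (r :< N) ∷ []
              ⊢ f :< N) N (from v e) (+ suc j) (q * N) fe′ s j<N
            bound (above _ s) = lin 4 (λ N f r z → (f := r :- z) ∷ (N :≤ z) ∷ (# 0 :< N) ∷ (r :< N)
              ∷ [] ⊢ f :< N) N (from v e) (+ suc j) (q * N) fe′ s 0<N j<N

    isBead⇐ : ∀ {e} → Bead v e → T (isBead n w e)
    isBead⇐ {e} (ent , fe<N) = go (runnerOf ent)
      where
      go : Runner e → T (isBead n w e)
      go (runner (+ zero) q (+<+ ()) _ _ _)
      go (runner r@(+ (suc j)) q a b@(+<+ (s≤s j<2n)) eq eq′) = Any.any⁺ (test e)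
        (lose (∈-map⁺ (λ j → ⟦ w ⟧ (+ suc j)) (∈-upTo⁺ j<2n))
          (⇐ (Bool.T-∧ {⌊ N ∣? to v r - e ⌋}) (fromWitness divisible , fromWitness
            (bound (scale q)))))
        where
        divisible : N ∣ to v r - e
        divisible = divides (- q) (trans (lin 3 (λ w e z → (e := w :+ z) ∷ [] ⊢ w :- e := :- z)
          (to v r) e (q * N) eq′) (ℤ.neg-distribˡ-* q N))
        bound : Scale q → e ≤ to v r
        bound (below _ s) = lin 4 (λ N e w z → (# 0 :< N) ∷ (e := w :+ z) ∷ (z :≤ :- N) ∷ []
          ⊢ e :≤ w) N e (to v r) (q * N) 0<N eq′ s
        bound (none _ s)  = lin 3 (λ e w z → (e := w :+ z) ∷ (z := # 0) ∷ [] ⊢ e :≤ w) e (to v r)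
          (q * N) eq′ s
        bound (above _ s) = ⊥-elim (lin 4 (λ N f r z → (f :< N) ∷ (f := r :+ z) ∷ (# 0 :< r) ∷
          (N :≤ z) ∷ [] ⊢ :⊥) N (from v e) r (q * N) fe<N eq a s)

    -- Counts the beads from `e` on and the gaps before `e`. No bead exceeds `M`, which bounds the
    -- search; the gaps become beads under the reflection about `N`.
    bd gp : ℤ → ℕ
    bd e = length (filter (bead? v) (map (λ k → e + + k) (upTo (suc ∣ + M - e ∣))))
    gp e = bd (reflected e + + 1)

    BeadsFrom GapsBefore : ℤ → ℤ → Set
    BeadsFrom e x = e ≤ x × Bead v x
    GapsBefore e x = x < e × Gap v x

    card-bd : ∀ e → Card (BeadsFrom e) (bd e)
    card-bd e = card _ (Unique.filter⁺ (bead? v) (ascending⇒unique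
      (ascending-upTo (λ k → e + + k) (λ i<j → ℤ.+-monoʳ-< e (+<+ i<j)) _)))
      (λ x → mk⇔ (fwd x) (bwd x)) refl
      where
      fwd : ∀ x → x ∈ filter (bead? v) (map (λ k → e + + k) (upTo (suc ∣ + M - e ∣)))
        → BeadsFrom e x
      fwd x p = let q , b = ∈-filter⁻ (bead? v) p in let k , _ , eq = ∈-map⁻ (λ k → e + + k) q in
        subst (e ≤_) (sym eq) (ℤ.i≤i+j e (+ k)) , b
      bwd : ∀ x → BeadsFrom e x → x ∈ filter (bead? v) (map (λ k → e + + k)
        (upTo (suc ∣ + M - e ∣)))
      bwd x (e≤x , b) = ∈-filter⁺ (bead? v) (subst (_∈ map (λ k → e + + k) (upTo (suc ∣ + M - e ∣)))
        x≡ (∈-map⁺ (λ k → e + + k) (∈-upTo⁺ k<))) b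
        where
        0≤x-e = ℤ.i≤j⇒0≤j-i e≤x
        x-e≡ : + ∣ x - e ∣ ≡ x - e
        x-e≡ = ℤ.0≤i⇒+∣i∣≡i 0≤x-e
        x≡ : e + + ∣ x - e ∣ ≡ x
        x≡ = lin 3 (λ x e d → (d := x :- e) ∷ [] ⊢ e :+ d := x) x e (+ ∣ x - e ∣) x-e≡
        x-e≤ : x - e ≤ + M - e
        x-e≤ = ℤ.+-monoˡ-≤ (- e) (bead-≤M b)
        k< : ∣ x - e ∣ ℕ.< suc ∣ + M - e ∣
        k< = s≤s (ℤ.drop‿+≤+ (subst₂ _≤_ (sym x-e≡) (sym (ℤ.0≤i⇒+∣i∣≡i (ℤ.≤-trans 0≤x-e x-e≤)))
          x-e≤))

    card-gp : ∀ e → Card (GapsBefore e) (gp e)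
    card-gp e = card-cong (λ x → mk⇔ (fwd x) (bwd x)) (card-preimage reflected reflected
      reflected-involutive reflected-involutive (card-bd (reflected e + + 1)))
      where
      fwd : ∀ x → BeadsFrom (reflected e + + 1) (reflected x) → GapsBefore e x
      fwd x (a , b) = lin 3 (λ N e x → (N :+ N :- e :+ # 1 :≤ N :+ N :- x) ∷ [] ⊢ x :< e) N e x a
        , subst (Gap v) (reflected-involutive x) (bead-reflected v b)
      bwd : ∀ x → GapsBefore e x → BeadsFrom (reflected e + + 1) (reflected x)
      bwd x (a , b) = lin 3 (λ N e x → (x :< e) ∷ [] ⊢ N :+ N :- e :+ # 1 :≤ N :+ N :- x) N e x a
        , gap-reflected v b

    private
      step : ℤ → Step
      step e = if isBead n w e then north else east

      labels es : List ℤ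
      labels = map (λ k → + k - + M) (upTo (suc (2 ℕ.* M)))
      es = filter (T? ∘ isEntry n) labels

      κ≡ : κ ≡ shape 0 (map step es) []
      κ≡ = cong (λ zs → shape 0 (map step zs) []) (filterᵇ≡filter (isEntry n) labels)

      es-ascending : Ascending es
      es-ascending = filter-ascending (T? ∘ isEntry n) (ascending-upTo (λ k → + k - + M)
        (λ i<j → ℤ.+-monoˡ-< (- + M) (+<+ i<j)) _)

      isEntry⇒ : ∀ {e} → T (isEntry n e) → Entry e
      isEntry⇒ {e} p with N ∣? e
      ... | no ¬d = ¬d

      isEntry⇐ : ∀ {e} → Entry e → T (isEntry n e)
      isEntry⇐ {e} ent with N ∣? e
      ... | yes d = ⊥-elim (ent d)
      ... | no _  = _

      es-entries : All Entry es
      es-entries = All.map isEntry⇒ (All.all-filter (T? ∘ isEntry n) labels)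

      ∈-es : ∀ {x} → Entry x → - + M ≤ x → x ≤ + M → x ∈ es
      ∈-es {x} ent a b = ∈-filter⁺ (T? ∘ isEntry n) (subst (_∈ labels) x≡
        (∈-map⁺ (λ k → + k - + M) (∈-upTo⁺ k<))) (isEntry⇐ ent)
        where
        k = ∣ x + + M ∣
        k≡ : + k ≡ x + + M
        k≡ = ℤ.0≤i⇒+∣i∣≡i (lin 2 (λ x m → (:- m :≤ x) ∷ [] ⊢ # 0 :≤ x :+ m) x (+ M) a)
        x≡ : + k - + M ≡ x
        x≡ = lin 3 (λ x m k → (k := x :+ m) ∷ [] ⊢ k :- m := x) x (+ M) (+ k) k≡
        k< : k ℕ.< suc (2 ℕ.* M)
        k< = s≤s (ℤ.drop‿+≤+ (lin 4 (λ x m k d → (k := x :+ m) ∷ (x :≤ m) ∷ (d := m :+ m) ∷ []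
          ⊢ k :≤ d) x (+ M) (+ k) (+ (2 ℕ.* M)) k≡ b
          (cong (λ z → + (M ℕ.+ z)) (ℕ.+-identityʳ M))))

      step-bead : ∀ {e} → from v e < N → Entry e → step e ≡ north
      step-bead a ent = if-true (isBead⇐ (ent , a))

      step-gap : ∀ {e} → ¬ from v e < N → step e ≡ east
      step-gap ¬a = if-false (¬a ∘ isBead⇒)

      norths-count : ∀ zs → All Entry zs → norths (map step zs) ≡ length (filter (bead? v) zs)
      norths-count []       []         = refl
      norths-count (z ∷ zs) (ent ∷ es) = go (from v z ℤ.<? N)
        where
        go : Dec (from v z < N) → norths (map step (z ∷ zs)) ≡ length (filter (bead? v) (z ∷ zs))
        go (yes a) = trans (cong (λ s → norths (s ∷ map step zs)) (step-bead a ent))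
          (trans (cong suc (norths-count zs es)) (cong length
            (sym (List.filter-accept (bead? v) {z} {zs} (ent , a)))))
        go (no ¬a) = trans (cong (λ s → norths (s ∷ map step zs)) (step-gap ¬a))
          (trans (norths-count zs es) (cong length (sym
            (List.filter-reject (bead? v) {z} {zs} (¬a ∘ proj₂)))))

      gap? : ∀ e → Dec (Gap v e)
      gap? e = entry? e ×-dec (N ℤ.<? from v e)

      easts-count : ∀ zs → All Entry zs → easts (map step zs) ≡ length (filter gap? zs)
      easts-count []       []         = refl
      easts-count (z ∷ zs) (ent ∷ es) = go (bead⊎gap v ent)
        where
        go : Bead v z ⊎ Gap v z → easts (map step (z ∷ zs)) ≡ length (filter gap? (z ∷ zs))
        go (inj₁ b) = trans (cong (λ s → easts (s ∷ map step zs)) (step-bead (proj₂ b) ent))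
          (trans (easts-count zs es) (cong length (sym (List.filter-reject gap? {z} {zs}
            (¬bead×gap v b)))))
        go (inj₂ g) = trans (cong (λ s → easts (s ∷ map step zs))
          (step-gap (λ a → ¬bead×gap v (ent , a) g)))
          (trans (cong suc (easts-count zs es)) (cong length
            (sym (List.filter-accept gap? {z} {zs} g))))

      module Split (e : ℤ) (1≤e : + 1 ≤ e) where
        parts = split-at e es es-ascending
        xs = proj₁ parts
        ys = proj₁ (proj₂ parts)
        es≡ : es ≡ xs ++ ys
        es≡ = proj₁ (proj₂ (proj₂ parts))
        xs< : All (_< e) xs
        xs< = proj₁ (proj₂ (proj₂ (proj₂ parts)))
        ys≥ : All (e ≤_) ys
        ys≥ = proj₂ (proj₂ (proj₂ (proj₂ parts)))

        ascending-parts : Ascending xs × Ascending ys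
        ascending-parts = AllPairs-++⁻ xs (subst Ascending es≡ es-ascending)
          where
          AllPairs-++⁻ : ∀ as {bs} → Ascending (as ++ bs) → Ascending as × Ascending bs
          AllPairs-++⁻ []       h        = [] , h
          AllPairs-++⁻ (a ∷ as) (h ∷ hs) = let p , q = AllPairs-++⁻ as hs in All.++⁻ˡ as h ∷ p , q

        entries-xs : All Entry xs
        entries-xs = All.++⁻ˡ xs (subst (All Entry) es≡ es-entries)
        entries-ys : All Entry ys
        entries-ys = All.++⁻ʳ xs (subst (All Entry) es≡ es-entries)

        κ-split : κ ≡ shape 0 (map step xs ++ map step ys) []
        κ-split = trans κ≡ (cong (λ ps → shape 0 ps [])
          (trans (cong (map step) es≡) (List.map-++ step xs ys)))

        norths≡ : norths (map step ys) ≡ bd e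
        norths≡ = trans (norths-count ys entries-ys) (card-unique c (card-bd e))
          where
          c : Card (BeadsFrom e) (length (filter (bead? v) ys))
          c = card _ (Unique.filter⁺ (bead? v) (ascending⇒unique (proj₂ ascending-parts)))
            (λ x → mk⇔
            (λ p → let q , b = ∈-filter⁻ (bead? v) p in All.lookup ys≥ q , b)
            (λ (a , b) → ∈-filter⁺ (bead? v) (member x a b) b)) refl
            where
            member : ∀ x → e ≤ x → Bead v x → x ∈ ys
            member x a b = case (∈-++⁻ xs (subst (x ∈_) es≡ (∈-es (proj₁ b)
                (lin 3 (λ e x m → (# 1 :≤ e) ∷ (e :≤ x) ∷ (# 0 :≤ m) ∷ [] ⊢ :- m :≤ x) e x
                  (+ M) 1≤e a (+≤+ z≤n)) (bead-≤M b))))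
              where
              case : x ∈ xs ⊎ x ∈ ys → x ∈ ys
              case (inj₁ p) = ⊥-elim (ℤ.<⇒≱ (All.lookup xs< p) a)
              case (inj₂ p) = p

        card-easts : ∀ {P : ℤ → Set} → (∀ x → (x ∈ xs × Gap v x) ⇔ P x) → Card P
          (easts (map step xs))
        card-easts {P} iff = card (filter gap? xs) (Unique.filter⁺ gap?
          (ascending⇒unique (proj₁ ascending-parts)))
          (λ x → mk⇔ (λ p → ⇒ (iff x) (∈-filter⁻ gap? p)) (λ p → let q , g = ⇐ (iff x) p in ∈-filter⁺ gap? q g))
          (sym (easts-count xs entries-xs))

        easts≤ : easts (map step xs) ℕ.≤ gp e
        easts≤ = card-⊆ (λ (p , g) → All.lookup xs< p , g) (card-easts (λ x → mk⇔ id id))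
          (card-gp e)

        -- Gaps beyond `M` lie on the horizontal ray that `boundary` cuts off, so for larger `e` the
        -- finite path can have too few east-steps.
        easts≡ : e ≤ + M → easts (map step xs) ≡ gp e
        easts≡ e≤M = card-unique (card-easts (λ x → mk⇔ (λ (p , g) → All.lookup xs< p , g)
          (λ (a , g) → member x a g , g))) (card-gp e)
          where
          member : ∀ x → x < e → Gap v x → x ∈ xs
          member x a g = case (∈-++⁻ xs (subst (x ∈_) es≡
            (∈-es (proj₁ g) (gap-≥-M g) (ℤ.<⇒≤ (ℤ.<-≤-trans a e≤M)))))
            where
            case : x ∈ xs ⊎ x ∈ ys → x ∈ xs
            case (inj₁ p) = p
            case (inj₂ p) = ⊥-elim (ℤ.<⇒≱ a (All.lookup ys≥ p))

    -- A row number up to `bd e` requires a bead at or after `e`. This puts `e` at or below `M`,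
    -- where the cut of the path is exact.
    row-≥ : ∀ {e} → + 1 ≤ e → ∀ {i} → 1 ℕ.≤ i → i ℕ.≤ bd e → gp e ℕ.≤ row κ i
    row-≥ {e} 1≤e {i} 1≤i i≤bd = subst₂ (λ a ρ → a ℕ.≤ row ρ i) (easts≡ e≤M) (sym κ-split)
        (north-row (map step xs) (map step ys) i 1≤i (ℕ.≤-trans i≤bd (ℕ.≤-reflexive (sym norths≡))))
      where
      open Split e 1≤e
      e≤M : e ≤ + M
      e≤M = go (card-bd e)
        where
        go : Card (BeadsFrom e) (bd e) → e ≤ + M
        go (card []       _ _ c) = ⊥-elim (ℕ.<⇒≱ (ℕ.≤-trans 1≤i i≤bd) (ℕ.≤-reflexive (sym c)))
        go (card (x ∷ _) _ m _) = let a , b = ⇒ (m x) (here refl) in ℤ.≤-trans a (bead-≤M b)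

    row-≤ : ∀ {e} → + 1 ≤ e → ∀ {i} → bd e ℕ.< i → row κ i ℕ.≤ gp e
    row-≤ {e} 1≤e {i} bd<i = ℕ.≤-trans (subst (λ ρ → row ρ i ℕ.≤ easts (map step xs)) (sym κ-split)
        (south-row (map step xs) (map step ys) i (subst (ℕ._< i) (sym norths≡) bd<i))) easts≤
      where open Split e 1≤e

    κ-positive : All (1 ℕ.≤_) κ
    κ-positive = shape-positive (boundary n w) 0 [] []

-- Diagonals of the core, injectivity of `𝒞`, and cores before and after a generator.

module Diagonals (t : AffineType) (n : ℕ) (rank : minRank t ℕ.≤ n) where
  open import Data.Integer using (_+_; _-_; _*_; -_; _≤_; _<_)
  open Cores t n rank public

  ref : ℕ
  ref = referenceDiagonal (variant₀ t)

  module Diagonal (w : MirroredPermutation n) where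
    open Core w public

    <⊎≡ : ∀ {e x : ℤ} → e ≤ x → x ≡ e ⊎ e + + 1 ≤ x
    <⊎≡ {e} {x} e≤x = go (x ℤ.≟ e)
      where
      go : Dec (x ≡ e) → x ≡ e ⊎ e + + 1 ≤ x
      go (yes p) = inj₁ p
      go (no x≢e) = inj₂ (lin 2 (λ e x → (e :< x) ∷ [] ⊢ e :+ # 1 :≤ x) e x
        (ℤ.≤∧≢⇒< e≤x (x≢e ∘ sym)))

    e≤e+1 : ∀ e → e ≤ e + + 1
    e≤e+1 e = ℤ.i≤i+j e (+ 1)

    bd-bead : ∀ {e} → Bead v e → bd e ≡ suc (bd (e + + 1))
    bd-bead {e} b = card-unique (card-bd e) (card-add e
      (λ (a , _) → lin 1 (λ e → (e :+ # 1 :≤ e) ∷ [] ⊢ :⊥) e a)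
      (λ y → mk⇔ (λ (a , b′) → Sum.map₂ (_, b′) (<⊎≡ a))
        (λ { (inj₁ refl) → ℤ.≤-refl , b ; (inj₂ (a , b′)) → ℤ.≤-trans (e≤e+1 e) a , b′ }))
          (card-bd (e + + 1)))

    bd-nonbead : ∀ {e} → ¬ Bead v e → bd e ≡ bd (e + + 1)
    bd-nonbead {e} ¬b = card-unique (card-bd e) (card-cong (λ y → mk⇔
      (λ (a , b′) → ℤ.≤-trans (e≤e+1 e) a , b′)
      (λ (a , b′) → Sum.[ (λ { refl → ⊥-elim (¬b b′) }) , (λ c → c , b′) ]′ (<⊎≡ a)))
        (card-bd (e + + 1)))

    bead-of : ∀ {e} → bd e ≡ suc (bd (e + + 1)) → Bead v e
    bead-of {e} eq = go (bead? v e)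
      where
      go : Dec (Bead v e) → Bead v e
      go (yes b) = b
      go (no ¬b) = ⊥-elim (ℕ.1+n≢n (trans (sym eq) (bd-nonbead ¬b)))

    private
      <-step : ∀ {e x : ℤ} → x < e + + 1 → x ≡ e ⊎ x < e
      <-step {e} {x} h = go (x ℤ.≟ e)
        where
        go : Dec (x ≡ e) → x ≡ e ⊎ x < e
        go (yes p) = inj₁ p
        go (no x≢e) = inj₂ (ℤ.≤∧≢⇒< (lin 2 (λ e x → (x :< e :+ # 1) ∷ [] ⊢ x :≤ e) e x h) x≢e)

      e<e+1 : ∀ e → e < e + + 1
      e<e+1 e = lin 1 (λ e → [] ⊢ e :< e :+ # 1) e

    gp-gap : ∀ {e} → Gap v e → gp (e + + 1) ≡ suc (gp e)
    gp-gap {e} g = card-unique (card-gp (e + + 1)) (card-add e (λ (a , _) → ℤ.<-irrefl refl a)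
      (λ y → mk⇔ (λ (a , g′) → Sum.map₂ (_, g′) (<-step a))
        (λ { (inj₁ refl) → e<e+1 e , g ; (inj₂ (a , g′)) → ℤ.<-trans a (e<e+1 e) , g′ }))
          (card-gp e))

    gp-nongap : ∀ {e} → ¬ Gap v e → gp (e + + 1) ≡ gp e
    gp-nongap {e} ¬g = card-unique (card-gp (e + + 1)) (card-cong (λ y → mk⇔
      (λ (a , g′) → ℤ.<-trans a (e<e+1 e) , g′)
      (λ (a , g′) → Sum.[ (λ { refl → ⊥-elim (¬g g′) }) , (λ c → c , g′) ]′ (<-step a)))
        (card-gp e))

    -- Where the boundary path crosses the c-th diagonal.
    Corner : ℤ → ℤ → Set
    Corner e c = + gp e ≡ + bd e + c

    -- A bead leaves the count of beads ahead, a gap enters the count of gaps behind; the difference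
    -- grows by one either way.
    corner-entry : ∀ e c → Entry e → Corner e c ⇔ Corner (e + + 1) (c + + 1)
    corner-entry e c ent = go (bead⊎gap v ent)
      where
      go : Bead v e ⊎ Gap v e → Corner e c ⇔ Corner (e + + 1) (c + + 1)
      go (inj₁ b) = mk⇔
        (λ h → lin 5 (λ g g′ β β′ c → (g′ := g) ∷ (β := # 1 :+ β′) ∷ (g := β :+ c) ∷ []
          ⊢ g′ := β′ :+ (c :+ # 1))
          (+ gp e) (+ gp (e + + 1)) (+ bd e) (+ bd (e + + 1)) c
            (cong +_ (gp-nongap (¬bead×gap v b))) (cong +_ (bd-bead b)) h)
        (λ h → lin 5 (λ g g′ β β′ c → (g′ := g) ∷ (β := # 1 :+ β′) ∷ (g′ := β′ :+ (c :+ # 1)) ∷ []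
          ⊢ g := β :+ c)
          (+ gp e) (+ gp (e + + 1)) (+ bd e) (+ bd (e + + 1)) c
            (cong +_ (gp-nongap (¬bead×gap v b))) (cong +_ (bd-bead b)) h)
      go (inj₂ g) = mk⇔
        (λ h → lin 5 (λ g g′ β β′ c → (g′ := # 1 :+ g) ∷ (β := β′) ∷ (g := β :+ c) ∷ []
          ⊢ g′ := β′ :+ (c :+ # 1))
          (+ gp e) (+ gp (e + + 1)) (+ bd e) (+ bd (e + + 1)) c (cong +_ (gp-gap g))
            (cong +_ (bd-nonbead (λ b → ¬bead×gap v b g))) h)
        (λ h → lin 5 (λ g g′ β β′ c → (g′ := # 1 :+ g) ∷ (β := β′) ∷ (g′ := β′ :+ (c :+ # 1)) ∷ []
          ⊢ g := β :+ c)
          (+ gp e) (+ gp (e + + 1)) (+ bd e) (+ bd (e + + 1)) c (cong +_ (gp-gap g))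
            (cong +_ (bd-nonbead (λ b → ¬bead×gap v b g))) h)

    corner-multiple : ∀ e c → N ∣ e → Corner e c → Corner (e + + 1) c
    corner-multiple e c d h = trans (cong +_ (gp-nongap (λ (ent , _) → ent d)))
      (trans h (cong (λ k → + k + c) (bd-nonbead (λ (ent , _) → ent d))))

    N∣N : N ∣ N
    N∣N = divides (+ 1) (sym (ℤ.*-identityˡ N))

    -- The reflection about `N` pairs the gaps before `N` with the beads after it.
    corner-N : Corner N (+ 0)
    corner-N = trans (cong (λ x → + bd x) (lin 1 (λ N → [] ⊢ N :+ N :- N :+ # 1 := N :+ # 1) N))
      (trans (cong +_ (sym (bd-nonbead (λ (ent , _) → ent N∣N)))) (sym (ℤ.+-identityʳ (+ bd N))))

    -- The entry at which the `m`-th diagonal meets the path, for `m < 2n`. At `m = 2n` the label is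
    -- `2N`, which is no entry, and the diagonal is carried on to `2N + 1`.
    label : ℕ → ℤ
    label m = N + (+ 1 + + m)

    label-suc : ∀ m → label m + + 1 ≡ label (suc m)
    label-suc m = lin 2 (λ N m → [] ⊢ N :+ (# 1 :+ m) :+ # 1 := N :+ (# 1 :+ (# 1 :+ m))) N (+ m)

    1≤label : ∀ m → + 1 ≤ label m
    1≤label m = +≤+ (s≤s z≤n)

    corner-0 : Corner (label 0) (+ 0)
    corner-0 = corner-multiple N (+ 0) N∣N corner-N

    entry-label : ∀ {m} → m ℕ.< 2 ℕ.* n → Entry (label m)
    entry-label {m} m<2n = subst Entry (lin 2 (λ N m → [] ⊢ # 1 :+ m :+ + 1 :* N := N :+ (# 1 :+ m))
      N (+ m))
      (entry-shift (+ 1) (entry-between {+ suc m} (+<+ (s≤s z≤n)) (+<+ (s≤s m<2n))))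

    corner-label : ∀ m → m ℕ.≤ 2 ℕ.* n → Corner (label m) (+ m)
    corner-label zero    _ = corner-0
    corner-label (suc m) h = subst₂ Corner (label-suc m)
      (lin 1 (λ m → [] ⊢ m :+ # 1 := # 1 :+ m) (+ m))
      (⇒ (corner-entry (label m) (+ m) (entry-label h)) (corner-label m (ℕ.<⇒≤ h)))

    corner-2N+1 : Corner (N + N + + 1) (+ (2 ℕ.* n))
    corner-2N+1 = corner-multiple (N + N) (+ (2 ℕ.* n))
      (divides (+ 2) (lin 1 (λ N → [] ⊢ N :+ N := + 2 :* N) N)) (corner-label (2 ℕ.* n) ℕ.≤-refl)

    corner-N-1 : Corner (N - + 1) (- + 1)
    corner-N-1 = ⇐ (corner-entry (N - + 1) (- + 1) ent)
      (subst (λ e → Corner e (+ 0)) (lin 1 (λ N → [] ⊢ N := N :- # 1 :+ # 1) N) corner-N)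
      where
      ent : Entry (N - + 1)
      ent = entry-between (lin 2 (λ N n → (N := # 1 :+ (n :+ n)) ∷ (# 1 :≤ n) ∷ []
        ⊢ # 0 :< N :- # 1) N n₊ N≡ (+≤+ 1≤n))
        (lin 1 (λ N → [] ⊢ N :- # 1 :< N) N)

    -- At the corner `gp e = bd e + c`, so `row-≥` and `row-≤` meet there: the `c`-th diagonal has a
    -- box in exactly the first `bd e` rows.
    on-diagonal : ∀ {e c} → + 1 ≤ e → Corner e (+ c) → ∀ {i} → 1 ℕ.≤ i
      → i ℕ.+ c ℕ.≤ row κ i ⇔ i ℕ.≤ bd e
    on-diagonal {e} {c} 1≤e corner {i} 1≤i = mk⇔ fwd bwd
      where
      gp≡ : gp e ≡ bd e ℕ.+ c
      gp≡ = ℤ.+-injective corner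
      fwd : i ℕ.+ c ℕ.≤ row κ i → i ℕ.≤ bd e
      fwd h = ℕ.≮⇒≥ λ bd<i → ℕ.<⇒≱ (ℕ.+-monoˡ-< c bd<i)
        (ℕ.≤-trans h (ℕ.≤-trans (row-≤ 1≤e bd<i) (ℕ.≤-reflexive gp≡)))
      bwd : i ℕ.≤ bd e → i ℕ.+ c ℕ.≤ row κ i
      bwd h = ℕ.≤-trans (ℕ.+-monoˡ-≤ c h) (ℕ.≤-trans (ℕ.≤-reflexive (sym gp≡)) (row-≥ 1≤e 1≤i h))

    -- The lower bound at the cut `e` and the upper bound at `e + 1` agree, because a bead is no
    -- gap.
    row-at-bead : ∀ {e} → + 1 ≤ e → Bead v e → row κ (bd e) ≡ gp e
    row-at-bead {e} 1≤e b = ℕ.≤-antisym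
      (ℕ.≤-trans (row-≤ (ℤ.≤-trans 1≤e (e≤e+1 e)) (ℕ.≤-reflexive (sym (bd-bead b))))
        (ℕ.≤-reflexive (gp-nongap (¬bead×gap v b))))
      (row-≥ 1≤e (subst (1 ℕ.≤_) (sym (bd-bead b)) (s≤s z≤n)) ℕ.≤-refl)

    bd-≤-length : ∀ {e c} → + 1 ≤ e → Corner e (+ c) → bd e ℕ.≤ length κ
    bd-≤-length {e} {c} 1≤e corner = ℕ.≮⇒≥ λ short → ℕ.<⇒≱ (positive short)
      (ℕ.≤-reflexive (Paths.row-beyond κ (bd e) short))
      where
      positive : length κ ℕ.< bd e → 1 ℕ.≤ row κ (bd e)
      positive short = ℕ.≤-trans 1≤bd (ℕ.≤-trans (ℕ.m≤m+n (bd e) c)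
        (⇐ (on-diagonal 1≤e corner 1≤bd) ℕ.≤-refl))
        where 1≤bd = ℕ.≤-trans (s≤s z≤n) short

    referenceBoxes≡ : ∀ {e} → + 1 ≤ e → Corner e (+ ref) → referenceBoxes t n κ ≡ bd e
    referenceBoxes≡ {e} 1≤e corner = Paths.threshold (λ i → i ℕ.+ ref ℕ.≤? row κ i) (length κ)
      (bd e)
      (bd-≤-length 1≤e corner) (λ i 1≤i → on-diagonal 1≤e corner 1≤i)

    empty : bd (label 0) ≡ 0 → κ ≡ []
    empty bd≡0 = go κ refl κ-positive
      where
      go : ∀ ρ → κ ≡ ρ → All (1 ℕ.≤_) ρ → κ ≡ []
      go []      eq _       = eq
      go (p ∷ ρ) eq (h ∷ _) = ⊥-elim (ℕ.<⇒≱ h (subst (λ ρ → row ρ 1 ℕ.≤ 0) eq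
        (ℕ.≤-trans (row-≤ (1≤label 0) (subst (ℕ._< 1) (sym bd≡0) (s≤s z≤n)))
          (ℕ.≤-reflexive (trans (ℤ.+-injective (trans corner-0 (ℤ.+-identityʳ _))) bd≡0)))))

    no-high-bead : κ ≡ [] → ∀ {e} → N < e → ¬ Bead v e
    no-high-bead κ≡[] {e} N<e b = ℕ.<⇒≱ positive (ℕ.≤-trans (bd-≤-length (1≤label 0) corner-0)
      (ℕ.≤-reflexive (cong length κ≡[])))
      where
      positive : 1 ℕ.≤ bd (label 0)
      positive = ℕ.≤-trans (subst (1 ℕ.≤_) (sym (bd-bead b)) (s≤s z≤n))
        (card-⊆ (λ (p , h) → ℤ.≤-trans
        (lin 2 (λ N e → (N :< e) ∷ [] ⊢ N :+ (# 1 :+ # 0) :≤ e) N e N<e) p , h) (card-bd e)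
          (card-bd (label 0)))

  module Injectivity (w w′ : MirroredPermutation n) (eq : 𝒞 n w ≡ 𝒞 n w′) where
    private
      module A = Diagonal w
      module B = Diagonal w′

    -- Both paths pass the same entries and the same multiples of `N`, so at each label they meet
    -- the same diagonal. Its length in the common partition is the bead count of both.
    corners : ∀ m → ∃[ c ] A.Corner (A.label m) (+ c) × B.Corner (A.label m) (+ c)
    corners zero    = 0 , A.corner-0 , B.corner-0
    corners (suc m) = go (N ∣? A.label m) (corners m)
      where
      go : Dec (N ∣ A.label m) → ∃[ c ] A.Corner (A.label m) (+ c) × B.Corner (A.label m) (+ c) →
           ∃[ c ] A.Corner (A.label (suc m)) (+ c) × B.Corner (A.label (suc m)) (+ c)
      go (yes d) (c , a , b) = c , subst (λ e → A.Corner e (+ c)) (A.label-suc m)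
        (A.corner-multiple (A.label m) (+ c) d a) ,
        subst (λ e → B.Corner e (+ c)) (A.label-suc m) (B.corner-multiple (A.label m) (+ c) d b)
      go (no ent) (c , a , b) = suc c , subst₂ A.Corner (A.label-suc m) (cong +_ (ℕ.+-comm c 1))
        (⇒ (A.corner-entry (A.label m) (+ c) ent) a) ,
        subst₂ B.Corner (A.label-suc m) (cong +_ (ℕ.+-comm c 1))
          (⇒ (B.corner-entry (A.label m) (+ c) ent) b)

    bd≡ : ∀ m → A.bd (A.label m) ≡ B.bd (A.label m)
    bd≡ m = ℕ.≤-antisym (le (A.bd e) refl) (ge (B.bd e) refl)
      where
      e = A.label m
      c = proj₁ (corners m)
      cA = proj₁ (proj₂ (corners m))
      cB = proj₂ (proj₂ (corners m))
      le : ∀ i → A.bd e ≡ i → i ℕ.≤ B.bd e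
      le zero    _ = z≤n
      le (suc i) h = ⇒ (B.on-diagonal (A.1≤label m) cB (s≤s z≤n))
        (subst (λ κ → suc i ℕ.+ c ℕ.≤ row κ (suc i)) eq
        (⇐ (A.on-diagonal (A.1≤label m) cA (s≤s z≤n)) (ℕ.≤-reflexive (sym h))))
      ge : ∀ i → B.bd e ≡ i → i ℕ.≤ A.bd e
      ge zero    _ = z≤n
      ge (suc i) h = ⇒ (A.on-diagonal (A.1≤label m) cA (s≤s z≤n))
        (subst (λ κ → suc i ℕ.+ c ℕ.≤ row κ (suc i)) (sym eq)
        (⇐ (B.on-diagonal (A.1≤label m) cB (s≤s z≤n)) (ℕ.≤-reflexive (sym h))))

    -- A bead at `e` shows as the drop of the bead count from `e` to `e + 1`.
    bead-high : ∀ {e} → N < e → Bead A.v e → Bead B.v e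
    bead-high {e} N<e b = subst (Bead B.v) e≡ (B.bead-of
      (trans (sym (bd≡ m)) (trans (A.bd-bead (subst (Bead A.v) (sym e≡) b))
        (cong suc (trans (cong A.bd (A.label-suc m)) (trans (bd≡ (suc m))
          (cong B.bd (sym (A.label-suc m)))))))))
      where
      m = ∣ e - (N + + 1) ∣
      m≡ : + m ≡ e - (N + + 1)
      m≡ = ℤ.0≤i⇒+∣i∣≡i (lin 2 (λ N e → (N :< e) ∷ [] ⊢ # 0 :≤ e :- (N :+ # 1)) N e N<e)
      e≡ : A.label m ≡ e
      e≡ = lin 3 (λ N e m → (m := e :- (N :+ # 1)) ∷ [] ⊢ N :+ (# 1 :+ m) := e) N e (+ m) m≡

  -- The beads below `N` are the reflections of the gaps above `N`.
  high-beads : ∀ v w → (∀ {e} → N < e → Bead v e → Bead w e) → (∀ {e} → N < e → Bead w e → Bead v e)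
    → ∀ {e} → Bead v e → Bead w e
  high-beads v w f g {e} b = go (ℤ.<-cmp N e)
    where
    go : _ → Bead w e
    go (tri< a _ _) = f a b
    go (tri≈ _ c _) = ⊥-elim (entry≢N (proj₁ b) (sym c))
    go (tri> _ _ e<N) = Sum.[ id , (λ h → ⊥-elim (¬bead×gap v
        (g (lin 2 (λ N e → (e :< N) ∷ [] ⊢ N :< N :+ N :- e) N e e<N) (gap-reflected w h))
          (bead-reflected v b))) ]′
      (bead⊎gap w (proj₁ b))

  𝒞-injective : ∀ w w′ → 𝒞 n w ≡ 𝒞 n w′ → Representative (toAut w) → Representative (toAut w′)
    → ⟦ w ⟧ ≗ ⟦ w′ ⟧
  𝒞-injective w w′ eq R R′ = Uniqueness.equal (toAut w) (toAut w′) R R′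
    (high-beads (toAut w) (toAut w′) (Injectivity.bead-high w w′ eq)
      (Injectivity.bead-high w′ w (sym eq)))
    (high-beads (toAut w′) (toAut w) (Injectivity.bead-high w′ w (sym eq))
      (Injectivity.bead-high w w′ eq))

  entry-after : ∀ {x} → N ∣ x → Entry (x + + 1)
  entry-after {x} (divides q eq) = subst Entry (lin 2 (λ x y → (x := y) ∷ [] ⊢ # 1 :+ y := x :+ # 1)
    x (q * N) eq)
    (entry-quotient {+ 1} {q} (+<+ (s≤s z≤n)) (lin 2 (λ N n → (N := # 1 :+ (n :+ n)) ∷ (# 1 :≤ n)
      ∷ [] ⊢ # 1 :< N) N n₊ N≡ (+≤+ 1≤n)))

  -- The c-th diagonal meets the boundary paths of all cores at the same entry.
  crossing : ∀ c → ∃[ e ] + 1 ≤ e × Entry e × (∀ w → Diagonal.Corner w e (+ c))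
  crossing zero    = + suc (2 ℕ.* n) + + 1 , +≤+ (s≤s z≤n) , entry-after
    (divides (+ 1) (sym (ℤ.*-identityˡ N))) , λ w → Diagonal.corner-0 w
  crossing (suc c) = go (crossing c)
    where
    go : ∃[ e ] + 1 ≤ e × Entry e × (∀ w → Diagonal.Corner w e (+ c)) → ∃[ e ] + 1 ≤ e × Entry e ×
      (∀ w → Diagonal.Corner w e (+ suc c))
    go (e , 1≤e , ent , corner) = next (N ∣? (e + + 1))
      where
      corner′ : ∀ w → Diagonal.Corner w (e + + 1) (+ suc c)
      corner′ w = subst (Diagonal.Corner w (e + + 1)) (cong +_ (ℕ.+-comm c 1))
        (⇒ (Diagonal.corner-entry w e (+ c) ent) (corner w))
      1≤e+1 : + 1 ≤ e + + 1
      1≤e+1 = ℤ.≤-trans 1≤e (ℤ.i≤i+j e (+ 1))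
      next : Dec (N ∣ e + + 1) → ∃[ e ] + 1 ≤ e × Entry e × (∀ w → Diagonal.Corner w e (+ suc c))
      next (no ent′) = e + + 1 , 1≤e+1 , ent′ , corner′
      next (yes d)   = e + + 1 + + 1 , ℤ.≤-trans 1≤e+1 (ℤ.i≤i+j (e + + 1) (+ 1)) , entry-after d ,
        λ w → Diagonal.corner-multiple w (e + + 1) (+ suc c) d (corner′ w)

  -- sᵢ moves beads to smaller labels when it shortens.
  module Shortening (w w′ : MirroredPermutation n) (i : Fin (suc n))
    (descent : from (toAut w) (high i) < from (toAut w) (low i))
    (bead-s : ∀ {e} → Bead (toAut w′) e → Bead (toAut w) (generator t n i e))
    (s-bead : ∀ {e} → Bead (toAut w) e → Bead (toAut w′) (generator t n i e)) where
    private
      a : Aut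
      a = toAut w

      s : ℤ → ℤ
      s = generator t n i

    module A = Diagonal w
    module B = Diagonal w′

    -- A label that `s` moves up is the lower point of an exchanged pair, and the descent orders the
    -- images of the pair under `w⁻¹` the other way round.
    up : ∀ {e} → e < s e → from a (s e) < from a e
    up {e} lt = go (generator-swap (kindOf i) e)
      where
      K = low<high (kindOf i)
      p = low i
      q = high i
      go : Swap p q e (s e) → from a (s e) < from a e
      go (stay eq) = ⊥-elim (ℤ.<⇒≢ lt (sym eq))
      go (↑ k eq eq′) = lin 5 (λ x y P Q z → (x := P :+ z) ∷ (y := Q :+ z) ∷ (Q :< P) ∷ [] ⊢ y :< x)
        (from a e) (from a (s e)) (from a p) (from a q) (k * N)
        (trans (cong (from a) eq) (from-shift a k p)) (trans (cong (from a) eq′) (from-shift a k q))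
          descent
      go (↓ k eq eq′) = ⊥-elim (lin 5 (λ x y P Q z → (x := Q :+ z) ∷ (y := P :+ z) ∷ (P :< Q) ∷
        (x :< y) ∷ [] ⊢ :⊥) e (s e) p q (k * N) eq eq′ K lt)
      go (-↑ k eq eq′) = lin 5 (λ x y P Q z → (x := :- Q :+ z) ∷ (y := :- P :+ z) ∷ (Q :< P) ∷ []
        ⊢ y :< x)
        (from a e) (from a (s e)) (from a p) (from a q) (k * N)
        (trans (cong (from a) eq) (trans (from-shift a k (- q)) (cong (_+ k * N) (from-neg a q))))
        (trans (cong (from a) eq′) (trans (from-shift a k (- p)) (cong (_+ k * N) (from-neg a p))))
          descent
      go (-↓ k eq eq′) = ⊥-elim (lin 5 (λ x y P Q z → (x := :- P :+ z) ∷ (y := :- Q :+ z) ∷ (P :< Q)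
        ∷ (x :< y) ∷ [] ⊢ :⊥) e (s e) p q (k * N) eq eq′ K lt)

    bead-up : ∀ {e} → e < s e → Bead A.v e → Bead A.v (s e)
    bead-up lt (ent , h) = to-entry (gen i) ent , ℤ.<-trans (up lt) h

    private
      clampBy : ∀ e x → Dec (e ≤ s x) → ℤ
      clampBy e x (yes _) = s x
      clampBy e x (no _)  = x

      -- An injection from the beads of `w′` from `e` on into those of `w`. A bead `x` that `s`
      -- would send below `e` stays where it is; it is a bead of `w` too, since `s` moves the bead
      -- `s x` of `w` up to `x`.
      clamp : ℤ → ℤ → ℤ
      clamp e x = clampBy e x (e ℤ.≤? s x)

      data Clamp (e x : ℤ) : ℤ → Set where
        moved : e ≤ s x → Clamp e x (s x)
        kept  : s x < e → Clamp e x x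

      clampBy-view : ∀ e x d → Clamp e x (clampBy e x d)
      clampBy-view e x (yes p) = moved p
      clampBy-view e x (no ¬p) = kept (ℤ.≰⇒> ¬p)

      clamp-view : ∀ e x → Clamp e x (clamp e x)
      clamp-view e x = clampBy-view e x (e ℤ.≤? s x)

      clamp-bead : ∀ {e x y} → Clamp e x y → B.BeadsFrom e x → A.BeadsFrom e y
      clamp-bead (moved p) (_ , b) = p , bead-s b
      clamp-bead {e} {x} (kept lt) (e≤x , b) = e≤x , subst (Bead A.v) (generator-involutive i x)
        (bead-up (subst (s x <_) (sym (generator-involutive i x)) (ℤ.<-≤-trans lt e≤x)) (bead-s b))

      clamp-injective : ∀ {e x y x′ y′} → Clamp e x x′ → Clamp e y y′ → e ≤ x → e ≤ y → x′ ≡ y′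
        → x ≡ y
      clamp-injective (moved _) (moved _) _ _ eq = to-injective (gen i) eq
      clamp-injective (kept _)  (kept _)  _ _ eq = eq
      clamp-injective {e} {x} {y} (moved _) (kept lt) e≤x _ eq = ⊥-elim
        (ℤ.<⇒≱ (subst (_< e) (trans (cong s (sym eq)) (generator-involutive i x)) lt) e≤x)
      clamp-injective {e} {x} {y} (kept lt) (moved _) _ e≤y eq = ⊥-elim
        (ℤ.<⇒≱ (subst (_< e) (trans (cong s eq) (generator-involutive i y)) lt) e≤y)

    bd-decreases : ∀ e → B.bd e ℕ.≤ A.bd e
    bd-decreases e = card-≤ (clamp e) (λ {x} → clamp-bead (clamp-view e x))
      (λ {x} {y} (p , _) (q , _) → clamp-injective (clamp-view e x) (clamp-view e y) p q)
        (B.card-bd e) (A.card-bd e)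

    -- The injection misses `b`: a bead moved to `b` would come from `s b < b`, and one kept at `b`
    -- would make `s b` a bead of `w`.
    bd-drops : ∀ {b} → Bead A.v b → s b < b → ¬ Bead A.v (s b) → B.bd b ℕ.< A.bd b
    bd-drops {b} bead sb<b gap = ℕ.≤-trans (s≤s (card-≤ (clamp b)
      (λ {x} h → past-b x h (clamp-view b x) )
        (λ {x} {y} (p , _) (q , _) → clamp-injective (clamp-view b x) (clamp-view b y) p q)
          (B.card-bd b) (A.card-bd (b + + 1))))
      (ℕ.≤-reflexive (sym (A.bd-bead bead)))
      where
      past-b : ∀ x {y} → B.BeadsFrom b x → Clamp b x y → A.BeadsFrom (b + + 1) y
      past-b x {y} h c = Sum.[ (λ eq → ⊥-elim (not-b c eq)) ,
        (λ le → le , proj₂ (clamp-bead c h)) ]′ (A.<⊎≡ (proj₁ (clamp-bead c h)))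
        where
        not-b : ∀ {y} → Clamp b x y → y ≡ b → ⊥
        not-b (moved _) eq = ℤ.<⇒≱ (subst (_< b) (trans (cong s (sym eq))
          (generator-involutive i x)) sb<b) (proj₁ h)
        not-b (kept _)  eq = gap (subst (λ z → Bead A.v (s z)) eq (bead-s (proj₂ h)))

    -- Here `s` itself is a bijection between the two sets of beads. This gives the exact row end
    -- after a generator of variant D.
    bd-moves : ∀ {b} → (∀ {x} → Bead A.v x → b ≤ x ⇔ s b ≤ s x) → B.bd (s b) ≡ A.bd b
    bd-moves {b} iff = card-unique (B.card-bd (s b)) (card-cong (λ y → mk⇔
        (λ (p , h) → subst (s b ≤_) (generator-involutive i y) (⇒ (iff h) p) , subst (Bead B.v)
          (generator-involutive i y) (s-bead h))
        (λ (p , h) → ⇐ (iff (bead-s h)) (subst (s b ≤_) (sym (generator-involutive i y)) p)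
          , bead-s h))
      (card-preimage s s (generator-involutive i) (generator-involutive i) (A.card-bd b)))

-- Residues at the end of a row.

module Cells (n : ℕ) (2≤n : 2 ℕ.≤ n) where
  open import Data.Integer using (_+_; _-_; _*_; -_; _≤_; _<_)

  private
    m : ℕ
    m = 2 ℕ.* n ∸ 1

    1≤2n : 1 ℕ.≤ 2 ℕ.* n
    1≤2n = ℕ.≤-trans (ℕ.≤-trans (s≤s z≤n) 2≤n) (ℕ.m≤m+n n _)

    1+m≡ : suc m ≡ 2 ℕ.* n
    1+m≡ = ℕ.m+[n∸m]≡n 1≤2n

  open DivisionBy m using (divMod-unique; quot; divide; scale; below; none; above; Scale) renaming
    (N to Q)

  n′ : ℤ
  n′ = + n

  2n≡ : + (2 ℕ.* n) ≡ n′ + n′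
  2n≡ = cong (λ k → + (n ℕ.+ k)) (ℕ.+-identityʳ n)

  Q≡ : Q ≡ n′ + n′
  Q≡ = trans (cong +_ 1+m≡) 2n≡

  2≤n′ : + 2 ≤ n′
  2≤n′ = +≤+ 2≤n

  ‖-unique : ∀ {p r} k → r ℕ.< 2 ℕ.* n → p ≡ + r + k * Q → p ‖ (2 ℕ.* n) ≡ r
  ‖-unique {p} {r} k r<2n eq = trans (cong (p ‖_) (sym 1+m≡))
    (trans (cong (_‖ suc m) eq) (proj₁ (divMod-unique r k (subst (r ℕ.<_) (sym 1+m≡) r<2n))))

  ‖-divide : ∀ p → ∃[ k ] p ≡ + (p ‖ (2 ℕ.* n)) + k * Q
  ‖-divide p = go (divide p)
    where
    go : DivisionBy.Quotient m p → ∃[ k ] p ≡ + (p ‖ (2 ℕ.* n)) + k * Q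
    go (quot r k r<Q eq) = k , trans eq (cong (λ z → + z + k * Q)
      (sym (‖-unique k (subst (r ℕ.<_) 1+m≡ r<Q) eq)))

  content : Cell → ℤ
  content (i , j) = + j - + i

  -- The residues of the `p`-th of the three cells, counted from 0, when it is the last box of its
  -- row: `a` for the first, `b` for the second, and both for the third.
  data Verdict (a b : ℕ) : ℕ → ℕ → Set where
    first  : Verdict a b 0 a
    second : Verdict a b 1 b
    third  : Verdict a b 2 a
    third′ : Verdict a b 2 b

  verdict-≤2 : ∀ {a b p r} → Verdict a b p r → p ℕ.≤ 2
  verdict-≤2 first  = z≤n
  verdict-≤2 second = s≤s z≤n
  verdict-≤2 third  = ℕ.≤-refl
  verdict-≤2 third′ = ℕ.≤-refl

  verdict : ∀ {a b e s rs r} (p : Fin 3) → Rule a b e s rs → e ≡ toℕ p ℕ.+ s → r ∈ lookup rs p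
    → Verdict a b (toℕ p) r
  verdict p  (ends-before-c₁ {s}) eq _ = ⊥-elim (ℕ.m≢1+n+m s (trans eq (ℕ.+-suc (toℕ p) s)))
  verdict 0F ends-at-c₁ eq (here refl) = first
  verdict 1F (ends-at-c₁ {s}) eq _ = ⊥-elim (ℕ.m≢1+n+m s {0} eq)
  verdict 2F (ends-at-c₁ {s}) eq _ = ⊥-elim (ℕ.m≢1+n+m s {1} eq)
  verdict 0F (ends-at-c₂ {s}) eq _ = ⊥-elim (ℕ.m≢1+n+m s {0} (sym eq))
  verdict 1F ends-at-c₂ eq (here refl) = second
  verdict 2F (ends-at-c₂ {s}) eq _ = ⊥-elim (ℕ.m≢1+n+m s {0} (ℕ.suc-injective eq))
  verdict 0F (ends-at-c₃ {s}) eq _ = ⊥-elim (ℕ.m≢1+n+m s {1} (sym eq))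
  verdict 1F (ends-at-c₃ {s}) eq _ = ⊥-elim (ℕ.m≢1+n+m s {0} (ℕ.suc-injective (sym eq)))
  verdict 2F ends-at-c₃ eq (here refl) = third
  verdict 2F ends-at-c₃ eq (there (here refl)) = third′

  ruled : ∀ {a b r s} (p : Fin 3) → Verdict a b (toℕ p) r → ∃[ rs ] Rule a b
    (toℕ p ℕ.+ s) s rs × r ∈ lookup rs p
  ruled 0F first  = _ , ends-at-c₁ , here refl
  ruled 1F second = _ , ends-at-c₂ , here refl
  ruled 2F third  = _ , ends-at-c₃ , here refl
  ruled 2F third′ = _ , ends-at-c₃ , there (here refl)

  -- Escalators and descalators both consist of the diagonals `L`, `L + 1`, `L + 2` modulo `Q = 2n`.
  -- Neighbouring cells differ by one in content, and as `Q ≥ 4` the contents `L - 1` and `L + 3`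
  -- are outside, so a component stays within one band.
  module Band (S : Cell → Set) (L : ℤ)
    (isCell : ∀ {c} → S c → IsCell c)
    (form : ∀ {c} → S c → ∃₂ λ o k → o ℕ.≤ 2 × content c ≡ L + + o + k * Q)
    (member : ∀ {c} o k → IsCell c → o ℕ.≤ 2 → content c ≡ L + + o + k * Q → S c) where

    private
      gap : ∀ {x k o k′} → x ≡ L + + o + k′ * Q → o ℕ.≤ 2
        → x ≢ L - + 1 + k * Q × x ≢ L + + 3 + k * Q
      gap {x} {k} {o} {k′} eq o≤2 = (λ eq′ → too-low eq′ (scale (k - k′))) ,
        (λ eq′ → too-high eq′ (scale (k - k′)))
        where
        diff : (k - k′) * Q ≡ k * Q - k′ * Q
        diff = lemma k k′ Q
          where
          lemma : ∀ k k′ Q → (k - k′) * Q ≡ k * Q - k′ * Q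
          lemma = solve-∀
        too-low : x ≡ L - + 1 + k * Q → Scale (k - k′) → ⊥
        too-low eq′ (below _ s) = lin 8 (λ x L o z z′ Q d n → (x := L :+ o :+ z′) ∷
          (x := L :- # 1 :+ z) ∷ (# 0 :≤ o) ∷ (d := z :- z′) ∷ (d :≤ :- Q) ∷ (Q := n :+ n) ∷
          (# 2 :≤ n) ∷ [] ⊢ :⊥)
          x L (+ o) (k * Q) (k′ * Q) Q ((k - k′) * Q) n′ eq eq′ (+≤+ z≤n) diff s Q≡ 2≤n′
        too-low eq′ (none _ s) = lin 6 (λ x L o z z′ d → (x := L :+ o :+ z′) ∷ (x := L :- # 1 :+ z)
          ∷ (# 0 :≤ o) ∷ (d := z :- z′) ∷ (d := # 0) ∷ [] ⊢ :⊥)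
          x L (+ o) (k * Q) (k′ * Q) ((k - k′) * Q) eq eq′ (+≤+ z≤n) diff s
        too-low eq′ (above _ s) = lin 8 (λ x L o z z′ Q d n → (x := L :+ o :+ z′) ∷
          (x := L :- # 1 :+ z) ∷ (o :≤ # 2) ∷ (d := z :- z′) ∷ (Q :≤ d) ∷ (Q := n :+ n) ∷ (# 2 :≤ n)
          ∷ [] ⊢ :⊥)
          x L (+ o) (k * Q) (k′ * Q) Q ((k - k′) * Q) n′ eq eq′ (+≤+ o≤2) diff s Q≡ 2≤n′
        too-high : x ≡ L + + 3 + k * Q → Scale (k - k′) → ⊥
        too-high eq′ (below _ s) = lin 8 (λ x L o z z′ Q d n → (x := L :+ o :+ z′) ∷
          (x := L :+ # 3 :+ z) ∷ (# 0 :≤ o) ∷ (d := z :- z′) ∷ (d :≤ :- Q) ∷ (Q := n :+ n) ∷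
          (# 2 :≤ n) ∷ [] ⊢ :⊥)
          x L (+ o) (k * Q) (k′ * Q) Q ((k - k′) * Q) n′ eq eq′ (+≤+ z≤n) diff s Q≡ 2≤n′
        too-high eq′ (none _ s) = lin 6 (λ x L o z z′ d → (x := L :+ o :+ z′) ∷ (x := L :+ # 3 :+ z)
          ∷ (o :≤ # 2) ∷ (d := z :- z′) ∷ (d := # 0) ∷ [] ⊢ :⊥)
          x L (+ o) (k * Q) (k′ * Q) ((k - k′) * Q) eq eq′ (+≤+ o≤2) diff s
        too-high eq′ (above _ s) = lin 8 (λ x L o z z′ Q d n → (x := L :+ o :+ z′) ∷
          (x := L :+ # 3 :+ z) ∷ (o :≤ # 2) ∷ (d := z :- z′) ∷ (Q :≤ d) ∷ (Q := n :+ n) ∷ (# 2 :≤ n)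
          ∷ [] ⊢ :⊥)
          x L (+ o) (k * Q) (k′ * Q) Q ((k - k′) * Q) n′ eq eq′ (+≤+ o≤2) diff s Q≡ 2≤n′

    ≢lower : ∀ {c} k → S c → content c ≢ L - + 1 + k * Q
    ≢lower k s = let o , k′ , o≤2 , eq = form s in proj₁ (gap {k = k} {o} {k′} eq o≤2)

    ≢upper : ∀ {c} k → S c → content c ≢ L + + 3 + k * Q
    ≢upper k s = let o , k′ , o≤2 , eq = form s in proj₂ (gap {k = k} {o} {k′} eq o≤2)

    InBand : ℤ → Cell → Set
    InBand k c = L + k * Q ≤ content c × content c ≤ L + + 2 + k * Q

    private
      raise : ∀ {k x y} → y ≡ x + + 1 → y ≢ L + + 3 + k * Q → L + k * Q ≤ x × x ≤ L + + 2 + k * Q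
        → L + k * Q ≤ y × y ≤ L + + 2 + k * Q
      raise {k} {x} {y} eq ne (a , b) = lin 4 (λ x y L z → (y := x :+ # 1) ∷ (L :+ z :≤ x) ∷ []
        ⊢ L :+ z :≤ y) x y L (k * Q) eq a ,
        lin 4 (λ y L z u → (y :< u) ∷ (u := L :+ # 3 :+ z) ∷ [] ⊢ y :≤ L :+ # 2 :+ z) y L (k * Q)
          (L + + 3 + k * Q)
          (ℤ.≤∧≢⇒< (lin 4 (λ x y L z → (y := x :+ # 1) ∷ (x :≤ L :+ # 2 :+ z) ∷ []
            ⊢ y :≤ L :+ # 3 :+ z) x y L (k * Q) eq b) ne) refl

      drop : ∀ {k x y} → y ≡ x + + 1 → x ≢ L - + 1 + k * Q → L + k * Q ≤ y × y ≤ L + + 2 + k * Q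
        → L + k * Q ≤ x × x ≤ L + + 2 + k * Q
      drop {k} {x} {y} eq ne (a , b) = lin 4 (λ x L z u → (u :< x) ∷ (u := L :- # 1 :+ z) ∷ []
        ⊢ L :+ z :≤ x) x L (k * Q) (L - + 1 + k * Q)
          (ℤ.≤∧≢⇒< (lin 4 (λ x y L z → (y := x :+ # 1) ∷ (L :+ z :≤ y) ∷ [] ⊢ L :- # 1 :+ z :≤ x) x
            y L (k * Q) eq a) (ne ∘ sym)) refl ,
        lin 4 (λ x y L z → (y := x :+ # 1) ∷ (y :≤ L :+ # 2 :+ z) ∷ [] ⊢ x :≤ L :+ # 2 :+ z) x y L
          (k * Q) eq b

      right : ∀ i j → + suc j - + i ≡ + j - + i + + 1
      right i j = lin 2 (λ i j → [] ⊢ # 1 :+ j :- i := j :- i :+ # 1) (+ i) (+ j)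

      down : ∀ i j → + j - + i ≡ + j - + suc i + + 1
      down i j = lin 2 (λ i j → [] ⊢ j :- i := j :- (# 1 :+ i) :+ # 1) (+ i) (+ j)

    neighbour-band : ∀ k {c c′} → S c → S c′ → Neighbours c c′ → InBand k c ⇔ InBand k c′
    neighbour-band k s s′ (horizontal {i} {j}) = mk⇔ (raise {k} (right i j) (≢upper k s′))
      (drop {k} (right i j) (≢lower k s))
    neighbour-band k s s′ (vertical {i} {j}) = mk⇔ (drop {k} (down i j) (≢lower k s′))
      (raise {k} (down i j) (≢upper k s))

    connected-band : ∀ k {c c′} → Connected S c c′ → InBand k c → InBand k c′
    connected-band k ε b = b
    connected-band k (Symmetric.fwd (s , s′ , nb) ◅ path) b = connected-band k path
      (Equivalence.to (neighbour-band k s s′ nb) b)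
    connected-band k (Symmetric.bwd (s , s′ , nb) ◅ path) b = connected-band k path
      (Equivalence.from (neighbour-band k s s′ nb) b)

    start-band : ∀ k {c} → content c ≡ L + k * Q → InBand k c
    start-band k {c} eq = ℤ.≤-reflexive (sym eq) , lin 3
      (λ x L z → (x := L :+ z) ∷ [] ⊢ x :≤ L :+ # 2 :+ z) (content c) L (k * Q) eq

    module Start {i j} (k : ℤ) (1≤i : 1 ℕ.≤ i) (1≤j : 1 ℕ.≤ j) (start : + j - + i ≡ L + k * Q) where

      in-row : ∀ o → o ℕ.≤ 2 → S (i , o ℕ.+ j)
      in-row o o≤2 = member o k (1≤i , ℕ.≤-trans 1≤j (ℕ.m≤n+m j o)) o≤2
        (lin 5 (λ i j o L z → (j :- i := L :+ z) ∷ [] ⊢ o :+ j :- i := L :+ o :+ z) (+ i) (+ j)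
          (+ o) L (k * Q) start)

      component : ∀ o → o ℕ.≤ 2 → InComponent S (i , j) (i , o ℕ.+ j)
      component o o≤2 = in-row 0 z≤n , in-row o o≤2 , path o o≤2
        where
        path : ∀ o → o ℕ.≤ 2 → Connected S (i , j) (i , o ℕ.+ j)
        path 0 _ = ε
        path 1 _ = Symmetric.fwd (in-row 0 z≤n , in-row 1 (s≤s z≤n) , horizontal) ◅ ε
        path 2 _ = Symmetric.fwd (in-row 0 z≤n , in-row 1 (s≤s z≤n) , horizontal) ◅ Symmetric.fwd
          (in-row 1 (s≤s z≤n) , in-row 2 ℕ.≤-refl , horizontal) ◅ ε
        path (suc (suc (suc o))) (s≤s (s≤s ()))

      rowTriple : RowTriple S (i , j)
      rowTriple x = mk⇔ fwd′ bwd′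
        where
        bwd′ : x ∈ j ∷ suc j ∷ suc (suc j) ∷ [] → InComponent S (i , j) (i , x)
        bwd′ (here refl) = component 0 z≤n
        bwd′ (there (here refl)) = component 1 (s≤s z≤n)
        bwd′ (there (there (here refl))) = component 2 ℕ.≤-refl
        fwd′ : InComponent S (i , j) (i , x) → x ∈ j ∷ suc j ∷ suc (suc j) ∷ []
        fwd′ (_ , _ , path) = go (x ∸ j) (ℕ.m+[n∸m]≡n j≤x)
          where
          band = connected-band k path (start-band k {i , j} start)
          j≤x : j ℕ.≤ x
          j≤x = ℤ.drop‿+≤+ (lin 5 (λ i j x L z → (j :- i := L :+ z) ∷ (L :+ z :≤ x :- i) ∷ []
            ⊢ j :≤ x) (+ i) (+ j) (+ x) L (k * Q) start (proj₁ band))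
          x≤ : x ℕ.≤ 2 ℕ.+ j
          x≤ = ℤ.drop‿+≤+ (lin 5 (λ i j x L z → (j :- i := L :+ z) ∷ (x :- i :≤ L :+ # 2 :+ z) ∷ []
            ⊢ x :≤ # 2 :+ j) (+ i) (+ j) (+ x) L (k * Q) start (proj₂ band))
          go : ∀ d → j ℕ.+ d ≡ x → x ∈ j ∷ suc j ∷ suc (suc j) ∷ []
          go 0 eq = here (trans (sym eq) (ℕ.+-identityʳ j))
          go 1 eq = there (here (trans (sym eq) (ℕ.+-comm j 1)))
          go 2 eq = there (there (here (trans (sym eq) (ℕ.+-comm j 2))))
          go (suc (suc (suc d))) eq = ⊥-elim (ℕ.<⇒≱ (subst (ℕ._≤ j ℕ.+ suc (suc (suc d)))
            (ℕ.+-comm j 3) (ℕ.+-monoʳ-≤ j (s≤s (s≤s (s≤s z≤n))))) (ℕ.≤-trans (ℕ.≤-reflexive eq) x≤))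

      aboveMain : + 0 < L + k * Q → ∀ c → InComponent S (i , j) c → AboveMain c
      aboveMain pos (a , b) (_ , _ , path) = ℤ.drop‿+<+
        (lin 4 (λ a b L z → (# 0 :< L :+ z) ∷ (L :+ z :≤ b :- a) ∷ [] ⊢ a :< b) (+ a) (+ b) L
        (k * Q) pos
        (proj₁ (connected-band k path (start-band k {i , j} start))))

      sliding-exists : ∀ {a b κ r} (p : Fin 3) → + 0 < L + k * Q → row κ i ≡ toℕ p ℕ.+ j
        → Verdict a b (toℕ p) r →
                       SlidingResidue S a b κ (i , row κ i) r
      sliding-exists {a} {b} {κ} {r} p pos eq V = let rs , rule , r∈ = ruled {s = j} p V in
        subst (λ x → SlidingResidue S a b κ (i , x) r) (sym eq)
          (upper p (aboveMain pos) rowTriple (subst (λ e → Rule a b e j rs) (sym eq) rule) r∈)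

    -- If the first of the three cells had content `L + 1` or `L + 2`, the third or the second would
    -- be at `L + 3`, outside `S`.
    row-start : ∀ {i j} → RowTriple S (i , j) → ∃[ k ] + j - + i ≡ L + k * Q
    row-start {i} {j} triple = go (form (at (here refl)))
      where
      at : ∀ {x} → x ∈ j ∷ suc j ∷ suc (suc j) ∷ [] → S (i , x)
      at {x} p = proj₁ (proj₂ (Equivalence.from (triple x) p))
      go : (∃₂ λ o k → o ℕ.≤ 2 × + j - + i ≡ L + + o + k * Q) → ∃[ k ] + j - + i ≡ L + k * Q
      go (0 , k , _ , eq) = k , trans eq (cong (_+ k * Q) (ℤ.+-identityʳ L))
      go (1 , k , _ , eq) = ⊥-elim (≢upper k (at (there (there (here refl))))
        (lin 4 (λ i j L z → (j :- i := L :+ # 1 :+ z) ∷ [] ⊢ # 2 :+ j :- i := L :+ # 3 :+ z) (+ i)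
          (+ j) L (k * Q) eq))
      go (2 , k , _ , eq) = ⊥-elim (≢upper k (at (there (here refl)))
        (lin 4 (λ i j L z → (j :- i := L :+ # 2 :+ z) ∷ [] ⊢ # 1 :+ j :- i := L :+ # 3 :+ z) (+ i)
          (+ j) L (k * Q) eq))
      go (suc (suc (suc o)) , _ , s≤s (s≤s ()) , _)

    -- A row end with `d ≤ row κ d` is on or above the main diagonal, which rules out the transposed
    -- rule.
    sliding : ∀ {a b κ c r d} → SlidingResidue S a b κ c r → c ≡ (d , row κ d) → d ℕ.≤ row κ d →
              ∃₂ λ p k → Verdict a b p r × + 0 < L + k * Q × content c ≡ L + + p + k * Q
    sliding {κ = κ} {d = d} (upper {i} {j} p abv triple rule r∈) eq d≤ =
      toℕ p , k , verdict p rule end r∈ , pos ,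
      lin 5 (λ i j p L z → (j :- i := L :+ z) ∷ [] ⊢ p :+ j :- i := L :+ p :+ z) (+ i) (+ j)
        (+ toℕ p) L (k * Q) start
      where
      k = proj₁ (row-start triple)
      start = proj₂ (row-start triple)
      i≡d : i ≡ d
      i≡d = cong proj₁ eq
      end : row κ i ≡ toℕ p ℕ.+ j
      end = trans (cong (row κ) i≡d) (sym (cong proj₂ eq))
      pos : + 0 < L + k * Q
      pos = lin 4 (λ i j L z → (i :< j) ∷ (j :- i := L :+ z) ∷ [] ⊢ # 0 :< L :+ z) (+ i) (+ j) L
        (k * Q)
        (+<+ (abv (i , j) (Equivalence.from (triple j) (here refl)))) start
    sliding {κ = κ} {d = d} (lower {i} {j} p blw triple rule r∈) eq d≤ =
      ⊥-elim (ℕ.<⇒≱ (subst₂ ℕ._<_ (cong proj₂ eq) (cong proj₁ eq)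
        (blw (toℕ p ℕ.+ i , j) (Equivalence.from (triple (toℕ p ℕ.+ i)) (at p)))) d≤)
      where
      at : ∀ (p : Fin 3) → toℕ p ℕ.+ i ∈ i ∷ suc i ∷ suc (suc i) ∷ []
      at 0F = here refl
      at 1F = there (here refl)
      at 2F = there (there (here refl))

  private
    at-residue : ∀ {c r} → diagonal n c ≡ r → ∃[ k ] content c ≡ + r + k * Q
    at-residue {c} refl = ‖-divide (content c)

    n∸1≡ : + (n ∸ 1) ≡ n′ - + 1
    n∸1≡ = lin 2 (λ n x → (# 1 :+ x := n) ∷ [] ⊢ x := n :- # 1) n′ (+ (n ∸ 1))
      (cong +_ (ℕ.m+[n∸m]≡n (ℕ.≤-trans (s≤s z≤n) 2≤n)))

    2n∸1≡ : + (2 ℕ.* n ∸ 1) ≡ Q - + 1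
    2n∸1≡ = lin 1 (λ m → [] ⊢ m := # 1 :+ m :- # 1) (+ m)

    n+1≡ : + (n ℕ.+ 1) ≡ n′ + + 1
    n+1≡ = refl

    <2n : ∀ {r} → + r < n′ + n′ → r ℕ.< 2 ℕ.* n
    <2n {r} h = ℤ.drop‿+<+ (subst (+ r <_) (sym 2n≡) h)

    suc-* : ∀ k Q → (k + + 1) * Q ≡ k * Q + Q
    suc-* = solve-∀

    pred-* : ∀ k Q → (k - + 1) * Q ≡ k * Q - Q
    pred-* = solve-∀

  escalator-form : ∀ {c} → EscalatorCell n c → ∃₂ λ o k
    → o ℕ.≤ 2 × content c ≡ n′ - + 1 + + o + k * Q
  escalator-form {c} (_ , inj₁ e) = let k , eq = at-residue {c} e in 0 , k , z≤n ,
    trans eq (trans (cong (_+ k * Q) n∸1≡) (cong (_+ k * Q) (sym (ℤ.+-identityʳ (n′ - + 1)))))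
  escalator-form {c} (_ , inj₂ (inj₁ e)) = let k , eq = at-residue {c} e in 1 , k , s≤s z≤n ,
    lin 3 (λ x n z → (x := n :+ z) ∷ [] ⊢ x := n :- # 1 :+ # 1 :+ z) (content c) n′ (k * Q) eq
  escalator-form {c} (_ , inj₂ (inj₂ e)) = let k , eq = at-residue {c} e in 2 , k , ℕ.≤-refl ,
    lin 3 (λ x n z → (x := n :+ # 1 :+ z) ∷ [] ⊢ x := n :- # 1 :+ # 2 :+ z) (content c) n′
      (k * Q) eq
  escalator-member : ∀ {c} o k → IsCell c → o ℕ.≤ 2 → content c ≡ n′ - + 1 + + o + k * Q
    → EscalatorCell n c
  escalator-member {c} 0 k ic _ eq = ic , inj₁ (‖-unique k
    (<2n (lin 2 (λ n x → (x := n :- # 1) ∷ (# 2 :≤ n) ∷ [] ⊢ x :< n :+ n) n′ (+ (n ∸ 1)) n∸1≡ 2≤n′))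
    (lin 4 (λ x n y z → (x := n :- # 1 :+ # 0 :+ z) ∷ (y := n :- # 1) ∷ [] ⊢ x := y :+ z)
      (content c) n′ (+ (n ∸ 1)) (k * Q) eq n∸1≡))
  escalator-member {c} 1 k ic _ eq = ic , inj₂ (inj₁ (‖-unique k
    (<2n (lin 1 (λ n → (# 2 :≤ n) ∷ [] ⊢ n :< n :+ n) n′ 2≤n′))
    (lin 3 (λ x n z → (x := n :- # 1 :+ # 1 :+ z) ∷ [] ⊢ x := n :+ z) (content c) n′ (k * Q) eq)))
  escalator-member {c} 2 k ic _ eq = ic , inj₂ (inj₂ (‖-unique k
    (<2n (lin 1 (λ n → (# 2 :≤ n) ∷ [] ⊢ n :+ # 1 :< n :+ n) n′ 2≤n′))
    (lin 3 (λ x n z → (x := n :- # 1 :+ # 2 :+ z) ∷ [] ⊢ x := n :+ # 1 :+ z) (content c) n′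
      (k * Q) eq)))
  escalator-member (suc (suc (suc o))) k ic (s≤s (s≤s ())) eq

  module Escalator = Band (EscalatorCell n) (n′ - + 1) proj₁ escalator-form escalator-member

  descalator-form : ∀ {c} → DescalatorCell n c → ∃₂ λ o k
    → o ℕ.≤ 2 × content c ≡ - + 1 + + o + k * Q
  descalator-form {c} (_ , inj₁ e) = let k , eq = at-residue {c} e in 1 , k , s≤s z≤n , eq
  descalator-form {c} (_ , inj₂ (inj₁ e)) = let k , eq = at-residue {c} e in 2 , k , ℕ.≤-refl , eq
  descalator-form {c} (_ , inj₂ (inj₂ e)) = let k , eq = at-residue {c} e in 0 , k + + 1 , z≤n ,
    lin 5 (λ x y z z′ Q → (x := y :+ z) ∷ (y := Q :- # 1) ∷ (z′ := z :+ Q) ∷ []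
      ⊢ x := :- # 1 :+ # 0 :+ z′)
      (content c) (+ (2 ℕ.* n ∸ 1)) (k * Q) ((k + + 1) * Q) Q eq 2n∸1≡ (suc-* k Q)
  descalator-member : ∀ {c} o k → IsCell c → o ℕ.≤ 2 → content c ≡ - + 1 + + o + k * Q
    → DescalatorCell n c
  descalator-member {c} 0 k ic _ eq = ic , inj₂ (inj₂ (‖-unique (k - + 1)
    (<2n (lin 3 (λ n x Q → (x := Q :- # 1) ∷ (Q := n :+ n) ∷ [] ⊢ x :< n :+ n) n′
    (+ (2 ℕ.* n ∸ 1)) Q 2n∸1≡ Q≡))
    (lin 5 (λ x y z z′ Q → (x := :- # 1 :+ # 0 :+ z) ∷ (y := Q :- # 1) ∷ (z′ := z :- Q) ∷ []
      ⊢ x := y :+ z′)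
      (content c) (+ (2 ℕ.* n ∸ 1)) (k * Q) ((k - + 1) * Q) Q eq 2n∸1≡ (pred-* k Q))))
  descalator-member {c} 1 k ic _ eq = ic , inj₁ (‖-unique k
    (<2n (lin 1 (λ n → (# 2 :≤ n) ∷ [] ⊢ # 0 :< n :+ n) n′ 2≤n′)) eq)
  descalator-member {c} 2 k ic _ eq = ic , inj₂ (inj₁ (‖-unique k
    (<2n (lin 1 (λ n → (# 2 :≤ n) ∷ [] ⊢ # 1 :< n :+ n) n′ 2≤n′)) eq))
  descalator-member (suc (suc (suc o))) k ic (s≤s (s≤s ())) eq

  module Descalator = Band (DescalatorCell n) (- + 1) proj₁ descalator-form descalator-member

  private
    content-γ : ∀ d γ → content (d , d ℕ.+ γ) ≡ + γ
    content-γ d γ = lin 2 (λ d γ → [] ⊢ d :+ γ :- d := γ) (+ d) (+ γ)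

  diagonal-γ : ∀ d {γ} → γ ℕ.< 2 ℕ.* n → diagonal n (d , d ℕ.+ γ) ≡ γ
  diagonal-γ d {γ} γ<2n = ‖-unique (+ 0) γ<2n (trans (content-γ d γ) (sym (shift-0 (+ γ) Q)))

  fixedResidue-low : ∀ d {γ} → γ ℕ.≤ n → fixedResidue n (d , d ℕ.+ γ) ≡ γ
  fixedResidue-low d {γ} γ≤n = trans (if-true (ℕ.≤⇒≤ᵇ (subst (ℕ._≤ n) (sym diag) γ≤n))) diag
    where
    diag : diagonal n (d , d ℕ.+ γ) ≡ γ
    diag = diagonal-γ d (<2n (lin 2 (λ n γ → (γ :≤ n) ∷ (# 2 :≤ n) ∷ [] ⊢ γ :< n :+ n) n′ (+ γ)
      (+≤+ γ≤n) 2≤n′))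

  fixedResidue-high : ∀ d {γ} → n ℕ.< γ → γ ℕ.< 2 ℕ.* n → fixedResidue n (d , d ℕ.+ γ) ≡ 2 ℕ.* n ∸ γ
  fixedResidue-high d {γ} n<γ γ<2n = trans (if-false (λ p → ℕ.<⇒≱ n<γ
    (subst (ℕ._≤ n) diag (ℕ.≤ᵇ⇒≤ (diagonal n (d , d ℕ.+ γ)) n p)))) (cong (2 ℕ.* n ∸_) diag)
    where
    diag : diagonal n (d , d ℕ.+ γ) ≡ γ
    diag = diagonal-γ d γ<2n

  private
    -- Every other translate of the contents `n - 1, n, n + 1` leaves the range from 0 to `2n`.
    band₀ : ∀ {γ o k} → γ ℕ.≤ 2 ℕ.* n → o ℕ.≤ 2 → + γ ≡ n′ - + 1 + + o + k * Q → suc γ ≡ n ℕ.+ o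
    band₀ {γ} {o} {k} γ≤2n o≤2 eq = go (scale k)
      where
      γ≤ : + γ ≤ n′ + n′
      γ≤ = subst (+ γ ≤_) 2n≡ (+≤+ γ≤2n)
      go : Scale k → suc γ ≡ n ℕ.+ o
      go (below _ s) = ⊥-elim (lin 5 (λ γ n o z Q → (γ := n :- # 1 :+ o :+ z) ∷ (z :≤ :- Q) ∷
        (Q := n :+ n) ∷ (o :≤ # 2) ∷ (# 0 :≤ γ) ∷ (# 2 :≤ n) ∷ [] ⊢ :⊥) (+ γ) n′ (+ o)
        (k * Q) Q eq s Q≡ (+≤+ o≤2) (+≤+ z≤n) 2≤n′)
      go (none _ s) = ℤ.+-injective (lin 4 (λ γ n o z → (γ := n :- # 1 :+ o :+ z) ∷ (z := # 0) ∷ []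
        ⊢ # 1 :+ γ := n :+ o) (+ γ) n′ (+ o) (k * Q) eq s)
      go (above _ s) = ⊥-elim (lin 5 (λ γ n o z Q → (γ := n :- # 1 :+ o :+ z) ∷ (Q :≤ z) ∷
        (Q := n :+ n) ∷ (# 0 :≤ o) ∷ (γ :≤ n :+ n) ∷ (# 2 :≤ n) ∷ [] ⊢ :⊥) (+ γ) n′ (+ o)
        (k * Q) Q eq s Q≡ (+≤+ z≤n) γ≤ 2≤n′)

  escalator-γ : ∀ {d γ} → γ ℕ.≤ 2 ℕ.* n → EscalatorCell n (d , d ℕ.+ γ)
    → ∃[ o ] o ℕ.≤ 2 × suc γ ≡ n ℕ.+ o
  escalator-γ {d} {γ} γ≤2n S = let o , k , o≤2 , eq = escalator-form S in
    o , o≤2 , band₀ {γ} {o} {k} γ≤2n o≤2 (trans (sym (content-γ d γ)) eq)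

  private
    γ≤2n′ : ∀ {γ} → γ ℕ.≤ 2 ℕ.* n → + γ ≤ n′ + n′
    γ≤2n′ {γ} h = subst (+ γ ≤_) 2n≡ (+≤+ h)

    ≥2n : ∀ {γ} → n′ + n′ ≤ + γ → 2 ℕ.* n ℕ.≤ γ
    ≥2n {γ} h = ℤ.drop‿+≤+ (subst (_≤ + γ) (sym 2n≡) h)

  -- The main descalator ends at content 1, and the next one starts at `2n - 1`.
  descalator-γ : ∀ {d γ} → DescalatorCell n (d , d ℕ.+ γ) → γ ℕ.≤ 1 ⊎ 2 ℕ.* n ℕ.≤ suc γ
  descalator-γ {d} {γ} S = go (proj₁ (proj₂ (descalator-form S)))
    (proj₂ (proj₂ (descalator-form S)))
    where
    o = proj₁ (descalator-form S)
    go : ∀ k → o ℕ.≤ 2 × content (d , d ℕ.+ γ) ≡ - + 1 + + o + k * Q → γ ℕ.≤ 1 ⊎ 2 ℕ.* n ℕ.≤ suc γ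
    go k (o≤2 , eq′) = cases (scale k)
      where
      eq : + γ ≡ - + 1 + + o + k * Q
      eq = trans (sym (content-γ d γ)) eq′
      cases : Scale k → γ ℕ.≤ 1 ⊎ 2 ℕ.* n ℕ.≤ suc γ
      cases (below _ s) = ⊥-elim (lin 5 (λ γ n o z Q → (γ := con (- + 1) :+ o :+ z) ∷ (z :≤ :- Q) ∷
        (Q := n :+ n) ∷ (o :≤ # 2) ∷ (# 0 :≤ γ) ∷ (# 2 :≤ n) ∷ [] ⊢ :⊥)
        (+ γ) n′ (+ o) (k * Q) Q eq s Q≡ (+≤+ o≤2) (+≤+ z≤n) 2≤n′)
      cases (none _ s) = inj₁ (ℤ.drop‿+≤+ (lin 3 (λ γ o z → (γ := con (- + 1) :+ o :+ z) ∷
        (z := # 0) ∷ (o :≤ # 2) ∷ [] ⊢ γ :≤ # 1) (+ γ) (+ o) (k * Q) eq s (+≤+ o≤2)))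
      cases (above _ s) = inj₂ (≥2n (lin 5 (λ γ n o z Q → (γ := con (- + 1) :+ o :+ z) ∷ (Q :≤ z) ∷
        (Q := n :+ n) ∷ (# 0 :≤ o) ∷ [] ⊢ n :+ n :≤ # 1 :+ γ) (+ γ) n′ (+ o) (k * Q) Q eq s Q≡
        (+≤+ z≤n)))

  escalator-cell : ∀ {d γ} o → 1 ℕ.≤ d → o ℕ.≤ 2 → suc γ ≡ n ℕ.+ o → EscalatorCell n (d , d ℕ.+ γ)
  escalator-cell {d} {γ} o 1≤d o≤2 eq = escalator-member o (+ 0)
    (1≤d , ℕ.≤-trans 1≤d (ℕ.m≤m+n d γ)) o≤2
    (trans (content-γ d γ) (lin 4 (λ γ n o z → (# 1 :+ γ := n :+ o) ∷ (z := # 0) ∷ []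
      ⊢ γ := n :- # 1 :+ o :+ z)
      (+ γ) n′ (+ o) (+ 0 * Q) (cong +_ eq) (ℤ.*-zeroˡ Q)))

  descalator-cell : ∀ {d γ} o → 1 ℕ.≤ d → o ℕ.≤ 2 → suc γ ≡ 2 ℕ.* n ℕ.+ o → DescalatorCell n
    (d , d ℕ.+ γ)
  descalator-cell {d} {γ} o 1≤d o≤2 eq = descalator-member o (+ 1)
    (1≤d , ℕ.≤-trans 1≤d (ℕ.m≤m+n d γ)) o≤2
    (trans (content-γ d γ) (lin 5 (λ γ n o Q T → (# 1 :+ γ := T :+ o) ∷ (Q := n :+ n) ∷
      (T := n :+ n) ∷ [] ⊢ γ := con (- + 1) :+ o :+ + 1 :* Q)
      (+ γ) n′ (+ o) Q (+ (2 ℕ.* n)) (cong +_ eq) Q≡ 2n≡))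

  main-cell : ∀ {d γ} → 1 ℕ.≤ d → γ ℕ.≤ 1 → DescalatorCell n (d , d ℕ.+ γ)
  main-cell {d} {γ} 1≤d γ≤1 = descalator-member (suc γ) (+ 0) (1≤d , ℕ.≤-trans 1≤d (ℕ.m≤m+n d γ))
    (s≤s γ≤1)
    (trans (content-γ d γ) (lin 2 (λ γ z → (z := # 0) ∷ [] ⊢ γ := con (- + 1) :+ (# 1 :+ γ) :+ z)
      (+ γ) (+ 0 * Q) (ℤ.*-zeroˡ Q)))

  module RowEnd {κ : Partition} {d γ : ℕ} (1≤d : 1 ℕ.≤ d) (γ≤2n : γ ℕ.≤ 2 ℕ.* n)
    (end : row κ d ≡ d ℕ.+ γ) where

    private
      d≤ : d ℕ.≤ row κ d
      d≤ = subst (d ℕ.≤_) (sym end) (ℕ.m≤m+n d γ)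

    escalator-residue : ∀ {a b r} → SlidingResidue (EscalatorCell n) a b κ (d , row κ d) r
      → ∃[ p ] Verdict a b p r × suc γ ≡ n ℕ.+ p
    escalator-residue {a} {b} {r} sl = go (Escalator.sliding sl refl d≤)
      where
      go : (∃₂ λ p k → Verdict a b p r × + 0 < n′ - + 1 + k * Q × content
        (d , row κ d) ≡ n′ - + 1 + + p + k * Q) →
           ∃[ p ] Verdict a b p r × suc γ ≡ n ℕ.+ p
      go (p , k , V , _ , eq) = p , V , band₀ {γ} {p} {k} γ≤2n (verdict-≤2 V)
        (trans (sym (trans (cong (λ x → content (d , x)) end) (content-γ d γ))) eq)

    -- Above the main diagonal and up to content `2n`, the only band met is that of `k = 1`, with
    -- contents `2n - 1` to `2n + 1`.
    descalator-residue : ∀ {a b r} → SlidingResidue (DescalatorCell n) a b κ (d , row κ d) r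
      → ∃[ p ] Verdict a b p r × suc γ ≡ 2 ℕ.* n ℕ.+ p
    descalator-residue {a} {b} {r} sl = go (Descalator.sliding sl refl d≤)
      where
      go : (∃₂ λ p k → Verdict a b p r × + 0 < - + 1 + k * Q × content
        (d , row κ d) ≡ - + 1 + + p + k * Q) →
           ∃[ p ] Verdict a b p r × suc γ ≡ 2 ℕ.* n ℕ.+ p
      go (p , k , V , pos , eq′) = p , V , cases (scale (k - + 1))
        where
        eq : + γ ≡ - + 1 + + p + k * Q
        eq = trans (sym (trans (cong (λ x → content (d , x)) end) (content-γ d γ))) eq′
        cases : Scale (k - + 1) → suc γ ≡ 2 ℕ.* n ℕ.+ p
        cases (below _ s) = ⊥-elim (lin 3 (λ z z′ Q → (z′ := z :- Q) ∷ (z′ :≤ :- Q) ∷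
          (# 0 :< con (- + 1) :+ z) ∷ [] ⊢ :⊥) (k * Q) ((k - + 1) * Q) Q (pred-* k Q) s pos)
        cases (none _ s) = ℤ.+-injective (lin 7 (λ γ n p z z′ Q T → (γ := con (- + 1) :+ p :+ z) ∷
          (z′ := z :- Q) ∷ (z′ := # 0) ∷ (Q := n :+ n) ∷ (T := n :+ n) ∷ [] ⊢ # 1 :+ γ := T :+ p)
          (+ γ) n′ (+ p) (k * Q) ((k - + 1) * Q) Q (+ (2 ℕ.* n)) eq (pred-* k Q) s Q≡ 2n≡)
        cases (above _ s) = ⊥-elim (lin 6 (λ γ n p z z′ Q → (γ := con (- + 1) :+ p :+ z) ∷
          (z′ := z :- Q) ∷ (Q :≤ z′) ∷ (Q := n :+ n) ∷ (# 0 :≤ p) ∷ (γ :≤ n :+ n) ∷ (# 2 :≤ n) ∷ []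
          ⊢ :⊥)
          (+ γ) n′ (+ p) (k * Q) ((k - + 1) * Q) Q eq (pred-* k Q) s Q≡ (+≤+ z≤n) (γ≤2n′ γ≤2n) 2≤n′)

    escalator-exists : ∀ {a b r} (p : Fin 3) → suc γ ≡ n ℕ.+ toℕ p → Verdict a b (toℕ p) r
      → SlidingResidue (EscalatorCell n) a b κ (d , row κ d) r
    escalator-exists p eq V = Escalator.Start.sliding-exists {d} {d ℕ.+ (n ∸ 1)} (+ 0) 1≤d
      (ℕ.≤-trans 1≤d (ℕ.m≤m+n d _))
      (lin 4 (λ d n x z → (x := n :- # 1) ∷ (z := # 0) ∷ [] ⊢ d :+ x :- d := n :- # 1 :+ z) (+ d) n′
        (+ (n ∸ 1)) (+ 0 * Q) n∸1≡ (ℤ.*-zeroˡ Q))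
      p (lin 2 (λ n z → (z := # 0) ∷ (# 2 :≤ n) ∷ [] ⊢ # 0 :< n :- # 1 :+ z) n′ (+ 0 * Q)
        (ℤ.*-zeroˡ Q) 2≤n′)
      (trans end (ℤ.+-injective (lin 5 (λ d γ n x p → (# 1 :+ γ := n :+ p) ∷ (x := n :- # 1) ∷ []
        ⊢ d :+ γ := p :+ (d :+ x)) (+ d) (+ γ) n′ (+ (n ∸ 1)) (+ toℕ p) (cong +_ eq) n∸1≡)))
      V

    descalator-exists : ∀ {a b r} (p : Fin 3) → suc γ ≡ 2 ℕ.* n ℕ.+ toℕ p → Verdict a b (toℕ p) r
      → SlidingResidue (DescalatorCell n) a b κ (d , row κ d) r
    descalator-exists p eq V = Descalator.Start.sliding-exists {d} {d ℕ.+ (2 ℕ.* n ∸ 1)} (+ 1) 1≤d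
      (ℕ.≤-trans 1≤d (ℕ.m≤m+n d _))
      (lin 3 (λ d x Q → (x := Q :- # 1) ∷ [] ⊢ d :+ x :- d := con (- + 1) :+ + 1 :* Q) (+ d)
        (+ (2 ℕ.* n ∸ 1)) Q 2n∸1≡)
      p (lin 2 (λ n Q → (Q := n :+ n) ∷ (# 2 :≤ n) ∷ [] ⊢ # 0 :< con (- + 1) :+ + 1 :* Q) n′ Q Q≡
        2≤n′)
      (trans end (ℤ.+-injective (lin 7 (λ d γ n x p Q T → (# 1 :+ γ := T :+ p) ∷ (x := Q :- # 1) ∷
        (Q := n :+ n) ∷ (T := n :+ n) ∷ [] ⊢ d :+ γ := p :+ (d :+ x))
        (+ d) (+ γ) n′ (+ (2 ℕ.* n ∸ 1)) (+ toℕ p) Q (+ (2 ℕ.* n)) (cong +_ eq) 2n∸1≡ Q≡ 2n≡)))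
      V

    main-γ : OnMainDescalator n (d , row κ d) → γ ℕ.≤ 1
    main-γ (i , _ , _ , path) = ℤ.drop‿+≤+ (lin 3 (λ γ x z → (x := γ) ∷
      (x :≤ con (- + 1) :+ # 2 :+ z) ∷ (z := # 0) ∷ [] ⊢ γ :≤ # 1)
      (+ γ) (content (d , row κ d)) (+ 0 * Q) (trans (cong (λ x → content (d , x)) end)
        (content-γ d γ)) (proj₂ band) (ℤ.*-zeroˡ Q))
      where
      band : Descalator.InBand (+ 0) (d , row κ d)
      band = Descalator.connected-band (+ 0) path
        (lin 2 (λ i z → (z := # 0) ∷ [] ⊢ con (- + 1) :+ z :≤ i :- i) (+ i) (+ 0 * Q) (ℤ.*-zeroˡ Q)
          ,
         lin 2 (λ i z → (z := # 0) ∷ [] ⊢ i :- i :≤ con (- + 1) :+ # 2 :+ z) (+ i) (+ 0 * Q)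
           (ℤ.*-zeroˡ Q))

    main-exists : γ ≡ 1 → OnMainDescalator n (d , row κ d)
    main-exists refl = d , S₀ , S₁ , Symmetric.fwd (S₀ , S₁ , subst
      (λ x → Neighbours (d , d) (d , x)) (sym (trans end (ℕ.+-comm d 1))) horizontal) ◅ ε
      where
      S₀ : DescalatorCell n (d , d)
      S₀ = subst (λ x → DescalatorCell n (d , x)) (ℕ.+-identityʳ d) (main-cell 1≤d z≤n)
      S₁ : DescalatorCell n (d , row κ d)
      S₁ = subst (λ x → DescalatorCell n (d , x)) (sym end) (main-cell 1≤d ℕ.≤-refl)

-- Row and column add up to `4k + 1` here, and to `4k + 3` in an odd row. Thus the residue at
-- content 1 records the parity of the row number.
mainResidue-even : ∀ k → mainResidue (k ℕ.* 2 , k ℕ.* 2 ℕ.+ 1) ≡ 1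
mainResidue-even k = trans (if-≢ (ℕ.m≢1+m+n (k ℕ.* 2) {0} ∘ λ eq → trans eq
  (trans (ℕ.+-comm (k ℕ.* 2) 1) (cong suc (sym (ℕ.+-identityʳ _))))))
  (if-≡ {b = 1} (trans (cong (ℕ._% 4) (lemma k)) ([m+kn]%n≡m%n 1 k 4)))
  where
  lemma : ∀ k → k ℕ.* 2 ℕ.+ (k ℕ.* 2 ℕ.+ 1) ≡ 1 ℕ.+ k ℕ.* 4
  lemma = ℕ-Solver.solve-∀

mainResidue-odd : ∀ k → mainResidue (suc (k ℕ.* 2) , suc (k ℕ.* 2) ℕ.+ 1) ≡ 0
mainResidue-odd k = trans (if-≢ (ℕ.m≢1+m+n (k ℕ.* 2) {0} ∘ λ eq → trans (ℕ.suc-injective eq)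
  (trans (ℕ.+-comm (k ℕ.* 2) 1) (cong suc (sym (ℕ.+-identityʳ _))))))
  (if-≢ {b = 1} (λ eq → three≢one (trans (sym (trans (cong (ℕ._% 4) (lemma k))
    ([m+kn]%n≡m%n 3 k 4))) eq)))
  where
  three≢one : 3 ≢ 1
  three≢one ()
  lemma : ∀ k → suc (k ℕ.* 2) ℕ.+ (suc (k ℕ.* 2) ℕ.+ 1) ≡ 3 ℕ.+ k ℕ.* 4
  lemma = ℕ-Solver.solve-∀

-- The first bead after the reference diagonal and the generator it forces.

module Peels (t : AffineType) (n : ℕ) (rank : minRank t ℕ.≤ n) where
  open import Data.Integer using (_+_; _-_; _*_; -_; _≤_; _<_)
  open Diagonals t n rank public
  open Cells n 2≤n

  verdict₀ : ∀ {a b r} → Verdict a b 0 r → r ≡ a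
  verdict₀ first = refl

  verdict₁ : ∀ {a b r} → Verdict a b 1 r → r ≡ b
  verdict₁ second = refl

  module Peeled (w : MirroredPermutation n) (R : Representative (toAut w)) where
    open Diagonal w

    -- An upward search, bounded by the known bead at distance `k`.
    first-bead : ∀ k e → Bead v (e + + k) → ∃[ b ] Bead v b × e ≤ b ×
      (∀ {y} → Bead v y → e ≤ y → b ≤ y)
    first-bead k e bead = go k bead (bead? v e)
      where
      go : ∀ k → Bead v (e + + k) → Dec (Bead v e) → ∃[ b ] Bead v b × e ≤ b ×
        (∀ {y} → Bead v y → e ≤ y → b ≤ y)
      go _       _    (yes b) = e , b , ℤ.≤-refl , λ _ e≤y → e≤y
      go zero    bead (no ¬b) = ⊥-elim (¬b (subst (Bead v) (ℤ.+-identityʳ e) bead))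
      go (suc k) bead (no ¬b) =
        let b , B , e<b , least = first-bead k (e + + 1) (subst (Bead v) (lin 2 (λ e k → [] ⊢ e :+ (# 1 :+ k) := e :+ # 1 :+ k) e (+ k)) bead) in
        b , B , ℤ.≤-trans (e≤e+1 e) e<b , λ By e≤y → Sum.[
          (λ y≡e → ⊥-elim (¬b (subst (Bead v) y≡e By))) , least By ]′ (<⊎≡ e≤y)

    -- The map `k ↦ w(k) + N` carries the `k ≤ 0` with `w(k) ≥ 1` onto the beads from `N + 1` on, so
    -- the parity condition at 0 is one on the abacus.
    crossings : variant₀ t ≡ D → 2 ∣ℕ bd (label 0)
    crossings v₀ = go (fromEven (proj₁ (proj₁ R) v₀))
      where
      go : ∃[ k ] Card (Crossing (+ 0) (to v)) k × 2 ∣ℕ k → 2 ∣ℕ bd (label 0)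
      go (k , K , 2∣k) = subst (2 ∣ℕ_) (card-unique K′ (card-bd (label 0))) 2∣k
        where
        f f⁻¹ : ℤ → ℤ
        f x   = to v x + N
        f⁻¹ x = from v (x - N)
        lr : ∀ x → f⁻¹ (f x) ≡ x
        lr x = trans (cong (from v) (lin 2 (λ N y → [] ⊢ y :+ N :- N := y) N (to v x)))
          (from-to v x)
        rl : ∀ x → f (f⁻¹ x) ≡ x
        rl x = trans (cong (_+ N) (to-from v (x - N))) (lin 2 (λ N y → [] ⊢ y :- N :+ N := y) N x)
        from-N : ∀ x → from v x ≡ from v (x - N) + N
        from-N x = trans (cong (from v) (lin 2 (λ N y → [] ⊢ y := y :- N :+ N) N x))
          (from-+N v (x - N))
        K′ : Card (BeadsFrom (label 0)) k
        K′ = card-cong (λ x → mk⇔ (fwd x) (bwd x)) (card-preimage f f⁻¹ lr rl K)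
          where
          fwd : ∀ x → Crossing (+ 0) (to v) (f⁻¹ x) → BeadsFrom (label 0) x
          fwd x (a , b) = label≤ , ent , ℤ.≤∧≢⇒< from≤N (entry≢N (from-entry v ent))
            where
            b′ : + 1 ≤ x - N
            b′ = subst (+ 1 ≤_) (to-from v (x - N)) b
            label≤ : label 0 ≤ x
            label≤ = lin 2 (λ N x → (# 1 :≤ x :- N) ∷ [] ⊢ N :+ (# 1 :+ # 0) :≤ x) N x b′
            from≤N : from v x ≤ N
            from≤N = lin 3 (λ N y z → (y := z :+ N) ∷ (z :≤ # 0) ∷ [] ⊢ y :≤ N) N (from v x) (f⁻¹ x)
              (from-N x) a
            ent : Entry x
            ent (divides q eq) = lin 3 (λ N x y → (y := x) ∷ (y :≤ N) ∷ (# 1 :≤ x :- N) ∷ [] ⊢ :⊥) N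
              x (from v x) unmoved from≤N b′
              where
              unmoved : from v x ≡ x
              unmoved = trans (cong (from v) x≡) (trans (Windows.value-multiple (inverse v) q)
                (sym x≡))
                where
                x≡ : x ≡ + 0 + q * N
                x≡ = trans eq (sym (ℤ.+-identityˡ (q * N)))
          bwd : ∀ x → BeadsFrom (label 0) x → Crossing (+ 0) (to v) (f⁻¹ x)
          bwd x (a , _ , h) = lin 3 (λ N y z → (y := z :+ N) ∷ (y :< N) ∷ [] ⊢ z :≤ # 0) N
            (from v x) (f⁻¹ x) (from-N x) h ,
            subst (+ 1 ≤_) (sym (to-from v (x - N))) (lin 2
              (λ N x → (N :+ (# 1 :+ # 0) :≤ x) ∷ [] ⊢ # 1 :≤ x :- N) N x a)

    reference : ∀ {v₀} → variant₀ t ≡ v₀ → ref ≡ referenceDiagonal v₀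
    reference refl = refl

    -- In variant D the search starts at `N + 2`, one label late. A bead at `N + 1` alone would
    -- still be missed, but it would make the number of beads after `N` odd.
    beads-exist : κ ≢ [] → bd (label ref) ≢ 0
    beads-exist κ≢[] = go (variant₀ t) refl
      where
      go : ∀ v₀ → variant₀ t ≡ v₀ → bd (label ref) ≢ 0
      go C v₀ bd≡0 = κ≢[] (empty (subst (λ r → bd (label r) ≡ 0) (reference v₀) bd≡0))
      go D v₀ bd≡0 = Sum.[ (λ b → odd (ℕ.∣⇒≤ (subst (2 ∣ℕ_) (trans (bd-bead b) (cong suc bd₁≡0))
        (crossings v₀)))) ,
                           (λ g → κ≢[] (empty (trans (bd-nonbead (λ b → ¬bead×gap v b g)) bd₁≡0)))
                             ]′
        (bead⊎gap v (entry-label {0} (ℕ.≤-trans (s≤s z≤n) (ℕ.≤-trans 2≤n (ℕ.m≤m+n n _)))))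
        where
        bd₁≡0 : bd (label 0 + + 1) ≡ 0
        bd₁≡0 = trans (cong bd (label-suc 0)) (subst (λ r → bd (label r) ≡ 0) (reference v₀) bd≡0)
        odd : ¬ 2 ℕ.≤ 1
        odd (s≤s ())

    ref≤1 : ref ℕ.≤ 1
    ref≤1 = go (variant₀ t)
      where
      go : ∀ v → referenceDiagonal v ℕ.≤ 1
      go C = z≤n
      go D = ℕ.≤-refl

    First : ℤ → Set
    First b = Bead v b × label ref ≤ b × (∀ {y} → Bead v y → label ref ≤ y → b ≤ y)

    firstBead : κ ≢ [] → ∃ First
    firstBead κ≢[] = go (card-bd (label ref))
      where
      go : Card (BeadsFrom (label ref)) (bd (label ref)) → ∃ First
      go (card []      _ _ c) = ⊥-elim (beads-exist κ≢[] (sym c))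
      go (card (x ∷ _) _ m _) = first-bead ∣ x - label ref ∣ (label ref)
        (subst (Bead v) (sym x≡) (proj₂ x∈))
        where
        x∈ = ⇒ (m x) (here refl)
        x≡ : label ref + + ∣ x - label ref ∣ ≡ x
        x≡ = trans (cong (λ z → label ref + z) (ℤ.0≤i⇒+∣i∣≡i (ℤ.i≤j⇒0≤j-i (proj₁ x∈))))
          (lin 2 (λ e x → [] ⊢ e :+ (x :- e) := x) (label ref) x)

    -- Flushness puts the first bead within a period of the reference diagonal.
    data Place (b : ℤ) : Set where
      inner : ∀ γ → ref ℕ.≤ γ → γ ℕ.< 2 ℕ.* n → b ≡ label γ → Place b
      outer : variant₀ t ≡ D → b ≡ N + N + + 1 → Place b

    place : ∀ {b} → First b → Place b
    place {b} (bead , ≤b , least) = go (ℕ.<-cmp γ (2 ℕ.* n)) (variant₀ t) refl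
      where
      γ = ∣ b - (N + + 1) ∣
      b≥ : + 0 ≤ b - (N + + 1)
      b≥ = lin 3 (λ N b r → (N :+ (# 1 :+ r) :≤ b) ∷ (# 0 :≤ r) ∷ [] ⊢ # 0 :≤ b :- (N :+ # 1)) N b
        (+ ref) ≤b (+≤+ z≤n)
      γ≡ : + γ ≡ b - (N + + 1)
      γ≡ = ℤ.0≤i⇒+∣i∣≡i b≥
      b≡ : b ≡ label γ
      b≡ = lin 3 (λ N b γ → (γ := b :- (N :+ # 1)) ∷ [] ⊢ b := N :+ (# 1 :+ γ)) N b (+ γ) γ≡
      ref≤γ : ref ℕ.≤ γ
      ref≤γ = ℤ.drop‿+≤+ (lin 4 (λ N b γ r → (γ := b :- (N :+ # 1)) ∷ (N :+ (# 1 :+ r) :≤ b) ∷ []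
        ⊢ r :≤ γ) N b (+ γ) (+ ref) γ≡ ≤b)
      b< : b < label ref + N
      b< = ℤ.≰⇒> λ h → lin 2 (λ N b → (# 0 :< N) ∷ (b :≤ b :- N) ∷ [] ⊢ :⊥) N b 0<N
        (least (bead-flush v bead) (lin 3 (λ N b l → (l :+ N :≤ b) ∷ [] ⊢ l :≤ b :- N) N b
          (label ref) h))
      γ< : + γ < + ref + N
      γ< = lin 4 (λ N b γ r → (γ := b :- (N :+ # 1)) ∷ (b :< N :+ (# 1 :+ r) :+ N) ∷ []
        ⊢ γ :< r :+ N) N b (+ γ) (+ ref) γ≡ b<
      go : _ → ∀ v₀ → variant₀ t ≡ v₀ → Place b
      go (tri< a _ _) v₀ _ = inner γ ref≤γ a b≡
      -- Offset `2n` is the label `2N`, a multiple of `N`. The next label `2N + 1` is within a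
      -- period of the start only when the start is the first diagonal, hence in variant D.
      go (tri≈ _ e _) v₀ _ = ⊥-elim (proj₁ bead (divides (+ 2)
        (trans b≡ (trans (cong label e) (lin 1 (λ N → [] ⊢ N :+ N := + 2 :* N) N)))))
      go (tri> _ _ c) C v₀ = ⊥-elim (ℕ.<⇒≱ c (ℕ.≤-pred (ℤ.drop‿+<+
        (subst (λ r → + γ < + r + N) (reference v₀) γ<))))
      go (tri> _ _ c) D v₀ = outer v₀ (trans b≡ (trans (cong label γ≡2n+1)
        (lin 1 (λ N → [] ⊢ N :+ (# 1 :+ N) := N :+ N :+ # 1) N)))
        where
        γ≡2n+1 : γ ≡ suc (2 ℕ.* n)
        γ≡2n+1 = ℕ.≤-antisym (ℕ.≤-pred (ℤ.drop‿+<+ (subst (λ r → + γ < + r + N) (reference v₀) γ<)))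
          c

    ¬bead-between : ∀ {b} → First b → ∀ {m} → ref ℕ.≤ m → label m < b → ¬ Bead v (label m)
    ¬bead-between (_ , _ , least) {m} r≤m lt bead = ℤ.<⇒≱ lt
      (least bead (ℤ.+-monoʳ-≤ N (+≤+ (s≤s r≤m))))

    d : ℕ
    d = referenceBoxes t n κ

    bd-first : ∀ {b} → First b → d ≡ bd b
    bd-first {b} (bead , ≤b , least) = trans (referenceBoxes≡ (1≤label ref)
      (corner-label ref (ℕ.≤-trans ref≤1 (ℕ.≤-trans (s≤s z≤n) (ℕ.≤-trans 2≤n (ℕ.m≤m+n n _))))))
      (card-unique (card-bd (label ref)) (card-cong (λ x → mk⇔ (λ (p , h) → ℤ.≤-trans ≤b p , h)
        (λ (p , h) → least h p , h)) (card-bd b)))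

    Box : Cell
    Box = d , row κ d

    HasRes : ℕ → Set
    HasRes = HasResidue t n κ Box

    -- All sources of a residue for the last box of row `d`, with the geometry reduced to its
    -- content `γ`, so that uniqueness of the residue becomes arithmetic.
    data Known (γ : ℕ) : ℕ → Set where
      esc  : ∀ {r} → variantₙ t ≡ D → ∀ p → Verdict (n ∸ 1) n p r → suc γ ≡ n ℕ.+ p → Known γ r
      desc : ∀ {r} → variant₀ t ≡ D → ∀ p → Verdict 1 0 p r → suc γ ≡ 2 ℕ.* n ℕ.+ p → Known γ r
      main : ∀ {r} → variant₀ t ≡ D → γ ℕ.≤ 1 → r ≡ mainResidue (d , d ℕ.+ γ) → Known γ r
      fix  : ∀ {r} → (variantₙ t ≡ D → ¬ EscalatorCell n (d , d ℕ.+ γ)) →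
             (variant₀ t ≡ D → ¬ DescalatorCell n (d , d ℕ.+ γ)) → r ≡ fixedResidue n (d , d ℕ.+ γ)
               → Known γ r

    -- What a step needs of its generator. `forced` turns an arbitrary run into this one. `moves`
    -- and `box` serve the generators of variant D, which remove two boxes: `moves` places the bead
    -- exactly, and `δ` is the content of the box to record.
    record Peelable : Set where
      field
        b         : ℤ
        γ         : ℕ
        i         : Fin (suc n)
        bead      : Bead v b
        1≤b       : + 1 ≤ b
        d≡        : d ≡ bd b
        corner    : ∀ w′ → Diagonal.Corner w′ b (+ γ)
        end       : row κ d ≡ d ℕ.+ γ
        down      : generator t n i b < b
        gap       : ¬ Bead v (generator t n i b)
        descent   : from v (high i) < from v (low i)
        residue   : HasRes (toℕ i)
        tie       : HasRes (n ∸ 1) → HasRes n → toℕ i ≡ n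
        forced    : ∀ r → HasRes r → (HasRes (n ∸ 1) → HasRes n → r ≡ n) → r ≡ toℕ i
        moves     : (variant₀ t ≡ D × toℕ i ≡ 0) ⊎ (variantₙ t ≡ D × toℕ i ≡ n) →
                    (∀ {x} → Bead v x → b ≤ x ⇔ generator t n i b ≤ generator t n i x) ×
                    (∀ w′ → Diagonal.Corner w′ (generator t n i b) (+ γ - + 2)) ×
                    + 1 ≤ generator t n i b × 1 ℕ.≤ γ
        box       : (variant₀ t ≡ D × toℕ i ≡ 0 → ∃[ δ ] (δ ≡ γ ⊎ suc δ ≡ γ) × δ ≢ 0 × δ ≢ 2 ℕ.* n)
          ×
                    (variantₙ t ≡ D × toℕ i ≡ n → ∃[ δ ] (δ ≡ γ ⊎ suc δ ≡ γ) × δ ≢ n)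

    -- `b` is the upper point of an exchanged pair, either a translate of the pair or of its mirror
    -- image.
    data Side (b p q : ℤ) : Set where
      plus  : ∀ k → b ≡ q + k * N → Side b p q
      minus : ∀ k → b ≡ - p + k * N → Side b p q

    partner : ∀ {b p q} → Side b p q → ℤ
    partner {b} {p} {q} (plus k _)  = p + k * N
    partner {b} {p} {q} (minus k _) = - q + k * N

    partner-≡ : ∀ {i b p q} → Kind i p q → (σ : Side b p q) → generator t n i b ≡ partner σ
    partner-≡ {i} {b} {p} {q} K (plus k eq) = trans (cong (generator t n i) eq)
      (trans (generator-shift i q k) (cong (_+ k * N) (generator-high K)))
    partner-≡ {i} {b} {p} {q} K (minus k eq) = trans (cong (generator t n i) eq)
      (trans (generator-shift i (- p) k) (cong (_+ k * N)
        (trans (generator-neg i p) (cong -_ (generator-low K)))))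

    partner-< : ∀ {i b p q} → Kind i p q → (σ : Side b p q) → partner σ < b
    partner-< {i} {b} {p} {q} K (plus k eq) = lin 4 (λ b p q z → (b := q :+ z) ∷ (p :< q) ∷ []
      ⊢ p :+ z :< b) b p q (k * N) eq (low<high K)
    partner-< {i} {b} {p} {q} K (minus k eq) = lin 4 (λ b p q z → (b := :- p :+ z) ∷ (p :< q) ∷ []
      ⊢ :- q :+ z :< b) b p q (k * N) eq (low<high K)

    -- `w⁻¹` is below `N` at the bead and above `N` at the gap under it, so it descends along this
    -- pair, and with it along the pair of the generator.
    descent-at : ∀ {i b p q} → Kind i p q → (σ : Side b p q) → Bead v b → Gap v (partner σ) → from v
      (high i) < from v (low i)
    descent-at {i} {b} {p} {q} K σ (_ , fb) g = subst₂ (λ x y → from v x < from v y)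
      (sym (high-≡ K)) (sym (low-≡ K)) (go σ g)
      where
      go : (σ : Side b p q) → Gap v (partner σ) → from v q < from v p
      go (plus k eq) (_ , fg) = lin 6 (λ N x y P Q z → (x :< N) ∷ (N :< y) ∷ (x := Q :+ z) ∷
        (y := P :+ z) ∷ [] ⊢ Q :< P)
        N (from v b) (from v (p + k * N)) (from v p) (from v q) (k * N) fb fg
          (trans (cong (from v) eq) (from-shift v k q)) (from-shift v k p)
      go (minus k eq) (_ , fg) = lin 6 (λ N x y P Q z → (x :< N) ∷ (N :< y) ∷ (x := :- P :+ z) ∷
        (y := :- Q :+ z) ∷ [] ⊢ Q :< P)
        N (from v b) (from v (- q + k * N)) (from v p) (from v q) (k * N) fb fg
        (trans (cong (from v) eq) (trans (from-shift v k (- p)) (cong (_+ k * N) (from-neg v p))))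
        (trans (from-shift v k (- q)) (cong (_+ k * N) (from-neg v q)))

    module At {b} (F : First b) {γ : ℕ} (γ≤2n : γ ℕ.≤ 2 ℕ.* n)
      (corner : ∀ w′ → Diagonal.Corner w′ b (+ γ)) where

      bead-b : Bead v b
      bead-b = proj₁ F

      1≤b : + 1 ≤ b
      1≤b = ℤ.≤-trans (1≤label ref) (proj₁ (proj₂ F))

      d≡ : d ≡ bd b
      d≡ = bd-first F

      1≤d : 1 ℕ.≤ d
      1≤d = subst (1 ℕ.≤_) (sym (trans d≡ (bd-bead bead-b))) (s≤s z≤n)

      end : row κ d ≡ d ℕ.+ γ
      end = trans (cong (row κ) d≡) (trans (row-at-bead 1≤b bead-b)
        (trans (ℤ.+-injective (corner w)) (cong (ℕ._+ γ) (sym d≡))))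

      open RowEnd {κ} {d} {γ} 1≤d γ≤2n end public

      known : ∀ {r} → HasRes r → Known γ r
      known (escalator v₁ sl) = let p , V , eq = escalator-residue sl in esc v₁ p V eq
      known (descalator v₁ sl) = let p , V , eq = descalator-residue sl in desc v₁ p V eq
      known (main-descalator v₁ om) = main v₁ (main-γ om) (cong (λ x → mainResidue (d , x)) end)
      known (fixed _ ¬e ¬d) = fix (λ v₁ → subst (λ x → ¬ EscalatorCell n (d , x)) end (¬e v₁))
        (λ v₁ → subst (λ x → ¬ DescalatorCell n (d , x)) end (¬d v₁))
          (cong (λ x → fixedResidue n (d , x)) end)

      has-fixed : ∀ {r} → (variantₙ t ≡ D → ¬ EscalatorCell n (d , d ℕ.+ γ)) →
        (variant₀ t ≡ D → ¬ DescalatorCell n (d , d ℕ.+ γ)) →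
                  fixedResidue n (d , d ℕ.+ γ) ≡ r → HasRes r
      has-fixed ¬e ¬d eq = subst HasRes (trans (cong (λ x → fixedResidue n (d , x)) end) eq)
        (fixed (1≤d , ℕ.≤-trans 1≤d (ℕ.≤-trans (ℕ.m≤m+n d γ) (ℕ.≤-reflexive (sym end))))
          (λ v₁ → subst (λ x → ¬ EscalatorCell n (d , x)) (sym end) (¬e v₁))
          (λ v₁ → subst (λ x → ¬ DescalatorCell n (d , x)) (sym end) (¬d v₁)))

      has-main : ∀ {r} → variant₀ t ≡ D → γ ≡ 1 → mainResidue (d , d ℕ.+ γ) ≡ r → HasRes r
      has-main v₀ γ≡1 eq = subst HasRes (trans (cong (λ x → mainResidue (d , x)) end) eq)
        (main-descalator v₀ (main-exists γ≡1))

      -- The second alternative for a known residue is the tie: the box also has residue `n - 1`,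
      -- and the procedure takes `n`.
      peelable : ∀ i {p q} (K : Kind i p q) (σ : Side b p q) → Gap v (partner σ) → HasRes (toℕ i) →
        (∀ {r} → Known γ r → r ≡ toℕ i ⊎ toℕ i ≡ n × HasRes (n ∸ 1)) →
        ((variant₀ t ≡ D × toℕ i ≡ 0) ⊎ (variantₙ t ≡ D × toℕ i ≡ n) →
           (∀ {x} → Bead v x → b ≤ x ⇔ partner σ ≤ generator t n i x) ×
             (∀ w′ → Diagonal.Corner w′ (partner σ) (+ γ - + 2)) × + 1 ≤ partner σ × 1 ℕ.≤ γ) →
        ((variant₀ t ≡ D × toℕ i ≡ 0 → ∃[ δ ] (δ ≡ γ ⊎ suc δ ≡ γ) × δ ≢ 0 × δ ≢ 2 ℕ.* n) ×
           (variantₙ t ≡ D × toℕ i ≡ n → ∃[ δ ] (δ ≡ γ ⊎ suc δ ≡ γ) × δ ≢ n)) → Peelable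
      peelable i {p} {q} K σ g res uniq moves box = record
        { b = b ; γ = γ ; i = i ; bead = bead-b ; 1≤b = 1≤b ; d≡ = d≡ ; corner = corner ; end = end
        ; down = subst (_< b) (sym s≡) (partner-< K σ)
        ; gap = λ B → ¬bead×gap v (subst (Bead v) s≡ B) g
        ; descent = descent-at K σ bead-b g
        ; residue = res
        ; tie = λ _ hn → Sum.[ sym , proj₁ ]′ (uniq (known hn))
        ; forced = λ r h tie → Sum.[ id , (λ (i≡n , h′) → trans (tie h′ (subst HasRes i≡n res))
          (sym i≡n)) ]′ (uniq (known h))
        ; moves = λ s → let m , c , o , l = moves s in
            (λ {x} B → subst (λ y → b ≤ x ⇔ y ≤ generator t n i x) (sym s≡) (m B)) ,
            (λ w′ → subst (λ y → Diagonal.Corner w′ y (+ γ - + 2)) (sym s≡) (c w′)) , subst (+ 1 ≤_)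
              (sym s≡) o , l
        ; box = box
        }
        where
        s≡ : generator t n i b ≡ partner σ
        s≡ = partner-≡ K σ

    -- No exchanged pair straddles `h`. The bounds on `p` and `q` say so for the translates of the
    -- pair; among the mirrored pairs, `m` marks the first one above `h`.
    half-line : ∀ {p q x y} h m → h < p → p < q → q - N ≤ h → h < - q + m * N → - p + m * N - N ≤ h
      → Swap p q x y → x ≤ h → y ≤ h
    half-line h m a b c e f (stay refl) x≤h = x≤h
    half-line {p} {q} {x} {y} h m a b c e f (↑ k eq eq′) x≤h = go (scale k)
      where
      above-h : + 0 ≤ k * N → y ≤ h
      above-h s = ⊥-elim (lin 4 (λ h p x z → (h :< p) ∷ (x := p :+ z) ∷ (# 0 :≤ z) ∷ (x :≤ h) ∷ []
        ⊢ :⊥) h p x (k * N) a eq s x≤h)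
      go : Scale k → y ≤ h
      go (below _ s) = lin 5 (λ h q y z N → (y := q :+ z) ∷ (z :≤ :- N) ∷ (q :- N :≤ h) ∷ []
        ⊢ y :≤ h) h q y (k * N) N eq′ s c
      go (none _ s)  = above-h (ℤ.≤-reflexive (sym s))
      go (above _ s) = above-h (ℤ.≤-trans (ℤ.<⇒≤ 0<N) s)
    half-line {p} {q} {x} {y} h m a b c e f (↓ k eq eq′) x≤h = lin 6
      (λ h p q x y z → (p :< q) ∷ (x := q :+ z) ∷ (y := p :+ z) ∷ (x :≤ h) ∷ [] ⊢ y :≤ h) h p q x y
      (k * N) b eq eq′ x≤h
    half-line {p} {q} {x} {y} h m a b c e f (-↑ k eq eq′) x≤h = go (scale (k - m))
      where
      diff : (k - m) * N ≡ k * N - m * N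
      diff = lemma k m N
        where
        lemma : ∀ k m N → (k - m) * N ≡ k * N - m * N
        lemma = solve-∀
      above-h : + 0 ≤ (k - m) * N → y ≤ h
      above-h s = ⊥-elim (lin 6 (λ h q x z u v → (h :< :- q :+ u) ∷ (x := :- q :+ z) ∷ (v := z :- u)
        ∷ (# 0 :≤ v) ∷ (x :≤ h) ∷ [] ⊢ :⊥)
        h q x (k * N) (m * N) ((k - m) * N) e eq diff s x≤h)
      go : Scale (k - m) → y ≤ h
      go (below _ s) = lin 7 (λ h p y z u v N → (y := :- p :+ z) ∷ (v := z :- u) ∷ (v :≤ :- N) ∷
        (:- p :+ u :- N :≤ h) ∷ [] ⊢ y :≤ h)
        h p y (k * N) (m * N) ((k - m) * N) N eq′ diff s f
      go (none _ s)  = above-h (ℤ.≤-reflexive (sym s))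
      go (above _ s) = above-h (ℤ.≤-trans (ℤ.<⇒≤ 0<N) s)
    half-line {p} {q} {x} {y} h m a b c e f (-↓ k eq eq′) x≤h = lin 6
      (λ h p q x y z → (p :< q) ∷ (x := :- p :+ z) ∷ (y := :- q :+ z) ∷ (x :≤ h) ∷ [] ⊢ y :≤ h) h p
      q x y (k * N) b eq eq′ x≤h

    half-line-shift : ∀ i {h} j → (∀ x → x ≤ h → generator t n i x ≤ h) → ∀ x → x ≤ h + j * N
      → generator t n i x ≤ h + j * N
    half-line-shift i {h} j stable x x≤ = lin 5 (λ h x′ y y′ z → (y′ := y :+ z) ∷ (y :≤ h) ∷ []
      ⊢ y′ :≤ h :+ z) h x′ (generator t n i x′) (generator t n i x) (j * N)
      (trans (cong (generator t n i) (lin 2 (λ x z → [] ⊢ x := x :- z :+ z) x (j * N)))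
        (generator-shift i x′ j))
      (stable x′ (lin 3 (λ x h z → (x :≤ h :+ z) ∷ [] ⊢ x :- z :≤ h) x h (j * N) x≤))
      where
      x′ = x - j * N

    -- The points moved around 0 are `-2, -1, 1, 2`, and the cut is just before them.
    -- `half-line-lastD` cuts just before `n - 1, …, n + 2`.
    half-line-zeroD : ∀ {i} → toℕ i ≡ 0 → variant₀ t ≡ D → ∀ x → x ≤ - + 3
      → generator t n i x ≤ - + 3
    half-line-zeroD {i} i≡0 v₀ x = half-line {x = x} (- + 3) (+ 0) (-<- (s≤s (s≤s z≤n))) -<+
      (lin 1 (λ N → (# 5 :≤ N) ∷ [] ⊢ # 1 :- N :≤ con (- + 3)) N 5≤N)
      (lin 1 (λ z → (z := # 0) ∷ [] ⊢ con (- + 3) :< :- # 1 :+ z) (+ 0 * N) (ℤ.*-zeroˡ N))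
      (lin 2 (λ N z → (# 5 :≤ N) ∷ (z := # 0) ∷ [] ⊢ :- con (- + 2) :+ z :- N :≤ con (- + 3)) N
        (+ 0 * N) 5≤N (ℤ.*-zeroˡ N))
      (generator-swap (zeroD {i} i≡0 v₀) x)

    half-line-lastD : ∀ {i} → toℕ i ≡ n → variantₙ t ≡ D → ∀ x → x ≤ n₊ - + 2
      → generator t n i x ≤ n₊ - + 2
    half-line-lastD {i} i≡n vₙ x = half-line {x = x} (n₊ - + 2) (+ 1)
      (lin 1 (λ n → [] ⊢ n :- # 2 :< n :- # 1) n₊) (low<high (lastD {i} i≡n vₙ))
      (lin 2 (λ N n → (N := # 1 :+ (n :+ n)) ∷ (# 2 :≤ n) ∷ [] ⊢ # 1 :+ n :- N :≤ n :- # 2) N n₊ N≡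
        (+≤+ 2≤n))
      (lin 2 (λ N n → (N := # 1 :+ (n :+ n)) ∷ [] ⊢ n :- # 2 :< :- (# 1 :+ n) :+ + 1 :* N) N n₊ N≡)
      (lin 2 (λ N n → (N := # 1 :+ (n :+ n)) ∷ (# 2 :≤ n) ∷ []
        ⊢ :- (n :- # 1) :+ + 1 :* N :- N :≤ n :- # 2) N n₊ N≡ (+≤+ 2≤n))
      (generator-swap (lastD {i} i≡n vₙ) x)

    -- For `x ≤ h` both sides fail because `s` keeps this half-line. What remains is to compare the
    -- beads past a cut just below the moved points.
    ordered : ∀ i {b c h} → generator t n i b ≡ c → h < b → h < c →
      (∀ x → x ≤ h → generator t n i x ≤ h) →
              (∀ {x} → Bead v x → h < x → h < generator t n i x → b ≤ x ⇔ c ≤ generator t n i x) →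
              ∀ {x} → Bead v x → b ≤ x ⇔ c ≤ generator t n i x
    ordered i {b} {c} {h} sb h<b h<c stable far {x} B = go (x ℤ.≤? h)
      where
      go : Dec (x ≤ h) → b ≤ x ⇔ c ≤ generator t n i x
      go (yes x≤h) = mk⇔ (λ b≤x → ⊥-elim (ℤ.<⇒≱ h<b (ℤ.≤-trans b≤x x≤h)))
        (λ c≤sx → ⊥-elim (ℤ.<⇒≱ h<c (ℤ.≤-trans c≤sx (stable x x≤h))))
      go (no x≰h) = far B (ℤ.≰⇒> x≰h) (ℤ.≰⇒> λ sx≤h → x≰h
        (subst (_≤ h) (generator-involutive i x) (stable _ sx≤h)))

    2n≥4 : + 4 ≤ + (2 ℕ.* n)
    2n≥4 = lin 2 (λ n T → (T := n :+ n) ∷ (# 2 :≤ n) ∷ [] ⊢ # 4 :≤ T) n₊ (+ (2 ℕ.* n)) 2n≡ (+≤+ 2≤n)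

    1≤2n : 1 ℕ.≤ 2 ℕ.* n
    1≤2n = ℕ.≤-trans 1≤n (ℕ.m≤m+n n _)

    D≢C : ∀ {v} → v ≡ D → v ≢ C
    D≢C v≡D v≡C = C≢D v≡C v≡D

    odd-half : ∀ {d} → 2 ∣ℕ suc d → ∃[ k ] d ≡ suc (k ℕ.* 2)
    odd-half (ℕ.divides (suc k) eq) = k , ℕ.suc-injective eq

    even-half : ∀ {d} → 2 ∣ℕ d → ∃[ k ] d ≡ k ℕ.* 2
    even-half (ℕ.divides k eq) = k , eq

    module Inner {b} (F : First b) {γ} (ref≤γ : ref ℕ.≤ γ) (γ<2n : γ ℕ.< 2 ℕ.* n)
      (b≡ : b ≡ label γ) where

      open At F (ℕ.<⇒≤ γ<2n) (λ w′ → subst (λ e → Diagonal.Corner w′ e (+ γ)) (sym b≡)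
        (Diagonal.corner-label w′ γ (ℕ.<⇒≤ γ<2n)))

      gap-below : ∀ {m} → ref ℕ.≤ m → m ℕ.< γ → Gap v (label m)
      gap-below {m} r≤m m<γ = Sum.[ (λ B → ⊥-elim (¬bead-between F r≤m
        (subst (label m <_) (sym b≡) (ℤ.+-monoʳ-< N (+<+ (s≤s m<γ)))) B)) , id ]′
        (bead⊎gap v (entry-label (ℕ.<-trans m<γ γ<2n)))

      far-bead : ∀ {x} → Bead v x → label ref ≤ x → b ≤ x
      far-bead = proj₂ (proj₂ F)

      ¬desc-mid : 2 ℕ.≤ γ → suc γ ℕ.< 2 ℕ.* n → ¬ DescalatorCell n (d , d ℕ.+ γ)
      ¬desc-mid 2≤γ γ< S = Sum.[ ℕ.<⇒≱ 2≤γ , ℕ.<⇒≱ γ< ]′ (descalator-γ S)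

      -- `s₀ᶜ` moves the bead at `N + 1` to `N - 1`, its reflection about `N` and hence a gap.
      case-0 : γ ≡ 0 → variant₀ t ≡ C → Peelable
      case-0 refl v₀ = peelable zeroᶠ (zeroC refl v₀) (plus (+ 1)
        (trans b≡ (lin 1 (λ N → [] ⊢ N :+ (# 1 :+ # 0) := # 1 :+ + 1 :* N) N)))
        (subst (Gap v) (trans (cong reflected b≡) (lin 1
          (λ N → [] ⊢ N :+ N :- (N :+ (# 1 :+ # 0)) := con (- + 1) :+ + 1 :* N) N))
          (bead-reflected v bead-b))
        (has-fixed (λ _ S → let o , _ , eq = escalator-γ (ℕ.<⇒≤ γ<2n) S in no-esc eq) (λ v → ⊥-elim (D≢C v v₀)) (fixedResidue-low d z≤n))
        uniq
        Sum.[ (λ (v , _) → ⊥-elim (D≢C v v₀)) , (λ (_ , e) → ⊥-elim (n≢0 (sym e))) ]′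
        ((λ (v , _) → ⊥-elim (D≢C v v₀)) , (λ (_ , e) → ⊥-elim (n≢0 (sym e))))
        where
        no-esc : ∀ {p} → 1 ≢ n ℕ.+ p
        no-esc {p} eq = ℕ.<⇒≱ (s≤s (s≤s z≤n)) (ℕ.≤-trans 2≤n
          (ℕ.≤-trans (ℕ.m≤m+n n p) (ℕ.≤-reflexive (sym eq))))
        uniq : ∀ {r} → Known 0 r → r ≡ 0 ⊎ 0 ≡ n × HasRes (n ∸ 1)
        uniq (esc _ p _ eq) = ⊥-elim (no-esc eq)
        uniq (desc v _ _ _) = ⊥-elim (D≢C v v₀)
        uniq (main v _ _)   = ⊥-elim (D≢C v v₀)
        uniq (fix _ _ eq)   = inj₁ (trans eq (fixedResidue-low d z≤n))

      -- `N + 1` and `N + 2` both carry beads, and `s₀ᴰ` moves them to `N - 2` and `N - 1`. There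
      -- are `d + 1` beads from `N + 1` on, an even number, so `d` is odd and the box has residue 0.
      case-1 : γ ≡ 1 → variant₀ t ≡ D → Bead v (label 0) → Peelable
      case-1 refl v₀ B₀ = peelable zeroᶠ K σ g (has-main v₀ refl main≡0) uniq
        (λ _ → (λ {x} → order {x}) , (λ w′ → subst (λ e → Diagonal.Corner w′ e (- + 1))
          (sym partner≡) (Diagonal.corner-N-1 w′)) ,
          lin 3 (λ N n x → (N := # 1 :+ (n :+ n)) ∷ (# 2 :≤ n) ∷ (x := N :- # 1) ∷ [] ⊢ # 1 :≤ x) N
            n₊ (partner σ) N≡ (+≤+ 2≤n) partner≡ , ℕ.≤-refl)
        ((λ _ → 1 , inj₁ refl , (λ ()) , λ eq → lin 1 (λ T → (# 4 :≤ T) ∷ (# 1 := T) ∷ [] ⊢ :⊥)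
          (+ (2 ℕ.* n)) 2n≥4 (cong +_ eq)) ,
         (λ (_ , e) → ⊥-elim (n≢0 (sym e))))
        where
        K = zeroD {zeroᶠ} refl v₀
        b≡N+2 : b ≡ N + + 2
        b≡N+2 = trans b≡ (lin 1 (λ N → [] ⊢ N :+ (# 1 :+ # 1) := N :+ # 2) N)
        σ : Side b (- + 2) (+ 1)
        σ = minus (+ 1) (trans b≡N+2 (lin 1 (λ N → [] ⊢ N :+ # 2 := # 2 :+ + 1 :* N) N))
        partner≡ : partner σ ≡ N - + 1
        partner≡ = lin 1 (λ N → [] ⊢ :- # 1 :+ + 1 :* N := N :- # 1) N
        g : Gap v (partner σ)
        g = subst (Gap v) (trans (lin 1 (λ N → [] ⊢ N :+ N :- (N :+ (# 1 :+ # 0)) := N :- # 1) N)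
          (sym partner≡)) (bead-reflected v B₀)
        d-odd : ∃[ k ] d ≡ suc (k ℕ.* 2)
        d-odd = odd-half (subst (2 ∣ℕ_) (trans (bd-bead B₀)
          (cong suc (trans (cong bd (trans (label-suc 0) (sym b≡))) (sym d≡)))) (crossings v₀))
        main≡0 : mainResidue (d , d ℕ.+ 1) ≡ 0
        main≡0 = subst (λ d → mainResidue (d , d ℕ.+ 1) ≡ 0) (sym (proj₂ d-odd))
          (mainResidue-odd (proj₁ d-odd))
        uniq : ∀ {r} → Known 1 r → r ≡ 0 ⊎ 0 ≡ n × HasRes (n ∸ 1)
        uniq (esc vₙ p _ eq) = ⊥-elim (ℕ.<⇒≱ (s≤s (s≤s (s≤s z≤n)))
          (ℕ.≤-trans (rank₃-ₙ t rank vₙ) (ℕ.≤-trans (ℕ.m≤m+n n p) (ℕ.≤-reflexive (sym eq)))))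
        uniq (desc _ p _ eq) = ⊥-elim (lin 2 (λ T p → (# 4 :≤ T) ∷ (# 0 :≤ p) ∷ (# 2 := T :+ p) ∷ []
          ⊢ :⊥) (+ (2 ℕ.* n)) (+ p) 2n≥4 (+≤+ z≤n) (cong +_ eq))
        uniq (main _ _ eq)   = inj₁ (trans eq main≡0)
        uniq (fix _ ¬d _)    = ⊥-elim (¬d v₀ (main-cell 1≤d ℕ.≤-refl))
        s : ℤ → ℤ
        s = generator t n zeroᶠ
        sb : s b ≡ partner σ
        sb = partner-≡ K σ
        h = - + 3 + + 1 * N
        h≡ : h ≡ N - + 3
        h≡ = lin 1 (λ N → [] ⊢ con (- + 3) :+ + 1 :* N := N :- # 3) N
        s-N+1 : s (N + + 1) ≡ N - + 2
        s-N+1 = trans (cong s (lin 1 (λ N → [] ⊢ N :+ # 1 := # 1 :+ + 1 :* N) N))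
          (trans (generator-shift zeroᶠ (+ 1) (+ 1))
          (trans (cong (_+ + 1 * N) (generator-high K))
            (lin 1 (λ N → [] ⊢ con (- + 2) :+ + 1 :* N := N :- # 2) N)))
        order : ∀ {x} → Bead v x → b ≤ x ⇔ partner σ ≤ s x
        order = ordered zeroᶠ sb
          (lin 3 (λ N h b → (h := N :- # 3) ∷ (b := N :+ # 2) ∷ [] ⊢ h :< b) N h b h≡ b≡N+2)
          (lin 3 (λ N h c → (h := N :- # 3) ∷ (c := N :- # 1) ∷ [] ⊢ h :< c) N h
            (partner σ) h≡ partner≡)
          (half-line-shift zeroᶠ (+ 1) (half-line-zeroD refl v₀)) far
          where
          far : ∀ {x} → Bead v x → h < x → h < s x → b ≤ x ⇔ partner σ ≤ s x
          far {x} B h<x h<sx = mk⇔ fwd bwd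
            where
            not-N-2 : x ≢ N + + 1 → s x ≢ N - + 2
            not-N-2 ne eq = ne (to-injective (gen zeroᶠ) (trans eq (sym s-N+1)))
            fwd : b ≤ x → partner σ ≤ s x
            fwd b≤x = lin 4 (λ N c y u → (c := N :- # 1) ∷ (u :< y) ∷ (u := N :- # 2) ∷ [] ⊢ c :≤ y)
              N (partner σ) (s x) (N - + 2) partner≡
              (ℤ.≤∧≢⇒< (lin 3 (λ N h y → (h := N :- # 3) ∷ (h :< y) ∷ [] ⊢ N :- # 2 :≤ y) N h
                (s x) h≡ h<sx)
                (not-N-2 (λ { refl → lin 2 (λ N b → (b := N :+ # 2) ∷ (b :≤ N :+ # 1) ∷ [] ⊢ :⊥) N b
                  b≡N+2 b≤x }) ∘ sym)) refl
            bwd : partner σ ≤ s x → b ≤ x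
            -- Of the labels between the cut `N - 3` and `b`, `N - 2` and `N - 1` are gaps, `N` is
            -- no entry, and `N + 1` goes down to `N - 2`.
            bwd c≤sx = ℤ.≮⇒≥ λ x<b → small (N - + 2 ℤ.≟ x) (N - + 1 ℤ.≟ x) (N ℤ.≟ x)
              (N + + 1 ℤ.≟ x) x<b
              where
              small : Dec (N - + 2 ≡ x) → Dec (N - + 1 ≡ x) → Dec (N ≡ x) → Dec (N + + 1 ≡ x)
                → x < b → ⊥
              small (yes refl) _ _ _ _ = ¬bead×gap v B (subst (Gap v)
                (trans (cong reflected b≡N+2) (lin 1 (λ N → [] ⊢ N :+ N :- (N :+ # 2) := N :- # 2)
                N)) (bead-reflected v bead-b))
              small (no _) (yes refl) _ _ _ = ¬bead×gap v B (subst (Gap v) partner≡ g)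
              small (no _) (no _) (yes refl) _ _ = entry≢N (proj₁ B) refl
              small (no _) (no _) (no _) (yes refl) _ = lin 3
                (λ N c y → (c := N :- # 1) ∷ (y := N :- # 2) ∷ (c :≤ y) ∷ [] ⊢ :⊥) N (partner σ)
                (s (N + + 1)) partner≡ s-N+1 c≤sx
              small (no n₁) (no n₂) (no n₃) (no n₄) x<b = lin 3
                (λ N b x → (b := N :+ # 2) ∷ (N :+ # 1 :< x) ∷ (x :< b) ∷ [] ⊢ :⊥) N b x b≡N+2
                (up (up (up (up (lin 3 (λ N h x → (h := N :- # 3) ∷ (h :< x) ∷ [] ⊢ N :- # 3 :< x) N
                  h x h≡ h<x) eq₁ n₁) eq₂ n₂) eq₃ n₃) eq₄ n₄) x<b
                where
                up : ∀ {a a′} → a < x → a′ ≡ a + + 1 → a′ ≢ x → a′ < x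
                up {a} {a′} lt eq ne = ℤ.≤∧≢⇒< (lin 3 (λ a a′ x → (a :< x) ∷ (a′ := a :+ # 1) ∷ []
                  ⊢ a′ :≤ x) a a′ x lt eq) ne
                eq₁ = lin 1 (λ N → [] ⊢ N :- # 2 := N :- # 3 :+ # 1) N
                eq₂ = lin 1 (λ N → [] ⊢ N :- # 1 := N :- # 2 :+ # 1) N
                eq₃ = lin 1 (λ N → [] ⊢ N := N :- # 1 :+ # 1) N
                eq₄ = refl

      -- The generator of index `γ` moves the bead to the label before it. At content 1 in variant D
      -- the label `N + 1` is a gap, so `d` is even and the main descalator gives residue 1.
      case-low : ∀ {m} → γ ≡ suc m → (γ<n : γ ℕ.< n) → Gap v (label m) →
        (variant₀ t ≡ D → γ ≡ 1 → Gap v (label 0)) → Peelable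
      case-low {m} refl γ<n gap-m gap-0 = peelable i (middle 1≤i i<n) σ
        (subst (Gap v) (sym partner≡) gap-m) (subst HasRes (sym i≡) res)
        (λ k → inj₁ (trans (uniq k) (sym i≡)))
        Sum.[ (λ (_ , e) → ⊥-elim (ℕ.>⇒≢ 1≤i e)) , (λ (_ , e) → ⊥-elim (ℕ.<⇒≢ i<n e)) ]′
        ((λ (_ , e) → ⊥-elim (ℕ.>⇒≢ 1≤i e)) , (λ (_ , e) → ⊥-elim (ℕ.<⇒≢ i<n e)))
        where
        i = middleᶠ γ<n
        i≡ : toℕ i ≡ γ
        i≡ = toℕ-middleᶠ γ<n
        1≤i : 1 ℕ.≤ toℕ i
        1≤i = subst (1 ℕ.≤_) (sym i≡) (s≤s z≤n)
        i<n : toℕ i ℕ.< n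
        i<n = subst (ℕ._< n) (sym i≡) γ<n
        σ : Side b (+ toℕ i) (+ 1 + + toℕ i)
        σ = plus (+ 1) (trans b≡ (lin 3 (λ N γ i → (i := γ) ∷ []
          ⊢ N :+ (# 1 :+ γ) := # 1 :+ i :+ + 1 :* N) N (+ γ) (+ toℕ i) (cong +_ i≡)))
        partner≡ : partner σ ≡ label m
        partner≡ = lin 3 (λ N m i → (i := # 1 :+ m) ∷ [] ⊢ i :+ + 1 :* N := N :+ (# 1 :+ m)) N (+ m)
          (+ toℕ i) (cong +_ i≡)
        main≡1 : variant₀ t ≡ D → γ ≡ 1 → mainResidue (d , d ℕ.+ γ) ≡ 1
        main≡1 v₀ refl = subst (λ d → mainResidue (d , d ℕ.+ 1) ≡ 1) (sym (proj₂ half′))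
          (mainResidue-even (proj₁ half′))
          where
          half′ : ∃[ k ] d ≡ k ℕ.* 2
          half′ = even-half (subst (2 ∣ℕ_) (trans (bd-nonbead (λ B → ¬bead×gap v B (gap-0 v₀ refl)))
            (trans (cong bd (trans (label-suc 0) (sym b≡))) (sym d≡))) (crossings v₀))
        uniq : ∀ {r} → Known γ r → r ≡ γ
        uniq (esc _ 0 V eq) = trans (verdict₀ V) (sym (ℤ.+-injective
          (lin 3 (λ γ n x → (# 1 :+ γ := n :+ # 0) ∷ (x := n :- # 1) ∷ [] ⊢ γ := x) (+ γ) n₊
          (+ (n ∸ 1)) (cong +_ eq) n∸1≡)))
        uniq (esc _ (suc p) V eq) = ⊥-elim (lin 3 (λ γ n p → (# 1 :+ γ := n :+ (# 1 :+ p)) ∷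
          (# 0 :≤ p) ∷ (γ :< n) ∷ [] ⊢ :⊥) (+ γ) n₊ (+ p) (cong +_ eq) (+≤+ z≤n) (+<+ γ<n))
        uniq (desc _ p _ eq) = ⊥-elim (lin 4 (λ γ n p T → (# 1 :+ γ := T :+ p) ∷ (T := n :+ n) ∷
          (# 0 :≤ p) ∷ (γ :< n) ∷ (# 2 :≤ n) ∷ [] ⊢ :⊥) (+ γ) n₊ (+ p) (+ (2 ℕ.* n))
          (cong +_ eq) 2n≡ (+≤+ z≤n) (+<+ γ<n) (+≤+ 2≤n))
        uniq (main v₀ γ≤1 eq) = trans eq (trans (main≡1 v₀ γ≡1) (sym γ≡1))
          where
          γ≡1 = ℕ.≤-antisym γ≤1 (s≤s z≤n)
        uniq (fix _ _ eq) = trans eq (fixedResidue-low d (ℕ.<⇒≤ γ<n))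
        res : HasRes γ
        res = by-escalator (variantₙ t) refl (suc γ ℕ.≟ n)
          where
          by-main : variant₀ t ≡ D → Dec (γ ≡ 1) → (variantₙ t ≡ D → ¬ EscalatorCell n
            (d , d ℕ.+ γ)) → HasRes γ
          by-main v₀ (yes γ≡1) ¬e = has-main v₀ γ≡1 (trans (main≡1 v₀ γ≡1) (sym γ≡1))
          by-main v₀ (no γ≢1) ¬e = has-fixed ¬e (λ _ → ¬desc-mid (ℕ.≤∧≢⇒< (s≤s z≤n) (γ≢1 ∘ sym))
            (ℤ.drop‿+<+ (lin 3 (λ γ n T → (γ :< n) ∷ (T := n :+ n) ∷ (# 2 :≤ n) ∷ []
              ⊢ # 1 :+ γ :< T) (+ γ) n₊ (+ (2 ℕ.* n)) (+<+ γ<n) 2n≡ (+≤+ 2≤n))))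
              (fixedResidue-low d (ℕ.<⇒≤ γ<n))
          by-variant : ∀ v₀ → variant₀ t ≡ v₀ → (variantₙ t ≡ D → ¬ EscalatorCell n (d , d ℕ.+ γ))
            → HasRes γ
          by-variant C v₀ ¬e = has-fixed ¬e (λ v → ⊥-elim (D≢C v v₀))
            (fixedResidue-low d (ℕ.<⇒≤ γ<n))
          by-variant D v₀ ¬e = by-main v₀ (γ ℕ.≟ 1) ¬e
          by-escalator : ∀ vₙ → variantₙ t ≡ vₙ → Dec (suc γ ≡ n) → HasRes γ
          by-escalator C vₙ _ = by-variant (variant₀ t) refl (λ v → ⊥-elim (D≢C v vₙ))
          -- At `γ = n - 1` the row ends at the first cell of the escalator, with residue `n - 1`.
          by-escalator D vₙ (yes γ+1≡n) = subst HasRes (cong (_∸ 1) (sym γ+1≡n))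
            (escalator vₙ (escalator-exists 0F (trans γ+1≡n (sym (ℕ.+-identityʳ n))) first))
          by-escalator D vₙ (no γ+1≢n) = by-variant (variant₀ t) refl λ _ S → let o , _ , eq = escalator-γ (ℕ.<⇒≤ γ<2n) S in
            ℕ.<⇒≱ (ℕ.≤∧≢⇒< γ<n γ+1≢n) (ℕ.≤-trans (ℕ.m≤m+n n o) (ℕ.≤-reflexive (sym eq)))

      γ₊ : + γ < + (2 ℕ.* n)
      γ₊ = +<+ γ<2n

      case-n-C : γ ≡ n → variantₙ t ≡ C → Peelable
      case-n-C refl vₙ = peelable lastᶠ (lastC i≡ vₙ) σ
        (subst (Gap v) (sym partner≡) (gap-below (ℕ.≤-trans ref≤1 (ℕ.∸-monoˡ-≤ 1 2≤n))
        (ℕ.≤-reflexive (ℕ.m+[n∸m]≡n 1≤n))))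
        (subst HasRes (sym i≡) res) (λ k → inj₁ (trans (uniq k) (sym i≡)))
        Sum.[ (λ (_ , e) → ⊥-elim (last≢0 e)) , (λ (v , _) → ⊥-elim (D≢C v vₙ)) ]′
        ((λ (_ , e) → ⊥-elim (last≢0 e)) , (λ (v , _) → ⊥-elim (D≢C v vₙ)))
        where
        i≡ = toℕ-lastᶠ
        σ : Side b n₊ (+ 1 + n₊)
        σ = plus (+ 1) (trans b≡ (lin 2 (λ N n → [] ⊢ N :+ (# 1 :+ n) := # 1 :+ n :+ + 1 :* N) N
          n₊))
        partner≡ : partner σ ≡ label (n ∸ 1)
        partner≡ = lin 3 (λ N n x → (x := n :- # 1) ∷ [] ⊢ n :+ + 1 :* N := N :+ (# 1 :+ x)) N n₊
          (+ (n ∸ 1)) n∸1≡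
        uniq : ∀ {r} → Known n r → r ≡ n
        uniq (esc v _ _ _) = ⊥-elim (D≢C v vₙ)
        uniq (desc _ p _ eq) = ⊥-elim (lin 3 (λ n p T → (# 1 :+ n := T :+ p) ∷ (T := n :+ n) ∷
          (# 0 :≤ p) ∷ (# 2 :≤ n) ∷ [] ⊢ :⊥) n₊ (+ p) (+ (2 ℕ.* n)) (cong +_ eq) 2n≡ (+≤+ z≤n)
          (+≤+ 2≤n))
        uniq (main _ n≤1 _) = ⊥-elim (ℕ.<⇒≱ 2≤n n≤1)
        uniq (fix _ _ eq) = trans eq (fixedResidue-low d ℕ.≤-refl)
        res : HasRes n
        res = has-fixed (λ v → ⊥-elim (D≢C v vₙ)) (λ v₀ → ¬desc-mid 2≤n (n+1<2n v₀))
          (fixedResidue-low d ℕ.≤-refl)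
          where
          n+1<2n : variant₀ t ≡ D → suc n ℕ.< 2 ℕ.* n
          n+1<2n v₀ = ℤ.drop‿+<+ (lin 2 (λ n T → (T := n :+ n) ∷ (# 3 :≤ n) ∷ [] ⊢ # 1 :+ n :< T) n₊
            (+ (2 ℕ.* n)) 2n≡ (+≤+ (rank₃-₀ t rank v₀)))

      module LastD (vₙ : variantₙ t ≡ D) where
        i≡ = toℕ-lastᶠ
        K : Kind lastᶠ (n₊ - + 1) (+ 1 + n₊)
        K = lastD i≡ vₙ
        3≤n : + 3 ≤ n₊
        3≤n = +≤+ (rank₃-ₙ t rank vₙ)
        h : ℤ
        h = n₊ - + 2 + + 1 * N
        stable : ∀ x → x ≤ h → generator t n lastᶠ x ≤ h
        stable = half-line-shift lastᶠ (+ 1) (half-line-lastD i≡ vₙ)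
        label≤ : ∀ {x} → h < x → label ref ≤ x
        label≤ {x} h<x = lin 4 (λ N n r x → (n :- # 2 :+ + 1 :* N :< x) ∷ (r :≤ # 1) ∷ (# 3 :≤ n)
          ∷ [] ⊢ N :+ (# 1 :+ r) :≤ x) N n₊ (+ ref) x h<x (+≤+ ref≤1) 3≤n

      -- `sₙᴰ` moves the bead two labels down, from content `n` to `n - 2`. The box to record has
      -- content `n - 1`, off the `n`-th diagonal.
      case-n-D : γ ≡ n → variantₙ t ≡ D → Peelable
      case-n-D refl vₙ = peelable lastᶠ K σ (subst (Gap v) (sym partner≡)
        (gap-below (ℕ.≤-trans ref≤1 (ℕ.∸-monoˡ-≤ 2 (rank₃-ₙ t rank vₙ)))
        (ℕ.≤-trans (s≤s (ℕ.∸-monoʳ-≤ n (s≤s (z≤n {1})))) (ℕ.≤-reflexive (ℕ.m+[n∸m]≡n 1≤n)))))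
        (subst HasRes (sym i≡) res) (λ k → inj₁ (trans (uniq k) (sym i≡)))
        (λ _ → (λ {x} → order {x}) , (λ w′ → subst₂ (Diagonal.Corner w′) (sym partner≡) n∸2≡
          (Diagonal.corner-label w′ (n ∸ 2) (ℕ.≤-trans (ℕ.m∸n≤m n 2) (ℕ.m≤m+n n _)))) ,
          lin 4 (λ N n x p → (p := n :- # 1 :+ + 1 :* N) ∷ (# 3 :≤ n) ∷ (# 0 :< N) ∷ [] ⊢ # 1 :≤ p)
            N n₊ b (partner σ) refl 3≤n 0<N , 1≤n)
        ((λ (_ , e) → ⊥-elim (last≢0 e)) , (λ _ → n ∸ 1 , inj₂ (ℕ.m+[n∸m]≡n 1≤n) , λ eq → ℕ.1+n≢n
          (trans (ℕ.m+[n∸m]≡n 1≤n) (sym eq))))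
        where
        open LastD vₙ
        σ : Side b (n₊ - + 1) (+ 1 + n₊)
        σ = plus (+ 1) (trans b≡ (lin 2 (λ N n → [] ⊢ N :+ (# 1 :+ n) := # 1 :+ n :+ + 1 :* N) N
          n₊))
        n∸2≡ : + (n ∸ 2) ≡ n₊ - + 2
        n∸2≡ = lin 2 (λ n x → (# 2 :+ x := n) ∷ [] ⊢ x := n :- # 2) n₊ (+ (n ∸ 2))
          (cong +_ (ℕ.m+[n∸m]≡n 2≤n))
        partner≡ : partner σ ≡ label (n ∸ 2)
        partner≡ = lin 3 (λ N n x → (x := n :- # 2) ∷ [] ⊢ n :- # 1 :+ + 1 :* N := N :+ (# 1 :+ x))
          N n₊ (+ (n ∸ 2)) n∸2≡
        uniq : ∀ {r} → Known n r → r ≡ n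
        uniq (esc _ 1 V _) = verdict₁ V
        uniq (esc _ 0 _ eq) = ⊥-elim (ℕ.1+n≢n (trans eq (ℕ.+-identityʳ n)))
        uniq (esc _ (suc (suc p)) _ eq) = ⊥-elim (lin 2
          (λ n p → (# 1 :+ n := n :+ (# 2 :+ p)) ∷ (# 0 :≤ p) ∷ [] ⊢ :⊥) n₊ (+ p) (cong +_ eq)
          (+≤+ z≤n))
        uniq (desc _ p _ eq) = ⊥-elim (lin 3 (λ n p T → (# 1 :+ n := T :+ p) ∷ (T := n :+ n) ∷
          (# 0 :≤ p) ∷ (# 2 :≤ n) ∷ [] ⊢ :⊥) n₊ (+ p) (+ (2 ℕ.* n)) (cong +_ eq) 2n≡ (+≤+ z≤n)
          (+≤+ 2≤n))
        uniq (main _ n≤1 _) = ⊥-elim (ℕ.<⇒≱ 2≤n n≤1)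
        uniq (fix ¬e _ _) = ⊥-elim (¬e vₙ (escalator-cell 1 1≤d (s≤s z≤n) (ℕ.+-comm 1 n)))
        res : HasRes n
        res = escalator vₙ (escalator-exists 1F (ℕ.+-comm 1 n) second)
        order : ∀ {x} → Bead v x → b ≤ x ⇔ partner σ ≤ generator t n lastᶠ x
        order = ordered lastᶠ (partner-≡ K σ)
          (lin 3 (λ N n b → (b := N :+ (# 1 :+ n)) ∷ [] ⊢ n :- # 2 :+ + 1 :* N :< b) N n₊ b b≡)
          (lin 2 (λ N n → [] ⊢ n :- # 2 :+ + 1 :* N :< n :- # 1 :+ + 1 :* N) N n₊)
          stable (λ {x} B h<x h<sx → mk⇔
            (λ _ → lin 3 (λ N n y → (n :- # 2 :+ + 1 :* N :< y) ∷ [] ⊢ n :- # 1 :+ + 1 :* N :≤ y) N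
              n₊ (generator t n lastᶠ x) h<sx)
            (λ _ → far-bead B (label≤ h<x)))

      -- The row ends at the third cell of the escalator, with residues `n - 1` and `n`. The tie
      -- goes to `sₙᴰ`, which moves the bead to content `n - 1`; the box to record is the last one.
      case-n+1-D : γ ≡ suc n → variantₙ t ≡ D → Peelable
      case-n+1-D refl vₙ = peelable lastᶠ K σ (subst (Gap v) (sym partner≡)
        (gap-below (ℕ.≤-trans ref≤1 (ℕ.∸-monoˡ-≤ 1 2≤n)) (s≤s (ℕ.m∸n≤m n 1))))
        (subst HasRes (sym i≡) res) uniq
        (λ _ → (λ {x} → order {x}) , (λ w′ → subst₂ (Diagonal.Corner w′) (sym partner≡)
          (trans n∸1≡ (lin 1 (λ n → [] ⊢ n :- # 1 := # 1 :+ n :- # 2) n₊))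
          (Diagonal.corner-label w′ (n ∸ 1) (ℕ.≤-trans (ℕ.m∸n≤m n 1) (ℕ.m≤m+n n _)))) ,
          lin 3 (λ N n p → (p := :- (# 1 :+ n) :+ + 2 :* N) ∷ (N := # 1 :+ (n :+ n)) ∷ (# 3 :≤ n)
            ∷ [] ⊢ # 1 :≤ p) N n₊ (partner σ) refl N≡ 3≤n , s≤s z≤n)
        ((λ (_ , e) → ⊥-elim (last≢0 e)) , (λ _ → suc n , inj₁ refl , ℕ.1+n≢n))
        where
        open LastD vₙ
        b≡′ : b ≡ N + (+ 2 + n₊)
        b≡′ = trans b≡ (lin 2 (λ N n → [] ⊢ N :+ (# 1 :+ (# 1 :+ n)) := N :+ (# 2 :+ n)) N n₊)
        σ : Side b (n₊ - + 1) (+ 1 + n₊)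
        σ = minus (+ 2) (trans b≡′ (lin 2 (λ N n → (N := # 1 :+ (n :+ n)) ∷ []
          ⊢ N :+ (# 2 :+ n) := :- (n :- # 1) :+ + 2 :* N) N n₊ N≡))
        partner≡ : partner σ ≡ label (n ∸ 1)
        partner≡ = lin 3 (λ N n x → (x := n :- # 1) ∷ (N := # 1 :+ (n :+ n)) ∷ []
          ⊢ :- (# 1 :+ n) :+ + 2 :* N := N :+ (# 1 :+ x)) N n₊ (+ (n ∸ 1)) n∸1≡ N≡
        eq₂ : suc (suc n) ≡ n ℕ.+ 2
        eq₂ = ℕ.+-comm 2 n
        low-res : HasRes (n ∸ 1)
        low-res = escalator vₙ (escalator-exists 2F eq₂ third)
        res : HasRes n
        res = escalator vₙ (escalator-exists 2F eq₂ third′)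
        uniq : ∀ {r} → Known (suc n) r → r ≡ toℕ lastᶠ ⊎ toℕ lastᶠ ≡ n × HasRes (n ∸ 1)
        uniq _ = inj₂ (i≡ , low-res)
        order : ∀ {x} → Bead v x → b ≤ x ⇔ partner σ ≤ generator t n lastᶠ x
        order = ordered lastᶠ (partner-≡ K σ)
          (lin 3 (λ N n b → (b := N :+ (# 2 :+ n)) ∷ [] ⊢ n :- # 2 :+ + 1 :* N :< b) N n₊ b b≡′)
          (lin 2 (λ N n → (N := # 1 :+ (n :+ n)) ∷ [] ⊢ n :- # 2 :+ + 1 :* N :< :- (# 1 :+ n) :+ + 2
            :* N) N n₊ N≡)
          stable (λ {x} B h<x h<sx → mk⇔
            (λ b≤x → lin 4 (λ N n y u → (N := # 1 :+ (n :+ n)) ∷ (u :< y) ∷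
              (u := n :- # 1 :+ + 1 :* N) ∷ [] ⊢ :- (# 1 :+ n) :+ + 2 :* N :≤ y) N n₊
              (generator t n lastᶠ x) (n₊ - + 1 + + 1 * N) N≡
              (ℤ.≤∧≢⇒< (lin 3 (λ N n y → (n :- # 2 :+ + 1 :* N :< y) ∷ []
                ⊢ n :- # 1 :+ + 1 :* N :≤ y) N n₊ (generator t n lastᶠ x) h<sx) (not-low x b≤x))
                refl)
            (λ _ → far-bead B (label≤ h<x)))
          where
          not-low : ∀ x → b ≤ x → n₊ - + 1 + + 1 * N ≢ generator t n lastᶠ x
          not-low x b≤x eq = lin 4 (λ N n b x → (b := N :+ (# 2 :+ n)) ∷ (b :≤ x) ∷
            (x := # 1 :+ n :+ + 1 :* N) ∷ [] ⊢ :⊥) N n₊ b x b≡′ b≤x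
            (to-injective (gen lastᶠ) (trans (sym eq) (sym
              (trans (generator-shift lastᶠ (+ 1 + n₊) (+ 1))
              (cong (_+ + 1 * N) (generator-high K))))))

      -- With `r = 2n - γ`, the residue at content `γ`, the bead is at `2N - r`: the upper point of
      -- a mirrored pair of the generator of index `r`.
      case-high : n ℕ.< γ → (variantₙ t ≡ C ⊎ suc n ℕ.< γ) → Peelable
      case-high n<γ ok = peelable i (middle 1≤i i<n) σ (subst (Gap v) (sym partner≡)
        (gap-below (ℕ.≤-trans ref≤1 (ℕ.∸-monoˡ-≤ 1 (ℕ.≤-trans 2≤n (ℕ.<⇒≤ n<γ))))
        (ℕ.≤-reflexive γ-1)))
        (subst HasRes (sym i≡) res) (λ k → inj₁ (trans (uniq k) (sym i≡)))
        Sum.[ (λ (_ , e) → ⊥-elim (ℕ.>⇒≢ 1≤i e)) , (λ (_ , e) → ⊥-elim (ℕ.<⇒≢ i<n e)) ]′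
        ((λ (_ , e) → ⊥-elim (ℕ.>⇒≢ 1≤i e)) , (λ (_ , e) → ⊥-elim (ℕ.<⇒≢ i<n e)))
        where
        γ-1 : suc (γ ∸ 1) ≡ γ
        γ-1 = ℕ.m+[n∸m]≡n (ℕ.≤-trans 1≤n (ℕ.<⇒≤ n<γ))
        r₀ : ℕ
        r₀ = 2 ℕ.* n ∸ γ
        r₀≡ : + γ + + r₀ ≡ + (2 ℕ.* n)
        r₀≡ = cong +_ (ℕ.m+[n∸m]≡n (ℕ.<⇒≤ γ<2n))
        r₀<n : r₀ ℕ.< n
        r₀<n = ℤ.drop‿+<+ (lin 4 (λ n γ r T → (γ :+ r := T) ∷ (T := n :+ n) ∷ (n :< γ) ∷ []
          ⊢ r :< n) n₊ (+ γ) (+ r₀) (+ (2 ℕ.* n)) r₀≡ 2n≡ (+<+ n<γ))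
        i = middleᶠ r₀<n
        i≡ : toℕ i ≡ r₀
        i≡ = toℕ-middleᶠ r₀<n
        1≤i : 1 ℕ.≤ toℕ i
        1≤i = subst (1 ℕ.≤_) (sym i≡) (ℕ.m<n⇒0<n∸m γ<2n)
        i<n : toℕ i ℕ.< n
        i<n = subst (ℕ._< n) (sym i≡) r₀<n
        σ : Side b (+ toℕ i) (+ 1 + + toℕ i)
        σ = minus (+ 2) (trans b≡ (lin 5 (λ N γ i r T → (i := r) ∷ (γ :+ r := T) ∷ (N := # 1 :+ T)
          ∷ [] ⊢ N :+ (# 1 :+ γ) := :- i :+ + 2 :* N) N (+ γ) (+ toℕ i) (+ r₀) (+ (2 ℕ.* n))
          (cong +_ i≡) r₀≡ refl))
        partner≡ : partner σ ≡ label (γ ∸ 1)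
        partner≡ = lin 6 (λ N γ i r T x → (i := r) ∷ (γ :+ r := T) ∷ (N := # 1 :+ T) ∷
          (# 1 :+ x := γ) ∷ [] ⊢ :- (# 1 :+ i) :+ + 2 :* N := N :+ (# 1 :+ x))
          N (+ γ) (+ toℕ i) (+ r₀) (+ (2 ℕ.* n)) (+ (γ ∸ 1)) (cong +_ i≡) r₀≡ refl (cong +_ γ-1)
        no-esc : variantₙ t ≡ D → ∀ {p} → p ℕ.≤ 2 → suc γ ≢ n ℕ.+ p
        no-esc vₙ {p} p≤2 eq = Sum.[ (λ v → D≢C vₙ v) ,
          (λ n+1<γ → lin 3 (λ n γ p → (# 1 :+ n :< γ) ∷ (# 1 :+ γ := n :+ p) ∷ (p :≤ # 2) ∷ [] ⊢ :⊥)
          n₊ (+ γ) (+ p) (+<+ n+1<γ) (cong +_ eq) (+≤+ p≤2)) ]′ ok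
        uniq : ∀ {r} → Known γ r → r ≡ r₀
        uniq (esc vₙ p V eq) = ⊥-elim (no-esc vₙ (verdict-≤2 V) eq)
        uniq (desc _ 0 V eq) = trans (verdict₀ V) (ℤ.+-injective
          (lin 3 (λ γ r T → (γ :+ r := T) ∷ (# 1 :+ γ := T :+ # 0) ∷ [] ⊢ # 1 := r) (+ γ) (+ r₀)
          (+ (2 ℕ.* n)) r₀≡ (cong +_ eq)))
        uniq (desc _ (suc p) V eq) = ⊥-elim (lin 3 (λ γ p T → (γ :< T) ∷
          (# 1 :+ γ := T :+ (# 1 :+ p)) ∷ (# 0 :≤ p) ∷ [] ⊢ :⊥) (+ γ) (+ p) (+ (2 ℕ.* n)) γ₊
          (cong +_ eq) (+≤+ z≤n))
        uniq (main _ γ≤1 _) = ⊥-elim (ℕ.<⇒≱ (ℕ.<-trans (ℕ.<-≤-trans (s≤s (s≤s z≤n)) 2≤n) n<γ) γ≤1)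
        uniq (fix _ _ eq) = trans eq (fixedResidue-high d n<γ γ<2n)
        ¬e : variantₙ t ≡ D → ¬ EscalatorCell n (d , d ℕ.+ γ)
        ¬e vₙ S = let o , o≤2 , eq = escalator-γ (ℕ.<⇒≤ γ<2n) S in no-esc vₙ o≤2 eq
        res : HasRes r₀
        res = by-variant (variant₀ t) refl (suc γ ℕ.≟ 2 ℕ.* n)
          where
          by-variant : ∀ v₀ → variant₀ t ≡ v₀ → Dec (suc γ ≡ 2 ℕ.* n) → HasRes r₀
          by-variant C v₀ _ = has-fixed ¬e (λ v → ⊥-elim (D≢C v v₀)) (fixedResidue-high d n<γ γ<2n)
          by-variant D v₀ (yes eq) = subst HasRes (ℤ.+-injective
            (lin 3 (λ γ r T → (γ :+ r := T) ∷ (# 1 :+ γ := T) ∷ [] ⊢ # 1 := r) (+ γ) (+ r₀)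
            (+ (2 ℕ.* n)) r₀≡ (cong +_ eq)))
            (descalator v₀ (descalator-exists 0F (trans eq (sym (ℕ.+-identityʳ _))) first))
          by-variant D v₀ (no ne) = has-fixed ¬e (λ _ → ¬desc-mid (ℕ.≤-trans 2≤n (ℕ.<⇒≤ n<γ))
            (ℕ.≤∧≢⇒< γ<2n ne)) (fixedResidue-high d n<γ γ<2n)

      peelable-inner : Peelable
      peelable-inner = go (ℕ.<-cmp γ n)
        where
        2n>0 : 0 ℕ.< 2 ℕ.* n
        2n>0 = 1≤2n
        high-D : variantₙ t ≡ D → n ℕ.< γ → Peelable
        high-D vₙ n<γ = Sum.[ (λ lt → case-high n<γ (inj₂ lt)) , (λ eq → case-n+1-D (sym eq) vₙ) ]′
          (ℕ.m≤n⇒m<n∨m≡n n<γ)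
        below-n : ∀ m → γ ≡ m → m ℕ.< n → ∀ v₀ → variant₀ t ≡ v₀ → Peelable
        below-n zero eq _ C v₀ = case-0 eq v₀
        below-n zero eq _ D v₀ = ⊥-elim (ℕ.<⇒≱ (subst (ℕ._≤ 0) (reference v₀)
          (subst (ref ℕ.≤_) eq ref≤γ)) z≤n)
        below-n (suc m) eq m<n C v₀ = case-low eq (subst (ℕ._< n) (sym eq) m<n)
          (gap-below (subst (ℕ._≤ m) (sym (reference v₀)) z≤n) (ℕ.≤-reflexive (sym eq)))
          (λ v → ⊥-elim (D≢C v v₀))
        below-n (suc zero) eq m<n D v₀ = Sum.[ (λ B → case-1 eq v₀ B) ,
          (λ G → case-low eq (subst (ℕ._< n) (sym eq) m<n) G (λ _ _ → G)) ]′
          (bead⊎gap v (entry-label 2n>0))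
        below-n (suc (suc m)) eq m<n D v₀ = case-low eq (subst (ℕ._< n) (sym eq) m<n)
          (gap-below (subst (ℕ._≤ suc m) (sym (reference v₀)) (s≤s z≤n)) (ℕ.≤-reflexive (sym eq)))
          (λ _ e → ⊥-elim (ℕ.1+n≢0 (ℕ.suc-injective (trans (sym eq) e))))
        go : _ → Peelable
        go (tri< a _ _) = below-n γ refl a (variant₀ t) refl
        go (tri≈ _ e _) = by (variantₙ t) refl
          where
          by : ∀ v → variantₙ t ≡ v → Peelable
          by C vₙ = case-n-C e vₙ
          by D vₙ = case-n-D e vₙ
        go (tri> _ _ c) = by (variantₙ t) refl
          where
          by : ∀ v → variantₙ t ≡ v → Peelable
          by C vₙ = case-high c (inj₁ vₙ)
          by D vₙ = high-D vₙ c

    module Outer {b} (F : First b) (v₀ : variant₀ t ≡ D) (b≡ : b ≡ N + N + + 1) where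

      open At F {2 ℕ.* n} ℕ.≤-refl (λ w′ → subst (λ e → Diagonal.Corner w′ e (+ (2 ℕ.* n))) (sym b≡)
        (Diagonal.corner-2N+1 w′))

      -- The row ends at the second cell of the first upper descalator, with residue 0. `s₀ᴰ` moves
      -- the bead from `2N + 1` to `2N - 2`, and the box to record has content `2n - 1`.
      peelable-outer : Peelable
      peelable-outer = peelable zeroᶠ K σ g (descalator v₀
        (descalator-exists 1F (ℕ.+-comm 1 _) second)) (λ k → inj₁ (uniq k))
        (λ _ → (λ {x} → order {x}) , (λ w′ → subst₂ (Diagonal.Corner w′) (sym partner≡) 2n∸2≡
          (Diagonal.corner-label w′ (2 ℕ.* n ∸ 2) (ℕ.m∸n≤m _ 2))) ,
          lin 2 (λ N p → (p := con (- + 2) :+ + 2 :* N) ∷ (# 5 :≤ N) ∷ [] ⊢ # 1 :≤ p) N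
            (partner σ) refl 5≤N , 1≤2n)
        ((λ _ → 2 ℕ.* n ∸ 1 , inj₂ (ℕ.m+[n∸m]≡n 1≤2n) ,
           (λ eq → lin 2 (λ T x → (# 4 :≤ T) ∷ (# 1 :+ x := T) ∷ (x := # 0) ∷ [] ⊢ :⊥) (+ (2 ℕ.* n))
             (+ (2 ℕ.* n ∸ 1)) 2n≥4 (cong +_ (ℕ.m+[n∸m]≡n 1≤2n)) (cong +_ eq)) ,
           (λ eq → ℕ.1+n≢n (trans (ℕ.m+[n∸m]≡n 1≤2n) (sym eq)))) ,
         (λ (_ , e) → ⊥-elim (n≢0 (sym e))))
        where
        7≤N : + 7 ≤ N
        7≤N = lin 2 (λ N n → (N := # 1 :+ (n :+ n)) ∷ (# 3 :≤ n) ∷ [] ⊢ # 7 :≤ N) N n₊ N≡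
          (+≤+ (rank₃-₀ t rank v₀))
        K = zeroD {zeroᶠ} refl v₀
        σ : Side b (- + 2) (+ 1)
        σ = plus (+ 2) (trans b≡ (lin 1 (λ N → [] ⊢ N :+ N :+ # 1 := # 1 :+ + 2 :* N) N))
        2n∸2≡ : + (2 ℕ.* n ∸ 2) ≡ + (2 ℕ.* n) - + 2
        2n∸2≡ = lin 2 (λ n x → (# 2 :+ x := n) ∷ [] ⊢ x := n :- # 2) (+ (2 ℕ.* n)) (+ (2 ℕ.* n ∸ 2))
          (cong +_ (ℕ.m+[n∸m]≡n (ℕ.≤-trans 2≤n (ℕ.m≤m+n n _))))
        partner≡ : partner σ ≡ label (2 ℕ.* n ∸ 2)
        partner≡ = lin 3 (λ N T x → (x := T :- # 2) ∷ (N := # 1 :+ T) ∷ [] ⊢ con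
          (- + 2) :+ + 2 :* N := N :+ (# 1 :+ x)) N (+ (2 ℕ.* n)) (+ (2 ℕ.* n ∸ 2)) 2n∸2≡ refl
        2n∸2< : 2 ℕ.* n ∸ 2 ℕ.< 2 ℕ.* n
        2n∸2< = ℤ.drop‿+<+ (lin 2 (λ T x → (x := T :- # 2) ∷ [] ⊢ x :< T) (+ (2 ℕ.* n))
          (+ (2 ℕ.* n ∸ 2)) 2n∸2≡)
        ref≤ : ref ℕ.≤ 2 ℕ.* n ∸ 2
        ref≤ = ℕ.≤-trans ref≤1 (ℤ.drop‿+≤+ (lin 2 (λ T x → (x := T :- # 2) ∷ (# 4 :≤ T) ∷ []
          ⊢ # 1 :≤ x) (+ (2 ℕ.* n)) (+ (2 ℕ.* n ∸ 2)) 2n∸2≡ 2n≥4))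
        partner<b : label (2 ℕ.* n ∸ 2) < b
        partner<b = subst (_< b) partner≡ (partner-< K σ)
        g : Gap v (partner σ)
        g = subst (Gap v) (sym partner≡) (Sum.[ (λ B → ⊥-elim (¬bead-between F ref≤ partner<b B))
          , id ]′ (bead⊎gap v (entry-label 2n∸2<)))
        uniq : ∀ {r} → Known (2 ℕ.* n) r → r ≡ 0
        uniq (esc _ p V eq) = ⊥-elim (lin 3 (λ n p T → (# 1 :+ T := n :+ p) ∷ (T := n :+ n) ∷
          (# 2 :≤ n) ∷ (p :≤ # 2) ∷ [] ⊢ :⊥) n₊ (+ p) (+ (2 ℕ.* n)) (cong +_ eq) 2n≡ (+≤+ 2≤n)
          (+≤+ (verdict-≤2 V)))
        uniq (desc _ 1 V _) = verdict₁ V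
        uniq (desc _ 0 _ eq) = ⊥-elim (ℕ.1+n≢n (trans eq (ℕ.+-identityʳ _)))
        uniq (desc _ (suc (suc p)) _ eq) = ⊥-elim (lin 2
          (λ T p → (# 1 :+ T := T :+ (# 2 :+ p)) ∷ (# 0 :≤ p) ∷ [] ⊢ :⊥) (+ (2 ℕ.* n)) (+ p)
          (cong +_ eq) (+≤+ z≤n))
        uniq (main _ 2n≤1 _) = ⊥-elim (ℕ.<⇒≱ (ℕ.≤-trans 2≤n (ℕ.m≤m+n n _)) 2n≤1)
        uniq (fix _ ¬d _) = ⊥-elim (¬d v₀ (descalator-cell 1 1≤d (s≤s z≤n) (ℕ.+-comm 1 _)))
        order : ∀ {x} → Bead v x → b ≤ x ⇔ partner σ ≤ generator t n zeroᶠ x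
        order = ordered zeroᶠ (partner-≡ K σ)
          (lin 2 (λ N b → (b := N :+ N :+ # 1) ∷ [] ⊢ con (- + 3) :+ + 2 :* N :< b) N b b≡)
          (lin 1 (λ N → [] ⊢ con (- + 3) :+ + 2 :* N :< con (- + 2) :+ + 2 :* N) N)
          (half-line-shift zeroᶠ (+ 2) (half-line-zeroD refl v₀))
          (λ {x} B h<x h<sx → mk⇔
            (λ _ → lin 2 (λ N y → (con (- + 3) :+ + 2 :* N :< y) ∷ [] ⊢ con
              (- + 2) :+ + 2 :* N :≤ y) N (generator t n zeroᶠ x) h<sx)
            (λ _ → proj₂ (proj₂ F) B (lin 3 (λ N x r → (con (- + 3) :+ + 2 :* N :< x) ∷ (# 7 :≤ N) ∷
              (r :≤ # 1) ∷ [] ⊢ N :+ (# 1 :+ r) :≤ x) N x (+ ref) h<x 7≤N (+≤+ ref≤1))))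

    peel-step : κ ≢ [] → Peelable
    peel-step κ≢[] = go (firstBead κ≢[])
      where
      go : ∃ First → Peelable
      go (b , F) = at (place F)
        where
        at : Place b → Peelable
        at (inner γ ref≤γ γ<2n b≡) = Inner.peelable-inner F ref≤γ γ<2n b≡
        at (outer v₀ b≡)           = Outer.peelable-outer F v₀ b≡

-- The upper diagram is a set of boxes, hence `deduplicate` in the theorem; a list of distinct boxes
-- passes it unchanged.
deduplicate-unique : ∀ {U} → Unique U → deduplicate _≟ᶜ_ U ≡ U
deduplicate-unique []               = refl
deduplicate-unique {c ∷ U} (c∉U ∷ u) = cong (c ∷_)
  (trans (cong (filter (λ c′ → ¬? (c ≟ᶜ c′))) (deduplicate-unique u))
    (List.filter-all (λ c′ → ¬? (c ≟ᶜ c′)) c∉U))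

-- Assembling the steps of a peeling.

module Theorem (t : AffineType) (n : ℕ) (rank : minRank t ℕ.≤ n) where
  open import Data.Integer using (_+_; _-_; _*_; -_; _≤_; _<_)
  open Peels t n rank

  -- Boxes of `κ` on or above the main diagonal, where `crossing` compares the diagonals of two
  -- cores. All recorded boxes are of this sort.
  Good : Partition → Cell → Set
  Good κ (x , y) = 1 ℕ.≤ x × (∃[ c ] y ≡ x ℕ.+ c) × y ℕ.≤ row κ x

  module OneStep (w : MirroredPermutation n) (R : Representative (toAut w)) (κ≢[] : 𝒞 n w ≢ [])
                 (w′ : MirroredPermutation n) where
    open Peeled w R using (d; peel-step; module Peelable)

    P : Peeled.Peelable w R
    P = peel-step κ≢[]

    open Peelable P public

    a′ : Aut
    a′ = gen i ⊙ toAut w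

    κ μ : Partition
    κ = 𝒞 n w
    μ = 𝒞 n w′

    1≤d : 1 ℕ.≤ d
    1≤d = subst (1 ℕ.≤_) (sym (trans d≡ (Diagonal.bd-bead w bead))) (s≤s z≤n)

    module Boxes (bead-⇒ : ∀ {e} → Bead a′ e → Bead (toAut w′) e)
      (bead-⇐ : ∀ {e} → Bead (toAut w′) e → Bead a′ e) where

      bead-s : ∀ {e} → Bead (toAut w′) e → Bead (toAut w) (generator t n i e)
      bead-s B = to-entry (gen i) (proj₁ B) , proj₂ (bead-⇐ B)

      s-bead : ∀ {e} → Bead (toAut w) e → Bead (toAut w′) (generator t n i e)
      s-bead {e} (ent , h) = bead-⇒ (to-entry (gen i) ent , subst (λ x → from (toAut w) x < N)
        (sym (generator-involutive i e)) h)

      open Shortening w w′ i descent bead-s s-bead using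
        (module A; module B; bd-decreases; bd-drops; bd-moves)

      -- The box is on a diagonal whose length is, in both cores, the bead count at one and the same
      -- label, and the step does not raise this count.
      good-grows : ∀ {c} → Good μ c → Good κ c
      good-grows {x , y} (1≤x , (c , refl) , h) = 1≤x , (c , refl) , go (crossing c)
        where
        go : ∃[ e ] + 1 ≤ e × Entry e × (∀ w → Diagonal.Corner w e (+ c)) → x ℕ.+ c ℕ.≤ row κ x
        go (e , 1≤e , _ , corners) = ⇐ (A.on-diagonal 1≤e (corners w) 1≤x)
          (ℕ.≤-trans (⇒ (B.on-diagonal 1≤e (corners w′) 1≤x) h) (bd-decreases e))

      -- Fewer than `d` beads remain from `b` on, so row `d` no longer reaches the `γ`-th diagonal.
      row-drops : row μ d ℕ.< d ℕ.+ γ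
      row-drops = ℕ.≰⇒> λ h → ℕ.<⇒≱ (subst (B.bd b ℕ.<_) (sym d≡) (bd-drops bead down gap))
        (⇒ (B.on-diagonal 1≤b (corner w′) 1≤d) h)

      Special : Set
      Special = (variant₀ t ≡ D × toℕ i ≡ 0) ⊎ (variantₙ t ≡ D × toℕ i ≡ n)

      -- After the move there are still `d` beads from `s b` on, so the moved bead ends row `d`
      -- again, now at content `γ - 2`.
      row-by-two : Special → row κ d ≡ 2 ℕ.+ row μ d
      row-by-two sp = trans end (ℤ.+-injective (lin 4 (λ d γ g r → (g := d :+ (γ :- # 2)) ∷ (r := g)
        ∷ [] ⊢ d :+ γ := # 2 :+ r)
          (+ d) (+ γ) (+ B.gp sb) (+ row μ d) gp≡ (cong +_ row≡)))
        where
        sb = generator t n i b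
        order = proj₁ (moves sp)
        corner-sb = proj₁ (proj₂ (moves sp)) w′
        1≤sb = proj₁ (proj₂ (proj₂ (moves sp)))
        bd≡ : B.bd sb ≡ d
        bd≡ = trans (bd-moves order) (sym d≡)
        row≡ : row μ d ≡ B.gp sb
        row≡ = trans (cong (row μ) (sym bd≡)) (B.row-at-bead 1≤sb (s-bead bead))
        gp≡ : + B.gp sb ≡ + d + (+ γ - + 2)
        gp≡ = trans corner-sb (cong (λ k → + k + (+ γ - + 2)) bd≡)

      -- `γ ≥ 1` keeps both removed boxes on or above the main diagonal.
      good-between : ∀ {j} → Special → row κ d ≡ 2 ℕ.+ row μ d → row μ d ℕ.< j → j ℕ.≤ row κ d
        → Good κ (d , j) × row μ d ℕ.< j
      good-between {j} sp eq lo hi = (1≤d , (j ∸ d , sym (ℕ.m+[n∸m]≡n d≤j)) , hi) , lo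
        where
        d≤j : d ℕ.≤ j
        d≤j = ℤ.drop‿+≤+ (lin 5 (λ d γ j k m → (k := d :+ γ) ∷ (k := # 2 :+ m) ∷ (m :< j) ∷
          (# 1 :≤ γ) ∷ [] ⊢ d :≤ j)
          (+ d) (+ γ) (+ j) (+ row κ d) (+ row μ d) (cong +_ end) (cong +_ eq) (+<+ lo)
            (+≤+ (proj₂ (proj₂ (proj₂ (moves sp))))))

      recorded-good : ∀ {c} → Recorded t n κ μ d i c → Good κ c × row μ (proj₁ c) ℕ.< proj₂ c
      recorded-good (recorded _ _) = (1≤d , (γ , end) , ℕ.≤-refl) , ℕ.<-≤-trans row-drops
        (ℕ.≤-reflexive (sym end))
      recorded-good (recordedₙ v e eq lo hi _) = good-between (inj₂ (v , e)) eq lo hi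
      recorded-good (recorded₀ v e eq lo hi _ _) = good-between (inj₁ (v , e)) eq lo hi

      record-exists : ∃[ c ] Recorded t n κ μ d i c
      record-exists = go (is-D (variant₀ t) (toℕ i ℕ.≟ 0)) (is-D (variantₙ t) (toℕ i ℕ.≟ n))
        where
        is-D : ∀ v {Q : Set} → Dec Q → Dec (v ≡ D × Q)
        is-D C _       = no λ ()
        is-D D (yes q) = yes (refl , q)
        is-D D (no ¬q) = no (¬q ∘ proj₂)
        within : ∀ {δ} → Special → (δ ≡ γ ⊎ suc δ ≡ γ) → row μ d ℕ.< d ℕ.+ δ × d ℕ.+ δ ℕ.≤ row κ d
        within {δ} sp (inj₁ δ≡γ) = subst (λ x → row μ d ℕ.< d ℕ.+ x) (sym δ≡γ) row-drops ,
          ℕ.≤-reflexive (trans (cong (d ℕ.+_) δ≡γ) (sym end))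
        within {δ} sp (inj₂ δ+1≡γ) = ℤ.drop‿+<+ (lin 5 (λ d δ γ k m → (k := d :+ γ) ∷
          (# 1 :+ δ := γ) ∷ (k := # 2 :+ m) ∷ [] ⊢ m :< d :+ δ)
            (+ d) (+ δ) (+ γ) (+ row κ d) (+ row μ d) (cong +_ end) (cong +_ δ+1≡γ)
              (cong +_ (row-by-two sp))) ,
          ℕ.≤-trans (ℕ.+-monoʳ-≤ d (ℕ.n≤1+n δ)) (ℕ.≤-reflexive
            (trans (cong (d ℕ.+_) δ+1≡γ) (sym end)))
        go : Dec (variant₀ t ≡ D × toℕ i ≡ 0) → Dec (variantₙ t ≡ D × toℕ i ≡ n)
          → ∃[ c ] Recorded t n κ μ d i c
        go (yes p) _ = let δ , δγ , δ≢0 , δ≢2n = proj₁ box p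
                           lo , hi = within (inj₁ p) δγ in
          (d , d ℕ.+ δ) , recorded₀ (proj₁ p) (proj₂ p) (row-by-two (inj₁ p)) lo hi
            (λ eq → δ≢0 (ℕ.+-cancelˡ-≡ d δ 0 (trans eq (sym (ℕ.+-identityʳ d)))))
              (λ eq → δ≢2n (ℕ.+-cancelˡ-≡ d δ (2 ℕ.* n) eq))
        go (no _) (yes p) = let δ , δγ , δ≢n = proj₂ box p
                                lo , hi = within (inj₂ p) δγ in
          (d , d ℕ.+ δ) , recordedₙ (proj₁ p) (proj₂ p) (row-by-two (inj₂ p)) lo hi
            (λ eq → δ≢n (ℕ.+-cancelˡ-≡ d δ n eq))
        go (no ¬p) (no ¬q) = (d , row κ d) , recorded ¬p ¬q

  -- `good` is there to maintain `distinct`: the later boxes lie in the smaller core, which the new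
  -- box has left.
  record Sound (w : MirroredPermutation n) (ws : Word t n) (U : List Cell) : Set where
    field
      expresses : prod ws ≗ ⟦ w ⟧
      reduced   : length ws ≡ length′ ⟦ w ⟧
      boxes     : length U ≡ length ws
      distinct  : Unique U
      good      : All (Good (𝒞 n w)) U

  identity-representative : Representative identity
  identity-representative = inGroup-identity , λ ws _ → subst (ℕ._≤ length′ (prod ws))
    (sym length-identity) z≤n

  -- Under an empty core no bead lies past `N`, as for the identity, and representatives with the
  -- same beads agree.
  sound-done : ∀ w → Representative (toAut w) → 𝒞 n w ≡ [] → Sound w [] []
  sound-done w R eq = record
    { expresses = same ; reduced = trans (sym length-identity) (length-cong id ⟦ w ⟧ same)
    ; boxes = refl ; distinct = [] ; good = [] }
    where
    absent = Diagonal.no-high-bead w eq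
    same : id ≗ ⟦ w ⟧
    same = Uniqueness.equal identity (toAut w) identity-representative R
      (high-beads identity (toAut w) (λ N<e B → ⊥-elim (ℤ.<-asym N<e (proj₂ B)))
        (λ N<e B → ⊥-elim (absent N<e B)))
      (high-beads (toAut w) identity (λ N<e B → ⊥-elim (absent N<e B))
        (λ N<e B → ⊥-elim (ℤ.<-asym N<e (proj₂ B))))

  sound-step : ∀ w (R : Representative (toAut w)) (κ≢[] : 𝒞 n w ≢ []) v′
    (R′ : Representative (toAut v′)) →
    ∀ us → ParabolicWord t n us → (∀ k → generator t n (OneStep.i w R κ≢[] v′) (⟦ w ⟧ k) ≡ ⟦ v′ ⟧
      (prod us k)) →
    ∀ {c ws U} → Recorded t n (𝒞 n w) (𝒞 n v′) (referenceBoxes t n (𝒞 n w))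
      (OneStep.i w R κ≢[] v′) c →
    Sound v′ ws U → Sound w (OneStep.i w R κ≢[] v′ ∷ ws) (c ∷ U)
  sound-step w R κ≢[] v′ R′ us par act {c} {ws} {U} rec S = record
    { expresses = λ x → trans (cong s (trans (Sound.expresses S x) (sym (same x))))
      (generator-involutive i (⟦ w ⟧ x))
    ; reduced = trans (cong suc (trans (Sound.reduced S)
      (length-cong ⟦ v′ ⟧ (to a′) (λ x → sym (same x)))))
        (sym (left-shortens (toAut w) i (proj₁ R) descent))
    ; boxes = cong suc (Sound.boxes S)
    ; distinct = All.map new (Sound.good S) ∷ Sound.distinct S
    ; good = proj₁ good-c ∷ All.map good-grows (Sound.good S)
    }
    where
    open OneStep w R κ≢[] v′
    s = generator t n i
    module Q = Coset a′ (toAut v′) us par act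
    -- The action fixes only the coset of `v′`; both sides are minimal in it.
    same : to a′ ≗ ⟦ v′ ⟧
    same = Uniqueness.equal a′ (toAut v′) (representative-left (toAut w) i R descent) R′ Q.bead-⇒
      Q.bead-⇐
    open Boxes Q.bead-⇒ Q.bead-⇐
    good-c = recorded-good rec
    new : ∀ {c′} → Good μ c′ → c ≢ c′
    new (_ , _ , h) refl = ℕ.<⇒≱ (proj₂ good-c) h

  sound : ∀ {κ ws U} → Peeling t n κ ws U → ∀ w → Representative (toAut w) → 𝒞 n w ≡ κ
    → Sound w ws U
  sound done w R eq = sound-done w R eq
  sound (peel {μ = μ} {is = ws} {U = U} {c = c} κ≢[] _ j res tie
    (v , v′ , us , mv , mv′ , eqv , eqv′ , par , act) rec rest) w R refl =
    go (Fin.toℕ-injective (OneStep.forced w R κ≢[] v′ (toℕ j) res tie)) eqv′ act rec rest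
    where
    R′ = minimal⇒representative mv′
    go : ∀ {j μ} → j ≡ OneStep.i w R κ≢[] v′ → 𝒞 n v′ ≡ μ →
      (∀ k → generator t n j (⟦ v ⟧ k) ≡ ⟦ v′ ⟧ (prod us k)) →
         Recorded t n (𝒞 n w) μ (referenceBoxes t n (𝒞 n w)) j c → Peeling t n μ ws U → Sound w
           (j ∷ ws) (c ∷ U)
    go refl refl act rec rest = sound-step w R κ≢[] v′ R′ us par
      -- The representative `v` chosen by the action has the core of `w`, so it is `w`.
      (λ k → trans (cong (generator t n (OneStep.i w R κ≢[] v′))
        (sym (𝒞-injective v w eqv (minimal⇒representative mv) R k))) (act k))
      rec (sound rest v′ R′ refl)

  -- The length drops in each step and carries the recursion; the same drop excludes a nonempty core
  -- of length 0.
  peeling-exists : ∀ k w → _∈W̃/W t n w → length′ ⟦ w ⟧ ≡ k → ∃[ ws ] ∃[ U ] Peeling t n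
    (𝒞 n w) ws U
  peeling-exists k w m len = go (𝒞 n w) refl
    where
    R = minimal⇒representative m
    go : ∀ κ → 𝒞 n w ≡ κ → ∃[ ws ] ∃[ U ] Peeling t n (𝒞 n w) ws U
    go [] eq = [] , [] , subst (λ κ → Peeling t n κ [] []) (sym eq) done
    go (_ ∷ _) eq = step k len
      where
      κ≢[] : 𝒞 n w ≢ []
      κ≢[] eq′ = nonempty (trans (sym eq) eq′)
        where
        nonempty : ∀ {x : ℕ} {xs : List ℕ} → _≢_ {A = List ℕ} (x ∷ xs) []
        nonempty ()
      i = Peeled.Peelable.i (Peeled.peel-step w R κ≢[])
      w′ : MirroredPermutation n
      w′ = fromAut (gen i ⊙ toAut w)
      open OneStep w R κ≢[] w′ hiding (i)
      open Boxes id id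
      m′ : _∈W̃/W t n w′
      m′ = representative⇒minimal (gen i ⊙ toAut w) (representative-left (toAut w) i R descent)
      step : ∀ k → length′ ⟦ w ⟧ ≡ k → ∃[ ws ] ∃[ U ] Peeling t n (𝒞 n w) ws U
      step zero    len = ⊥-elim (ℕ.1+n≢0 (trans (sym (left-shortens (toAut w) i (proj₁ R) descent))
        len))
      step (suc k) len =
        let c , rec = record-exists
            ws , U , rest = peeling-exists k w′ m′ (ℕ.suc-injective (trans (sym (left-shortens (toAut w) i (proj₁ R) descent)) len)) in
        i ∷ ws , c ∷ U , peel κ≢[] 1≤d i residue tie (w , w′ , [] , m , m′ , refl , refl , [] , λ _
          → refl) rec rest

open import Data.Nat using (_≤_)

proposition6p2 : (t : AffineType) (n : ℕ) → minRank t ≤ n →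
    (w : MirroredPermutation n) → _∈W̃/W t n w →
    (∃[ is ] ∃[ U ] Peeling t n (𝒞 n w) is U) ×
    (∀ is U → Peeling t n (𝒞 n w) is U →
    _ReducedFor_ t n is ⟦ w ⟧ ×
    HasLength t n ⟦ w ⟧ (length (deduplicate _≟ᶜ_ U)))
proposition6p2 t n rank w m = peeling-exists _ w m refl , λ ws U p → conclude
  (sound p w (minimal⇒representative m) refl)
  where
  open Reduced t n rank
  open Theorem t n rank
  conclude : ∀ {ws U} → Sound w ws U → _ReducedFor_ t n ws ⟦ w ⟧ × HasLength t n ⟦ w ⟧
    (length (deduplicate _≟ᶜ_ U))
  conclude {ws} {U} S = red , ws , red , trans (sym (Sound.boxes S))
    (cong length (sym (deduplicate-unique (Sound.distinct S))))
    where
    red = reducedFor ws ⟦ w ⟧ (Sound.expresses S) (Sound.reduced S)
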